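{- Up to unimodular equivalence, the only lattice-spanning lattice $3$-polytopes that do not contain a unimodular tetrahedron are the two tetrahedra of size five $E^1_{(5,1)}=\conv\{(1,0,0),(0,0,1),(2,7,1),(-1,-2,-1)\}$, whose four empty tetrahedra have normalized volumes $2,3,5,7$, and $E^2_{(5,1)}=\conv\{(1,0,0),(0,0,1),(3,7,1),(-2,-3,-1)\}$, whose four empty tetrahedra have normalized volumes $3,4,5,7$.
   Context: A lattice $3$-polytope is a polytope in $\mathbb{R}^3$ with vertices in $\mathbb{Z}^3$ and dimension $3$; its size is $|P\cap\mathbb{Z}^3|$. It is lattice-spanning if the affine lattice generated (by integer affine combinations) by $P\cap\mathbb{Z}^3$ is all of $\mathbb{Z}^3$. Unimodular equivalence: an affine map $f$ with $f(\mathbb{Z}^3)=\mathbb{Z}^3$. Normalized volume of $\conv(v_0,\dots,v_3)$ is $|\det\begin{pmatrix}v_0&\cdots&v_3\\1&\cdots&1\end{pmatrix}|$; a unimodular tetrahedron is a lattice tetrahedron of normalized volume $1$; an empty tetrahedron is a lattice tetrahedron in $P$ whose only lattice points are its vertices. -}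

module Defs where

open import Data.Nat using (ℕ)
open import Data.Integer as ℤ using (ℤ; +_; -[1+_]; ∣_∣)
open import Data.Rational as ℚ using (ℚ; 0ℚ; 1ℚ)
open import Data.Product using (Σ; ∃; _×_; _,_; proj₁; proj₂)
open import Data.Sum using (_⊎_)
open import Data.List using (List; []; _∷_; map; length; foldr)
open import Data.List.Relation.Unary.All using (All)
open import Data.List.Relation.Unary.Any using (Any)
open import Data.List.Membership.Propositional using (_∈_)
open import Data.List.Relation.Unary.Unique.Propositional using (Unique)
open import Relation.Binary.PropositionalEquality using (_≡_; _≢_)
open import Relation.Nullary using (¬_)

Pt : Set
Pt = ℤ × ℤ × ℤ

QPt : Set
QPt = ℚ × ℚ × ℚ

toQ : ℤ → ℚ
toQ n = n ℚ./ 1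

embed : Pt → QPt
embed (x , y , z) = toQ x , toQ y , toQ z

_-ᵖ_ : Pt → Pt → Pt
(a , b , c) -ᵖ (d , e , f) = (a ℤ.- d) , (b ℤ.- e) , (c ℤ.- f)

det3 : Pt → Pt → Pt → ℤ
det3 (a , b , c) (d , e , f) (g , h , i) =
  (a ℤ.* ((e ℤ.* i) ℤ.- (f ℤ.* h)))
  ℤ.- (b ℤ.* ((d ℤ.* i) ℤ.- (f ℤ.* g)))
  ℤ.+ (c ℤ.* ((d ℤ.* h) ℤ.- (e ℤ.* g)))

-- normalized volume of conv(a,b,c,d) = |det [[a,b,c,d],[1,1,1,1]]|
normVol : Pt → Pt → Pt → Pt → ℕ
normVol a b c d = ∣ det3 (b -ᵖ a) (c -ᵖ a) (d -ᵖ a) ∣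

linQ : List (ℚ × Pt) → QPt
linQ [] = 0ℚ , 0ℚ , 0ℚ
linQ ((c , v) ∷ cs) with embed v | linQ cs
... | (x , y , z) | (X , Y , Z) = (c ℚ.* x ℚ.+ X) , (c ℚ.* y ℚ.+ Y) , (c ℚ.* z ℚ.+ Z)

sumQ : List ℚ → ℚ
sumQ = foldr ℚ._+_ 0ℚ

InConv : List Pt → Pt → Set
InConv V p = Σ (List (ℚ × Pt)) λ cs →
  (map proj₂ cs ≡ V) × All (λ cv → 0ℚ ℚ.≤ proj₁ cv) cs ×
  (sumQ (map proj₁ cs) ≡ 1ℚ) × (linQ cs ≡ embed p)

-- conv V is a lattice 3-polytope (V ⊂ ℤ³ finite; dimension 3)
Is3Polytope : List Pt → Set
Is3Polytope V = Σ Pt λ a → Σ Pt λ b → Σ Pt λ c → Σ Pt λ d →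
  a ∈ V × b ∈ V × c ∈ V × d ∈ V × normVol a b c d ≢ 0

linZ : List (ℤ × Pt) → Pt
linZ [] = + 0 , + 0 , + 0
linZ ((c , (x , y , z)) ∷ cs) with linZ cs
... | (X , Y , Z) = (c ℤ.* x ℤ.+ X) , (c ℤ.* y ℤ.+ Y) , (c ℤ.* z ℤ.+ Z)

sumZ : List ℤ → ℤ
sumZ = foldr ℤ._+_ (+ 0)

LatticeSpanning : List Pt → Set
LatticeSpanning V = ∀ (q : Pt) → Σ (List (ℤ × Pt)) λ cs →
  All (λ cp → InConv V (proj₂ cp)) cs × (sumZ (map proj₁ cs) ≡ + 1) × (linZ cs ≡ q)

HasUnimodularTet : List Pt → Set
HasUnimodularTet V = Σ Pt λ a → Σ Pt λ b → Σ Pt λ c → Σ Pt λ d →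
  InConv V a × InConv V b × InConv V c × InConv V d × normVol a b c d ≡ 1

record Affine : Set where
  field
    r₁ r₂ r₃ t : Pt

dot : Pt → Pt → ℤ
dot (a , b , c) (d , e , f) = a ℤ.* d ℤ.+ b ℤ.* e ℤ.+ c ℤ.* f

apply : Affine → Pt → Pt
apply f x = (dot r₁ x ℤ.+ t₁) , (dot r₂ x ℤ.+ t₂) , (dot r₃ x ℤ.+ t₃)
  where
  open Affine f
  t₁ = proj₁ t
  t₂ = proj₁ (proj₂ t)
  t₃ = proj₂ (proj₂ t)

Unimodular : Affine → Set
Unimodular f = ∣ det3 (Affine.r₁ f) (Affine.r₂ f) (Affine.r₃ f) ∣ ≡ 1

-- conv V and conv W are unimodularly equivalent: f(conv V) = conv W
UnimodEquiv : List Pt → List Pt → Set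
UnimodEquiv V W = Σ Affine λ f → Unimodular f ×
  All (λ v → InConv W (apply f v)) V × All (λ w → InConv (map (apply f) V) w) W

Size : List Pt → ℕ → Set
Size V n = Σ (List Pt) λ L → length L ≡ n × Unique L × All (InConv V) L ×
  (∀ p → InConv V p → p ∈ L)

Tet : Set
Tet = Pt × Pt × Pt × Pt

verts : Tet → List Pt
verts (a , b , c , d) = a ∷ b ∷ c ∷ d ∷ []

volT : Tet → ℕ
volT (a , b , c , d) = normVol a b c d

EmptyTet : List Pt → Tet → Set
EmptyTet V T = All (InConv V) (verts T) × volT T ≢ 0 ×
  (∀ p → InConv (verts T) p → p ∈ verts T)

-- the empty tetrahedra of conv V (as vertex sets) are exactly the listed Ts,
-- whose normalized volumes are vols
EmptyTetVolumes : List Pt → List ℕ → Set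
EmptyTetVolumes V vols = Σ (List Tet) λ Ts → map volT Ts ≡ vols ×
  All (EmptyTet V) Ts ×
  (∀ T → EmptyTet V T → Any (λ T' → All (_∈ verts T') (verts T)) Ts)


E1 : List Pt
E1 = (+ 1 , + 0 , + 0) ∷ (+ 0 , + 0 , + 1) ∷ (+ 2 , + 7 , + 1) ∷ (-[1+ 0 ] , -[1+ 1 ] , -[1+ 0 ]) ∷ []

E2 : List Pt
E2 = (+ 1 , + 0 , + 0) ∷ (+ 0 , + 0 , + 1) ∷ (+ 3 , + 7 , + 1) ∷ (-[1+ 1 ] , -[1+ 2 ] , -[1+ 0 ]) ∷ []

Exceptional : List Pt → List ℕ → Set
Exceptional E vols = Is3Polytope E × LatticeSpanning E × ¬ HasUnimodularTet E ×
  Size E 5 × EmptyTetVolumes E vols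

{-# OPTIONS --safe #-}
-- Work with the set A of lattice points of the polytope: it contains all lattice points of hulls
-- of its points, spans ℤ³ and contains no unimodular tetrahedron.
--
-- White's theorem, that an empty lattice tetrahedron lies between two consecutive lattice planes
-- containing two of its vertices each, is proved by induction on the volume.  Take an empty
-- tetrahedron and a lattice point x of A such that their hull contains no further lattice point.
-- White's theorem, applied to all empty tetrahedra among the five points, shows that these are not
-- in convex position (Howe); if one of them, o, is interior to the hull abcd of the others, then it
-- gives congruences between the barycentric weights of o that only (2,3,5,7) and (3,4,5,7) satisfy.
-- Otherwise replacing a vertex by x brings the tetrahedron closer to a point of A outside the
-- lattice it generates, which exists because A spans ℤ³; so this descent must end in one of the
-- two configurations.
--
-- The weights determine the configuration up to unimodular equivalence.  Any further point of A
-- lies in the cone from o over a facet and forces a point 2a − o, which the weights exclude; so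
-- A = {o,a,b,c,d}.  All of this only refutes; the equivalence itself is found by a decidable search
-- for vertices with the prescribed affine functionals in the given list.
module Submission where

open import Defs
open import Data.Product using (_×_; _,_)
open import Data.Sum using (_⊎_)
open import Data.List using (List; []; _∷_)
open import Relation.Nullary using (¬_)

-- Points are handled through integral affine functionals: an affine dependence is the statement
-- that every functional respects it, and the constant functional then supplies the sum of the
-- coefficients. A functional with values 0 and 1 from White's theorem, evaluated on the dependence
-- of a fifth point, leaves one unknown integer and so becomes a divisibility between weights.
--
-- The second source of divisibilities is that an empty lattice triangle is unimodular in its plane.
-- Relative to an empty tetrahedron with denominator D, a lattice point with one coordinate
-- divisible by D has all coordinates divisible by D; applied to dilations, this shows that all its
-- coordinates have the same order modulo D.
--
-- The obstacle is that A is a mere predicate: a smallest height, a nearest point or a smallest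
-- volume over A cannot be chosen outright. Each of these minima is approached by recursion on an
-- integer bound inside a refutation, which is why existence statements, White's theorem among them,
-- are phrased as continuations into the empty type.

module Arith where

  -- Certificates for integer inequalities, equations and divisibility

  open import Data.Nat as ℕ using (ℕ; zero; suc; z≤n)
  open import Data.Integer hiding (suc; pos)
  open import Data.Integer.Properties
  open import Data.Integer.DivMod using (a≡a%n+[a/n]*n; n%d<d)
  open import Data.Integer.Divisibility.Signed
  open import Data.Integer.Tactic.RingSolver using (solve; solve-∀)
  open import Data.List using (_∷_; [])
  open import Data.Product using (∃; _×_; _,_)
  open import Data.Sum using (_⊎_; inj₁; inj₂)
  open import Data.Empty using (⊥; ⊥-elim)
  open import Relation.Nullary using (¬_; Dec; yes; no)
  open import Relation.Binary.PropositionalEquality using (_≡_; _≢_; refl; sym; trans; cong; subst)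

  split : ∀ {A B C : Set} → A ⊎ B → (A → C) → (B → C) → C
  split (inj₁ a) f g = f a
  split (inj₂ b) f g = g b

  split? : ∀ {A C : Set} → Dec A → (A → C) → (¬ A → C) → C
  split? (yes a) f g = f a
  split? (no b) f g = g b

  record NN (x : ℤ) : Set where
    constructor nn
    field 0≤ : + 0 ≤ x
  open NN public

  -- Over the integers strictness is a slack of one, so a positive number enters a certificate as
  -- the nonnegative term `x - 1`.
  record Pos (x : ℤ) : Set where
    constructor pos
    field ↓ : NN (x - + 1)
  open Pos public

  infixl 6 _⊞_
  infixl 7 _⊠_

  _⊞_ : ∀ {x y} → NN x → NN y → NN (x + y)
  nn p ⊞ nn q = nn (+-mono-≤ p q)

  _⊠_ : ∀ {x y} → NN x → NN y → NN (x * y)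
  _⊠_ {+ m} {+ n} _ _ = nn (subst (+ 0 ≤_) (pos-* m n) (+≤+ z≤n))
  _⊠_ {+ m} { -[1+ n ]} _ (nn ())
  _⊠_ { -[1+ m ]} (nn ()) _

  num : ∀ n → NN (+ n)
  num n = nn (+≤+ z≤n)

  -- Linear and quadratic inequalities are refuted by certificates: a sum of products of
  -- nonnegative terms that the ring solver evaluates to −1.
  contra : ∀ {x} → NN x → x ≡ -[1+ 0 ] → ⊥
  contra (nn ()) refl

  cast : ∀ {x y} → NN x → x ≡ y → NN y
  cast p refl = p

  castP : ∀ {x y} → NN x → x ≡ y - + 1 → Pos y
  castP p refl = pos p

  -- The contribution of an equation is zero, so its multiplier `k` may have either sign.
  eqNN : ∀ {x y} → x ≡ y → ∀ k → NN (k * (x - y))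
  eqNN {x} refl k = cast (num 0) (zer k x)
    where
    zer : ∀ k x → + 0 ≡ k * (x - x)
    zer = solve-∀

  sgn : ∀ x → Pos x ⊎ x ≡ + 0 ⊎ Pos (- x)
  sgn (+ zero) = inj₂ (inj₁ refl)
  sgn (+ suc n) = inj₁ (pos (num n))
  sgn -[1+ n ] = inj₂ (inj₂ (pos (num n)))

  nn? : ∀ x → NN x ⊎ Pos (- x)
  nn? (+ n) = inj₁ (num n)
  nn? -[1+ n ] = inj₂ (pos (num n))

  cmp : ∀ x y → NN (x - y) ⊎ Pos (y - x)
  cmp x y with nn? (x - y)
  ... | inj₁ p = inj₁ p
  ... | inj₂ p = inj₂ (castP (↓ p) (solve (x ∷ y ∷ [])))

  pos⇒nn : ∀ {x} → Pos x → NN x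
  pos⇒nn {x} p = cast (↓ p ⊞ num 1) (solve (x ∷ []))

  posM : ∀ {x y} → Pos x → Pos y → Pos (x * y)
  posM {x} {y} (pos p) (pos q) = castP (p ⊠ q ⊞ p ⊞ q) (solve (x ∷ y ∷ []))

  pos≢0 : ∀ {x} → Pos x → x ≢ + 0
  pos≢0 (pos (nn ())) refl

  neg≢0 : ∀ {x} → Pos (- x) → x ≢ + 0
  neg≢0 (pos (nn ())) refl

  antisym : ∀ {x y} → NN (x - y) → NN (y - x) → x ≡ y
  antisym {x} {y} p q = ≤-antisym (lem q) (lem p)
    where
    lem : ∀ {x y} → NN (x - y) → y ≤ x
    lem (nn p) = 0≤i-j⇒j≤i p

  nn≢0 : ∀ {x} → NN x → x ≢ + 0 → Pos x
  nn≢0 {+ zero} _ h = ⊥-elim (h refl)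
  nn≢0 {+ suc n} _ h = pos (num n)
  nn≢0 { -[1+ n ]} (nn ()) h

  pos-cancel : ∀ {k x} → Pos k → NN (k * x) → NN x
  pos-cancel {k} {x} (pos p) q =
    split (nn? x) (λ r → r) (λ r → ⊥-elim (contra (q ⊞ p ⊠ ↓ r ⊞ p ⊞ ↓ r) (solve (k ∷ x ∷ []))))

  pos-cancel⁺ : ∀ {k x} → NN k → Pos (k * x) → Pos x
  pos-cancel⁺ {k} {x} p (pos q) =
    split (nn? (x - + 1)) pos (λ r → ⊥-elim (contra (q ⊞ p ⊠ ↓ r) (solve (k ∷ x ∷ []))))

  mul-cancel : ∀ k {x y} → k ≢ + 0 → k * x ≡ k * y → x ≡ y
  mul-cancel k {x} {y} h e = *-cancelˡ-≡ k x y {{≢-nonZero h}} e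

  mul≢0 : ∀ {x y} → x ≢ + 0 → y ≢ + 0 → x * y ≢ + 0
  mul≢0 {x} h k e with i*j≡0⇒i≡0∨j≡0 x e
  ... | inj₁ p = h p
  ... | inj₂ p = k p

  neg≢ : ∀ {x} → x ≢ + 0 → - x ≢ + 0
  neg≢ {x} h e = h (trans (sym (neg-involutive x)) (cong -_ e))

  divmod : ∀ D x → Pos D → ∃ λ q → ∃ λ r → x ≡ r + q * D × NN r × Pos (D - r)
  divmod D@(+ suc n) x _ = (x / D) , + (x % D) , a≡a%n+[a/n]*n x D , num _ , lt (n%d<d x D)
    where
    alg : ∀ n m → n - (+ 1 + m) ≡ n - m - + 1
    alg = solve-∀
    lt : ∀ {m n} → m ℕ.< n → Pos (+ n - + m)
    lt {m} {n} h = castP (nn (i≤j⇒0≤j-i (+≤+ h))) (trans (cong (λ t → + n - t) (pos-+ 1 m)) (alg (+ n) (+ m)))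

  -- A quotient of at least one forces `x ≥ D`, and a quotient of at most zero forces `x ≤ 0`.
  -- Positivity of `D` comes from adding the two bounds.
  ∣-small : ∀ {D x} → Pos x → Pos (D - x) → D ∣ x → ⊥
  ∣-small {D} {x} (pos p) (pos q) (divides k e) =
    split (nn? (k - + 1))
      (λ h → contra (h ⊠ (p ⊞ q) ⊞ q ⊞ eqNN e (+ 1) ⊞ h ⊞ h) (solve (D ∷ x ∷ k ∷ [])))
      (λ (pos h) → contra (h ⊠ (p ⊞ q) ⊞ p ⊞ eqNN e (- + 1) ⊞ h ⊞ h) (solve (D ∷ x ∷ k ∷ [])))

  ab : ℤ → ℤ
  ab x = + ∣ x ∣

  ab-nn : ∀ x → NN (ab x)
  ab-nn x = num _

  ab-≥ : ∀ x → NN (ab x - x)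
  ab-≥ (+ n) = cast (num 0) (sym (+-inverseʳ (+ n)))
  ab-≥ -[1+ n ] = cast (num (suc n ℕ.+ suc n)) (pos-+ (suc n) (suc n))

  ab-≥⁻ : ∀ x → NN (ab x + x)
  ab-≥⁻ (+ n) = cast (num (n ℕ.+ n)) (pos-+ n n)
  ab-≥⁻ -[1+ n ] = cast (num 0) (sym (+-inverseʳ (+ suc n)))

  ab-≤ : ∀ {t} x → NN (t - x) → NN (t + x) → NN (t - ab x)
  ab-≤ (+ n) p q = p
  ab-≤ {t} -[1+ n ] p q = q

  ab-neg : ∀ x → ab (- x) ≡ ab x
  ab-neg x = cong +_ (∣-i∣≡∣i∣ x)

  ab-pos : ∀ {x} → NN x → ab x ≡ x
  ab-pos {+ n} _ = refl
  ab-pos { -[1+ n ]} (nn ())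

  ab-sign : ∀ x → ab x ≡ x ⊎ ab x ≡ - x
  ab-sign (+ n) = inj₁ refl
  ab-sign -[1+ n ] = inj₂ refl

  ab-≢0 : ∀ {x} → x ≢ + 0 → Pos (ab x)
  ab-≢0 {+ zero} h = ⊥-elim (h refl)
  ab-≢0 {+ suc n} h = pos (num n)
  ab-≢0 { -[1+ n ]} h = pos (num n)

  ∣-neg : ∀ {D x} → D ∣ x → - D ∣ x
  ∣-neg {D} (divides q e) = divides (- q) (trans e (solve (q ∷ D ∷ [])))

  ∣-lin : ∀ {D x y} k l → D ∣ x → D ∣ y → D ∣ k * x + l * y
  ∣-lin {D} k l (divides q refl) (divides r refl) = divides (k * q + l * r) (solve (k ∷ l ∷ q ∷ r ∷ D ∷ []))

  ∣-to : ∀ {D x y} → D ∣ x → x ≡ y → D ∣ y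
  ∣-to h refl = h

  pin₁ : ∀ {z} → Pos z → Pos (+ 2 - z) → z ≡ + 1
  pin₁ {z} (pos p) (pos q) = antisym p (cast q (solve (z ∷ [])))

  pin₂ : ∀ {z} → Pos z → Pos (+ 3 - z) → z ≡ + 1 ⊎ z ≡ + 2
  pin₂ {z} (pos p) (pos q) with cmp (+ 1) z
  ... | inj₁ h = inj₁ (antisym p h)
  ... | inj₂ (pos h) = inj₂ (antisym (cast h (solve (z ∷ []))) (cast q (solve (z ∷ []))))

  pin₃ : ∀ {z} → Pos z → Pos (+ 4 - z) → z ≡ + 1 ⊎ z ≡ + 2 ⊎ z ≡ + 3
  pin₃ {z} p (pos q) with cmp (+ 2) z
  ... | inj₂ (pos h) = inj₂ (inj₂ (antisym (cast h (solve (z ∷ []))) (cast q (solve (z ∷ [])))))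
  ... | inj₁ h with pin₂ p (castP h (solve (z ∷ [])))
  ...   | inj₁ e = inj₁ e
  ...   | inj₂ e = inj₂ (inj₁ e)

  -- The counterpart of the certificates for equations: a difference vanishes once it is written as
  -- a combination of hypotheses `k * (x - y)`.
  record ZZ (x : ℤ) : Set where
    constructor zz
    field ≡0 : x ≡ + 0
  open ZZ public

  infixl 6 _⊹_

  _⊹_ : ∀ {x y} → ZZ x → ZZ y → ZZ (x + y)
  zz refl ⊹ zz refl = zz refl

  eqZ : ∀ {x y} → x ≡ y → ∀ k → ZZ (k * (x - y))
  eqZ {x} refl k = zz (zer k x)
    where
    zer : ∀ k x → k * (x - x) ≡ + 0
    zer = solve-∀

  fromZ : ∀ {x y s} → ZZ s → x - y ≡ s → x ≡ y
  fromZ {x} {y} (zz refl) e = i-j≡0⇒i≡j x y e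

  cancelʳ : ∀ k {x y} → k ≢ + 0 → x * k ≡ y * k → x ≡ y
  cancelʳ k {x} {y} h e = *-cancelʳ-≡ x y k {{≢-nonZero h}} e

  ab-* : ∀ x y → ab (x * y) ≡ ab x * ab y
  ab-* x y = trans (cong +_ (abs-* x y)) (pos-* ∣ x ∣ ∣ y ∣)

-- Affine functionals, signed volumes and Cramer's rule

module Base where

  open import Data.Nat as ℕ using (ℕ)
  open import Data.Integer hiding (suc; pos)
  open import Data.Integer.Properties
  open import Data.Integer.Solver
  open import Data.Product
  open import Data.Sum
  open import Data.Empty
  open import Relation.Binary.PropositionalEquality

  open +-*-Solver

  -- An integral affine functional: its linear part and its constant term.
  Fun : Set
  Fun = Pt × ℤ

  opaque
    ev : Fun → Pt → ℤ
    ev (n , k) p = dot n p + k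

    vol : Pt → Pt → Pt → Pt → ℤ
    vol a b c d = det3 (b -ᵖ a) (c -ᵖ a) (d -ᵖ a)

    lin : Pt → ℤ → Pt → Pt → Pt
    lin (p₁ , p₂ , p₃) k (u₁ , u₂ , u₃) (w₁ , w₂ , w₃) =
      p₁ + k * (u₁ - w₁) , p₂ + k * (u₂ - w₂) , p₃ + k * (u₃ - w₃)

  affMap : Fun → Fun → Fun → Pt → Pt
  affMap f g h p = ev f p , ev g p , ev h p

  one coordX coordY coordZ : Fun
  one = (+ 0 , + 0 , + 0) , + 1
  coordX = (+ 1 , + 0 , + 0) , + 0
  coordY = (+ 0 , + 1 , + 0) , + 0
  coordZ = (+ 0 , + 0 , + 1) , + 0

  private
    cong₃ : ∀ {A B C D : Set} (f : A → B → C → D) {x x′ y y′ z z′} → x ≡ x′ → y ≡ y′ → z ≡ z′ → f x y z ≡ f x′ y′ z′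
    cong₃ f refl refl refl = refl

    detᴾ : ∀ {n} → (a b c d e f g h i : Polynomial n) → Polynomial n
    detᴾ a b c d e f g h i = (a :* ((e :* i) :- (f :* h))) :- (b :* ((d :* i) :- (f :* g))) :+ (c :* ((d :* h) :- (e :* g)))

    P : ℕ → Set
    P n = Polynomial n × Polynomial n × Polynomial n

    V : ∀ {n} → (a b c d : P n) → Polynomial n
    V (a , b , c) (d , e , f) (g , h , i) (j , k , l) =
      detᴾ (d :- a) (e :- b) (f :- c) (g :- a) (h :- b) (i :- c) (j :- a) (k :- b) (l :- c)

    E : ∀ {n} → P n × Polynomial n → P n → Polynomial n
    E ((n , m , k) , t) (a , b , c) = n :* a :+ m :* b :+ k :* c :+ t

  opaque
    unfolding ev vol lin

    vol-swap₀ : ∀ a b c d → vol b a c d ≡ - vol a b c d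
    vol-swap₀ (a₁ , a₂ , a₃) (b₁ , b₂ , b₃) (c₁ , c₂ , c₃) (d₁ , d₂ , d₃) =
      solve 12 (λ a₁ a₂ a₃ b₁ b₂ b₃ c₁ c₂ c₃ d₁ d₂ d₃ →
        let a = (a₁ , a₂ , a₃) ; b = (b₁ , b₂ , b₃) ; c = (c₁ , c₂ , c₃) ; d = (d₁ , d₂ , d₃) in
        V b a c d := :- V a b c d) refl a₁ a₂ a₃ b₁ b₂ b₃ c₁ c₂ c₃ d₁ d₂ d₃

    vol-swap₁ : ∀ a b c d → vol a c b d ≡ - vol a b c d
    vol-swap₁ (a₁ , a₂ , a₃) (b₁ , b₂ , b₃) (c₁ , c₂ , c₃) (d₁ , d₂ , d₃) =
      solve 12 (λ a₁ a₂ a₃ b₁ b₂ b₃ c₁ c₂ c₃ d₁ d₂ d₃ →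
        let a = (a₁ , a₂ , a₃) ; b = (b₁ , b₂ , b₃) ; c = (c₁ , c₂ , c₃) ; d = (d₁ , d₂ , d₃) in
        V a c b d := :- V a b c d) refl a₁ a₂ a₃ b₁ b₂ b₃ c₁ c₂ c₃ d₁ d₂ d₃

    vol-swap₂ : ∀ a b c d → vol a b d c ≡ - vol a b c d
    vol-swap₂ (a₁ , a₂ , a₃) (b₁ , b₂ , b₃) (c₁ , c₂ , c₃) (d₁ , d₂ , d₃) =
      solve 12 (λ a₁ a₂ a₃ b₁ b₂ b₃ c₁ c₂ c₃ d₁ d₂ d₃ →
        let a = (a₁ , a₂ , a₃) ; b = (b₁ , b₂ , b₃) ; c = (c₁ , c₂ , c₃) ; d = (d₁ , d₂ , d₃) in
        V a b d c := :- V a b c d) refl a₁ a₂ a₃ b₁ b₂ b₃ c₁ c₂ c₃ d₁ d₂ d₃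

    -- Cramer's rule as the affine dependence among five points of space. Testing it against an
    -- arbitrary functional `z` covers the three coordinates and the coefficient sum in one
    -- identity.
    vol-cramer : ∀ a b c d p z → vol a b c d * ev z p ≡
      vol p b c d * ev z a + vol a p c d * ev z b + vol a b p d * ev z c + vol a b c p * ev z d
    vol-cramer (a₁ , a₂ , a₃) (b₁ , b₂ , b₃) (c₁ , c₂ , c₃) (d₁ , d₂ , d₃) (p₁ , p₂ , p₃) ((n , m , k) , t) =
      solve 19 (λ a₁ a₂ a₃ b₁ b₂ b₃ c₁ c₂ c₃ d₁ d₂ d₃ p₁ p₂ p₃ n m k t →
        let a = (a₁ , a₂ , a₃) ; b = (b₁ , b₂ , b₃) ; c = (c₁ , c₂ , c₃) ; d = (d₁ , d₂ , d₃)
            p = (p₁ , p₂ , p₃) ; z = ((n , m , k) , t) in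
        V a b c d :* E z p := V p b c d :* E z a :+ V a p c d :* E z b :+ V a b p d :* E z c :+ V a b c p :* E z d)
        refl a₁ a₂ a₃ b₁ b₂ b₃ c₁ c₂ c₃ d₁ d₂ d₃ p₁ p₂ p₃ n m k t

    -- The determinant expanded along its first point: a multiple of the height over the plane
    -- `bcd`, with the cofactors as coefficients.
    volF : Pt → Pt → Pt → Fun
    volF (b₁ , b₂ , b₃) (c₁ , c₂ , c₃) (d₁ , d₂ , d₃) =
      ( - (c₂ * d₃ - c₃ * d₂) + (b₂ * d₃ - b₃ * d₂) - (b₂ * c₃ - b₃ * c₂)
      , (c₁ * d₃ - c₃ * d₁) - (b₁ * d₃ - b₃ * d₁) + (b₁ * c₃ - b₃ * c₁)
      , - (c₁ * d₂ - c₂ * d₁) + (b₁ * d₂ - b₂ * d₁) - (b₁ * c₂ - b₂ * c₁))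
      , det3 (b₁ , b₂ , b₃) (c₁ , c₂ , c₃) (d₁ , d₂ , d₃)

    ev-volF : ∀ p b c d → ev (volF b c d) p ≡ vol p b c d
    ev-volF (a₁ , a₂ , a₃) (b₁ , b₂ , b₃) (c₁ , c₂ , c₃) (d₁ , d₂ , d₃) =
      solve 12 (λ a₁ a₂ a₃ b₁ b₂ b₃ c₁ c₂ c₃ d₁ d₂ d₃ →
        let a = (a₁ , a₂ , a₃) ; b = (b₁ , b₂ , b₃) ; c = (c₁ , c₂ , c₃) ; d = (d₁ , d₂ , d₃) in
        E (( (:- (c₂ :* d₃ :- c₃ :* d₂) :+ (b₂ :* d₃ :- b₃ :* d₂) :- (b₂ :* c₃ :- b₃ :* c₂))
           , ((c₁ :* d₃ :- c₃ :* d₁) :- (b₁ :* d₃ :- b₃ :* d₁) :+ (b₁ :* c₃ :- b₃ :* c₁))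
           , (:- (c₁ :* d₂ :- c₂ :* d₁) :+ (b₁ :* d₂ :- b₂ :* d₁) :- (b₁ :* c₂ :- b₂ :* c₁)))
           , detᴾ b₁ b₂ b₃ c₁ c₂ c₃ d₁ d₂ d₃) a := V a b c d)
        refl a₁ a₂ a₃ b₁ b₂ b₃ c₁ c₂ c₃ d₁ d₂ d₃

    vol-aacd : ∀ a c d → vol a a c d ≡ + 0
    vol-aacd (a₁ , a₂ , a₃) (c₁ , c₂ , c₃) (d₁ , d₂ , d₃) =
      solve 9 (λ a₁ a₂ a₃ c₁ c₂ c₃ d₁ d₂ d₃ →
        let a = (a₁ , a₂ , a₃) ; c = (c₁ , c₂ , c₃) ; d = (d₁ , d₂ , d₃) in
        V a a c d := con (+ 0)) refl a₁ a₂ a₃ c₁ c₂ c₃ d₁ d₂ d₃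

    vol-abad : ∀ a b d → vol a b a d ≡ + 0
    vol-abad a b d = trans (vol-swap₁ a a b d) (cong -_ (vol-aacd a b d))

    vol-abca : ∀ a b c → vol a b c a ≡ + 0
    vol-abca a b c = trans (vol-swap₂ a b a c) (cong -_ (vol-abad a b c))

    vol-linear : ∀ f g h u v w →
      det3 (dot f u , dot g u , dot h u) (dot f v , dot g v , dot h v) (dot f w , dot g w , dot h w)
      ≡ det3 f g h * det3 u v w
    vol-linear (p , q , r) (s , t , u) (x , y , z) (a , b , c) (d , e , f) (g , h , i) =
      solve 18 (λ a b c d e f g h i p q r s t u x y z →
        let dt = λ a b c x y z → a :* x :+ b :* y :+ c :* z in
        detᴾ (dt p q r a b c) (dt s t u a b c) (dt x y z a b c) (dt p q r d e f) (dt s t u d e f) (dt x y z d e f)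
             (dt p q r g h i) (dt s t u g h i) (dt x y z g h i)
        := detᴾ p q r s t u x y z :* detᴾ a b c d e f g h i) refl a b c d e f g h i p q r s t u x y z

    ev-diff : ∀ f p q → ev f p - ev f q ≡ dot (proj₁ f) (p -ᵖ q)
    ev-diff ((n₁ , n₂ , n₃) , s) (b₁ , b₂ , b₃) (a₁ , a₂ , a₃) =
      solve 10 (λ n₁ n₂ n₃ s b₁ b₂ b₃ a₁ a₂ a₃ →
        E ((n₁ , n₂ , n₃) , s) (b₁ , b₂ , b₃) :- E ((n₁ , n₂ , n₃) , s) (a₁ , a₂ , a₃) :=
        n₁ :* (b₁ :- a₁) :+ n₂ :* (b₂ :- a₂) :+ n₃ :* (b₃ :- a₃)) refl n₁ n₂ n₃ s b₁ b₂ b₃ a₁ a₂ a₃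

    affMap-diff : ∀ f g h p q → affMap f g h p -ᵖ affMap f g h q ≡
      (dot (proj₁ f) (p -ᵖ q) , dot (proj₁ g) (p -ᵖ q) , dot (proj₁ h) (p -ᵖ q))
    affMap-diff f g h p q = cong₂ _,_ (ev-diff f p q) (cong₂ _,_ (ev-diff g p q) (ev-diff h p q))

    vol-affMap : ∀ f g h a b c d →
      vol (affMap f g h a) (affMap f g h b) (affMap f g h c) (affMap f g h d) ≡
      det3 (proj₁ f) (proj₁ g) (proj₁ h) * vol a b c d
    vol-affMap f g h a b c d =
      trans (cong₃ det3 (affMap-diff f g h b a) (affMap-diff f g h c a) (affMap-diff f g h d a))
            (vol-linear (proj₁ f) (proj₁ g) (proj₁ h) (b -ᵖ a) (c -ᵖ a) (d -ᵖ a))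

    ev-lin : ∀ z p k u w → ev z (lin p k u w) ≡ ev z p + k * (ev z u - ev z w)
    ev-lin ((n , m , l) , t) (p₁ , p₂ , p₃) k (u₁ , u₂ , u₃) (w₁ , w₂ , w₃) =
      solve 14 (λ n m l t p₁ p₂ p₃ k u₁ u₂ u₃ w₁ w₂ w₃ →
        let z = ((n , m , l) , t) in
        E z (p₁ :+ k :* (u₁ :- w₁) , p₂ :+ k :* (u₂ :- w₂) , p₃ :+ k :* (u₃ :- w₃)) :=
        E z (p₁ , p₂ , p₃) :+ k :* (E z (u₁ , u₂ , u₃) :- E z (w₁ , w₂ , w₃)))
        refl n m l t p₁ p₂ p₃ k u₁ u₂ u₃ w₁ w₂ w₃

    ev-one : ∀ p → ev one p ≡ + 1
    ev-one (a , b , c) = solve 3 (λ a b c → E ((con (+ 0) , con (+ 0) , con (+ 0)) , con (+ 1)) (a , b , c) := con (+ 1)) refl a b c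

    ev-X : ∀ p → ev coordX p ≡ proj₁ p
    ev-X (a , b , c) = solve 3 (λ a b c → E ((con (+ 1) , con (+ 0) , con (+ 0)) , con (+ 0)) (a , b , c) := a) refl a b c

    ev-Y : ∀ p → ev coordY p ≡ proj₁ (proj₂ p)
    ev-Y (a , b , c) = solve 3 (λ a b c → E ((con (+ 0) , con (+ 1) , con (+ 0)) , con (+ 0)) (a , b , c) := b) refl a b c

    ev-Z : ∀ p → ev coordZ p ≡ proj₂ (proj₂ p)
    ev-Z (a , b , c) = solve 3 (λ a b c → E ((con (+ 0) , con (+ 0) , con (+ 1)) , con (+ 0)) (a , b , c) := c) refl a b c

    pt-ext : ∀ {p q} → (∀ z → ev z p ≡ ev z q) → p ≡ q
    pt-ext {p} {q} h = cong₂ _,_ (coord coordX ev-X) (cong₂ _,_ (coord coordY ev-Y) (coord coordZ ev-Z))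
      where
      coord : ∀ z {f : Pt → ℤ} → (∀ p → ev z p ≡ f p) → f p ≡ f q
      coord z e = trans (sym (e p)) (trans (h z) (e q))

    normVol-vol : ∀ a b c d → normVol a b c d ≡ ∣ vol a b c d ∣
    normVol-vol a b c d = refl

    addF : Fun → Fun → Fun
    addF ((n₁ , n₂ , n₃) , s) ((m₁ , m₂ , m₃) , t) = (n₁ + m₁ , n₂ + m₂ , n₃ + m₃) , s + t

    ev-addF : ∀ f g p → ev (addF f g) p ≡ ev f p + ev g p
    ev-addF ((n₁ , n₂ , n₃) , s) ((m₁ , m₂ , m₃) , t) (a₁ , a₂ , a₃) =
      solve 11 (λ n₁ n₂ n₃ s m₁ m₂ m₃ t a₁ a₂ a₃ →
        E ((n₁ :+ m₁ , n₂ :+ m₂ , n₃ :+ m₃) , s :+ t) (a₁ , a₂ , a₃) :=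
        E ((n₁ , n₂ , n₃) , s) (a₁ , a₂ , a₃) :+ E ((m₁ , m₂ , m₃) , t) (a₁ , a₂ , a₃))
        refl n₁ n₂ n₃ s m₁ m₂ m₃ t a₁ a₂ a₃

    scaleF : ℤ → Fun → Fun
    scaleF k ((n₁ , n₂ , n₃) , s) = (k * n₁ , k * n₂ , k * n₃) , k * s

    ev-scaleF : ∀ k f p → ev (scaleF k f) p ≡ k * ev f p
    ev-scaleF k ((n₁ , n₂ , n₃) , s) (a₁ , a₂ , a₃) =
      solve 8 (λ k n₁ n₂ n₃ s a₁ a₂ a₃ →
        E ((k :* n₁ , k :* n₂ , k :* n₃) , k :* s) (a₁ , a₂ , a₃) := k :* E ((n₁ , n₂ , n₃) , s) (a₁ , a₂ , a₃))
        refl k n₁ n₂ n₃ s a₁ a₂ a₃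

    O e₁ e₂ e₃ : Pt
    O = + 0 , + 0 , + 0
    e₁ = + 1 , + 0 , + 0
    e₂ = + 0 , + 1 , + 0
    e₃ = + 0 , + 0 , + 1

    -- The origin and the unit vectors form an affine basis of the lattice, so divisibility of four
    -- values already makes the functional `D` times an integral one.
    ev-basis : ∀ f t₁ t₂ t₃ t D → ev f O ≡ t * D → ev f e₁ ≡ t₁ * D → ev f e₂ ≡ t₂ * D → ev f e₃ ≡ t₃ * D →
      ∀ p → ev f p ≡ D * ev ((t₁ - t , t₂ - t , t₃ - t) , t) p
    ev-basis ((n₁ , n₂ , n₃) , s) t₁ t₂ t₃ t D h h₁ h₂ h₃ (a₁ , a₂ , a₃) =
      fromEqs (+ 1 - a₁ - a₂ - a₃) a₁ a₂ a₃ h h₁ h₂ h₃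
        (solve 12 (λ n₁ n₂ n₃ s t₁ t₂ t₃ t D a₁ a₂ a₃ →
          let f = ((n₁ , n₂ , n₃) , s)
              z = con (+ 0)
              i = con (+ 1)
              O′ = E f (z , z , z) :- t :* D in
          E f (a₁ , a₂ , a₃) :=
          D :* E ((t₁ :- t , t₂ :- t , t₃ :- t) , t) (a₁ , a₂ , a₃)
            :+ ((i :- a₁ :- a₂ :- a₃) :* O′ :+ a₁ :* (E f (i , z , z) :- t₁ :* D)
                :+ a₂ :* (E f (z , i , z) :- t₂ :* D) :+ a₃ :* (E f (z , z , i) :- t₃ :* D)))
          refl n₁ n₂ n₃ s t₁ t₂ t₃ t D a₁ a₂ a₃)
      where
      fromEqs : ∀ {x y u v x′ y′ u′ v′} k l m n {L R} → x ≡ x′ → y ≡ y′ → u ≡ u′ → v ≡ v′ →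
        L ≡ R + (k * (x - x′) + l * (y - y′) + m * (u - u′) + n * (v - v′)) → L ≡ R
      fromEqs {x} {y} {u} {v} k l m n {L} {R} refl refl refl refl e = trans e
        (solve 9 (λ x y u v k l m n R → R :+ (k :* (x :- x) :+ l :* (y :- y) :+ m :* (u :- u) :+ n :* (v :- v)) := R)
          refl x y u v k l m n R)

    vol-std : vol (+ 0 , + 0 , + 0) (+ 1 , + 0 , + 0) (+ 0 , + 1 , + 0) (+ 0 , + 0 , + 1) ≡ + 1
    vol-std = refl

    ev-def : ∀ n m k t a b c → ev ((n , m , k) , t) (a , b , c) ≡ n * a + m * b + k * c + t
    ev-def n m k t a b c = refl

-- Barycentric relations and empty tetrahedra

module Tet where

  open Base
  open Arith
  open import Data.Integer hiding (suc; pos; ∣_∣)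
  open import Data.Integer.Properties
  open import Data.Integer.Divisibility.Signed
  open import Data.Integer.Tactic.RingSolver using (solve; solve-∀)
  open import Data.List using (_∷_; [])
  open import Data.Product using (∃; _×_; _,_)
  open import Data.Empty using (⊥; ⊥-elim)
  open import Relation.Nullary using (¬_)
  open import Relation.Binary.PropositionalEquality using (_≡_; _≢_; refl; sym; trans; cong; subst)

  tet-identity-1 : ∀ x y u v → x + y + u + v ≡ y + x + u + v
  tet-identity-1 = solve-∀

  tet-identity-2 : ∀ x y u v → x + y + u + v ≡ x + u + y + v
  tet-identity-2 = solve-∀

  tet-identity-3 : ∀ x y u v → x + y + u + v ≡ x + y + v + u
  tet-identity-3 = solve-∀

  tet-identity-4 : ∀ (n₀ n₁ n₂ n₃ : ℤ) → ∀ x → n₀ * x + n₁ * + 0 + n₂ * + 0 + n₃ * + 0 ≡ n₀ * x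
  tet-identity-4 n₀ n₁ n₂ n₃ x = solve (x ∷ n₀ ∷ n₁ ∷ n₂ ∷ n₃ ∷ [])

  tet-identity-5 : ∀ (N n₁ : ℤ) → ∀ {x y u v} → x ≡ - u → y ≡ - v → N * u ≡ n₁ * v → N * x ≡ n₁ * y
  tet-identity-5 N n₁ {u = u} {v} refl refl h = fromZ (eqZ h (- + 1)) (solve (N ∷ n₁ ∷ u ∷ v ∷ []))

  tet-identity-6 : ∀ (N n₂ : ℤ) → ∀ {x y u v} → x ≡ - u → y ≡ - v → N * u ≡ n₂ * v → N * x ≡ n₂ * y
  tet-identity-6 N n₂ {u = u} {v} refl refl h = fromZ (eqZ h (- + 1)) (solve (N ∷ n₂ ∷ u ∷ v ∷ []))

  tet-identity-7 : ∀ (N n₃ : ℤ) → ∀ {x y u v} → x ≡ - u → y ≡ - v → N * u ≡ n₃ * v → N * x ≡ n₃ * y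
  tet-identity-7 N n₃ {u = u} {v} refl refl h = fromZ (eqZ h (- + 1)) (solve (N ∷ n₃ ∷ u ∷ v ∷ []))

  tet-identity-8 : ∀ (N n₀ n₁ n₂ n₃ : ℤ) → ∀ {x y u v w} → x ≡ + 1 → y ≡ + 1 → u ≡ + 1 → v ≡ + 1 → w ≡ + 1 →
    N * x ≡ n₀ * y + n₁ * u + n₂ * v + n₃ * w → N ≡ n₀ + n₁ + n₂ + n₃
  tet-identity-8 N n₀ n₁ n₂ n₃ refl refl refl refl refl h = fromZ (eqZ h (+ 1)) (solve (N ∷ n₀ ∷ n₁ ∷ n₂ ∷ n₃ ∷ []))

  tet-identity-9 : ∀ (N n₃ : ℤ) → ∀ {v} → N * v ≡ n₃ * v → v * (N - n₃) ≡ v * + 0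
  tet-identity-9 N n₃ {v} e = fromZ (eqZ e (+ 1)) (solve (N ∷ n₃ ∷ v ∷ []))

  tet-identity-10 : ∀ (N n₀ n₁ n₂ n₃ : ℤ) → ∀ {P A B C D} → N * P ≡ n₀ * A + n₁ * B + n₂ * C + n₃ * D → - N * P ≡ - n₀ * A + - n₁ * B + - n₂ * C + - n₃ * D
  tet-identity-10 N n₀ n₁ n₂ n₃ {P} {A} {B} {C} {D} h = fromZ (eqZ h (- + 1)) (solve (N ∷ n₀ ∷ n₁ ∷ n₂ ∷ n₃ ∷ P ∷ A ∷ B ∷ C ∷ D ∷ []))

  tet-identity-12 : ∀ (D r₁ r₂ : ℤ) → ∀ {P″ P A B C E} → P″ ≡ B + + 1 * (C - P) →
    D * P ≡ (D - r₁ - r₂) * A + r₁ * B + r₂ * C + + 0 * E →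
    D * P″ ≡ - (D - r₁ - r₂) * A + (D - r₁) * B + (D - r₂) * C + + 0 * E
  tet-identity-12 D r₁ r₂ {P″} {P} {A} {B} {C} {E} refl h =
    fromZ (eqZ h (- + 1)) (solve (D ∷ r₁ ∷ r₂ ∷ P ∷ A ∷ B ∷ C ∷ E ∷ []))

  tet-identity-13 : ∀ (D c₂ : ℤ) → - D ∣ - c₂ → D ∣ c₂
  tet-identity-13 D c₂ (divides q e) = divides q (fromZ (eqZ e (- + 1)) (solve (q ∷ D ∷ c₂ ∷ [])))

  tet-identity-14 : ∀ (k N n₀ n₁ n₂ n₃ : ℤ) → ∀ {P′ P A B C D} → P′ ≡ A + k * (P - A) → N * P ≡ n₀ * A + n₁ * B + n₂ * C + n₃ * D →
    N * P′ ≡ (k * n₀ + (+ 1 - k) * N) * A + k * n₁ * B + k * n₂ * C + k * n₃ * D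
  tet-identity-14 k N n₀ n₁ n₂ n₃ {P′} {P} {A} {B} {C} {D} refl h = fromZ (eqZ h k) (solve (k ∷ N ∷ n₀ ∷ n₁ ∷ n₂ ∷ n₃ ∷ P ∷ A ∷ B ∷ C ∷ D ∷ []))

  tet-identity-15 : ∀ (k N n₀ n₁ n₂ n₃ m₀ m₁ m₂ m₃ l₀ l₁ l₂ l₃ : ℤ) → ∀ {P′ P Q S A B C D} → P′ ≡ P + k * (Q - S) → N * P ≡ n₀ * A + n₁ * B + n₂ * C + n₃ * D →
    N * Q ≡ m₀ * A + m₁ * B + m₂ * C + m₃ * D → N * S ≡ l₀ * A + l₁ * B + l₂ * C + l₃ * D →
    N * P′ ≡ (n₀ + k * (m₀ - l₀)) * A + (n₁ + k * (m₁ - l₁)) * B + (n₂ + k * (m₂ - l₂)) * C + (n₃ + k * (m₃ - l₃)) * D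
  tet-identity-15 k N n₀ n₁ n₂ n₃ m₀ m₁ m₂ m₃ l₀ l₁ l₂ l₃ {P′} {P} {Q} {S} {A} {B} {C} {D} refl h h′ h″ = fromZ (eqZ h (+ 1) ⊹ eqZ h′ k ⊹ eqZ h″ (- k))
    (solve (k ∷ N ∷ n₀ ∷ n₁ ∷ n₂ ∷ n₃ ∷ m₀ ∷ m₁ ∷ m₂ ∷ m₃ ∷ l₀ ∷ l₁ ∷ l₂ ∷ l₃ ∷ P ∷ Q ∷ S ∷ A ∷ B ∷ C ∷ D ∷ []))

  tet-identity-16 : ∀ (N : ℤ) → ∀ A B C D → N * A ≡ N * A + + 0 * B + + 0 * C + + 0 * D
  tet-identity-16 N A B C D = solve (N ∷ A ∷ B ∷ C ∷ D ∷ [])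

  tet-identity-17 : ∀ (N n₀ n₁ n₂ n₃ : ℤ) → ∀ {P A B C D} → N * P ≡ n₀ * A + n₁ * B + n₂ * C + n₃ * D → n₀ * A ≡ N * P + - n₁ * B + - n₂ * C + - n₃ * D
  tet-identity-17 N n₀ n₁ n₂ n₃ {P} {A} {B} {C} {D} h = fromZ (eqZ h (- + 1)) (solve (N ∷ n₀ ∷ n₁ ∷ n₂ ∷ n₃ ∷ P ∷ A ∷ B ∷ C ∷ D ∷ []))

  tet-identity-20 : ∀ (N n₀ : ℤ) → ∀ {n₁ n₂ n₃ P A B C D} → n₁ ≡ + 0 → n₂ ≡ + 0 → n₃ ≡ + 0 → N ≡ n₀ + n₁ + n₂ + n₃ → N * P ≡ n₀ * A + n₁ * B + n₂ * C + n₃ * D → N * P ≡ N * A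
  tet-identity-20 N n₀ {P = P} {A} {B} {C} {D} refl refl refl e k = fromZ (eqZ k (+ 1) ⊹ eqZ e (- A)) (solve (N ∷ n₀ ∷ P ∷ A ∷ B ∷ C ∷ D ∷ []))

  tet-identity-23 : ∀ x y u v w → x + y + u + v + w ≡ y + x + u + v + w
  tet-identity-23 = solve-∀

  tet-identity-24 : ∀ x y u v w → x + y + u + v + w ≡ x + u + y + v + w
  tet-identity-24 = solve-∀

  tet-identity-25 : ∀ x y u v w → x + y + u + v + w ≡ x + y + v + u + w
  tet-identity-25 = solve-∀

  tet-identity-26 : ∀ a b c d x → + 1 * x ≡ + 0 * a + + 0 * b + + 0 * c + + 0 * d + + 1 * x
  tet-identity-26 = solve-∀

  tet-identity-27 : ∀ x y u v w → x + y + u + v ≡ x + y + u + v + + 0 * w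
  tet-identity-27 = solve-∀

  tet-identity-28 : ∀ (n₀ n₁ n₂ n₃ : ℤ) → ∀ x a b c d → n₀ * x + n₁ * b + n₂ * c + n₃ * d ≡ + 0 * a + n₁ * b + n₂ * c + n₃ * d + n₀ * x
  tet-identity-28 n₀ n₁ n₂ n₃ x a b c d = solve (n₀ ∷ n₁ ∷ n₂ ∷ n₃ ∷ x ∷ a ∷ b ∷ c ∷ d ∷ [])

  tet-identity-29 : ∀ (N M n₀ n₁ n₂ n₃ l m₀ m₁ m₂ m₃ k : ℤ) → ∀ A B C D X P Y → N * P ≡ n₀ * A + n₁ * B + n₂ * C + n₃ * D + l * X → M * Y ≡ m₀ * A + m₁ * B + m₂ * C + m₃ * D + k * P →
    N * M * Y ≡ (N * m₀ + k * n₀) * A + (N * m₁ + k * n₁) * B + (N * m₂ + k * n₂) * C + (N * m₃ + k * n₃) * D + k * l * X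
  tet-identity-29 N M n₀ n₁ n₂ n₃ l m₀ m₁ m₂ m₃ k A B C D X P Y e f = fromZ (eqZ e k ⊹ eqZ f N)
    (solve (N ∷ M ∷ n₀ ∷ n₁ ∷ n₂ ∷ n₃ ∷ l ∷ m₀ ∷ m₁ ∷ m₂ ∷ m₃ ∷ k ∷ A ∷ B ∷ C ∷ D ∷ X ∷ P ∷ Y ∷ []))

  tet-identity-30 : ∀ (K N n₀ n₁ n₂ n₃ l χ₀ χ₁ χ₂ χ₃ : ℤ) → ∀ A B C D X P → K * X ≡ χ₀ * A + χ₁ * B + χ₂ * C + χ₃ * D → N * P ≡ n₀ * A + n₁ * B + n₂ * C + n₃ * D + l * X →
    N * K * P ≡ (l * χ₀ + K * n₀) * A + (l * χ₁ + K * n₁) * B + (l * χ₂ + K * n₂) * C + (l * χ₃ + K * n₃) * D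
  tet-identity-30 K N n₀ n₁ n₂ n₃ l χ₀ χ₁ χ₂ χ₃ A B C D X P e f = fromZ (eqZ e l ⊹ eqZ f K) (solve (K ∷ N ∷ n₀ ∷ n₁ ∷ n₂ ∷ n₃ ∷ l ∷ χ₀ ∷ χ₁ ∷ χ₂ ∷ χ₃ ∷ A ∷ B ∷ C ∷ D ∷ X ∷ P ∷ []))

  tet-identity-31 : ∀ (k N n₀ n₁ n₂ n₃ : ℤ) → ∀ A B C D P → N * P ≡ n₀ * A + n₁ * B + n₂ * C + n₃ * D → k * N * P ≡ k * n₀ * A + k * n₁ * B + k * n₂ * C + k * n₃ * D
  tet-identity-31 k N n₀ n₁ n₂ n₃ A B C D P e = fromZ (eqZ e k) (solve (k ∷ N ∷ n₀ ∷ n₁ ∷ n₂ ∷ n₃ ∷ A ∷ B ∷ C ∷ D ∷ P ∷ []))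

  -- Quantifying over all functionals makes this an identity of homogeneous vectors. The constant
  -- functional forces `N` to be the sum of the coefficients, and a well-chosen functional extracts
  -- a single coefficient.
  record Rel₄ (N : ℤ) (p : Pt) (n₀ : ℤ) (a : Pt) (n₁ : ℤ) (b : Pt) (n₂ : ℤ) (c : Pt) (n₃ : ℤ) (d : Pt) : Set where
    constructor rel₄
    field at : ∀ z → N * ev z p ≡ n₀ * ev z a + n₁ * ev z b + n₂ * ev z c + n₃ * ev z d
  open Rel₄ public

  Rel-swap₀ : ∀ {N p n₀ a n₁ b n₂ c n₃ d} → Rel₄ N p n₀ a n₁ b n₂ c n₃ d → Rel₄ N p n₁ b n₀ a n₂ c n₃ d
  Rel-swap₀ {n₀ = n₀} {a} {n₁} {b} {n₂} {c} {n₃} {d} (rel₄ r) = rel₄ λ z → trans (r z) (alg (n₀ * ev z a) (n₁ * ev z b) (n₂ * ev z c) (n₃ * ev z d))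
    where
    alg : ∀ x y u v → x + y + u + v ≡ y + x + u + v
    alg = tet-identity-1

  Rel-swap₁ : ∀ {N p n₀ a n₁ b n₂ c n₃ d} → Rel₄ N p n₀ a n₁ b n₂ c n₃ d → Rel₄ N p n₀ a n₂ c n₁ b n₃ d
  Rel-swap₁ {n₀ = n₀} {a} {n₁} {b} {n₂} {c} {n₃} {d} (rel₄ r) = rel₄ λ z → trans (r z) (alg (n₀ * ev z a) (n₁ * ev z b) (n₂ * ev z c) (n₃ * ev z d))
    where
    alg : ∀ x y u v → x + y + u + v ≡ x + u + y + v
    alg = tet-identity-2

  Rel-swap₂ : ∀ {N p n₀ a n₁ b n₂ c n₃ d} → Rel₄ N p n₀ a n₁ b n₂ c n₃ d → Rel₄ N p n₀ a n₁ b n₃ d n₂ c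
  Rel-swap₂ {n₀ = n₀} {a} {n₁} {b} {n₂} {c} {n₃} {d} (rel₄ r) = rel₄ λ z → trans (r z) (alg (n₀ * ev z a) (n₁ * ev z b) (n₂ * ev z c) (n₃ * ev z d))
    where
    alg : ∀ x y u v → x + y + u + v ≡ x + y + v + u
    alg = tet-identity-3

  -- Barycentric coordinates over a common denominator `N`, so that no rationals occur.
  record In₄ (a b c d p : Pt) : Set where
    constructor in₄
    field
      {N n₀ n₁ n₂ n₃} : ℤ
      N>0 : Pos N
      n₀≥0 : NN n₀
      n₁≥0 : NN n₁
      n₂≥0 : NN n₂
      n₃≥0 : NN n₃
      rel : Rel₄ N p n₀ a n₁ b n₂ c n₃ d

  In₄-swap₀ : ∀ {a b c d p} → In₄ a b c d p → In₄ b a c d p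
  In₄-swap₀ (in₄ N h₀ h₁ h₂ h₃ r) = in₄ N h₁ h₀ h₂ h₃ (Rel-swap₀ r)

  In₄-swap₁ : ∀ {a b c d p} → In₄ a b c d p → In₄ a c b d p
  In₄-swap₁ (in₄ N h₀ h₁ h₂ h₃ r) = in₄ N h₀ h₂ h₁ h₃ (Rel-swap₁ r)

  In₄-swap₂ : ∀ {a b c d p} → In₄ a b c d p → In₄ a b d c p
  In₄-swap₂ (in₄ N h₀ h₁ h₂ h₃ r) = in₄ N h₀ h₁ h₃ h₂ (Rel-swap₂ r)

  Empty : (a b c d : Pt) → Set
  Empty a b c d = ∀ {p} → In₄ a b c d p → p ≢ a → p ≢ b → p ≢ c → p ≢ d → ⊥

  record Good (a b c d : Pt) : Set where
    constructor good
    field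
      empty : Empty a b c d
      nondeg : vol a b c d ≢ + 0
  open Good public

  Good-swap₀ : ∀ {a b c d} → Good a b c d → Good b a c d
  Good-swap₀ {a} {b} {c} {d} (good e v) = good (λ i x y u w → e (In₄-swap₀ i) y x u w) (λ h → neg≢ v (trans (sym (vol-swap₀ a b c d)) h))

  Good-swap₁ : ∀ {a b c d} → Good a b c d → Good a c b d
  Good-swap₁ {a} {b} {c} {d} (good e v) = good (λ i x y u w → e (In₄-swap₁ i) x u y w) (λ h → neg≢ v (trans (sym (vol-swap₁ a b c d)) h))

  Good-swap₂ : ∀ {a b c d} → Good a b c d → Good a b d c
  Good-swap₂ {a} {b} {c} {d} (good e v) = good (λ i x y u w → e (In₄-swap₂ i) x y w u) (λ h → neg≢ v (trans (sym (vol-swap₂ a b c d)) h))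

  -- Evaluate the relation at the height over `bcd`, which annihilates the other three vertices.
  coef₀ : ∀ {N p n₀ a n₁ b n₂ c n₃ d} → Rel₄ N p n₀ a n₁ b n₂ c n₃ d → N * vol p b c d ≡ n₀ * vol a b c d
  coef₀ {N} {p} {n₀} {a} {n₁} {b} {n₂} {c} {n₃} {d} r =
    alg (trans (ev-volF b b c d) (vol-aacd b c d)) (trans (ev-volF c b c d) (vol-abad c b d))
        (trans (ev-volF d b c d) (vol-abca d b c)) (ev-volF p b c d) (ev-volF a b c d) (at r (volF b c d))
    where
    alg : ∀ {x y u v w P A} → y ≡ + 0 → u ≡ + 0 → v ≡ + 0 → w ≡ P → x ≡ A →
      N * w ≡ n₀ * x + n₁ * y + n₂ * u + n₃ * v → N * P ≡ n₀ * A
    alg {x} refl refl refl refl refl h = trans h (id x)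
      where
      id : ∀ x → n₀ * x + n₁ * + 0 + n₂ * + 0 + n₃ * + 0 ≡ n₀ * x
      id = tet-identity-4 n₀ n₁ n₂ n₃

  coef₁ : ∀ {N p n₀ a n₁ b n₂ c n₃ d} → Rel₄ N p n₀ a n₁ b n₂ c n₃ d → N * vol a p c d ≡ n₁ * vol a b c d
  coef₁ {N} {p} {n₀} {a} {n₁} {b} {n₂} {c} {n₃} {d} r =
    alg (vol-swap₀ p a c d) (vol-swap₀ b a c d) (coef₀ (Rel-swap₀ r))
    where
    alg : ∀ {x y u v} → x ≡ - u → y ≡ - v → N * u ≡ n₁ * v → N * x ≡ n₁ * y
    alg {x} {y} {u} {v} = tet-identity-5 N n₁ {x} {y} {u} {v}

  coef₂ : ∀ {N p n₀ a n₁ b n₂ c n₃ d} → Rel₄ N p n₀ a n₁ b n₂ c n₃ d → N * vol a b p d ≡ n₂ * vol a b c d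
  coef₂ {N} {p} {n₀} {a} {n₁} {b} {n₂} {c} {n₃} {d} r =
    alg (vol-swap₁ a p b d) (vol-swap₁ a c b d) (coef₁ (Rel-swap₁ r))
    where
    alg : ∀ {x y u v} → x ≡ - u → y ≡ - v → N * u ≡ n₂ * v → N * x ≡ n₂ * y
    alg {x} {y} {u} {v} = tet-identity-6 N n₂ {x} {y} {u} {v}

  coef₃ : ∀ {N p n₀ a n₁ b n₂ c n₃ d} → Rel₄ N p n₀ a n₁ b n₂ c n₃ d → N * vol a b c p ≡ n₃ * vol a b c d
  coef₃ {N} {p} {n₀} {a} {n₁} {b} {n₂} {c} {n₃} {d} r =
    alg (vol-swap₂ a b p c) (vol-swap₂ a b d c) (coef₂ (Rel-swap₂ r))
    where
    alg : ∀ {x y u v} → x ≡ - u → y ≡ - v → N * u ≡ n₃ * v → N * x ≡ n₃ * y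
    alg {x} {y} {u} {v} = tet-identity-7 N n₃ {x} {y} {u} {v}

  sum₄ : ∀ {N p n₀ a n₁ b n₂ c n₃ d} → Rel₄ N p n₀ a n₁ b n₂ c n₃ d → N ≡ n₀ + n₁ + n₂ + n₃
  sum₄ {N} {p} {n₀} {a} {n₁} {b} {n₂} {c} {n₃} {d} r = alg (ev-one p) (ev-one a) (ev-one b) (ev-one c) (ev-one d) (at r one)
    where
    alg : ∀ {x y u v w} → x ≡ + 1 → y ≡ + 1 → u ≡ + 1 → v ≡ + 1 → w ≡ + 1 →
      N * x ≡ n₀ * y + n₁ * u + n₂ * v + n₃ * w → N ≡ n₀ + n₁ + n₂ + n₃
    alg {x} {y} {u} {v} {w} = tet-identity-8 N n₀ n₁ n₂ n₃ {x} {y} {u} {v} {w}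

  -- A relation determines its coefficients, so in an empty tetrahedron no lattice point
  -- has a coefficient strictly between 0 and N.
  strict₃ : ∀ {a b c d N p n₀ n₁ n₂ n₃} → Good a b c d → Pos N → NN n₀ → NN n₁ → NN n₂ → Pos n₃ → Pos (N - n₃) →
    Rel₄ N p n₀ a n₁ b n₂ c n₃ d → ⊥
  strict₃ {a} {b} {c} {d} {N} {p} {n₀} {n₁} {n₂} {n₃} (good E v) hN h₀ h₁ h₂ h₃ h r =
    E (in₄ hN h₀ h₁ h₂ (pos⇒nn h₃) r)
      -- If `p` is `a`, `b` or `c`, then `vol a b c p` vanishes although `n₃ > 0`; if `p` is `d`,
      -- then `n₃ = N`.
      (λ { refl → zero! (vol-abca a b c) }) (λ { refl → zero! (trans (vol-swap₀ p a c p) (cong -_ (vol-abca p a c))) })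
      (λ { refl → zero! (trans (vol-swap₁ a p b p) (cong -_ (trans (vol-swap₀ p a b p) (cong -_ (vol-abca p a b))))) })
      (λ { refl → pos≢0 h (full (coef₃ r)) })
    where
    zero! : vol a b c p ≡ + 0 → ⊥
    zero! e = mul≢0 (pos≢0 h₃) v (trans (sym (coef₃ r)) (trans (cong (N *_) e) (*-zeroʳ N)))
    alg : ∀ {v} → N * v ≡ n₃ * v → v * (N - n₃) ≡ v * + 0
    alg {v} = tet-identity-9 N n₃ {v}
    full : N * vol a b c d ≡ n₃ * vol a b c d → N - n₃ ≡ + 0
    full e = mul-cancel (vol a b c d) v (alg e)

  cramer : ∀ a b c d p → Rel₄ (vol a b c d) p (vol p b c d) a (vol a p c d) b (vol a b p d) c (vol a b c p) d
  cramer a b c d p = rel₄ (vol-cramer a b c d p)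

  Rel-neg : ∀ {N p n₀ a n₁ b n₂ c n₃ d} → Rel₄ N p n₀ a n₁ b n₂ c n₃ d → Rel₄ (- N) p (- n₀) a (- n₁) b (- n₂) c (- n₃) d
  Rel-neg {N} {p} {n₀} {a} {n₁} {b} {n₂} {c} {n₃} {d} r = rel₄ λ z → alg (at r z)
    where
    alg : ∀ {P A B C D} → N * P ≡ n₀ * A + n₁ * B + n₂ * C + n₃ * D → - N * P ≡ - n₀ * A + - n₁ * B + - n₂ * C + - n₃ * D
    alg {P} {A} {B} {C} {D} = tet-identity-10 N n₀ n₁ n₂ n₃ {P} {A} {B} {C} {D}

  private
    -- An empty lattice triangle is unimodular in its plane. Integral translations bring `p` into
    -- the plane `abc` and reduce its coordinates to `0 ≤ r₁, r₂ < D`. Either this point or its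
    -- reflection in the midpoint of `bc` lies in the triangle, and a nonzero `r₂` makes it a
    -- forbidden lattice point.
    transfer⁺ : ∀ {a b c d D p c₀ c₁ c₂ c₃} → Good a b c d → Pos D → Rel₄ D p c₀ a c₁ b c₂ c c₃ d → D ∣ c₃ → D ∣ c₂
    transfer⁺ {a} {b} {c} {d} {D} {p} {c₀} {c₁} {c₂} {c₃} G hD r (divides k e₃) =
      split? (D ∣? c₂) (λ h → h) (λ ∤c₂ → ⊥-elim (step ∤c₂ (divmod D c₁ hD) (divmod D c₂ hD)))
      where
      step : ¬ (D ∣ c₂) → (∃ λ q → ∃ λ r → c₁ ≡ r + q * D × NN r × Pos (D - r)) → (∃ λ q → ∃ λ r → c₂ ≡ r + q * D × NN r × Pos (D - r)) → ⊥
      step ∤c₂ (q₁ , r₁ , e₁ , r₁≥0 , r₁<D) (q₂ , r₂ , e₂ , r₂≥0 , r₂<D) =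
        split (nn? (D - r₁ - r₂))
          (λ h → strict₃ (Good-swap₂ G) hD h r₁≥0 (num 0) r₂>0 r₂<D (Rel-swap₂ rel′))
          (λ h → strict₃ (Good-swap₂ G) hD (pos⇒nn h) (pos⇒nn r₁<D) (num 0) r₂<D (castP (↓ r₂>0) (solve (D ∷ r₂ ∷ []))) (Rel-swap₂ rel″))
        where
        r₂>0 : Pos r₂
        r₂>0 = nn≢0 r₂≥0 (λ z → ∤c₂ (divides q₂ (trans e₂ (trans (cong (_+ q₂ * D) z) (+-identityˡ (q₂ * D))))))
        p′ p″ : Pt
        p′ = lin (lin (lin p (- k) d a) (- q₁) b a) (- q₂) c a
        p″ = lin b (+ 1) c p′
        ev′ : ∀ z → ev z p′ ≡ ev z p + - k * (ev z d - ev z a) + - q₁ * (ev z b - ev z a) + - q₂ * (ev z c - ev z a)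
        ev′ z = trans (ev-lin z _ (- q₂) c a) (cong (_+ - q₂ * (ev z c - ev z a))
                (trans (ev-lin z _ (- q₁) b a) (cong (_+ - q₁ * (ev z b - ev z a)) (ev-lin z p (- k) d a))))
        rel′ : Rel₄ D p′ (D - r₁ - r₂) a r₁ b r₂ c (+ 0) d
        rel′ = rel₄ λ z → alg (ev′ z) (at r z)
          where
          alg : ∀ {P′ P A B C E} → P′ ≡ P + - k * (E - A) + - q₁ * (B - A) + - q₂ * (C - A) →
            D * P ≡ c₀ * A + c₁ * B + c₂ * C + c₃ * E → D * P′ ≡ (D - r₁ - r₂) * A + r₁ * B + r₂ * C + + 0 * E
          alg {P′} {P} {A} {B} {C} {E} refl h =
            fromZ (eqZ h (+ 1) ⊹ eqZ e₁ (B - A) ⊹ eqZ e₂ (C - A) ⊹ eqZ e₃ (E - A) ⊹ eqZ (sum₄ r) (- A))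
              (solve (D ∷ k ∷ q₁ ∷ q₂ ∷ r₁ ∷ r₂ ∷ c₀ ∷ c₁ ∷ c₂ ∷ c₃ ∷ P ∷ A ∷ B ∷ C ∷ E ∷ []))
        rel″ : Rel₄ D p″ (- (D - r₁ - r₂)) a (D - r₁) b (D - r₂) c (+ 0) d
        rel″ = rel₄ λ z → alg {E = ev z d} (ev-lin z b (+ 1) c p′) (at rel′ z)
          where
          alg : ∀ {P″ P A B C E} → P″ ≡ B + + 1 * (C - P) →
            D * P ≡ (D - r₁ - r₂) * A + r₁ * B + r₂ * C + + 0 * E →
            D * P″ ≡ - (D - r₁ - r₂) * A + (D - r₁) * B + (D - r₂) * C + + 0 * E
          alg {P″} {P} {A} {B} {C} {E} = tet-identity-12 D r₁ r₂ {P″} {P} {A} {B} {C} {E}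

  transfer₃₂ : ∀ {a b c d D p c₀ c₁ c₂ c₃} → Good a b c d → D ≢ + 0 → Rel₄ D p c₀ a c₁ b c₂ c c₃ d → D ∣ c₃ → D ∣ c₂
  transfer₃₂ {D = D} {c₂ = c₂} {c₃} G D≢0 r h = split (sgn D) (λ p → transfer⁺ G p r h)
    (λ q → split q (λ e → ⊥-elim (D≢0 e)) (λ p → neg′ (transfer⁺ G p (Rel-neg r) (∣m⇒∣-m (∣-neg h)))))
    where
    neg′ : - D ∣ - c₂ → D ∣ c₂
    neg′ = tet-identity-13 D c₂

  -- The lattice points of the plane of a facet are integral combinations of its vertices.
  transfer₃ : ∀ {a b c d D p c₀ c₁ c₂ c₃} → Good a b c d → D ≢ + 0 → Rel₄ D p c₀ a c₁ b c₂ c c₃ d → D ∣ c₃ →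
    D ∣ c₀ × D ∣ c₁ × D ∣ c₂
  transfer₃ G D≢0 r h =
    transfer₃₂ (Good-swap₁ (Good-swap₀ G)) D≢0 (Rel-swap₁ (Rel-swap₀ r)) h ,
    transfer₃₂ (Good-swap₁ G) D≢0 (Rel-swap₁ r) h ,
    transfer₃₂ G D≢0 r h

  Rel-scale : ∀ {N p n₀ a n₁ b n₂ c n₃ d} k → Rel₄ N p n₀ a n₁ b n₂ c n₃ d →
    Rel₄ N (lin a k p a) (k * n₀ + (+ 1 - k) * N) a (k * n₁) b (k * n₂) c (k * n₃) d
  Rel-scale {N} {p} {n₀} {a} {n₁} {b} {n₂} {c} {n₃} {d} k r = rel₄ λ z → alg (ev-lin z a k p a) (at r z)
    where
    alg : ∀ {P′ P A B C D} → P′ ≡ A + k * (P - A) → N * P ≡ n₀ * A + n₁ * B + n₂ * C + n₃ * D →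
      N * P′ ≡ (k * n₀ + (+ 1 - k) * N) * A + k * n₁ * B + k * n₂ * C + k * n₃ * D
    alg {P′} {P} {A} {B} {C} {D} = tet-identity-14 k N n₀ n₁ n₂ n₃ {P′} {P} {A} {B} {C} {D}

  -- Transfer applied to the dilation of `p` from `a` by the factor `k`. Over all `k` and all orders
  -- of the vertices, the coordinates of one lattice point have equal order modulo `D`.
  transferᵏ₃₂ : ∀ {a b c d D p c₀ c₁ c₂ c₃} k → Good a b c d → D ≢ + 0 → Rel₄ D p c₀ a c₁ b c₂ c c₃ d →
    D ∣ k * c₃ → D ∣ k * c₂
  transferᵏ₃₂ k G D≢0 r h = transfer₃₂ G D≢0 (Rel-scale k r) h

  Rel-cong : ∀ {N p n₀ a n₁ b n₂ c n₃ d n₀′ n₁′ n₂′ n₃′} → Rel₄ N p n₀ a n₁ b n₂ c n₃ d →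
    n₀ ≡ n₀′ → n₁ ≡ n₁′ → n₂ ≡ n₂′ → n₃ ≡ n₃′ → Rel₄ N p n₀′ a n₁′ b n₂′ c n₃′ d
  Rel-cong r refl refl refl refl = r

  Rel-lin : ∀ {N p n₀ a n₁ b n₂ c n₃ d q m₀ m₁ m₂ m₃ s l₀ l₁ l₂ l₃} k →
    Rel₄ N p n₀ a n₁ b n₂ c n₃ d → Rel₄ N q m₀ a m₁ b m₂ c m₃ d → Rel₄ N s l₀ a l₁ b l₂ c l₃ d →
    Rel₄ N (lin p k q s) (n₀ + k * (m₀ - l₀)) a (n₁ + k * (m₁ - l₁)) b (n₂ + k * (m₂ - l₂)) c (n₃ + k * (m₃ - l₃)) d
  Rel-lin {N} {p} {n₀} {a} {n₁} {b} {n₂} {c} {n₃} {d} {q} {m₀} {m₁} {m₂} {m₃} {s} {l₀} {l₁} {l₂} {l₃} k r r′ r″ =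
    rel₄ λ z → alg (ev-lin z p k q s) (at r z) (at r′ z) (at r″ z)
    where
    alg : ∀ {P′ P Q S A B C D} → P′ ≡ P + k * (Q - S) → N * P ≡ n₀ * A + n₁ * B + n₂ * C + n₃ * D →
      N * Q ≡ m₀ * A + m₁ * B + m₂ * C + m₃ * D → N * S ≡ l₀ * A + l₁ * B + l₂ * C + l₃ * D →
      N * P′ ≡ (n₀ + k * (m₀ - l₀)) * A + (n₁ + k * (m₁ - l₁)) * B + (n₂ + k * (m₂ - l₂)) * C + (n₃ + k * (m₃ - l₃)) * D
    alg {P′} {P} {Q} {S} {A} {B} {C} {D} = tet-identity-15 k N n₀ n₁ n₂ n₃ m₀ m₁ m₂ m₃ l₀ l₁ l₂ l₃ {P′} {P} {Q} {S} {A} {B} {C} {D}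

  Rel-v₀ : ∀ {N a b c d} → Rel₄ N a N a (+ 0) b (+ 0) c (+ 0) d
  Rel-v₀ {N} {a} {b} {c} {d} = rel₄ λ z → alg (ev z a) (ev z b) (ev z c) (ev z d)
    where
    alg : ∀ A B C D → N * A ≡ N * A + + 0 * B + + 0 * C + + 0 * D
    alg = tet-identity-16 N

  Rel-v₁ : ∀ {N a b c d} → Rel₄ N b (+ 0) a N b (+ 0) c (+ 0) d
  Rel-v₁ = Rel-swap₀ Rel-v₀

  Rel-v₂ : ∀ {N a b c d} → Rel₄ N c (+ 0) a (+ 0) b N c (+ 0) d
  Rel-v₂ = Rel-swap₁ Rel-v₁

  Rel-v₃ : ∀ {N a b c d} → Rel₄ N d (+ 0) a (+ 0) b (+ 0) c N d
  Rel-v₃ = Rel-swap₂ Rel-v₂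

  -- The same dependence read in the tetrahedron `pbcd`. When `N` is the volume of `abcd`, `n₀` is
  -- up to sign the volume of `pbcd`, so transfer becomes available with modulus `n₀`.
  Rel-solve : ∀ {N p n₀ a n₁ b n₂ c n₃ d} → Rel₄ N p n₀ a n₁ b n₂ c n₃ d → Rel₄ n₀ a N p (- n₁) b (- n₂) c (- n₃) d
  Rel-solve {N} {p} {n₀} {a} {n₁} {b} {n₂} {c} {n₃} {d} r = rel₄ λ z → alg (at r z)
    where
    alg : ∀ {P A B C D} → N * P ≡ n₀ * A + n₁ * B + n₂ * C + n₃ * D → n₀ * A ≡ N * P + - n₁ * B + - n₂ * C + - n₃ * D
    alg {P} {A} {B} {C} {D} = tet-identity-17 N n₀ n₁ n₂ n₃ {P} {A} {B} {C} {D}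

  ab-swap₀ : ∀ a b c d → ab (vol b a c d) ≡ ab (vol a b c d)
  ab-swap₀ a b c d = trans (cong ab (vol-swap₀ a b c d)) (ab-neg (vol a b c d))

  ab-swap₁ : ∀ a b c d → ab (vol a c b d) ≡ ab (vol a b c d)
  ab-swap₁ a b c d = trans (cong ab (vol-swap₁ a b c d)) (ab-neg (vol a b c d))

  ab-swap₂ : ∀ a b c d → ab (vol a b d c) ≡ ab (vol a b c d)
  ab-swap₂ a b c d = trans (cong ab (vol-swap₂ a b c d)) (ab-neg (vol a b c d))

  subVol : ∀ {N p n₀ a n₁ b n₂ c n₃ d} → Rel₄ N p n₀ a n₁ b n₂ c n₃ d → Pos N → ab (vol a b c d) ≡ N → ab (vol p b c d) ≡ ab n₀
  subVol {N} {p} {n₀} {a} {n₁} {b} {n₂} {c} {n₃} {d} r hN e = mul-cancel N (pos≢0 hN)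
    (trans (trans (cong (_* ab (vol p b c d)) (sym (ab-pos (pos⇒nn hN)))) (sym (ab-* N (vol p b c d))))
    (trans (cong ab (coef₀ r)) (trans (ab-* n₀ (vol a b c d)) (trans (cong (ab n₀ *_) e) (*-comm (ab n₀) N)))))

  -- The coefficients are nonnegative apart from `n₀` and add up to `N`, so the other three vanish.
  vertex₀ : ∀ {N p n₀ a n₁ b n₂ c n₃ d} → Pos N → NN n₁ → NN n₂ → NN n₃ → Rel₄ N p n₀ a n₁ b n₂ c n₃ d → NN (n₀ - N) → p ≡ a
  vertex₀ {N} {p} {n₀} {a} {n₁} {b} {n₂} {c} {n₃} {d} hN h₁ h₂ h₃ r h =
    pt-ext λ z → mul-cancel N (pos≢0 hN) (alg {A = ev z a} {ev z b} {ev z c} {ev z d} (z₁ h₁ h₂ h₃ S) (z₁ h₂ h₁ h₃ S₂) (z₁ h₃ h₁ h₂ S₃) (sum₄ r) (at r z))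
    where
    S = sum₄ r
    S₂ : N ≡ n₀ + n₂ + n₁ + n₃
    S₂ = trans S (solve (n₀ ∷ n₁ ∷ n₂ ∷ n₃ ∷ []))
    S₃ : N ≡ n₀ + n₃ + n₁ + n₂
    S₃ = trans S (solve (n₀ ∷ n₁ ∷ n₂ ∷ n₃ ∷ []))
    z₁ : ∀ {x y z} → NN x → NN y → NN z → N ≡ n₀ + x + y + z → x ≡ + 0
    z₁ {x} {y} {z} hx hy hz s = antisym (cast hx (solve (x ∷ []))) (cast (hy ⊞ hz ⊞ h ⊞ eqNN s (+ 1)) (solve (N ∷ n₀ ∷ x ∷ y ∷ z ∷ [])))
    alg : ∀ {n₁ n₂ n₃ P A B C D} → n₁ ≡ + 0 → n₂ ≡ + 0 → n₃ ≡ + 0 → N ≡ n₀ + n₁ + n₂ + n₃ → N * P ≡ n₀ * A + n₁ * B + n₂ * C + n₃ * D → N * P ≡ N * A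
    alg {n₁} {n₂} {n₃} {P} {A} {B} {C} {D} = tet-identity-20 N n₀ {n₁} {n₂} {n₃} {P} {A} {B} {C} {D}

  -- The two volumes are in the ratio `n₀ : N`, and `n₀ < N` because only `a` itself reaches `N`.
  descend₀ : ∀ {N p n₀ a n₁ b n₂ c n₃ d} → vol a b c d ≢ + 0 → Pos N → NN n₀ → NN n₁ → NN n₂ → NN n₃ → Rel₄ N p n₀ a n₁ b n₂ c n₃ d →
    p ≢ a → n₀ ≢ + 0 → vol p b c d ≢ + 0 × Pos (ab (vol a b c d) - ab (vol p b c d))
  descend₀ {N} {p} {n₀} {a} {n₁} {b} {n₂} {c} {n₃} {d} v hN h₀ h₁ h₂ h₃ r p≢a n₀≢0 =
    (λ e → mul≢0 n₀≢0 v (trans (sym (coef₀ r)) (trans (cong (N *_) e) (*-zeroʳ N)))) ,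
    alg (trans (cong (_* ab (vol p b c d)) (sym (ab-pos (pos⇒nn hN)))) (trans (sym (ab-* N (vol p b c d)))
        (trans (cong ab (coef₀ r)) (trans (ab-* n₀ (vol a b c d)) (cong (_* ab (vol a b c d)) (ab-pos h₀)))))) (ab-≢0 v)
    where
    lt : Pos (N - n₀)
    lt = split {C = Pos (N - n₀)} (nn? (n₀ - N)) (λ h → ⊥-elim (p≢a (vertex₀ hN h₁ h₂ h₃ r h))) (λ (pos h) → castP h (solve (N ∷ n₀ ∷ [])))
    alg : ∀ {x y} → N * x ≡ n₀ * y → Pos y → Pos (y - x)
    alg {x} {y} e hy = pos-cancel⁺ (pos⇒nn hN) (castP (↓ (posM lt hy) ⊞ eqNN e (- + 1)) (solve (N ∷ n₀ ∷ x ∷ y ∷ [])))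

  Rel-uniq : ∀ {N p n₀ a n₁ b n₂ c n₃ d m₀ m₁ m₂ m₃} → vol a b c d ≢ + 0 → Rel₄ N p n₀ a n₁ b n₂ c n₃ d → Rel₄ N p m₀ a m₁ b m₂ c m₃ d →
    n₀ ≡ m₀ × n₁ ≡ m₁ × n₂ ≡ m₂ × n₃ ≡ m₃
  Rel-uniq {a = a} {b = b} {c = c} {d = d} v r s =
    cancelʳ (vol a b c d) v (trans (sym (coef₀ r)) (coef₀ s)) , cancelʳ (vol a b c d) v (trans (sym (coef₁ r)) (coef₁ s)) ,
    cancelʳ (vol a b c d) v (trans (sym (coef₂ r)) (coef₂ s)) , cancelʳ (vol a b c d) v (trans (sym (coef₃ r)) (coef₃ s))

  record Coord (K : ℤ) (a b c d p : Pt) : Set where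
    constructor coord
    field
      {c₀ c₁ c₂ c₃} : ℤ
      crel : Rel₄ K p c₀ a c₁ b c₂ c c₃ d

  -- Cramer's dependence, negated for a negative orientation, so that the denominator is the
  -- unsigned volume.
  coords : ∀ {K a b c d} → ab (vol a b c d) ≡ K → ∀ p → Coord K a b c d p
  coords {K} {a} {b} {c} {d} e p = split (ab-sign (vol a b c d))
    (λ h → coord (subst (λ t → Rel₄ t p _ a _ b _ c _ d) (trans (sym h) e) (cramer a b c d p)))
    (λ h → coord (subst (λ t → Rel₄ t p _ a _ b _ c _ d) (trans (sym h) e) (Rel-neg (cramer a b c d p))))

  record In₅ (a b c d x p : Pt) : Set where
    constructor in₅
    field
      {N n₀ n₁ n₂ n₃ l} : ℤ
      N>0 : Pos N
      n₀≥0 : NN n₀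
      n₁≥0 : NN n₁
      n₂≥0 : NN n₂
      n₃≥0 : NN n₃
      l≥0 : NN l
      rel : ∀ z → N * ev z p ≡ n₀ * ev z a + n₁ * ev z b + n₂ * ev z c + n₃ * ev z d + l * ev z x

  In₅-swap₀ : ∀ {a b c d x p} → In₅ a b c d x p → In₅ b a c d x p
  In₅-swap₀ {a} {b} {c} {d} {x} (in₅ {N} {n₀} {n₁} {n₂} {n₃} {l} hN h₀ h₁ h₂ h₃ hl r) =
    in₅ hN h₁ h₀ h₂ h₃ hl (λ z → trans (r z) (alg (n₀ * ev z a) (n₁ * ev z b) (n₂ * ev z c) (n₃ * ev z d) (l * ev z x)))
    where
    alg : ∀ x y u v w → x + y + u + v + w ≡ y + x + u + v + w
    alg = tet-identity-23

  In₅-swap₁ : ∀ {a b c d x p} → In₅ a b c d x p → In₅ a c b d x p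
  In₅-swap₁ {a} {b} {c} {d} {x} (in₅ {N} {n₀} {n₁} {n₂} {n₃} {l} hN h₀ h₁ h₂ h₃ hl r) =
    in₅ hN h₀ h₂ h₁ h₃ hl (λ z → trans (r z) (alg (n₀ * ev z a) (n₁ * ev z b) (n₂ * ev z c) (n₃ * ev z d) (l * ev z x)))
    where
    alg : ∀ x y u v w → x + y + u + v + w ≡ x + u + y + v + w
    alg = tet-identity-24

  In₅-swap₂ : ∀ {a b c d x p} → In₅ a b c d x p → In₅ a b d c x p
  In₅-swap₂ {a} {b} {c} {d} {x} (in₅ {N} {n₀} {n₁} {n₂} {n₃} {l} hN h₀ h₁ h₂ h₃ hl r) =
    in₅ hN h₀ h₁ h₃ h₂ hl (λ z → trans (r z) (alg (n₀ * ev z a) (n₁ * ev z b) (n₂ * ev z c) (n₃ * ev z d) (l * ev z x)))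
    where
    alg : ∀ x y u v w → x + y + u + v + w ≡ x + y + v + u + w
    alg = tet-identity-25

  In₅-self : ∀ {a b c d x} → In₅ a b c d x x
  In₅-self {a} {b} {c} {d} {x} = in₅ {N = + 1} {+ 0} {+ 0} {+ 0} {+ 0} {+ 1} (pos (num 0)) (num 0) (num 0) (num 0) (num 0) (num 1)
    (λ z → alg (ev z a) (ev z b) (ev z c) (ev z d) (ev z x))
    where
    alg : ∀ a b c d x → + 1 * x ≡ + 0 * a + + 0 * b + + 0 * c + + 0 * d + + 1 * x
    alg = tet-identity-26

  In₄⇒In₅ : ∀ {a b c d x p} → In₄ a b c d p → In₅ a b c d x p
  In₄⇒In₅ {a} {b} {c} {d} {x} (in₄ {N} {n₀} {n₁} {n₂} {n₃} hN h₀ h₁ h₂ h₃ r) = in₅ {l = + 0} hN h₀ h₁ h₂ h₃ (num 0)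
    (λ z → trans (at r z) (alg (n₀ * ev z a) (n₁ * ev z b) (n₂ * ev z c) (n₃ * ev z d) (ev z x)))
    where
    alg : ∀ x y u v w → x + y + u + v ≡ x + y + u + v + + 0 * w
    alg = tet-identity-27

  In₄-replace : ∀ {a b c d x p} → In₄ x b c d p → In₅ a b c d x p
  In₄-replace {a} {b} {c} {d} {x} {p} (in₄ {N} {n₀} {n₁} {n₂} {n₃} hN h₀ h₁ h₂ h₃ r) = in₅ {n₀ = + 0} {n₁} {n₂} {n₃} {n₀} hN (num 0) h₁ h₂ h₃ h₀
    (λ z → trans (at r z) (alg (ev z x) (ev z a) (ev z b) (ev z c) (ev z d)))
    where
    alg : ∀ x a b c d → n₀ * x + n₁ * b + n₂ * c + n₃ * d ≡ + 0 * a + n₁ * b + n₂ * c + n₃ * d + n₀ * x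
    alg = tet-identity-28 n₀ n₁ n₂ n₃

  In₅-trans : ∀ {a b c d r x y} → In₅ a b c d r x → In₅ a b c d x y → In₅ a b c d r y
  In₅-trans {a} {b} {c} {d} {r} {x} {y} (in₅ {N} {n₀} {n₁} {n₂} {n₃} {l} hN h₀ h₁ h₂ h₃ hl R) (in₅ {M} {m₀} {m₁} {m₂} {m₃} {k} hM k₀ k₁ k₂ k₃ hk S) =
    in₅ {N = N * M} {N * m₀ + k * n₀} {N * m₁ + k * n₁} {N * m₂ + k * n₂} {N * m₃ + k * n₃} {k * l} (posM hN hM)
      (pos⇒nn hN ⊠ k₀ ⊞ hk ⊠ h₀) (pos⇒nn hN ⊠ k₁ ⊞ hk ⊠ h₁) (pos⇒nn hN ⊠ k₂ ⊞ hk ⊠ h₂) (pos⇒nn hN ⊠ k₃ ⊞ hk ⊠ h₃) (hk ⊠ hl)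
      (λ z → alg (ev z a) (ev z b) (ev z c) (ev z d) (ev z r) (ev z x) (ev z y) (R z) (S z))
    where
    alg : ∀ A B C D X P Y → N * P ≡ n₀ * A + n₁ * B + n₂ * C + n₃ * D + l * X → M * Y ≡ m₀ * A + m₁ * B + m₂ * C + m₃ * D + k * P →
      N * M * Y ≡ (N * m₀ + k * n₀) * A + (N * m₁ + k * n₁) * B + (N * m₂ + k * n₂) * C + (N * m₃ + k * n₃) * D + k * l * X
    alg = tet-identity-29 N M n₀ n₁ n₂ n₃ l m₀ m₁ m₂ m₃ k

  In₅-coords : ∀ {a b c d x p K N n₀ n₁ n₂ n₃ l χ₀ χ₁ χ₂ χ₃} → Rel₄ K x χ₀ a χ₁ b χ₂ c χ₃ d →
    (∀ z → N * ev z p ≡ n₀ * ev z a + n₁ * ev z b + n₂ * ev z c + n₃ * ev z d + l * ev z x) →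
    Rel₄ (N * K) p (l * χ₀ + K * n₀) a (l * χ₁ + K * n₁) b (l * χ₂ + K * n₂) c (l * χ₃ + K * n₃) d
  In₅-coords {a} {b} {c} {d} {x} {p} {K} {N} {n₀} {n₁} {n₂} {n₃} {l} {χ₀} {χ₁} {χ₂} {χ₃} r s =
    rel₄ λ z → alg (ev z a) (ev z b) (ev z c) (ev z d) (ev z x) (ev z p) (at r z) (s z)
    where
    alg : ∀ A B C D X P → K * X ≡ χ₀ * A + χ₁ * B + χ₂ * C + χ₃ * D → N * P ≡ n₀ * A + n₁ * B + n₂ * C + n₃ * D + l * X →
      N * K * P ≡ (l * χ₀ + K * n₀) * A + (l * χ₁ + K * n₁) * B + (l * χ₂ + K * n₂) * C + (l * χ₃ + K * n₃) * D
    alg = tet-identity-30 K N n₀ n₁ n₂ n₃ l χ₀ χ₁ χ₂ χ₃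

  Rel-mul : ∀ {N p n₀ a n₁ b n₂ c n₃ d} k → Rel₄ N p n₀ a n₁ b n₂ c n₃ d → Rel₄ (k * N) p (k * n₀) a (k * n₁) b (k * n₂) c (k * n₃) d
  Rel-mul {N} {p} {n₀} {a} {n₁} {b} {n₂} {c} {n₃} {d} k r = rel₄ λ z → alg (ev z a) (ev z b) (ev z c) (ev z d) (ev z p) (at r z)
    where
    alg : ∀ A B C D P → N * P ≡ n₀ * A + n₁ * B + n₂ * C + n₃ * D → k * N * P ≡ k * n₀ * A + k * n₁ * B + k * n₂ * C + k * n₃ * D
    alg = tet-identity-31 k N n₀ n₁ n₂ n₃

  Isolated : (a b c d x : Pt) → Set
  Isolated a b c d x = ∀ {y} → In₅ a b c d x y → y ≢ a → y ≢ b → y ≢ c → y ≢ d → y ≢ x → ⊥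

  -- For coordinates with sum `K` this is `K` plus twice the sum of the negative parts. Each
  -- negative coordinate belongs to a facet visible from the point, so the negative parts add up to
  -- the volume by which the point enlarges the hull.
  sum-ab : (x y u v : ℤ) → ℤ
  sum-ab x y u v = ab x + ab y + ab u + ab v

-- White's theorem on empty tetrahedra

module White where

  open Base
  open Arith
  open Tet
  open import Data.Nat using (zero; suc)
  open import Data.Integer hiding (suc; pos; ∣_∣)
  open import Data.Integer.Properties
  open import Data.Integer.Divisibility.Signed
  open import Data.Integer.Tactic.RingSolver using (solve; solve-∀)
  open import Data.List using (_∷_; [])
  open import Data.Product using (∃; _×_; _,_)
  open import Data.Sum using (_⊎_; inj₁; inj₂)
  open import Data.Empty using (⊥; ⊥-elim)
  open import Function using (_∘_)
  open import Relation.Nullary using (¬_)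
  open import Relation.Binary.PropositionalEquality using (_≡_; _≢_; refl; sym; trans; cong; cong₂; subst)

  white-identity-1 : ∀ x → x - + 1 + (+ 0 - x) ≡ -[1+ 0 ]
  white-identity-1 = solve-∀

  white-identity-2 : ∀ {Q P A r m} → Q ≡ r + m * P → A ≡ + 0 → Q + - m * (P - A) ≡ r
  white-identity-2 {P = P} {r = r} {m} refl refl = solve (r ∷ m ∷ P ∷ [])

  white-identity-3 : ∀ n p r → + 1 + n - p + (p - r - + 1) ≡ n - r
  white-identity-3 = solve-∀

  white-identity-9 : ∀ (D A B C g : ℤ) → ∀ {W B′ C′ D′ A′} → W ≡ + 1 → B′ ≡ + 1 → C′ ≡ + 0 → D′ ≡ + 0 →
    D * W ≡ A * A′ + B * B′ + C * C′ + - g * D′ → D ≡ A + B + C + - g → C - g ≡ (A′ - + 1) * A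
  white-identity-9 D A B C g {A′ = A′} refl refl refl refl h s = fromZ (eqZ h (+ 1) ⊹ eqZ s (- + 1)) (solve (D ∷ A ∷ B ∷ C ∷ g ∷ A′ ∷ []))

  white-identity-10 : ∀ (D A B C g : ℤ) → ∀ {W B′ C′ D′ A′} → W ≡ + 1 → B′ ≡ + 0 → C′ ≡ + 1 → D′ ≡ + 0 →
    D * W ≡ A * A′ + B * B′ + C * C′ + - g * D′ → D ≡ A + B + C + - g → B - g ≡ (A′ - + 1) * A
  white-identity-10 D A B C g {A′ = A′} refl refl refl refl h s = fromZ (eqZ h (+ 1) ⊹ eqZ s (- + 1)) (solve (D ∷ A ∷ B ∷ C ∷ g ∷ A′ ∷ []))

  white-identity-11 : ∀ (D A B C g : ℤ) → ∀ {W B′ C′ D′ A′} → W ≡ + 1 → B′ ≡ + 0 → C′ ≡ + 0 → D′ ≡ + 1 →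
    D * W ≡ A * A′ + B * B′ + C * C′ + - g * D′ → D ≡ A + B + C + - g → B + C ≡ (A′ - + 1) * A
  white-identity-11 D A B C g {A′ = A′} refl refl refl refl h s = fromZ (eqZ h (+ 1) ⊹ eqZ s (- + 1)) (solve (D ∷ A ∷ B ∷ C ∷ g ∷ A′ ∷ []))

  white-identity-12 : ∀ (D A B C g : ℤ) → ∀ {W A′ B′ C′ D′} → A′ ≡ + 0 → B′ ≡ + 0 → C′ ≡ + 0 → D′ ≡ D → D * W ≡ A * A′ + B * B′ + C * C′ + - g * D′ → D * W ≡ D * - g
  white-identity-12 D A B C g {W} refl refl refl refl h = trans h (solve (D ∷ A ∷ B ∷ C ∷ g ∷ []))

  white-identity-14 : ∀ (N D g n₀ n₁ n₂ n₃ A B C : ℤ) → ∀ {Y W A′ B′ C′ D′} → N * Y ≡ n₀ * W + n₁ * B′ + n₂ * C′ + n₃ * D′ → D * W ≡ A * A′ + B * B′ + C * C′ + - g * D′ →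
    N * D * Y ≡ n₀ * A * A′ + (n₀ * B + D * n₁) * B′ + (n₀ * C + D * n₂) * C′ + (D * n₃ - g * n₀) * D′
  white-identity-14 N D g n₀ n₁ n₂ n₃ A B C {Y} {W} {A′} {B′} {C′} {D′} h k = fromZ (eqZ h D ⊹ eqZ k n₀)
      (solve (N ∷ D ∷ g ∷ n₀ ∷ n₁ ∷ n₂ ∷ n₃ ∷ A ∷ B ∷ C ∷ Y ∷ W ∷ A′ ∷ B′ ∷ C′ ∷ D′ ∷ []))

  white-identity-17 : ∀ (N n₀ : ℤ) → ∀ {n₁ n₂ n₃ Y W B′ C′ D′} → n₁ ≡ + 0 → n₂ ≡ + 0 → n₃ ≡ + 0 → N ≡ n₀ → N * Y ≡ n₀ * W + n₁ * B′ + n₂ * C′ + n₃ * D′ → N * Y ≡ N * W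
  white-identity-17 N n₀ {Y = Y} {W} {B′} {C′} {D′} refl refl refl e h = fromZ (eqZ h (+ 1) ⊹ eqZ e (- W)) (solve (N ∷ n₀ ∷ Y ∷ W ∷ B′ ∷ C′ ∷ D′ ∷ []))

  white-identity-19 : ∀ n D x → + 1 + n - D + (D - x - + 1) ≡ n - x
  white-identity-19 = solve-∀

  white-identity-23 : ∀ v → NN (v - + 1) → NN (+ 0 - v) → ⊥
  white-identity-23 v p q = contra (p ⊞ q) (solve (v ∷ []))

  white-identity-24 : ∀ (p q₁ q₂ B : ℤ) → ∀ D → + 0 + - + 1 * (p - + 0) ≡ B + q₁ * D → + 0 + - + 1 * (p - + 0) + - q₁ * (D - + 0) + - q₂ * (+ 0 - + 0) ≡ B
  white-identity-24 p q₁ q₂ B D h = fromZ (eqZ h (+ 1)) (solve (p ∷ q₁ ∷ q₂ ∷ B ∷ D ∷ []))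

  white-identity-25 : ∀ (p q₁ q₂ C : ℤ) → ∀ D → + 0 + - + 1 * (p - + 0) ≡ C + q₂ * D → + 0 + - + 1 * (p - + 0) + - q₁ * (+ 0 - + 0) + - q₂ * (D - + 0) ≡ C
  white-identity-25 p q₁ q₂ C D h = fromZ (eqZ h (+ 1)) (solve (p ∷ q₁ ∷ q₂ ∷ C ∷ D ∷ []))

  white-identity-26 : ∀ (q₁ q₂ : ℤ) → ∀ {a b c p} → a ≡ + 0 → b ≡ + 0 → c ≡ + 0 →
    a + - + 1 * (p - a) + - q₁ * (b - a) + - q₂ * (c - a) ≡ - p
  white-identity-26 q₁ q₂ {p = p} refl refl refl = solve (p ∷ q₁ ∷ q₂ ∷ [])

  white-identity-27 : ∀ (x y m B C : ℤ) → ∀ {D A g} → D ≡ A + B + C + - g → C ≡ g → D ∣ + 1 * (x + m * A) + + 1 * (y + m * B) → D ∣ x + y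
  white-identity-27 x y m B C {D} {A} s refl h = ∣-to (∣-lin (+ 1) (- m) h ∣-refl) (fromZ (eqZ s (- m)) (solve (x ∷ y ∷ m ∷ A ∷ B ∷ C ∷ D ∷ [])))

  white-identity-28 : ∀ (x u m B C : ℤ) → ∀ {D A g} → D ≡ A + B + C + - g → B ≡ g → D ∣ + 1 * (x + m * A) + + 1 * (u + m * C) → D ∣ x + u
  white-identity-28 x u m B C {D} {A} s refl h = ∣-to (∣-lin (+ 1) (- m) h ∣-refl) (fromZ (eqZ s (- m)) (solve (x ∷ u ∷ m ∷ A ∷ B ∷ C ∷ D ∷ [])))

  white-identity-29 : ∀ (x y u v m B C : ℤ) → ∀ {D A g} → D ≡ A + B + C + - g → D ≡ x + y + u + v → A ≡ g → D ∣ + 1 * (y + m * B) + + 1 * (u + m * C) → D ∣ x + v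
  white-identity-29 x y u v m B C {D} {A} s t refl h = ∣-to (∣-lin (- + 1) (+ 1 + m) h ∣-refl) (fromZ (eqZ s m ⊹ eqZ t (+ 1)) (solve (x ∷ y ∷ u ∷ v ∷ m ∷ A ∷ B ∷ C ∷ D ∷ [])))

  -- A functional that takes both values 0 and 1 is onto the integers, so its levels 0 and 1 are
  -- consecutive lattice planes, here through two opposite edges.
  record Split (a b c d : Pt) : Set where
    constructor splits
    field
      fn : Fun
      va : ev fn a ≡ + 1
      vb : ev fn b ≡ + 1
      vc : ev fn c ≡ + 0
      vd : ev fn d ≡ + 0

  Split-flip : ∀ {a b c d} → Split a b c d → Split b a c d
  Split-flip (splits z p q r s) = splits z q p r s

  Split-comp : ∀ {a b c d} → Split a b c d → Split c d a b
  Split-comp {a} {b} {c} {d} (splits z p q r s) = splits z′ (val r) (val s) (val p) (val q)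
    where
    z′ : Fun
    z′ = addF one (scaleF (- + 1) z)
    val : ∀ {x v} → ev z x ≡ v → ev z′ x ≡ + 1 + - + 1 * v
    val {x} refl = trans (ev-addF one (scaleF (- + 1) z) x) (cong₂ _+_ (ev-one x) (ev-scaleF (- + 1) z x))

  -- The three pairings of the vertices, as a disjunction in continuation form: the smallest height
  -- used in the induction is only available inside a refutation.
  White : (a b c d : Pt) → Set
  White a b c d = (Split a b c d → ⊥) → (Split a c b d → ⊥) → (Split a d b c → ⊥) → ⊥

  -- Each functional substitutes a point for one vertex and vanishes on the opposite facet. Divided
  -- by `D`, the four values are the barycentric coordinates of the point.
  module Slots (a b c d : Pt) where
    F₀ F₁ F₂ F₃ : Fun
    F₀ = volF b c d
    F₁ = scaleF (- + 1) (volF a c d)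
    F₂ = volF a b d
    F₃ = scaleF (- + 1) (volF a b c)

    ev₀ : ∀ p → ev F₀ p ≡ vol p b c d
    ev₀ p = ev-volF p b c d

    ev₁ : ∀ p → ev F₁ p ≡ vol a p c d
    ev₁ p = trans (ev-scaleF (- + 1) (volF a c d) p) (trans (cong (- + 1 *_) (ev-volF p a c d))
              (trans (-1*i≡-i _) (sym (vol-swap₀ p a c d))))

    ev₂ : ∀ p → ev F₂ p ≡ vol a b p d
    ev₂ p = trans (ev-volF p a b d) (trans (sym (neg-involutive _)) (trans (cong -_ (sym (vol-swap₀ p a b d))) (sym (vol-swap₁ a p b d))))

    ev₃ : ∀ p → ev F₃ p ≡ vol a b c p
    ev₃ p = trans (ev-scaleF (- + 1) (volF a b c) p) (trans (cong (- + 1 *_) (ev-volF p a b c)) (trans (-1*i≡-i _)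
       (trans (sym (vol-swap₀ p a b c)) (trans (sym (neg-involutive _)) (trans (cong -_ (sym (vol-swap₁ a p b c))) (sym (vol-swap₂ a b p c)))))))

    D : ℤ
    D = vol a b c d

    F₀a : ev F₀ a ≡ D
    F₀a = ev₀ a
    F₀b : ev F₀ b ≡ + 0
    F₀b = trans (ev₀ b) (vol-aacd b c d)
    F₀c : ev F₀ c ≡ + 0
    F₀c = trans (ev₀ c) (vol-abad c b d)
    F₀d : ev F₀ d ≡ + 0
    F₀d = trans (ev₀ d) (vol-abca d b c)
    F₁a : ev F₁ a ≡ + 0
    F₁a = trans (ev₁ a) (vol-aacd a c d)
    F₁b : ev F₁ b ≡ D
    F₁b = ev₁ b
    F₁c : ev F₁ c ≡ + 0
    F₁c = trans (ev₁ c) (trans (vol-swap₀ c a c d) (cong -_ (vol-abad c a d)))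
    F₁d : ev F₁ d ≡ + 0
    F₁d = trans (ev₁ d) (trans (vol-swap₀ d a c d) (cong -_ (vol-abca d a c)))
    F₂a : ev F₂ a ≡ + 0
    F₂a = trans (ev-volF a a b d) (vol-aacd a b d)
    F₂b : ev F₂ b ≡ + 0
    F₂b = trans (ev-volF b a b d) (vol-abad b a d)
    F₂c : ev F₂ c ≡ D
    F₂c = ev₂ c
    F₂d : ev F₂ d ≡ + 0
    F₂d = trans (ev-volF d a b d) (vol-abca d a b)
    F₃a : ev F₃ a ≡ + 0
    F₃a = trans (ev-scaleF (- + 1) (volF a b c) a) (cong (- + 1 *_) (trans (ev-volF a a b c) (vol-aacd a b c)))
    F₃b : ev F₃ b ≡ + 0
    F₃b = trans (ev-scaleF (- + 1) (volF a b c) b) (cong (- + 1 *_) (trans (ev-volF b a b c) (vol-abad b a c)))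
    F₃c : ev F₃ c ≡ + 0
    F₃c = trans (ev-scaleF (- + 1) (volF a b c) c) (cong (- + 1 *_) (trans (ev-volF c a b c) (vol-abca c a b)))
    F₃d : ev F₃ d ≡ D
    F₃d = ev₃ d

  divF : ∀ {D} φ → (∀ p → D ∣ ev φ p) → ∃ λ z → ∀ p → ev φ p ≡ D * ev z p
  divF {D} φ h with h O | h e₁ | h e₂ | h e₃
  ... | divides t p | divides t₁ p₁ | divides t₂ p₂ | divides t₃ p₃ = _ , ev-basis φ t₁ t₂ t₃ t D p p₁ p₂ p₃

  mkSplit : ∀ {D a b c d} φ → D ≢ + 0 → (∀ p → D ∣ ev φ p) →
    ev φ a ≡ D → ev φ b ≡ D → ev φ c ≡ + 0 → ev φ d ≡ + 0 → Split a b c d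
  mkSplit {D} φ D≢0 h pa pb pc pd with divF φ h
  ... | z , e = splits z (one′ pa) (one′ pb) (zero′ pc) (zero′ pd)
    where
    one′ : ∀ {p} → ev φ p ≡ D → ev z p ≡ + 1
    one′ {p} q = mul-cancel D D≢0 (trans (sym (e p)) (trans q (sym (*-identityʳ D))))
    zero′ : ∀ {p} → ev φ p ≡ + 0 → ev z p ≡ + 0
    zero′ {p} q = mul-cancel D D≢0 (trans (sym (e p)) (trans q (sym (*-zeroʳ D))))

  -- Euclid's algorithm on the values of `φ`. If `ev φ p` does not divide `ev φ q`, the remainder is
  -- attained at `q - m(p - a)`, because `φ` vanishes at `a`. So a smallest positive value divides
  -- all values.
  least : ∀ n (φ : Fun) a p → ev φ a ≡ + 0 → Pos (ev φ p) → NN (+ n - ev φ p) →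
    (∀ p → Pos (ev φ p) → (∀ q → ev φ p ∣ ev φ q) → ⊥) → ⊥
  least zero φ a p _ (pos h) k _ = contra (h ⊞ k) (alg (ev φ p))
    where
    alg : ∀ x → x - + 1 + (+ 0 - x) ≡ -[1+ 0 ]
    alg = white-identity-1
  least (suc n) φ a p a0 h k K = K p h λ q → split? (ev φ p ∣? ev φ q) (λ x → x) (λ ∤ → ⊥-elim (go q ∤ (divmod (ev φ p) (ev φ q) h)))
    where
    go : ∀ q → ¬ (ev φ p ∣ ev φ q) → (∃ λ m → ∃ λ r → ev φ q ≡ r + m * ev φ p × NN r × Pos (ev φ p - r)) → ⊥
    go q ∤ (m , r , e , r≥0 , r<) = least n φ a q′ a0 (subst Pos (sym evq′) r>0)
        (cast (k ⊞ ↓ r<) (trans (alg₁ (+ n) (ev φ p) r) (cong (λ t → + n - t) (sym evq′)))) K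
      where
      r>0 : Pos r
      r>0 = nn≢0 r≥0 (λ z → ∤ (divides m (trans e (trans (cong (_+ m * ev φ p) z) (+-identityˡ _)))))
      q′ : Pt
      q′ = lin q (- m) p a
      alg₀ : ∀ {Q P A r m} → Q ≡ r + m * P → A ≡ + 0 → Q + - m * (P - A) ≡ r
      alg₀ {Q} {P} {A} {r} {m} = white-identity-2 {Q} {P} {A} {r} {m}
      evq′ : ev φ q′ ≡ r
      evq′ = trans (ev-lin φ q (- m) p a) (alg₀ {P = ev φ p} {m = m} e a0)
      alg₁ : ∀ n p r → + 1 + n - p + (p - r - + 1) ≡ n - r
      alg₁ = white-identity-3

  -- What the induction hypothesis of White's theorem says about one of the three
  -- tetrahedra (of volumes A, B, C) cut out by the auxiliary lattice point.
  record Weight (A B C g : ℤ) : Set where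
    field
      big : NN (A - + 2 * g)
      pairs : (A ∣ B - g → ⊥) → (A ∣ C - g → ⊥) → (A ∣ B + C → ⊥) → ⊥
      t₁ : ∀ k → A ∣ k * B → A ∣ k * g
      t₂ : ∀ k → A ∣ k * C → A ∣ k * g

  Weight-flip : ∀ {A B C g} → Weight A B C g → Weight A C B g
  Weight-flip {A} {B} {C} w = record { big = big ; pairs = λ x y u → pairs y x (λ h → u (∣-to h (+-comm B C))) ; t₁ = t₂ ; t₂ = t₁ }
    where open Weight w

  private
    -- For `A > B > C ≥ 2g` only `A = B + C` survives the pairings of `A`. Two pairings of `B` then
    -- require `B` to divide `C - g`, which is too small; the third makes `B` divide `2C`, hence
    -- `2g`, although `2g ≤ C < B`.
    sorted : ∀ {A B C g} → Pos g → Weight A B C g → Weight B A C g → Weight C A B g → Pos (A - B) → Pos (B - C) → ⊥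
    sorted {A} {B} {C} {g} (pos hg) wA wB wC (pos AB) (pos BC) =
      Weight.pairs wA
        (∣-small (castP (BC ⊞ Weight.big wC ⊞ hg ⊞ num 1) (solve (A ∷ B ∷ C ∷ g ∷ []))) (castP (AB ⊞ hg ⊞ num 1) (solve (A ∷ B ∷ C ∷ g ∷ []))))
        (∣-small C-g>0 (castP (AB ⊞ BC ⊞ hg ⊞ num 2) (solve (A ∷ B ∷ C ∷ g ∷ []))))
        (λ (divides q e) → second (eqA q e))
      where
      C-g>0 : Pos (C - g)
      C-g>0 = castP (Weight.big wC ⊞ hg) (solve (C ∷ g ∷ []))
      hC : NN C
      hC = cast (Weight.big wC ⊞ hg ⊞ hg ⊞ num 2) (solve (C ∷ g ∷ []))
      eqA : ∀ q → B + C ≡ q * A → A ≡ B + C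
      eqA q e = trans (sym (*-identityˡ A)) (trans (cong (_* A) (sym (pin₁ lo hi))) (sym e))
        where
        lo : Pos q
        lo = split (nn? (q - + 1)) pos (λ (pos h) → ⊥-elim (contra (h ⊠ (AB ⊞ BC ⊞ hC ⊞ num 2) ⊞ hC ⊞ hC ⊞ BC ⊞ eqNN e (- + 1)) (solve (q ∷ A ∷ B ∷ C ∷ []))))
        hi : Pos (+ 2 - q)
        hi = split (nn? (+ 2 - q - + 1)) pos (λ (pos h) → ⊥-elim (contra (h ⊠ (AB ⊞ BC ⊞ hC ⊞ num 2) ⊞ AB ⊞ AB ⊞ BC ⊞ num 2 ⊞ eqNN e (+ 1)) (solve (q ∷ A ∷ B ∷ C ∷ []))))
      second : A ≡ B + C → ⊥
      second refl = Weight.pairs wB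
        (λ h → ∣-small {B} {C - g} C-g>0 C-g<B (∣-to (∣-lin (+ 1) (- + 1) h ∣-refl) (solve (B ∷ C ∷ g ∷ []))))
        (∣-small C-g>0 C-g<B)
        (λ h → ∣-small {B} {+ 2 * g} (castP (hg ⊞ hg ⊞ num 1) (solve (g ∷ []))) (castP (BC ⊞ Weight.big wC) (solve (B ∷ C ∷ g ∷ [])))
          (Weight.t₂ wB (+ 2) (∣-to (∣-lin (+ 1) (- + 1) h ∣-refl) (solve (B ∷ C ∷ [])))))
        where
        C-g<B : Pos (B - (C - g))
        C-g<B = castP (BC ⊞ hg ⊞ num 1) (solve (B ∷ C ∷ g ∷ []))

    -- If `B = A`, then `A` divides `B` and by `t₁` also `g`, against `A ≥ 2g`.
    distinct : ∀ {A B C g} → Pos g → Weight A B C g → A ≡ B → ⊥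
    distinct {A} {g = g} (pos hg) w refl = ∣-small {A} {+ 1 * g} (castP hg (solve (g ∷ []))) (castP (Weight.big w ⊞ hg) (solve (A ∷ g ∷ [])))
      (Weight.t₁ w (+ 1) (divides (+ 1) refl))

    order : ∀ {A B C g} → Pos g → Weight A B C g → Pos (A - B) ⊎ Pos (B - A)
    order {A} {B} hg w with sgn (A - B)
    ... | inj₁ h = inj₁ h
    ... | inj₂ (inj₁ e) = ⊥-elim (distinct hg w (i-j≡0⇒i≡j A B e))
    ... | inj₂ (inj₂ (pos h)) = inj₂ (castP h (solve (A ∷ B ∷ [])))

  weights-absurd : ∀ {A B C g} → Pos g → Weight A B C g → Weight B A C g → Weight C A B g → ⊥
  weights-absurd hg wA wB wC with order hg wA | order hg (Weight-flip wA) | order hg (Weight-flip wB)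
  ... | inj₁ AB | _       | inj₁ BC = sorted hg wA wB wC AB BC
  ... | inj₁ AB | inj₁ AC | inj₂ CB = sorted hg (Weight-flip wA) wC wB AC CB
  ... | inj₁ AB | inj₂ CA | inj₂ CB = sorted hg wC (Weight-flip wA) (Weight-flip wB) CA AB
  ... | inj₂ BA | inj₁ AC | _       = sorted hg wB wA (Weight-flip wC) BA AC
  ... | inj₂ BA | inj₂ CA | inj₁ BC = sorted hg (Weight-flip wB) (Weight-flip wC) wA BC CA
  ... | inj₂ BA | inj₂ CA | inj₂ CB = sorted hg (Weight-flip wC) (Weight-flip wB) (Weight-flip wA) CB BA

  -- A splitting of `wbcd` has known values at every point but `a`. Subtracting the coefficient sum
  -- from the evaluated dependence leaves only a multiple of `A` on one side.
  evalPairs : ∀ {a b c d w D A B C g} → White w b c d → Rel₄ D w A a B b C c (- g) d →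
    (A ∣ B - g → ⊥) → (A ∣ C - g → ⊥) → (A ∣ B + C → ⊥) → ⊥
  evalPairs {a} {b} {c} {d} {w} {D} {A} {B} {C} {g} W r kB kC kBC =
    W (λ (splits z vw vb vc vd) → kC (divides (ev z a - + 1) (eval vw vb vc vd (at r z) (sum₄ r))))
      (λ (splits z vw vc vb vd) → kB (divides (ev z a - + 1) (eval₂ vw vb vc vd (at r z) (sum₄ r))))
      (λ (splits z vw vd vb vc) → kBC (divides (ev z a - + 1) (eval₃ vw vb vc vd (at r z) (sum₄ r))))
    where
    eval : ∀ {W B′ C′ D′ A′} → W ≡ + 1 → B′ ≡ + 1 → C′ ≡ + 0 → D′ ≡ + 0 →
      D * W ≡ A * A′ + B * B′ + C * C′ + - g * D′ → D ≡ A + B + C + - g → C - g ≡ (A′ - + 1) * A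
    eval {W} {B′} {C′} {D′} {A′} = white-identity-9 D A B C g {W} {B′} {C′} {D′} {A′}
    eval₂ : ∀ {W B′ C′ D′ A′} → W ≡ + 1 → B′ ≡ + 0 → C′ ≡ + 1 → D′ ≡ + 0 →
      D * W ≡ A * A′ + B * B′ + C * C′ + - g * D′ → D ≡ A + B + C + - g → B - g ≡ (A′ - + 1) * A
    eval₂ {W} {B′} {C′} {D′} {A′} = white-identity-10 D A B C g {W} {B′} {C′} {D′} {A′}
    eval₃ : ∀ {W B′ C′ D′ A′} → W ≡ + 1 → B′ ≡ + 0 → C′ ≡ + 0 → D′ ≡ + 1 →
      D * W ≡ A * A′ + B * B′ + C * C′ + - g * D′ → D ≡ A + B + C + - g → B + C ≡ (A′ - + 1) * A
    eval₃ {W} {B′} {C′} {D′} {A′} = white-identity-11 D A B C g {W} {B′} {C′} {D′} {A′}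

  -- All heights `φ` are multiples of `g`. A lattice point of `wbcd` of nonnegative height lies in
  -- the empty `abcd`; any other has height at most `-g`, which only `w` attains.
  cutOff : ∀ {a b c d w D A B C g} (φ : Fun) → Good a b c d → Pos D → Rel₄ D w A a B b C c (- g) d →
    Pos A → Pos (D - A) → NN B → NN C → Pos g → (∀ p → g ∣ ev φ p) →
    ev φ a ≡ + 0 → ev φ b ≡ + 0 → ev φ c ≡ + 0 → ev φ d ≡ D → Good w b c d
  cutOff {a} {b} {c} {d} {w} {D} {A} {B} {C} {g} φ G hD r hA A<D hB hC hg div φa φb φc φd = good E nd
    where
    φw : ev φ w ≡ - g
    φw = mul-cancel D (pos≢0 hD) (alg φa φb φc φd (at r φ))
      where
      alg : ∀ {W A′ B′ C′ D′} → A′ ≡ + 0 → B′ ≡ + 0 → C′ ≡ + 0 → D′ ≡ D → D * W ≡ A * A′ + B * B′ + C * C′ + - g * D′ → D * W ≡ D * - g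
      alg {W} {A′} {B′} {C′} {D′} = white-identity-12 D A B C g {W} {A′} {B′} {C′} {D′}
    nd : vol w b c d ≢ + 0
    nd e = mul≢0 (pos≢0 hA) (nondeg G) (trans (sym (coef₀ r)) (trans (cong (D *_) e) (*-zeroʳ D)))
    E : Empty w b c d
    E {y} (in₄ {N} {n₀} {n₁} {n₂} {n₃} hN h₀ h₁ h₂ h₃ s) y≢w y≢b y≢c y≢d = go (div y)
      where
      φy : N * ev φ y ≡ D * n₃ - g * n₀
      φy = alg φw φb φc φd (at s φ)
        where
        alg : ∀ {Y W B′ C′ D′} → W ≡ - g → B′ ≡ + 0 → C′ ≡ + 0 → D′ ≡ D → N * Y ≡ n₀ * W + n₁ * B′ + n₂ * C′ + n₃ * D′ → N * Y ≡ D * n₃ - g * n₀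
        alg refl refl refl refl h = trans h (solve (D ∷ g ∷ n₀ ∷ n₁ ∷ n₂ ∷ n₃ ∷ []))
      rel′ : Rel₄ (N * D) y (n₀ * A) a (n₀ * B + D * n₁) b (n₀ * C + D * n₂) c (D * n₃ - g * n₀) d
      rel′ = rel₄ λ z → alg {Y = ev z y} {ev z w} {ev z a} {ev z b} {ev z c} {ev z d} (at s z) (at r z)
        where
        alg : ∀ {Y W A′ B′ C′ D′} → N * Y ≡ n₀ * W + n₁ * B′ + n₂ * C′ + n₃ * D′ → D * W ≡ A * A′ + B * B′ + C * C′ + - g * D′ →
          N * D * Y ≡ n₀ * A * A′ + (n₀ * B + D * n₁) * B′ + (n₀ * C + D * n₂) * C′ + (D * n₃ - g * n₀) * D′
        alg {Y} {W} {A′} {B′} {C′} {D′} = white-identity-14 N D g n₀ n₁ n₂ n₃ A B C {Y} {W} {A′} {B′} {C′} {D′}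
      -- The coefficient of `a` is at most `A / D`, which is below one.
      notA : y ≢ a
      notA y≡a = alg (cancelʳ (vol a b c d) (nondeg G) (trans (cong (λ t → N * D * vol t b c d) (sym y≡a)) (coef₀ rel′)))
        where
        alg : N * D ≡ n₀ * A → ⊥
        alg e = contra (pos⇒nn hA ⊠ (h₁ ⊞ h₂ ⊞ h₃) ⊞ ↓ (posM hN A<D) ⊞ eqNN (sum₄ s) A ⊞ eqNN e (- + 1)) (solve (N ∷ D ∷ A ∷ n₀ ∷ n₁ ∷ n₂ ∷ n₃ ∷ []))
      go : g ∣ ev φ y → ⊥
      go (divides k e) = split (nn? k)
        (λ hk → empty G (in₄ (posM hN hD) (h₀ ⊠ pos⇒nn hA) (h₀ ⊠ hB ⊞ pos⇒nn hD ⊠ h₁) (h₀ ⊠ hC ⊞ pos⇒nn hD ⊠ h₂)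
                   (cast (pos⇒nn hN ⊠ cast (hk ⊠ pos⇒nn hg) (sym e)) φy) rel′) notA y≢b y≢c y≢d)
        (λ (pos hk) → y≢w (atw (n₀≡N hk)))
        where
        n₀≡N : NN (- k - + 1) → N ≡ n₀
        n₀≡N hk = antisym (cast (h₁ ⊞ h₂ ⊞ h₃ ⊞ eqNN (sum₄ s) (+ 1)) (solve (N ∷ n₀ ∷ n₁ ∷ n₂ ∷ n₃ ∷ [])))
          (pos-cancel hg (alg e φy))
          where
          alg : ∀ {f} → f ≡ k * g → N * f ≡ D * n₃ - g * n₀ → NN (g * (n₀ - N))
          alg {f} e h = cast (pos⇒nn hN ⊠ (hk ⊠ pos⇒nn hg) ⊞ pos⇒nn hD ⊠ h₃ ⊞ eqNN e (- N) ⊞ eqNN h (+ 1))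
            (solve (N ∷ D ∷ g ∷ k ∷ f ∷ n₀ ∷ n₃ ∷ []))
        atw : N ≡ n₀ → y ≡ w
        atw e = pt-ext λ z → mul-cancel N (pos≢0 hN) (alg (zero₁ h₁ h₂ h₃ e (sum₄ s)) (zero₁ h₂ h₁ h₃ e (trans (sum₄ s) (solve (n₀ ∷ n₁ ∷ n₂ ∷ n₃ ∷ []))))
                 (zero₁ h₃ h₁ h₂ e (trans (sum₄ s) (solve (n₀ ∷ n₁ ∷ n₂ ∷ n₃ ∷ [])))) e (at s z))
          where
          zero₁ : ∀ {x y z} → NN x → NN y → NN z → N ≡ n₀ → N ≡ n₀ + x + y + z → x ≡ + 0
          zero₁ {x} {y} {z} hx hy hz e s = antisym (cast hx (solve (x ∷ []))) (cast (hy ⊞ hz ⊞ eqNN e (- + 1) ⊞ eqNN s (+ 1)) (solve (N ∷ n₀ ∷ x ∷ y ∷ z ∷ [])))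
          alg : ∀ {n₁ n₂ n₃ Y W B′ C′ D′} → n₁ ≡ + 0 → n₂ ≡ + 0 → n₃ ≡ + 0 → N ≡ n₀ → N * Y ≡ n₀ * W + n₁ * B′ + n₂ * C′ + n₃ * D′ → N * Y ≡ N * W
          alg {n₁} {n₂} {n₃} {Y} {W} {B′} {C′} {D′} = white-identity-17 N n₀ {n₁} {n₂} {n₃} {Y} {W} {B′} {C′} {D′}

  multiple≥2 : ∀ {g A} → Pos g → Pos A → g ∣ A → A ≢ g → NN (A - + 2 * g)
  multiple≥2 {g} {A} (pos hg) (pos hA) (divides m e) A≢g = split {C = NN (A - + 2 * g)} (cmp m (+ 2))
    (λ h → cast (h ⊠ (hg ⊞ num 1) ⊞ eqNN e (+ 1)) (solve (A ∷ g ∷ m ∷ [])))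
    (λ (pos h) → split (nn? (m - + 1))
      (λ h′ → ⊥-elim (A≢g (trans e (trans (cong (_* g) (antisym {m} {+ 1} h′ (cast h (solve (m ∷ []))))) (*-identityˡ g)))))
      (λ (pos h′) → ⊥-elim (contra (h′ ⊠ (hg ⊞ num 1) ⊞ hA ⊞ eqNN e (- + 1)) (solve (A ∷ g ∷ m ∷ [])))))

  -- The fields `t₁` and `t₂` are transfers for the point `a`, whose coordinates relative to the
  -- empty tetrahedron `wbcd` have denominator `A`.
  mkWeight : ∀ {a b c d w D A B C g} → Good w b c d → White w b c d → Rel₄ D w A a B b C c (- g) d →
    Pos A → Pos g → g ∣ A → A ≢ g → Weight A B C g
  mkWeight {A = A} {B} {C} {g} G W r hA hg g∣A A≢g = record
    { big = multiple≥2 hg hA g∣A A≢g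
    ; pairs = evalPairs W r
    ; t₁ = λ k h → ∣-to (transferᵏ₃₂ k (Good-swap₂ (Good-swap₁ G)) (pos≢0 hA) (Rel-swap₂ (Rel-swap₁ (Rel-solve r))) (neg′ k B h)) (cong (k *_) (neg-involutive g))
    ; t₂ = λ k h → ∣-to (transferᵏ₃₂ k (Good-swap₂ G) (pos≢0 hA) (Rel-swap₂ (Rel-solve r)) (neg′ k C h)) (cong (k *_) (neg-involutive g))
    }
    where
    neg′ : ∀ k x → A ∣ k * x → A ∣ k * - x
    neg′ k x h = ∣-to (∣m⇒∣-m h) (neg-distribʳ-* k x)

  private
    -- The auxiliary point `w`, at height `-g` beyond the facet `abc`, yields three smaller empty
    -- tetrahedra to which the induction hypothesis applies. Their weight conditions are
    -- incompatible unless `A`, `B` or `C` equals `g`.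
    white-step : ∀ n {a b c d w D A B C g} →
      (∀ {a b c d} → Good a b c d → NN (+ n - ab (vol a b c d)) → White a b c d) →
      (φ : Fun) → Good a b c d → ab (vol a b c d) ≡ D → Pos D → NN (+ 1 + + n - D) →
      Rel₄ D w A a B b C c (- g) d → Pos g → ¬ (D ∣ g) → g ∣ D → NN B → Pos (D - B) → NN C → Pos (D - C) →
      (∀ p → g ∣ ev φ p) → ev φ a ≡ + 0 → ev φ b ≡ + 0 → ev φ c ≡ + 0 → ev φ d ≡ D →
      (A ≡ g → ⊥) → (B ≡ g → ⊥) → (C ≡ g → ⊥) → ⊥
    white-step n {a} {b} {c} {d} {w} {D} {A} {B} {C} {g} IH φ G vD hD bound r hg D∤g g∣D B≥0 B<D C≥0 C<D div φa φb φc φd A≢g B≢g C≢g =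
      weights-absurd hg
        (mkWeight GA (IH GA (bd A (trans (subVol r hD vD) (ab-pos (pos⇒nn A>0))) A<D)) r A>0 hg g∣A A≢g)
        (mkWeight GB (IH GB (bd B (trans (subVol rB hD vB) (ab-pos B≥0)) B<D)) rB B>0 hg g∣B B≢g)
        (mkWeight GC (IH GC (bd C (trans (subVol rC hD vC) (ab-pos C≥0)) C<D)) rC C>0 hg g∣C C≢g)
      where
      D≢0 : D ≢ + 0
      D≢0 = pos≢0 hD
      rB : Rel₄ D w B b A a C c (- g) d
      rB = Rel-swap₀ r
      rC : Rel₄ D w C c A a B b (- g) d
      rC = Rel-swap₀ (Rel-swap₁ r)
      vB : ab (vol b a c d) ≡ D
      vB = trans (ab-swap₀ a b c d) vD
      vC : ab (vol c a b d) ≡ D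
      vC = trans (ab-swap₀ a c b d) (trans (ab-swap₁ a b c d) vD)
      fromNeg : D ∣ - g → ⊥
      fromNeg h = D∤g (∣-to (∣m⇒∣-m h) (neg-involutive g))
      D∤A : ¬ (D ∣ A)
      D∤A h = fromNeg (transfer₃₂ (Good-swap₂ (Good-swap₁ (Good-swap₀ G))) D≢0 (Rel-swap₂ (Rel-swap₁ (Rel-swap₀ r))) h)
      D∤B : ¬ (D ∣ B)
      D∤B h = fromNeg (transfer₃₂ (Good-swap₂ (Good-swap₁ G)) D≢0 (Rel-swap₂ (Rel-swap₁ r)) h)
      D∤C : ¬ (D ∣ C)
      D∤C h = fromNeg (transfer₃₂ (Good-swap₂ G) D≢0 (Rel-swap₂ r) h)
      ≢0 : ∀ {x} → ¬ (D ∣ x) → x ≢ + 0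
      ≢0 k e = k (divides (+ 0) e)
      B>0 : Pos B
      B>0 = nn≢0 B≥0 (≢0 D∤B)
      C>0 : Pos C
      C>0 = nn≢0 C≥0 (≢0 D∤C)
      g<D : Pos (D - g)
      g<D = split {C = Pos (D - g)} (sgn (D - g)) (λ h → h) (λ h → split {C = Pos (D - g)} h
        (λ e → ⊥-elim (D∤g (divides (+ 1) (trans (sym (i-j≡0⇒i≡j D g e)) (sym (*-identityˡ D))))))
        (λ (pos h) → ⊥-elim (∣-small {g} {D} hD (castP h (solve (D ∷ g ∷ []))) g∣D)))
      -- Were `A` negative, the point `b + c - w` would lie in `abcd` with coordinate `g` at `d`,
      -- strictly between 0 and `D`.
      A>0 : Pos A
      A>0 = split {C = Pos A} (sgn A) (λ h → h) (λ h → split {C = Pos A} h (λ e → ⊥-elim (≢0 D∤A e))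
        (λ h → ⊥-elim (strict₃ {n₃ = g} G hD (pos⇒nn h) (pos⇒nn B<D) (pos⇒nn C<D) hg g<D
          (Rel-cong (Rel-lin (+ 1) (Rel-v₁ {D}) (Rel-v₂ {D}) r) (solve (A ∷ [])) (solve (B ∷ D ∷ [])) (solve (C ∷ D ∷ [])) (solve (g ∷ []))))))
      -- Were `A` larger than `D`, the point `w + d - a` would lie in `abcd` with coordinate `D - g`
      -- at `d`.
      A<D : Pos (D - A)
      A<D = split {C = Pos (D - A)} (sgn (D - A)) (λ h → h) (λ h → split {C = Pos (D - A)} h
        (λ e → ⊥-elim (D∤A (divides (+ 1) (trans (sym (i-j≡0⇒i≡j D A e)) (sym (*-identityˡ D))))))
        (λ h → ⊥-elim (strict₃ {n₀ = - (D - A)} {n₃ = D - g} G hD (pos⇒nn h) B≥0 C≥0 g<D (castP (↓ hg) (solve (D ∷ g ∷ [])))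
          (Rel-cong (Rel-lin (+ 1) r (Rel-v₃ {D}) (Rel-v₀ {D})) (solve (A ∷ D ∷ [])) (solve (B ∷ [])) (solve (C ∷ [])) (solve (g ∷ D ∷ []))))))
      GA : Good w b c d
      GA = cutOff φ G hD r A>0 A<D B≥0 C≥0 hg div φa φb φc φd
      GB : Good w a c d
      GB = cutOff φ (Good-swap₀ G) hD rB B>0 B<D (pos⇒nn A>0) C≥0 hg div φb φa φc φd
      GC : Good w a b d
      GC = cutOff φ (Good-swap₀ (Good-swap₁ G)) hD rC C>0 C<D (pos⇒nn A>0) B≥0 hg div φc φa φb φd
      bd : ∀ x {v} → v ≡ x → Pos (D - x) → NN (+ n - v)
      bd x refl (pos h) = cast (bound ⊞ h) (alg (+ n) D x)
        where
        alg : ∀ n D x → + 1 + n - D + (D - x - + 1) ≡ n - x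
        alg = white-identity-19
      -- Since `D = m g`, divisibility of `m x` by `D` is divisibility of `x` by `g`; transfer is
      -- therefore used with the multiplier `m`.
      m : ℤ
      m = quotient g∣D
      gdiv : ∀ {x} → D ∣ m * x → g ∣ x
      gdiv {x} (divides t e) = divides t (mul-cancel m m≢0 (trans e (alg {m} (_∣_.equality g∣D))))
        where
        m≢0 : m ≢ + 0
        m≢0 z = D≢0 (trans (_∣_.equality g∣D) (cong (_* g) z))
        alg : ∀ {m} → D ≡ m * g → t * D ≡ m * (t * g)
        alg {m} refl = solve (m ∷ t ∷ g ∷ [])
      D∣mg : D ∣ m * - g
      D∣mg = divides (- + 1) (alg {m} (_∣_.equality g∣D))
        where
        alg : ∀ {m} → D ≡ m * g → m * - g ≡ - + 1 * D
        alg {m} refl = solve (m ∷ g ∷ [])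
      g∣C : g ∣ C
      g∣C = gdiv (transferᵏ₃₂ m G D≢0 r D∣mg)
      g∣B : g ∣ B
      g∣B = gdiv (transferᵏ₃₂ m (Good-swap₁ G) D≢0 (Rel-swap₁ r) D∣mg)
      g∣A : g ∣ A
      g∣A = gdiv (transferᵏ₃₂ m (Good-swap₁ (Good-swap₀ G)) D≢0 (Rel-swap₁ (Rel-swap₀ r)) D∣mg)

    -- The translate `p + m(w - a)` has height zero, so it lies in the facet plane and its
    -- coordinates are divisible by `D`.
    shift-div : ∀ {a b c d w D A B C g p b₀ b₁ b₂ b₃} → Good a b c d → D ≢ + 0 → Rel₄ D w A a B b C c (- g) d →
      Rel₄ D p b₀ a b₁ b b₂ c b₃ d → ∀ m → b₃ ≡ m * g → D ∣ b₀ + m * A × D ∣ b₁ + m * B × D ∣ b₂ + m * C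
    shift-div {D = D} {A} {B} {C} {g} {b₀ = b₀} {b₁} {b₂} {b₃} G D≢0 r s m e =
      let (x , y , z) = transfer₃ G D≢0 (Rel-lin m s r Rel-v₀) (divides (+ 0) zero′) in
      ∣-to (∣-lin (+ 1) m x ∣-refl) (solve (b₀ ∷ m ∷ A ∷ D ∷ [])) , ∣-to y (solve (b₁ ∷ m ∷ B ∷ [])) , ∣-to z (solve (b₂ ∷ m ∷ C ∷ []))
      where
      zero′ : b₃ + m * (- g - + 0) ≡ + 0 * D
      zero′ = fromZ (eqZ e (+ 1)) (solve (b₃ ∷ m ∷ g ∷ D ∷ []))

  mutual
    white-bounded : ∀ n {a b c d} → Good a b c d → NN (+ n - ab (vol a b c d)) → White a b c d
    white-bounded n {a} {b} {c} {d} G h k₁ k₂ k₃ = split (sgn (vol a b c d)) (λ p → white⁺ n G p h k₁ k₂ k₃)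
      (λ q → split q (nondeg G) (λ p → white⁺ n (Good-swap₀ G) (subst Pos (sym (vol-swap₀ a b c d)) p)
        (subst (λ t → NN (+ n - t)) (sym (ab-swap₀ a b c d)) h)
        (k₁ ∘ Split-flip) (k₃ ∘ Split-comp) (k₂ ∘ Split-comp)))

    white⁺ : ∀ n {a b c d} → Good a b c d → Pos (vol a b c d) → NN (+ n - ab (vol a b c d)) → White a b c d
    white⁺ zero {a} {b} {c} {d} G hD h k₁ k₂ k₃ = absurd (vol a b c d) (↓ hD) (subst (λ t → NN (+ 0 - t)) (ab-pos (pos⇒nn hD)) h)
      where
      absurd : ∀ v → NN (v - + 1) → NN (+ 0 - v) → ⊥
      absurd = white-identity-23
    white⁺ (suc n) {a} {b} {c} {d} G hD h k₁ k₂ k₃ =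
      least (suc n) F₃ a d F₃a (subst Pos (sym F₃d) hD) (subst (λ t → NN (+ suc n - t)) (trans (ab-pos (pos⇒nn hD)) (sym F₃d)) h) body
      where
      open Slots a b c d
      D≢0 : D ≢ + 0
      D≢0 = nondeg G
      sum-val : ∀ f f′ {p x y} → ev f p ≡ x → ev f′ p ≡ y → ev (addF f f′) p ≡ x + y
      sum-val f f′ {p} e e′ = trans (ev-addF f f′ p) (cong₂ _+_ e e′)
      mk₁ : (∀ q → D ∣ vol q b c d + vol a q c d) → ⊥
      mk₁ H = k₁ (mkSplit (addF F₀ F₁) D≢0 (λ q → ∣-to (H q) (sym (sum-val F₀ F₁ (ev₀ q) (ev₁ q))))
        (trans (sum-val F₀ F₁ F₀a F₁a) (+-identityʳ D)) (trans (sum-val F₀ F₁ F₀b F₁b) (+-identityˡ D)) (sum-val F₀ F₁ F₀c F₁c) (sum-val F₀ F₁ F₀d F₁d))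
      mk₂ : (∀ q → D ∣ vol q b c d + vol a b q d) → ⊥
      mk₂ H = k₂ (mkSplit (addF F₀ F₂) D≢0 (λ q → ∣-to (H q) (sym (sum-val F₀ F₂ (ev₀ q) (ev₂ q))))
        (trans (sum-val F₀ F₂ F₀a F₂a) (+-identityʳ D)) (trans (sum-val F₀ F₂ F₀c F₂c) (+-identityˡ D)) (sum-val F₀ F₂ F₀b F₂b) (sum-val F₀ F₂ F₀d F₂d))
      mk₃ : (∀ q → D ∣ vol q b c d + vol a b c q) → ⊥
      mk₃ H = k₃ (mkSplit (addF F₀ F₃) D≢0 (λ q → ∣-to (H q) (sym (sum-val F₀ F₃ (ev₀ q) (ev₃ q))))
        (trans (sum-val F₀ F₃ F₀a F₃a) (+-identityʳ D)) (trans (sum-val F₀ F₃ F₀d F₃d) (+-identityˡ D)) (sum-val F₀ F₃ F₀b F₃b) (sum-val F₀ F₃ F₀c F₃c))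
      body : ∀ p → Pos (ev F₃ p) → (∀ q → ev F₃ p ∣ ev F₃ q) → ⊥
      body p hg div = split? (D ∣? ev F₃ p)
        -- If `D` divides the generator of all heights, transfer makes every coordinate of every
        -- point divisible by `D`, and any pairing splits.
        (λ D∣g → mk₁ λ q → let (x , y , _) = transfer₃ G D≢0 (cramer a b c d q) (∣-to (∣-trans D∣g (div q)) (ev₃ q)) in ∣m∣n⇒∣m+n x y)
        (λ D∤g → start p hg div D∤g (divmod D (ev F₁ (w₀ p)) hD) (divmod D (ev F₂ (w₀ p)) hD))
        where
        -- The reflection `2a - p`, at height `-g`. Adding multiples of `b - a` and `c - a` then
        -- reduces its coordinates `B` and `C` to the range from 0 to `D - 1`.
        w₀ : Pt → Pt
        w₀ p = lin a (- + 1) p a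
        start : ∀ p → Pos (ev F₃ p) → (∀ q → ev F₃ p ∣ ev F₃ q) → ¬ (D ∣ ev F₃ p) →
          (∃ λ q → ∃ λ r → ev F₁ (w₀ p) ≡ r + q * D × NN r × Pos (D - r)) →
          (∃ λ q → ∃ λ r → ev F₂ (w₀ p) ≡ r + q * D × NN r × Pos (D - r)) → ⊥
        start p hg div D∤g (q₁ , B , e₁ , B≥0 , B<D) (q₂ , C , e₂ , C≥0 , C<D) =
          white-step n (white-bounded n) F₃ G (ab-pos (pos⇒nn hD)) hD (subst (λ t → NN (+ suc n - t)) (ab-pos (pos⇒nn hD)) h)
            relw hg D∤g (∣-to (div d) F₃d) B≥0 B<D C≥0 C<D div F₃a F₃b F₃c F₃d
            (λ A≡g → mk₃ (λ q → pair₃ A≡g (cramer a b c d q) (shifted q)))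
            (λ B≡g → mk₂ (λ q → pair₂ B≡g {vol q b c d} {vol a q c d} {vol a b q d} (shifted q)))
            (λ C≡g → mk₁ (λ q → pair₁ C≡g {vol q b c d} {vol a q c d} {vol a b q d} (shifted q)))
          where
          g A : ℤ
          g = ev F₃ p
          w : Pt
          w = lin (lin (w₀ p) (- q₁) b a) (- q₂) c a
          A = vol w b c d
          evw : ∀ z → ev z w ≡ ev z a + - + 1 * (ev z p - ev z a) + - q₁ * (ev z b - ev z a) + - q₂ * (ev z c - ev z a)
          evw z = trans (ev-lin z _ (- q₂) c a) (cong (_+ - q₂ * (ev z c - ev z a))
            (trans (ev-lin z (w₀ p) (- q₁) b a) (cong (_+ - q₁ * (ev z b - ev z a)) (ev-lin z a (- + 1) p a))))
          w₁ : vol a w c d ≡ B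
          w₁ = trans (sym (ev₁ w)) (trans (evw F₁) (alg {p = ev F₁ p} F₁a F₁b F₁c (trans (sym (ev-lin F₁ a (- + 1) p a)) e₁)))
            where
            alg : ∀ {a b c p} → a ≡ + 0 → b ≡ D → c ≡ + 0 → a + - + 1 * (p - a) ≡ B + q₁ * D →
              a + - + 1 * (p - a) + - q₁ * (b - a) + - q₂ * (c - a) ≡ B
            alg {p = p} refl refl refl h = alg′ D h
              where
              alg′ : ∀ D → + 0 + - + 1 * (p - + 0) ≡ B + q₁ * D → + 0 + - + 1 * (p - + 0) + - q₁ * (D - + 0) + - q₂ * (+ 0 - + 0) ≡ B
              alg′ = white-identity-24 p q₁ q₂ B
          w₂ : vol a b w d ≡ C
          w₂ = trans (sym (ev₂ w)) (trans (evw F₂) (alg {p = ev F₂ p} F₂a F₂b F₂c (trans (sym (ev-lin F₂ a (- + 1) p a)) e₂)))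
            where
            alg : ∀ {a b c p} → a ≡ + 0 → b ≡ + 0 → c ≡ D → a + - + 1 * (p - a) ≡ C + q₂ * D →
              a + - + 1 * (p - a) + - q₁ * (b - a) + - q₂ * (c - a) ≡ C
            alg {p = p} refl refl refl h = alg′ D h
              where
              alg′ : ∀ D → + 0 + - + 1 * (p - + 0) ≡ C + q₂ * D → + 0 + - + 1 * (p - + 0) + - q₁ * (+ 0 - + 0) + - q₂ * (D - + 0) ≡ C
              alg′ = white-identity-25 p q₁ q₂ C
          w₃ : vol a b c w ≡ - g
          w₃ = trans (sym (ev₃ w)) (trans (evw F₃) (alg F₃a F₃b F₃c))
            where
            alg : ∀ {a b c p} → a ≡ + 0 → b ≡ + 0 → c ≡ + 0 →
              a + - + 1 * (p - a) + - q₁ * (b - a) + - q₂ * (c - a) ≡ - p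
            alg {a} {b} {c} {p} = white-identity-26 q₁ q₂ {a} {b} {c} {p}
          relw : Rel₄ D w A a B b C c (- g) d
          relw = Rel-cong (cramer a b c d w) refl w₁ w₂ w₃
          shifted : ∀ q → ∃ λ m → D ∣ vol q b c d + m * A × D ∣ vol a q c d + m * B × D ∣ vol a b q d + m * C
          shifted q = quotient (div q) , shift-div G D≢0 relw (cramer a b c d q) (quotient (div q)) (trans (sym (ev₃ q)) (_∣_.equality (div q)))
          -- With `C = g` the coefficient sum gives `D = A + B`. The first two coordinates of any
          -- point are `-mA` and `-mB` modulo `D`, so their sum is divisible by `D` and `ab` splits
          -- from `cd`.
          pair₁ : C ≡ g → ∀ {x y u} → (∃ λ m → D ∣ x + m * A × D ∣ y + m * B × D ∣ u + m * C) → D ∣ x + y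
          pair₁ C≡g {x} {y} (m , p , q , _) = alg (sum₄ relw) C≡g (∣-lin (+ 1) (+ 1) p q)
            where
            alg : ∀ {D A g} → D ≡ A + B + C + - g → C ≡ g → D ∣ + 1 * (x + m * A) + + 1 * (y + m * B) → D ∣ x + y
            alg {D} {A} {g} = white-identity-27 x y m B C {D} {A} {g}
          pair₂ : B ≡ g → ∀ {x y u} → (∃ λ m → D ∣ x + m * A × D ∣ y + m * B × D ∣ u + m * C) → D ∣ x + u
          pair₂ B≡g {x} {y} {u} (m , p , _ , q) = alg (sum₄ relw) B≡g (∣-lin (+ 1) (+ 1) p q)
            where
            alg : ∀ {D A g} → D ≡ A + B + C + - g → B ≡ g → D ∣ + 1 * (x + m * A) + + 1 * (u + m * C) → D ∣ x + u
            alg {D} {A} {g} = white-identity-28 x u m B C {D} {A} {g}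
          pair₃ : A ≡ g → ∀ {q x y u v} → Rel₄ D q x a y b u c v d → (∃ λ m → D ∣ x + m * A × D ∣ y + m * B × D ∣ u + m * C) → D ∣ x + v
          pair₃ A≡g {q} {x} {y} {u} {v} r (m , _ , p , k) = alg (sum₄ relw) (sum₄ r) A≡g (∣-lin (+ 1) (+ 1) p k)
            where
            alg : ∀ {D A g} → D ≡ A + B + C + - g → D ≡ x + y + u + v → A ≡ g → D ∣ + 1 * (y + m * B) + + 1 * (u + m * C) → D ∣ x + v
            alg {D} {A} {g} = white-identity-29 x y u v m B C {D} {A} {g}

  white : ∀ {a b c d} → Good a b c d → White a b c d
  white {a} {b} {c} {d} G = white-bounded (Data.Integer.∣ vol a b c d ∣) G (cast (num 0) (sym (+-inverseʳ (ab (vol a b c d)))))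

-- From divisible coordinates to volume one

module Conf where

  open Base
  open Arith
  open Tet
  open White
  import Data.Nat.Properties as ℕP
  open import Data.Integer hiding (suc; pos; ∣_∣)
  open import Data.Integer.Properties
  open import Data.Integer.Divisibility.Signed
  open import Data.Integer.Tactic.RingSolver using (solve; solve-∀)
  open import Data.List using (_∷_; [])
  open import Data.Product using (∃; _,_; proj₁; proj₂)
  open import Data.Empty using (⊥)
  open import Relation.Binary.PropositionalEquality using (_≡_; refl; sym; trans; cong)

  conf-identity-1 : ∀ v → NN (v - + 1) → NN (+ 0 - v) → ⊥
  conf-identity-1 v p q = contra (p ⊞ q) (solve (v ∷ []))

  conf-identity-2 : ∀ {D p₀ p₁ p₂ p₃ P A′ B C D′} → A′ ≡ + 0 → B ≡ + 0 → C ≡ + 0 → D′ ≡ + 1 →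
    D * P ≡ p₀ * A′ + p₁ * B + p₂ * C + p₃ * D′ → p₃ ≡ P * D
  conf-identity-2 {D} {p₀} {p₁} {p₂} {p₃} {P} refl refl refl refl h = fromZ (eqZ h (- + 1)) (solve (D ∷ p₀ ∷ p₁ ∷ p₂ ∷ p₃ ∷ P ∷ []))

  conf-identity-4 : ∀ (N n₀ n₁ n₂ n₃ : ℤ) → n₀ ≡ + 0 → n₁ ≡ + 0 → n₃ ≡ + 0 → N ≡ n₀ + n₁ + n₂ + n₃ → NN (n₂ - N)
  conf-identity-4 N n₀ n₁ n₂ n₃ e₀ e₁ e₃ s = cast (eqNN e₀ (- + 1) ⊞ eqNN e₁ (- + 1) ⊞ eqNN e₃ (- + 1) ⊞ eqNN s (- + 1)) (solve (N ∷ n₀ ∷ n₁ ∷ n₂ ∷ n₃ ∷ []))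

  conf-identity-5 : ∀ n u v w → + 1 + n - w + (u - v - + 1) + (- + 1) * (u - w) ≡ n - v
  conf-identity-5 = solve-∀

  conf-identity-6 : ∀ x y u v w → y + x + u + v + w ≡ x + y + u + v + w
  conf-identity-6 = solve-∀

  conf-identity-7 : ∀ x y u v w → x + u + y + v + w ≡ x + y + u + v + w
  conf-identity-7 = solve-∀

  conf-identity-8 : ∀ x y u v w → x + y + v + u + w ≡ x + y + u + v + w
  conf-identity-8 = solve-∀

  conf-identity-9 : ∀ x y u v w → x + y + u + w + v ≡ x + y + u + v + w
  conf-identity-9 = solve-∀

  conf-identity-10 : ∀ (m₁ m₂ m₃ m₄ m₅ : ℤ) → ∀ {E F G H K} → m₁ * E + m₂ * F + m₃ * G + m₄ * H + m₅ * K ≡ + 0 →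
    - m₁ * E + - m₂ * F + - m₃ * G + - m₄ * H + - m₅ * K ≡ + 0
  conf-identity-10 m₁ m₂ m₃ m₄ m₅ {E} {F} {G} {H} {K} h = fromZ (eqZ h (- + 1)) (solve (m₁ ∷ m₂ ∷ m₃ ∷ m₄ ∷ m₅ ∷ E ∷ F ∷ G ∷ H ∷ K ∷ []))

  conf-identity-11 : ∀ (m₁ m₂ m₃ m₄ m₅ : ℤ) → ∀ {E F G H K} → E ≡ + 1 → F ≡ + 1 → G ≡ + 1 → H ≡ + 1 → K ≡ + 1 →
    m₁ * E + m₂ * F + m₃ * G + m₄ * H + m₅ * K ≡ + 0 → m₁ + m₂ + m₃ + m₄ + m₅ ≡ + 0
  conf-identity-11 m₁ m₂ m₃ m₄ m₅ refl refl refl refl refl h = fromZ (eqZ h (+ 1)) (solve (m₁ ∷ m₂ ∷ m₃ ∷ m₄ ∷ m₅ ∷ []))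

  unit-ab : ∀ x y → + 1 ≡ x * y → ab y ≡ + 1
  unit-ab x y e = cong +_ (ℕP.m*n≡1⇒n≡1 (Data.Integer.∣ x ∣) (Data.Integer.∣ y ∣) (trans (sym (abs-* x y)) (cong Data.Integer.∣_∣ (sym e))))

  -- Three barycentric coordinates, now integral, form an affine map taking `abcd` to the standard
  -- simplex; its determinant times `D` is 1.
  lattice-unit : ∀ {a b c d} → Good a b c d → (∀ p → vol a b c d ∣ vol a b c p) → ab (vol a b c d) ≡ + 1
  lattice-unit {a} {b} {c} {d} G H = go (divF F₁ d₁) (divF F₂ d₂) (divF F₃ d₃)
    where
    open Slots a b c d
    tr = λ p → transfer₃ G (nondeg G) (cramer a b c d p) (H p)
    d₁ : ∀ p → D ∣ ev F₁ p
    d₁ p = ∣-to (proj₁ (proj₂ (tr p))) (sym (ev₁ p))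
    d₂ : ∀ p → D ∣ ev F₂ p
    d₂ p = ∣-to (proj₂ (proj₂ (tr p))) (sym (ev₂ p))
    d₃ : ∀ p → D ∣ ev F₃ p
    d₃ p = ∣-to (H p) (sym (ev₃ p))
    zero′ : ∀ {z F} → (∀ p → ev F p ≡ D * ev z p) → ∀ p → ev F p ≡ + 0 → ev z p ≡ + 0
    zero′ h p e = mul-cancel D (nondeg G) (trans (sym (h p)) (trans e (sym (*-zeroʳ D))))
    one′ : ∀ {z F} → (∀ p → ev F p ≡ D * ev z p) → ∀ p → ev F p ≡ D → ev z p ≡ + 1
    one′ h p e = mul-cancel D (nondeg G) (trans (sym (h p)) (trans e (sym (*-identityʳ D))))
    pt : ∀ {x y z x′ y′ z′ : ℤ} → x ≡ x′ → y ≡ y′ → z ≡ z′ → (x , y , z) ≡ (x′ , y′ , z′)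
    pt refl refl refl = refl
    cong₄ : ∀ {p q r s p′ q′ r′ s′} → p ≡ p′ → q ≡ q′ → r ≡ r′ → s ≡ s′ → vol p q r s ≡ vol p′ q′ r′ s′
    cong₄ refl refl refl refl = refl
    go : (∃ λ z → ∀ p → ev F₁ p ≡ D * ev z p) → (∃ λ z → ∀ p → ev F₂ p ≡ D * ev z p) → (∃ λ z → ∀ p → ev F₃ p ≡ D * ev z p) → ab D ≡ + 1
    go (z₁ , h₁) (z₂ , h₂) (z₃ , h₃) =
      unit-ab (det3 (proj₁ z₁) (proj₁ z₂) (proj₁ z₃)) D (trans (sym (trans (cong₄ fa fb fc fd) vol-std)) (vol-affMap z₁ z₂ z₃ a b c d))
      where
      fa : affMap z₁ z₂ z₃ a ≡ (+ 0 , + 0 , + 0)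
      fa = pt (zero′ {z₁} {F₁} h₁ a F₁a) (zero′ {z₂} {F₂} h₂ a F₂a) (zero′ {z₃} {F₃} h₃ a F₃a)
      fb : affMap z₁ z₂ z₃ b ≡ (+ 1 , + 0 , + 0)
      fb = pt (one′ {z₁} {F₁} h₁ b F₁b) (zero′ {z₂} {F₂} h₂ b F₂b) (zero′ {z₃} {F₃} h₃ b F₃b)
      fc : affMap z₁ z₂ z₃ c ≡ (+ 0 , + 1 , + 0)
      fc = pt (zero′ {z₁} {F₁} h₁ c F₁c) (one′ {z₂} {F₂} h₂ c F₂c) (zero′ {z₃} {F₃} h₃ c F₃c)
      fd : affMap z₁ z₂ z₃ d ≡ (+ 0 , + 0 , + 1)
      fd = pt (zero′ {z₁} {F₁} h₁ d F₁d) (zero′ {z₂} {F₂} h₂ d F₂d) (one′ {z₃} {F₃} h₃ d F₃d)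

-- Identities for circuits of five points

module Howe where

  open Base
  open Arith
  open Tet
  open White
  open import Data.Integer hiding (suc; pos; ∣_∣)
  open import Data.Integer.Properties
  open import Data.Integer.Divisibility.Signed
  open import Data.Integer.Tactic.RingSolver using (solve; solve-∀)
  open import Data.List using (_∷_; [])
  open import Data.Empty using (⊥)
  open import Relation.Binary.PropositionalEquality using (_≡_; refl)

  howe-identity-1 : ∀ (M : ℤ) → ∀ {E F G H K} → M * E + M * F + + 0 * G + - M * H + - M * K ≡ + 0 → E ≡ + 1 → G ≡ + 1 → H ≡ + 0 → K ≡ + 0 → M * F ≡ M * - + 1
  howe-identity-1 M {F = F} r refl refl refl refl = fromZ (eqZ r (+ 1)) (solve (M ∷ F ∷ []))

  howe-identity-2 : ∀ (M : ℤ) → ∀ {E F G H K} → M * E + M * F + + 0 * G + - M * H + - M * K ≡ + 0 → E ≡ + 1 → F ≡ + 1 → G ≡ + 0 → K ≡ + 0 → M * H ≡ M * + 2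
  howe-identity-2 M {H = H} r refl refl refl refl = fromZ (eqZ r (- + 1)) (solve (M ∷ H ∷ []))

  howe-identity-3 : ∀ (D c₀ c₁ c₂ c₃ : ℤ) → ∀ {P Q F G H K F′ G′ H′ K′} → D * P ≡ c₀ * F + c₁ * G + c₂ * H + c₃ * K → D * Q ≡ c₀ * F′ + c₁ * G′ + c₂ * H′ + c₃ * K′ →
    F ≡ + 1 → G ≡ + 1 → H ≡ + 0 → K ≡ + 0 → F′ ≡ - + 1 → G′ ≡ + 1 → H′ ≡ + 0 → K′ ≡ + 0 → + 2 * c₁ ≡ (P + Q) * D
  howe-identity-3 D c₀ c₁ c₂ c₃ {P} {Q} r s refl refl refl refl refl refl refl refl = fromZ (eqZ r (- + 1) ⊹ eqZ s (- + 1)) (solve (D ∷ P ∷ Q ∷ c₀ ∷ c₁ ∷ c₂ ∷ c₃ ∷ []))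

  howe-identity-4 : ∀ (D c₀ c₁ c₂ c₃ : ℤ) → ∀ {P F G H K} → D * P ≡ c₀ * F + c₁ * G + c₂ * H + c₃ * K → F ≡ + 1 → G ≡ + 0 → H ≡ + 2 → K ≡ + 0 → P * D + - + 1 * (+ 2 * c₂) ≡ c₀
  howe-identity-4 D c₀ c₁ c₂ c₃ {P} r refl refl refl refl = fromZ (eqZ r (+ 1)) (solve (D ∷ P ∷ c₀ ∷ c₁ ∷ c₂ ∷ c₃ ∷ []))

  howe-identity-5 : ∀ (M m₂ m₃ : ℤ) → ∀ {E F G H K} → M * E + m₂ * F + m₃ * G + - M * H + - M * K ≡ + 0 → E ≡ + 1 → F ≡ + 1 → G ≡ + 0 → K ≡ + 0 → m₂ ≡ M * (H - + 1)
  howe-identity-5 M m₂ m₃ {H = H} r refl refl refl refl = fromZ (eqZ r (+ 1)) (solve (M ∷ m₂ ∷ m₃ ∷ H ∷ []))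

  howe-identity-6 : ∀ (M m₂ m₃ : ℤ) → ∀ {H} → m₂ ≡ M * (H - + 1) → M + m₂ + m₃ + - M + - M ≡ + 0 → m₃ ≡ M * (+ 2 - H)
  howe-identity-6 M m₂ m₃ {H} e t = fromZ (eqZ t (+ 1) ⊹ eqZ e (- + 1)) (solve (M ∷ m₂ ∷ m₃ ∷ H ∷ []))

  howe-identity-9 : ∀ t → - (t - + 3) ≡ + 3 - t
  howe-identity-9 = solve-∀

  howe-identity-11 : ∀ (M m₂ m₃ m₄ m₅ t : ℤ) → ∀ {E F G H K} → M * E + m₂ * F + m₃ * G + m₄ * H + m₅ * K ≡ + 0 → E ≡ t → F ≡ + 1 → G ≡ + 1 → H ≡ + 0 → K ≡ + 0 → m₂ + m₃ ≡ - (M * t)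
  howe-identity-11 M m₂ m₃ m₄ m₅ t r refl refl refl refl refl = fromZ (eqZ r (+ 1)) (solve (M ∷ m₂ ∷ m₃ ∷ m₄ ∷ m₅ ∷ t ∷ []))

  howe-identity-19 : ∀ (M : ℤ) → ∀ a x → M - a + (a - x) ≡ M - x
  howe-identity-19 M a x = solve (a ∷ x ∷ M ∷ [])

  howe-identity-20 : ∀ (M : ℤ) → ∀ a x → M - a + (a + x) ≡ M + x
  howe-identity-20 M a x = solve (a ∷ x ∷ M ∷ [])

  howe-identity-21 : ∀ x y z → y - x - + 1 + (x - z) + + 1 ≡ y - z
  howe-identity-21 = solve-∀

  howe-identity-22 : ∀ {a} → NN a → Pos (+ 0 - a) → ⊥
  howe-identity-22 {a} p (pos q) = contra (p ⊞ q) (solve (a ∷ []))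

-- The excess of a point outside a tetrahedron

module Near where

  open Base
  open Arith
  open Tet
  open White
  open import Data.Integer hiding (suc; pos; ∣_∣)
  open import Data.Integer.Properties
  open import Data.Integer.Divisibility.Signed
  open import Data.Integer.Tactic.RingSolver using (solve; solve-∀)
  open import Data.List using (_∷_; [])
  open import Data.Empty using (⊥; ⊥-elim)
  open import Relation.Binary.PropositionalEquality using (_≡_; refl)

  near-identity-1 : ∀ x y → x - y + y ≡ x
  near-identity-1 = solve-∀

  near-identity-7 : ∀ (N n₀ n₁ n₂ n₃ l : ℤ) → ∀ {A B C D X P} → A ≡ + 1 → B ≡ + 1 → C ≡ + 1 → D ≡ + 1 → X ≡ + 1 → P ≡ + 1 →
    N * P ≡ n₀ * A + n₁ * B + n₂ * C + n₃ * D + l * X → N ≡ n₀ + n₁ + n₂ + n₃ + l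
  near-identity-7 N n₀ n₁ n₂ n₃ l refl refl refl refl refl refl e = fromZ (eqZ e (+ 1)) (solve (N ∷ n₀ ∷ n₁ ∷ n₂ ∷ n₃ ∷ l ∷ []))

  near-identity-13 : ∀ (N l : ℤ) → ∀ A B C D X P {n₀ n₁ n₂ n₃} → n₀ ≡ + 0 → n₁ ≡ + 0 → n₂ ≡ + 0 → n₃ ≡ + 0 → N ≡ n₀ + n₁ + n₂ + n₃ + l →
    N * P ≡ n₀ * A + n₁ * B + n₂ * C + n₃ * D + l * X → N * P ≡ N * X
  near-identity-13 N l A B C D X P refl refl refl refl S e = fromZ (eqZ e (+ 1) ⊹ eqZ S (- X)) (solve (N ∷ l ∷ A ∷ B ∷ C ∷ D ∷ X ∷ P ∷ []))

  near-identity-14 : ∀ (n s : ℤ) → Pos (+ 1 + n - s) → NN (n - s)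
  near-identity-14 n s (pos y) = cast y (solve (n ∷ s ∷ []))

  -- If the absolute values did not add up to more than `K`, every coordinate would equal its
  -- absolute value.
  excess : ∀ {K ρ₀ ρ₁ ρ₂ ρ₃} → K ≡ ρ₀ + ρ₁ + ρ₂ + ρ₃ → (NN ρ₀ → NN ρ₁ → NN ρ₂ → NN ρ₃ → ⊥) → Pos (sum-ab ρ₀ ρ₁ ρ₂ ρ₃ - K)
  excess {K} {ρ₀} {ρ₁} {ρ₂} {ρ₃} s ¬all = split {C = Pos (sum-ab ρ₀ ρ₁ ρ₂ ρ₃ - K)} (nn? (sum-ab ρ₀ ρ₁ ρ₂ ρ₃ - K - + 1)) pos
    (λ (pos h) → ⊥-elim (¬all
      (back ρ₀ (alg₀ (ab ρ₀) (ab ρ₁) (ab ρ₂) (ab ρ₃) h (ab-≥ ρ₁) (ab-≥ ρ₂) (ab-≥ ρ₃)))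
      (back ρ₁ (alg₁ (ab ρ₀) (ab ρ₁) (ab ρ₂) (ab ρ₃) h (ab-≥ ρ₀) (ab-≥ ρ₂) (ab-≥ ρ₃)))
      (back ρ₂ (alg₂ (ab ρ₀) (ab ρ₁) (ab ρ₂) (ab ρ₃) h (ab-≥ ρ₀) (ab-≥ ρ₁) (ab-≥ ρ₃)))
      (back ρ₃ (alg₃ (ab ρ₀) (ab ρ₁) (ab ρ₂) (ab ρ₃) h (ab-≥ ρ₀) (ab-≥ ρ₁) (ab-≥ ρ₂)))))
    where
    back : ∀ x → NN (x - ab x) → NN x
    back x h = cast (h ⊞ ab-nn x) (alg x (ab x))
      where
      alg : ∀ x y → x - y + y ≡ x
      alg = near-identity-1
    alg₀ : ∀ a b c d → NN (- (a + b + c + d - K - + 1) - + 1) → NN (b - ρ₁) → NN (c - ρ₂) → NN (d - ρ₃) → NN (ρ₀ - a)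
    alg₀ a b c d h p q r = cast (h ⊞ p ⊞ q ⊞ r ⊞ eqNN s (- + 1)) (solve (a ∷ b ∷ c ∷ d ∷ K ∷ ρ₀ ∷ ρ₁ ∷ ρ₂ ∷ ρ₃ ∷ []))
    alg₁ : ∀ a b c d → NN (- (a + b + c + d - K - + 1) - + 1) → NN (a - ρ₀) → NN (c - ρ₂) → NN (d - ρ₃) → NN (ρ₁ - b)
    alg₁ a b c d h p q r = cast (h ⊞ p ⊞ q ⊞ r ⊞ eqNN s (- + 1)) (solve (a ∷ b ∷ c ∷ d ∷ K ∷ ρ₀ ∷ ρ₁ ∷ ρ₂ ∷ ρ₃ ∷ []))
    alg₂ : ∀ a b c d → NN (- (a + b + c + d - K - + 1) - + 1) → NN (a - ρ₀) → NN (b - ρ₁) → NN (d - ρ₃) → NN (ρ₂ - c)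
    alg₂ a b c d h p q r = cast (h ⊞ p ⊞ q ⊞ r ⊞ eqNN s (- + 1)) (solve (a ∷ b ∷ c ∷ d ∷ K ∷ ρ₀ ∷ ρ₁ ∷ ρ₂ ∷ ρ₃ ∷ []))
    alg₃ : ∀ a b c d → NN (- (a + b + c + d - K - + 1) - + 1) → NN (a - ρ₀) → NN (b - ρ₁) → NN (c - ρ₂) → NN (ρ₃ - d)
    alg₃ a b c d h p q r = cast (h ⊞ p ⊞ q ⊞ r ⊞ eqNN s (- + 1)) (solve (a ∷ b ∷ c ∷ d ∷ K ∷ ρ₀ ∷ ρ₁ ∷ ρ₂ ∷ ρ₃ ∷ []))

-- Identities for exchanging a vertex

module Pairs where

  open Arith
  open Tet
  open White
  open import Data.Integer hiding (suc; pos; ∣_∣)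
  open import Data.Integer.Properties
  open import Data.Integer.Divisibility.Signed
  open import Data.Integer.Tactic.RingSolver using (solve)
  open import Data.List using (_∷_; [])
  open import Relation.Binary.PropositionalEquality using (_≡_)

  pairs-identity-1 : ∀ (K : ℤ) → ∀ n χ → n * χ + K * + 0 ≡ n * χ
  pairs-identity-1 K n χ = solve (n ∷ χ ∷ K ∷ [])

  pairs-identity-2 : ∀ (n₀ n₁ n₂ n₃ : ℤ) → ∀ a b c d x → n₀ * x + n₁ * b + n₂ * c + n₃ * d ≡ + 0 * a + n₁ * b + n₂ * c + n₃ * d + n₀ * x
  pairs-identity-2 n₀ n₁ n₂ n₃ a b c d x = solve (n₀ ∷ n₁ ∷ n₂ ∷ n₃ ∷ a ∷ b ∷ c ∷ d ∷ x ∷ [])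

  pairs-identity-4 : ∀ (K χ₀ χ₁ χ₂ χ₃ : ℤ) → ∀ A B C D X → K * X ≡ χ₀ * A + χ₁ * B + χ₂ * C + χ₃ * D → K * X + - χ₀ * A + - χ₁ * B + - χ₂ * C + - χ₃ * D ≡ + 0
  pairs-identity-4 K χ₀ χ₁ χ₂ χ₃ A B C D X e = fromZ (eqZ e (+ 1)) (solve (K ∷ χ₀ ∷ χ₁ ∷ χ₂ ∷ χ₃ ∷ A ∷ B ∷ C ∷ D ∷ X ∷ []))

-- Arithmetic of the barycentric weights

module Weights where

  open Arith
  open import Data.Integer hiding (suc; pos; ∣_∣)
  open import Data.Integer.Properties
  open import Data.Integer.Divisibility.Signed
  open import Data.Integer.Tactic.RingSolver using (solve)
  open import Data.List using (_∷_; [])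
  open import Data.Sum using (_⊎_; inj₁; inj₂)
  open import Data.Empty using (⊥; ⊥-elim)
  open import Relation.Binary.PropositionalEquality using (_≡_; _≢_; refl; sym; trans; cong)

  weights-identity-1 : ∀ {m x q} → Pos m → Pos x → x ≡ q * m → Pos q
  weights-identity-1 {m} {x} {q} (pos hm) (pos hx) e = split {C = Pos q} (nn? (q - + 1)) pos
    (λ (pos h) → ⊥-elim (contra (h ⊠ (hm ⊞ num 1) ⊞ hx ⊞ eqNN e (- + 1)) (solve (m ∷ x ∷ q ∷ []))))

  weights-identity-2 : ∀ n {m x q} → Pos m → Pos (n * m - x) → x ≡ q * m → Pos (n - q)
  weights-identity-2 n {m} {x} {q} (pos hm) (pos hx) e = split {C = Pos (n - q)} (nn? (n - q - + 1)) pos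
    (λ (pos h) → ⊥-elim (contra (h ⊠ (hm ⊞ num 1) ⊞ hx ⊞ eqNN e (+ 1)) (solve (n ∷ m ∷ x ∷ q ∷ []))))

  weights-identity-4 : ∀ a b c → b + (a + b) ≡ + 2 * c → + 3 * a ≡ + 2 * b → + 2 * a + + 2 * a ≡ + 1 * c + + 1 * c
  weights-identity-4 a b c e f = fromZ (eqZ e (+ 1) ⊹ eqZ f (+ 1)) (solve (a ∷ b ∷ c ∷ []))

  weights-identity-5 : ∀ a b c → NN (a - + 1) →  + 2 * a ≡ + 1 * c → + 3 * a ≡ + 2 * b → + 2 * b ≡ c → ⊥
  weights-identity-5 a b c ha e f g = contra (ha ⊞ eqNN e (+ 1) ⊞ eqNN f (- + 1) ⊞ eqNN g (- + 1)) (solve (a ∷ b ∷ c ∷ []))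

  weights-identity-6 : ∀ a b c → NN (c - b - + 1) → NN a → a + (a + b) ≡ + 2 * c →  + 4 * a ≡ b → ⊥
  weights-identity-6 a b c bc a≥0 e f = contra (bc ⊞ bc ⊞ num 1 ⊞ eqNN e (+ 1) ⊞ eqNN f (- + 1) ⊞ a≥0 ⊞ a≥0) (solve (a ∷ b ∷ c ∷ []))

  weights-identity-7 : ∀ a b c → NN (c - b - + 1) → a + (a + b) ≡ + 2 * c →  + 4 * a ≡ + 2 * b → ⊥
  weights-identity-7 a b c bc e f = contra (bc ⊞ bc ⊞ bc ⊞ bc ⊞ num 3 ⊞ eqNN e (+ 2) ⊞ eqNN f (- + 1)) (solve (a ∷ b ∷ c ∷ []))

  weights-identity-8 : ∀ a b c → NN (c - b - + 1) → a + (a + b) ≡ + 2 * c →  + 2 * a ≡ b → ⊥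
  weights-identity-8 a b c bc e f = contra (bc ⊞ bc ⊞ num 1 ⊞ eqNN e (+ 1) ⊞ eqNN f (- + 1)) (solve (a ∷ b ∷ c ∷ []))

  weights-identity-9 : ∀ a b c → a + (a + b) ≡ + 2 * c → + 2 * c ≡ + 2 * a + b
  weights-identity-9 a b c e = trans (sym e) (solve (a ∷ b ∷ []))

  weights-identity-25 : ∀ (b c : ℤ) → + 1 * (b + (b + c)) + - + 1 * c ≡ + 2 * b
  weights-identity-25 b c = solve (b ∷ c ∷ [])

  weights-identity-28 : ∀ (a c : ℤ) → + 1 * (a + (a + c)) + - + 1 * c ≡ + 2 * a
  weights-identity-28 a c = solve (a ∷ c ∷ [])

  weights-identity-30 : ∀ (a b : ℤ) → a + (a + b) ≡ + 2 * a + b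
  weights-identity-30 a b = solve (a ∷ b ∷ [])

  private
    quot-pos : ∀ {m x q} → Pos m → Pos x → x ≡ q * m → Pos q
    quot-pos {m} {x} {q} = weights-identity-1 {m} {x} {q}

    quot-lt : ∀ n {m x q} → Pos m → Pos (n * m - x) → x ≡ q * m → Pos (n - q)
    quot-lt n {m} {x} {q} = weights-identity-2 n {m} {x} {q}

  multiple₁ : ∀ {m x} → Pos m → m ∣ x → Pos x → Pos (+ 2 * m - x) → x ≡ m
  multiple₁ {m} hm (divides q e) lo hi =
    trans e (trans (cong (_* m) (pin₁ {q} (quot-pos {q = q} hm lo e) (quot-lt (+ 2) {q = q} hm hi e))) (*-identityˡ m))

  multiple₂ : ∀ {m x} → Pos m → m ∣ x → Pos x → Pos (+ 3 * m - x) → x ≡ m ⊎ x ≡ + 2 * m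
  multiple₂ {m} {x} hm (divides q e) lo hi = split {C = x ≡ m ⊎ x ≡ + 2 * m} (pin₂ {q} (quot-pos {q = q} hm lo e) (quot-lt (+ 3) {q = q} hm hi e))
    (λ h → inj₁ (trans e (trans (cong (_* m) h) (*-identityˡ m)))) (λ h → inj₂ (trans e (cong (_* m) h)))

  multiple₃ : ∀ {m x} → Pos m → m ∣ x → Pos x → Pos (+ 4 * m - x) → x ≡ m ⊎ x ≡ + 2 * m ⊎ x ≡ + 3 * m
  multiple₃ {m} {x} hm (divides q e) lo hi = split {C = x ≡ m ⊎ x ≡ + 2 * m ⊎ x ≡ + 3 * m} (pin₃ {q} (quot-pos {q = q} hm lo e) (quot-lt (+ 4) {q = q} hm hi e))
    (λ h → inj₁ (trans e (trans (cong (_* m) h) (*-identityˡ m))))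
    (λ h → split {C = x ≡ m ⊎ x ≡ + 2 * m ⊎ x ≡ + 3 * m} h (λ h → inj₂ (inj₁ (trans e (cong (_* m) h)))) (λ h → inj₂ (inj₂ (trans e (cong (_* m) h)))))

  halve : ∀ x y → x + x ≡ y + y → x ≡ y
  halve x y e = split {C = x ≡ y} (sgn (x - y)) (λ (pos h) → ⊥-elim (contra (h ⊞ h ⊞ num 1 ⊞ eqNN e (- + 1)) (solve (x ∷ y ∷ []))))
    (λ q → split {C = x ≡ y} q (i-j≡0⇒i≡j x y) (λ (pos h) → ⊥-elim (contra (h ⊞ h ⊞ num 1 ⊞ eqNN e (+ 1)) (solve (x ∷ y ∷ [])))))

  odd-absurd : ∀ q b → b ≢ + 0 → + 2 * (q * b) ≡ + 7 * b → ⊥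
  odd-absurd q b b≢0 e = split (cmp q (+ 4))
      (λ h → contra (h ⊞ h ⊞ eqNN e′ (- + 1)) (solve (q ∷ [])))
      (λ (pos h) → contra (h ⊞ h ⊞ eqNN e′ (+ 1)) (solve (q ∷ [])))
    where
    e′ : + 2 * q ≡ + 7
    e′ = mul-cancel b b≢0 (fromZ (eqZ e (+ 1)) (solve (q ∷ b ∷ [])))

  private
    h₁ : ∀ a b c → b + (a + b) ≡ + 2 * c → + 3 * a ≡ + 2 * b → + 2 * a + + 2 * a ≡ + 1 * c + + 1 * c
    h₁ = weights-identity-4
    h₂ : ∀ a b c → NN (a - + 1) →  + 2 * a ≡ + 1 * c → + 3 * a ≡ + 2 * b → + 2 * b ≡ c → ⊥
    h₂ = weights-identity-5
    h₃ : ∀ a b c → NN (c - b - + 1) → NN a → a + (a + b) ≡ + 2 * c →  + 4 * a ≡ b → ⊥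
    h₃ = weights-identity-6
    h₄ : ∀ a b c → NN (c - b - + 1) → a + (a + b) ≡ + 2 * c →  + 4 * a ≡ + 2 * b → ⊥
    h₄ = weights-identity-7
    h₅ : ∀ a b c → NN (c - b - + 1) → a + (a + b) ≡ + 2 * c →  + 2 * a ≡ b → ⊥
    h₅ = weights-identity-8
    h₆ : ∀ a b c → a + (a + b) ≡ + 2 * c → + 2 * c ≡ + 2 * a + b
    h₆ = weights-identity-9

    -- The case `d = a + b`, `a + d = 2c`. Every pairing of `b` makes it divide `2a` or `4a`, and
    -- `a < b < c` leaves only `4a = 3b`.
    caseA : ∀ a b c → Pos a → Pos (b - a) → Pos (c - b) → a + (a + b) ≡ + 2 * c →
      ((b ∣ c + (a + b) → ⊥) → (b ∣ a + (a + b) → ⊥) → (b ∣ a + c → ⊥) → ⊥) → (+ 4 * a ≡ + 3 * b → ⊥) → ⊥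
    caseA a b c (pos ha) (pos ab′) (pos bc) e pb k = pb
        (λ h → four (∣-to (∣-lin (+ 2) (- + 3) h ∣-refl) (fromZ (eqZ e (- + 1)) (solve (a ∷ b ∷ c ∷ [])))))
        (λ h → two (∣-to (∣-lin (+ 1) (- + 1) h ∣-refl) (solve (a ∷ b ∷ []))))
        (λ h → four (∣-to (∣-lin (+ 2) (- + 1) h ∣-refl) (fromZ (eqZ e (- + 1)) (solve (a ∷ b ∷ c ∷ [])))))
      where
      hb : Pos b
      hb = castP (ha ⊞ ab′ ⊞ num 1) (solve (a ∷ b ∷ []))
      two : b ∣ + 2 * a → ⊥
      two h = h₅ a b c bc e (multiple₁ hb h (castP (ha ⊞ ha ⊞ num 1) (solve (a ∷ []))) (castP (ab′ ⊞ ab′ ⊞ num 1) (solve (a ∷ b ∷ []))))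
      four : b ∣ + 4 * a → ⊥
      four h = split (multiple₃ hb h (castP (ha ⊞ ha ⊞ ha ⊞ ha ⊞ num 3) (solve (a ∷ []))) (castP (ab′ ⊞ ab′ ⊞ ab′ ⊞ ab′ ⊞ num 3) (solve (a ∷ b ∷ []))))
        (h₃ a b c bc (cast (ha ⊞ num 1) (solve (a ∷ []))) e) (λ q → split q (h₄ a b c bc e) k)

    -- The case `d = a + b`, `b + d = 2c`, which never occurs: every pairing makes `b` divide `2a`
    -- or `3a`, and the transfers `tb₁` and `tc₁` exclude the resulting ratios.
    caseB : ∀ a b c → Pos a → Pos (b - a) → Pos (c - b) → b + (a + b) ≡ + 2 * c →
      ((b ∣ c + (a + b) → ⊥) → (b ∣ a + (a + b) → ⊥) → (b ∣ a + c → ⊥) → ⊥) →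
      (∀ k → b ∣ k * a → b ∣ k * c) → (∀ k → c ∣ k * a → c ∣ k * b) → ⊥
    caseB a b c (pos ha) (pos ab′) (pos bc) e pb tb₁ tc₁ = pb
        (λ h → three (∣-to (∣-lin (+ 2) (- + 4) h ∣-refl) (fromZ (eqZ e (- + 1)) (solve (a ∷ b ∷ c ∷ [])))))
        (λ h → two (∣-to (∣-lin (+ 1) (- + 1) h ∣-refl) (solve (a ∷ b ∷ []))))
        (λ h → three (∣-to (∣-lin (+ 2) (- + 2) h ∣-refl) (fromZ (eqZ e (- + 1)) (solve (a ∷ b ∷ c ∷ [])))))
      where
      hb : Pos b
      hb = castP (ha ⊞ ab′ ⊞ num 1) (solve (a ∷ b ∷ []))
      hc : Pos c
      hc = castP (ha ⊞ ab′ ⊞ bc ⊞ num 2) (solve (a ∷ b ∷ c ∷ []))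
      two : b ∣ + 2 * a → ⊥
      two h = ∣-small {b} {a} (pos ha) (pos ab′) (∣-to (∣-lin (+ 1) (- + 2) (tb₁ (+ 2) h) ∣-refl) (fromZ (eqZ e (- + 1)) (solve (a ∷ b ∷ c ∷ []))))
      -- Here `2c = a + 2b = 7a`, so `6c = 7b`; if `3c` were a multiple of `b`, 7 would be even.
      seven : + 3 * a ≡ b → b ∣ + 3 * c → ⊥
      seven f (divides q g) = odd-absurd q b (pos≢0 hb) (fromZ (eqZ g (- + 2) ⊹ eqZ e (- + 3) ⊹ eqZ f (+ 1)) (solve (a ∷ b ∷ c ∷ q ∷ [])))
      last : + 3 * a ≡ + 2 * b → ⊥
      last f = h₂ a b c ha 2a≡c f (multiple₁ hc (tc₁ (+ 2) (divides (+ 1) 2a≡c)) (castP (ha ⊞ ha ⊞ ab′ ⊞ ab′ ⊞ num 3) (solve (a ∷ b ∷ []))) (castP (bc ⊞ bc ⊞ num 1) (solve (b ∷ c ∷ []))))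
        where
        2a≡c : + 2 * a ≡ + 1 * c
        2a≡c = halve (+ 2 * a) (+ 1 * c) (h₁ a b c e f)
      three : b ∣ + 3 * a → ⊥
      three h = split (multiple₂ hb h (castP (ha ⊞ ha ⊞ ha ⊞ num 2) (solve (a ∷ []))) (castP (ab′ ⊞ ab′ ⊞ ab′ ⊞ num 2) (solve (a ∷ b ∷ []))))
        (λ f → seven f (tb₁ (+ 3) h)) last

  -- The weights of the (4,1)-circuits all of whose four tetrahedra satisfy White's theorem.
  classify : ∀ {a b c d} → Pos a → Pos (b - a) → Pos (c - b) → Pos (d - c) →
    ((d ∣ b + c → ⊥) → (d ∣ a + c → ⊥) → (d ∣ a + b → ⊥) → ⊥) →
    ((c ∣ b + d → ⊥) → (c ∣ a + d → ⊥) → (c ∣ a + b → ⊥) → ⊥) →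
    ((b ∣ c + d → ⊥) → (b ∣ a + d → ⊥) → (b ∣ a + c → ⊥) → ⊥) →
    (∀ k → b ∣ k * a → b ∣ k * c) → (∀ k → b ∣ k * d → b ∣ k * a) →
    (∀ k → c ∣ k * a → c ∣ k * b) → (∀ k → c ∣ k * b → c ∣ k * a) →
    (+ 3 * a ≡ + 2 * b → c ≡ a + b → d ≡ + 2 * a + b → ⊥) →
    (+ 4 * a ≡ + 3 * b → + 2 * c ≡ + 2 * a + b → d ≡ a + b → ⊥) →
    (b ≡ + 3 * a → c ≡ a + b → d ≡ + 2 * a + b → ⊥) →
    (b ≡ + 2 * a → c ≡ a + b → d ≡ a + + 2 * b → ⊥) → ⊥
  classify {a} {b} {c} {d} (pos ha) (pos ab′) (pos bc) (pos cd) pd pc pb tb₁ tb₂ tc₁ tc₂ k₁ k₂ k₃ k₄ =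
    -- A sum of two smaller weights is below `2d`, so if `d` divides it, it equals `d`.
    pd (λ h → d=b+c (sym (multiple₁ hd h (castP (↓ hb ⊞ ↓ hb ⊞ bc ⊞ num 2) (solve (a ∷ b ∷ c ∷ []))) (castP (cd ⊞ cd ⊞ bc ⊞ num 2) (solve (b ∷ c ∷ d ∷ []))))))
       (λ h → d=a+c (sym (multiple₁ hd h (castP (ha ⊞ ha ⊞ ab′ ⊞ bc ⊞ num 3) (solve (a ∷ b ∷ c ∷ []))) (castP (cd ⊞ cd ⊞ bc ⊞ ab′ ⊞ num 3) (solve (a ∷ b ∷ c ∷ d ∷ []))))))
       (λ h → d=a+b (sym (multiple₁ hd h (castP (ha ⊞ ha ⊞ ab′ ⊞ num 2) (solve (a ∷ b ∷ []))) (castP (cd ⊞ cd ⊞ bc ⊞ bc ⊞ ab′ ⊞ num 4) (solve (a ∷ b ∷ c ∷ d ∷ []))))))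
    where
    a≥0 : NN a
    a≥0 = cast (ha ⊞ num 1) (solve (a ∷ []))
    hb′ : NN b
    hb′ = cast (ha ⊞ ab′ ⊞ num 2) (solve (a ∷ b ∷ []))
    hb : Pos b
    hb = castP (ha ⊞ ab′ ⊞ num 1) (solve (a ∷ b ∷ []))
    hc : Pos c
    hc = castP (ha ⊞ ab′ ⊞ bc ⊞ num 2) (solve (a ∷ b ∷ c ∷ []))
    hd : Pos d
    hd = castP (ha ⊞ ab′ ⊞ bc ⊞ cd ⊞ num 3) (solve (a ∷ b ∷ c ∷ d ∷ []))
    2a>0 : Pos (+ 2 * a)
    2a>0 = castP (ha ⊞ ha ⊞ num 1) (solve (a ∷ []))
    2b>0 : Pos (+ 2 * b)
    2b>0 = castP (↓ hb ⊞ ↓ hb ⊞ num 1) (solve (b ∷ []))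
    c=a+b : c ∣ a + b → c ≡ a + b
    c=a+b h = sym (multiple₁ hc h (castP (ha ⊞ ha ⊞ ab′ ⊞ num 2) (solve (a ∷ b ∷ []))) (castP (bc ⊞ bc ⊞ ab′ ⊞ num 2) (solve (a ∷ b ∷ c ∷ []))))
    b∣2a : b ∣ + 2 * a → + 2 * a ≡ b
    b∣2a h = multiple₁ hb h 2a>0 (castP (ab′ ⊞ ab′ ⊞ num 1) (solve (a ∷ b ∷ [])))
    3a>0 : Pos (+ 3 * a)
    3a>0 = castP (ha ⊞ ha ⊞ ha ⊞ num 2) (solve (a ∷ []))
    b∣3a : b ∣ + 3 * a → + 3 * a ≡ b ⊎ + 3 * a ≡ + 2 * b
    b∣3a h = multiple₂ hb h 3a>0 (castP (ab′ ⊞ ab′ ⊞ ab′ ⊞ num 2) (solve (a ∷ b ∷ [])))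

    -- This branch survives only for weights proportional to (1,2,3,5).
    d=b+c : d ≡ b + c → ⊥
    d=b+c refl = pc
      (λ h → first (multiple₁ hc (∣-to (∣-lin (+ 1) (- + 1) h ∣-refl) two) 2b>0 (castP (bc ⊞ bc ⊞ num 1) (solve (b ∷ c ∷ [])))))
      (λ h → last (c=a+b (∣-to (∣-lin (+ 1) (- + 1) h ∣-refl) (solve (a ∷ b ∷ c ∷ [])))))
      (λ h → last (c=a+b h))
      where
      two : + 1 * (b + (b + c)) + - + 1 * c ≡ + 2 * b
      two = weights-identity-25 b c
      first : + 2 * b ≡ c → ⊥
      first e = ∣-small {c} {+ 2 * a} 2a>0 (castP (ab′ ⊞ ab′ ⊞ num 1 ⊞ eqNN e (- + 1)) (solve (a ∷ b ∷ c ∷ []))) (tc₂ (+ 2) (divides (+ 1) (trans e (sym (*-identityˡ c)))))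
      last : c ≡ a + b → ⊥
      last refl = pb
        (λ h → done (b∣2a (∣-to (∣-lin (+ 1) (- + 3) h ∣-refl) (solve (a ∷ b ∷ [])))))
        (λ h → done (b∣2a (∣-to (∣-lin (+ 1) (- + 2) h ∣-refl) (solve (a ∷ b ∷ [])))))
        (λ h → done (b∣2a (∣-to (∣-lin (+ 1) (- + 1) h ∣-refl) (solve (a ∷ b ∷ [])))))
        where
        done : + 2 * a ≡ b → ⊥
        done e = k₄ (sym e) refl (solve (a ∷ b ∷ []))

    -- This branch survives only for weights proportional to (2,3,5,7) or (1,3,4,5).
    d=a+c : d ≡ a + c → ⊥
    d=a+c refl = pc
      (λ h → last (c=a+b (∣-to (∣-lin (+ 1) (- + 1) h ∣-refl) (solve (a ∷ b ∷ c ∷ [])))))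
      (λ h → first (multiple₁ hc (∣-to (∣-lin (+ 1) (- + 1) h ∣-refl) two) 2a>0 (castP (ab′ ⊞ ab′ ⊞ bc ⊞ bc ⊞ num 3) (solve (a ∷ b ∷ c ∷ [])))))
      (λ h → last (c=a+b h))
      where
      two : + 1 * (a + (a + c)) + - + 1 * c ≡ + 2 * a
      two = weights-identity-28 a c
      first : + 2 * a ≡ c → ⊥
      first e = absurd (multiple₁ hc (tc₁ (+ 2) (divides (+ 1) (trans e (sym (*-identityˡ c))))) 2b>0 (castP (bc ⊞ bc ⊞ num 1) (solve (b ∷ c ∷ []))))
        where
        absurd : + 2 * b ≡ c → ⊥
        absurd f = contra (ab′ ⊞ ab′ ⊞ num 1 ⊞ eqNN e (+ 1) ⊞ eqNN f (- + 1)) (solve (a ∷ b ∷ c ∷ []))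
      last : c ≡ a + b → ⊥
      last refl = pb
        (λ h → three (b∣3a (∣-to (∣-lin (+ 1) (- + 2) h ∣-refl) (solve (a ∷ b ∷ [])))))
        (λ h → three (b∣3a (∣-to (∣-lin (+ 1) (- + 1) h ∣-refl) (solve (a ∷ b ∷ [])))))
        (λ h → two′ (b∣2a (∣-to (∣-lin (+ 1) (- + 1) h ∣-refl) (solve (a ∷ b ∷ [])))))
        where
        dd : a + (a + b) ≡ + 2 * a + b
        dd = weights-identity-30 a b
        three : + 3 * a ≡ b ⊎ + 3 * a ≡ + 2 * b → ⊥
        three (inj₁ e) = k₃ (sym e) refl dd
        three (inj₂ e) = k₁ e refl dd
        two′ : + 2 * a ≡ b → ⊥
        two′ e = ∣-small {b} {+ 1 * a} (castP ha (solve (a ∷ []))) (castP ab′ (solve (a ∷ b ∷ [])))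
          (tb₂ (+ 1) (divides (+ 2) (fromZ (eqZ e (+ 1)) (solve (a ∷ b ∷ [])))))

    -- This branch survives only for weights proportional to (3,4,5,7).
    d=a+b : d ≡ a + b → ⊥
    d=a+b refl = pc
      (λ h → split (multiple₂ hc h (castP (ha ⊞ ↓ hb ⊞ ↓ hb ⊞ num 2) (solve (a ∷ b ∷ []))) (castP (bc ⊞ bc ⊞ bc ⊞ ab′ ⊞ num 3) (solve (a ∷ b ∷ c ∷ []))))
        (λ e → contra (cd ⊞ hb′ ⊞ eqNN e (- + 1)) (solve (a ∷ b ∷ c ∷ []))) (λ e → caseB a b c (pos ha) (pos ab′) (pos bc) e pb tb₁ tc₁))
      (λ h → split (multiple₂ hc h (castP (ha ⊞ ha ⊞ ↓ hb ⊞ num 2) (solve (a ∷ b ∷ []))) (castP (bc ⊞ bc ⊞ bc ⊞ ab′ ⊞ ab′ ⊞ num 4) (solve (a ∷ b ∷ c ∷ []))))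
        (λ e → contra (cd ⊞ a≥0 ⊞ eqNN e (- + 1)) (solve (a ∷ b ∷ c ∷ []))) (λ e → caseA a b c (pos ha) (pos ab′) (pos bc) e pb (λ f → k₂ f (h₆ a b c e) refl)))
      (λ h → absurd (c=a+b h))
      where
      absurd : c ≡ a + b → ⊥
      absurd e = contra (cd ⊞ eqNN e (+ 1)) (solve (a ∷ b ∷ c ∷ []))

-- Congruences between the weights of an interior point

module Quads where

  open Base
  open Arith
  open Tet
  open White
  open Near
  open Weights
  open import Data.Integer hiding (suc; pos; ∣_∣)
  open import Data.Integer.Properties
  open import Data.Integer.Divisibility.Signed
  open import Data.Integer.Tactic.RingSolver using (solve; solve-∀)
  open import Data.List using (_∷_; [])
  open import Data.Empty using (⊥)
  open import Relation.Binary.PropositionalEquality using (_≡_; _≢_; refl)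

  quads-identity-1 : ∀ (N α β γ δ : ℤ) → ∀ t → N * + 0 ≡ α * + 0 + β * + 1 + γ * + 1 + δ * t → β + γ ≡ - t * δ
  quads-identity-1 N α β γ δ t e = fromZ (eqZ e (- + 1)) (solve (N ∷ α ∷ β ∷ γ ∷ δ ∷ t ∷ []))

  quads-identity-2 : ∀ (N α β γ δ : ℤ) → ∀ t → N * + 0 ≡ α * + 1 + β * + 0 + γ * + 1 + δ * t → α + γ ≡ - t * δ
  quads-identity-2 N α β γ δ t e = fromZ (eqZ e (- + 1)) (solve (N ∷ α ∷ β ∷ γ ∷ δ ∷ t ∷ []))

  quads-identity-3 : ∀ (N α β γ δ : ℤ) → ∀ t → N * + 0 ≡ α * + 1 + β * + 1 + γ * + 0 + δ * t → α + β ≡ - t * δ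
  quads-identity-3 N α β γ δ t e = fromZ (eqZ e (- + 1)) (solve (N ∷ α ∷ β ∷ γ ∷ δ ∷ t ∷ []))

  quads-identity-4 : ∀ k γ → - (k * - γ) ≡ k * γ
  quads-identity-4 = solve-∀

  quads-identity-5 : ∀ (t N′ α′ β′ γ′ δ′ : ℤ) → ∀ O A B C D → t * N′ * O ≡ t * α′ * A + t * β′ * B + t * γ′ * C + t * δ′ * D →
    t * (N′ * O) ≡ t * (α′ * A + β′ * B + γ′ * C + δ′ * D)
  quads-identity-5 t N′ α′ β′ γ′ δ′ O A B C D e = fromZ (eqZ e (+ 1)) (solve (t ∷ N′ ∷ α′ ∷ β′ ∷ γ′ ∷ δ′ ∷ O ∷ A ∷ B ∷ C ∷ D ∷ []))

  quads-identity-10 : ∀ (N α β γ δ : ℤ) → + 3 * α ≡ + 2 * β → γ ≡ α + β → δ ≡ + 2 * α + β → N ≡ α + β + γ + δ → N ≡ (β - α) * + 17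
  quads-identity-10 N α β γ δ e f g s = fromZ (eqZ s (+ 1) ⊹ eqZ f (+ 1) ⊹ eqZ g (+ 1) ⊹ eqZ e (+ 7)) (solve (N ∷ α ∷ β ∷ γ ∷ δ ∷ []))

  quads-identity-11 : ∀ (α β : ℤ) → + 3 * α ≡ + 2 * β → α ≡ (β - α) * + 2
  quads-identity-11 α β e = fromZ (eqZ e (+ 1)) (solve (α ∷ β ∷ []))

  quads-identity-12 : ∀ (α β : ℤ) → + 3 * α ≡ + 2 * β → β ≡ (β - α) * + 3
  quads-identity-12 α β e = fromZ (eqZ e (+ 1)) (solve (α ∷ β ∷ []))

  quads-identity-13 : ∀ (α β γ : ℤ) → + 3 * α ≡ + 2 * β → γ ≡ α + β → γ ≡ (β - α) * + 5
  quads-identity-13 α β γ e f = fromZ (eqZ e (+ 2) ⊹ eqZ f (+ 1)) (solve (α ∷ β ∷ γ ∷ []))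

  quads-identity-14 : ∀ (α β δ : ℤ) → + 3 * α ≡ + 2 * β → δ ≡ + 2 * α + β → δ ≡ (β - α) * + 7
  quads-identity-14 α β δ e f = fromZ (eqZ e (+ 3) ⊹ eqZ f (+ 1)) (solve (α ∷ β ∷ δ ∷ []))

  quads-identity-15 : ∀ (α β γ : ℤ) → + 4 * α ≡ + 3 * β → + 2 * γ ≡ + 2 * α + β → γ ≡ (β - α) * + 5
  quads-identity-15 α β γ e f = halve γ ((β - α) * + 5) (fromZ (eqZ f (+ 1) ⊹ eqZ e (+ 3)) (solve (α ∷ β ∷ γ ∷ [])))

  quads-identity-17 : ∀ (α β : ℤ) → + 4 * α ≡ + 3 * β → α ≡ (β - α) * + 3
  quads-identity-17 α β e = fromZ (eqZ e (+ 1)) (solve (α ∷ β ∷ []))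

  quads-identity-18 : ∀ (α β : ℤ) → + 4 * α ≡ + 3 * β → β ≡ (β - α) * + 4
  quads-identity-18 α β e = fromZ (eqZ e (+ 1)) (solve (α ∷ β ∷ []))

  quads-identity-19 : ∀ (α β δ : ℤ) → + 4 * α ≡ + 3 * β → δ ≡ α + β → δ ≡ (β - α) * + 7
  quads-identity-19 α β δ e f = fromZ (eqZ e (+ 2) ⊹ eqZ f (+ 1)) (solve (α ∷ β ∷ δ ∷ []))

  quads-identity-20 : ∀ (N α β γ δ : ℤ) → β ≡ + 3 * α → γ ≡ α + β → δ ≡ + 2 * α + β → N ≡ α + β + γ + δ → N ≡ α * + 13
  quads-identity-20 N α β γ δ e f g s = fromZ (eqZ s (+ 1) ⊹ eqZ f (+ 1) ⊹ eqZ g (+ 1) ⊹ eqZ e (+ 3)) (solve (N ∷ α ∷ β ∷ γ ∷ δ ∷ []))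

  quads-identity-21 : ∀ (α β γ : ℤ) → β ≡ + 3 * α → γ ≡ α + β → γ ≡ α * + 4
  quads-identity-21 α β γ e f = fromZ (eqZ e (+ 1) ⊹ eqZ f (+ 1)) (solve (α ∷ β ∷ γ ∷ []))

  quads-identity-22 : ∀ (α β δ : ℤ) → β ≡ + 3 * α → δ ≡ + 2 * α + β → δ ≡ α * + 5
  quads-identity-22 α β δ e f = fromZ (eqZ e (+ 1) ⊹ eqZ f (+ 1)) (solve (α ∷ β ∷ δ ∷ []))

  quads-identity-23 : ∀ (N α β γ δ : ℤ) → β ≡ + 2 * α → γ ≡ α + β → δ ≡ α + + 2 * β → N ≡ α + β + γ + δ → N ≡ α * + 11
  quads-identity-23 N α β γ δ e f g s = fromZ (eqZ s (+ 1) ⊹ eqZ f (+ 1) ⊹ eqZ g (+ 1) ⊹ eqZ e (+ 4)) (solve (N ∷ α ∷ β ∷ γ ∷ δ ∷ []))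

  quads-identity-24 : ∀ (α β γ : ℤ) → β ≡ + 2 * α → γ ≡ α + β → γ ≡ α * + 3
  quads-identity-24 α β γ e f = fromZ (eqZ e (+ 1) ⊹ eqZ f (+ 1)) (solve (α ∷ β ∷ γ ∷ []))

  quads-identity-25 : ∀ (α β δ : ℤ) → β ≡ + 2 * α → δ ≡ α + + 2 * β → δ ≡ α * + 5
  quads-identity-25 α β δ e f = fromZ (eqZ e (+ 2) ⊹ eqZ f (+ 1)) (solve (α ∷ β ∷ δ ∷ []))

  -- White's theorem, with the functional normalised to vanish at o.
  white₀ : ∀ {o a b c} → Good o a b c →
    (∀ z → ev z o ≡ + 0 → ev z a ≡ + 0 → ev z b ≡ + 1 → ev z c ≡ + 1 → ⊥) →
    (∀ z → ev z o ≡ + 0 → ev z a ≡ + 1 → ev z b ≡ + 0 → ev z c ≡ + 1 → ⊥) →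
    (∀ z → ev z o ≡ + 0 → ev z a ≡ + 1 → ev z b ≡ + 1 → ev z c ≡ + 0 → ⊥) → ⊥
  white₀ G k₁ k₂ k₃ = white G
    (λ s → case₁ (Split-comp s)) (λ s → case₂ (Split-comp s)) (λ s → case₃ (Split-comp s))
    where
    case₁ : Split _ _ _ _ → ⊥
    case₁ (splits z vb vc vo va) = k₁ z vo va vb vc
    case₂ : Split _ _ _ _ → ⊥
    case₂ (splits z va vc vo vb) = k₂ z vo va vb vc
    case₃ : Split _ _ _ _ → ⊥
    case₃ (splits z va vb vo vc) = k₃ z vo va vb vc

  eval : ∀ {N o α a β b γ c δ d} → Rel₄ N o α a β b γ c δ d → ∀ z {vo va vb vc} →
    ev z o ≡ vo → ev z a ≡ va → ev z b ≡ vb → ev z c ≡ vc → N * vo ≡ α * va + β * vb + γ * vc + δ * ev z d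
  eval r z refl refl refl refl = at r z

  -- The splitting functional vanishes at `o`, so the dependence equates a sum of two weights with a
  -- multiple of the weight at `d`.
  pairings : ∀ {N o α a β b γ c δ d} → Good o a b c → Rel₄ N o α a β b γ c δ d →
    (δ ∣ β + γ → ⊥) → (δ ∣ α + γ → ⊥) → (δ ∣ α + β → ⊥) → ⊥
  pairings {N} {o} {α} {a} {β} {b} {γ} {c} {δ} {d} G r k₁ k₂ k₃ = white₀ G
    (λ z vo va vb vc → k₁ (divides (- ev z d) (alg₁ (ev z d) (eval r z vo va vb vc))))
    (λ z vo va vb vc → k₂ (divides (- ev z d) (alg₂ (ev z d) (eval r z vo va vb vc))))
    (λ z vo va vb vc → k₃ (divides (- ev z d) (alg₃ (ev z d) (eval r z vo va vb vc))))
    where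
    alg₁ : ∀ t → N * + 0 ≡ α * + 0 + β * + 1 + γ * + 1 + δ * t → β + γ ≡ - t * δ
    alg₁ = quads-identity-1 N α β γ δ
    alg₂ : ∀ t → N * + 0 ≡ α * + 1 + β * + 0 + γ * + 1 + δ * t → α + γ ≡ - t * δ
    alg₂ = quads-identity-2 N α β γ δ
    alg₃ : ∀ t → N * + 0 ≡ α * + 1 + β * + 1 + γ * + 0 + δ * t → α + β ≡ - t * δ
    alg₃ = quads-identity-3 N α β γ δ

  -- Solved for `a`, the dependence gives the coordinates of `a` relative to the empty tetrahedron
  -- `obcd`, with denominator `α`.
  weight-transfer : ∀ {N o α a β b γ c δ d} → Good o b c d → α ≢ + 0 → Rel₄ N o α a β b γ c δ d → ∀ k → α ∣ k * δ → α ∣ k * γ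
  weight-transfer {α = α} {γ = γ} {δ = δ} G α≢0 r k h =
    ∣-to (∣m⇒∣-m (transferᵏ₃₂ k G α≢0 (Rel-solve r) (∣-to (∣m⇒∣-m h) (neg-distribʳ-* k δ)))) (alg k γ)
    where
    alg : ∀ k γ → - (k * - γ) ≡ k * γ
    alg = quads-identity-4

-- Identities and bounds for the descent

module Descent where

  open Base
  open Arith
  open Tet
  open White
  open import Data.Integer hiding (suc; pos; ∣_∣)
  open import Data.Integer.Properties
  open import Data.Integer.Divisibility.Signed
  open import Data.Integer.Tactic.RingSolver using (solve; solve-∀)
  open import Data.List using (_∷_; [])
  open import Data.Sum using (_⊎_; inj₁; inj₂)
  open import Data.Empty using (⊥)
  open import Relation.Binary.PropositionalEquality using (_≡_; refl)

  descent-identity-1 : ∀ n x y u v → n - (x + y + u + v) ≡ n - (y + x + u + v)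
  descent-identity-1 = solve-∀

  descent-identity-2 : ∀ n x y u v → n - (x + y + u + v) ≡ n - (x + u + y + v)
  descent-identity-2 = solve-∀

  descent-identity-3 : ∀ n x y u v → n - (x + y + u + v) ≡ n - (x + y + v + u)
  descent-identity-3 = solve-∀

  descent-identity-6 : ∀ (N n₀ n₁ n₂ n₃ l : ℤ) → ∀ {A B C D X P} → A ≡ + 1 → B ≡ + 1 → C ≡ + 1 → D ≡ + 1 → X ≡ + 1 → P ≡ + 1 →
    N * P ≡ n₀ * A + n₁ * B + n₂ * C + n₃ * D + l * X → N ≡ n₀ + n₁ + n₂ + n₃ + l
  descent-identity-6 N n₀ n₁ n₂ n₃ l refl refl refl refl refl refl e = fromZ (eqZ e (+ 1)) (solve (N ∷ n₀ ∷ n₁ ∷ n₂ ∷ n₃ ∷ l ∷ []))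

  descent-identity-12 : ∀ (n ρ₀ s : ℤ) → Pos (+ 1 + n + ρ₀ - s) → NN (n + ρ₀ - s)
  descent-identity-12 n ρ₀ s (pos y) = cast y (solve (n ∷ ρ₀ ∷ s ∷ []))

  descent-identity-14 : ∀ {x K} → Pos K → Pos (- x - K) → Pos (- x)
  descent-identity-14 {x} {K} h (pos k) = castP (k ⊞ pos⇒nn h) (solve (x ∷ K ∷ []))

  descent-identity-15 : ∀ (ρ₀ ρ₁ ρ₂ ρ₃ : ℤ) → ∀ w x y z → NN (w - ρ₀) → NN (x - ρ₁) → NN (y - ρ₂) → NN (z - ρ₃) → NN (w + x + y + z - (ρ₀ + ρ₁ + ρ₂ + ρ₃))
  descent-identity-15 ρ₀ ρ₁ ρ₂ ρ₃ w x y z a b c d = cast (a ⊞ b ⊞ c ⊞ d) (solve (w ∷ x ∷ y ∷ z ∷ ρ₀ ∷ ρ₁ ∷ ρ₂ ∷ ρ₃ ∷ []))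

  descent-identity-17 : ∀ v → NN (v - + 1) → NN (+ 0 - v) → ⊥
  descent-identity-17 v p q = contra (p ⊞ q) (solve (v ∷ []))

  descent-identity-18 : ∀ n v w K → + 1 + n - K + (v - w - + 1) + (- + 1) * (v - K) ≡ n - w
  descent-identity-18 = solve-∀

  descent-identity-19 : ∀ K D {q ρ₃} → ρ₃ ≡ q * K → ρ₃ * D ≡ K * (q * D)
  descent-identity-19 K D {q} refl = solve (K ∷ D ∷ q ∷ [])

  posOr : ∀ x → Pos x ⊎ NN (- x)
  posOr x with sgn x
  ... | inj₁ h = inj₁ h
  ... | inj₂ (inj₁ refl) = inj₂ (num 0)
  ... | inj₂ (inj₂ h) = inj₂ (pos⇒nn h)

-- Identities for doubled points and cones

module Finish where

  open Base
  open Arith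
  open Tet
  open White
  open import Data.Integer hiding (suc; pos; ∣_∣)
  open import Data.Integer.Properties
  open import Data.Integer.Divisibility.Signed
  open import Data.Integer.Tactic.RingSolver using (solve)
  open import Data.List using (_∷_; [])
  open import Data.Empty using (⊥-elim)
  open import Relation.Binary.PropositionalEquality using (_≡_; refl)

  finish-identity-3 : ∀ (K : ℤ) → ∀ O P Q R {X} → X ≡ + 2 * P - O → K * X ≡ - K * O + + 2 * K * P + + 0 * Q + + 0 * R
  finish-identity-3 K O P Q R refl = solve (K ∷ O ∷ P ∷ Q ∷ R ∷ [])

  finish-identity-4 : ∀ (N n₀ n₁ n₂ n₃ : ℤ) → ∀ O P Q R Y {X} → X ≡ + 2 * P - O → N * Y ≡ n₀ * X + n₁ * P + n₂ * Q + n₃ * R → N * Y ≡ - n₀ * O + (+ 2 * n₀ + n₁) * P + n₂ * Q + n₃ * R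
  finish-identity-4 N n₀ n₁ n₂ n₃ O P Q R Y refl e = fromZ (eqZ e (+ 1)) (solve (N ∷ n₀ ∷ n₁ ∷ n₂ ∷ n₃ ∷ O ∷ P ∷ Q ∷ R ∷ Y ∷ []))

  finish-identity-6 : ∀ (Fy M N l m₀ m₁ m₂ m₃ n₀ n₁ n₂ n₃ : ℤ) → ∀ V → M * (+ 2 * + 0 - V) ≡ m₀ * V + m₁ * + 0 + m₂ * + 0 + m₃ * + 0 + l * Fy → N * Fy ≡ - n₀ * V + (+ 2 * n₀ + n₁) * + 0 + n₂ * + 0 + n₃ * + 0 →
    V * (l * n₀) ≡ V * (M * N + N * m₀)
  finish-identity-6 Fy M N l m₀ m₁ m₂ m₃ n₀ n₁ n₂ n₃ V e f = fromZ (eqZ e N ⊹ eqZ f l) (solve (V ∷ Fy ∷ M ∷ N ∷ l ∷ m₀ ∷ m₁ ∷ m₂ ∷ m₃ ∷ n₀ ∷ n₁ ∷ n₂ ∷ n₃ ∷ []))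

  finish-identity-7 : ∀ (M m₀ m₁ m₂ m₃ l : ℤ) → ∀ {A B C D X P} → A ≡ + 1 → B ≡ + 1 → C ≡ + 1 → D ≡ + 1 → X ≡ + 1 → P ≡ + 1 →
    M * P ≡ m₀ * A + m₁ * B + m₂ * C + m₃ * D + l * X → M ≡ m₀ + m₁ + m₂ + m₃ + l
  finish-identity-7 M m₀ m₁ m₂ m₃ l refl refl refl refl refl refl e = fromZ (eqZ e (+ 1)) (solve (M ∷ m₀ ∷ m₁ ∷ m₂ ∷ m₃ ∷ l ∷ []))

  finish-identity-10 : ∀ (N π κ λ′ σ : ℤ) → ∀ t {Y P Q R O} → Y ≡ + 1 → P ≡ + 1 → Q ≡ + 0 → R ≡ + 0 → Y ≡ + 2 * P - O → N * O ≡ π * P + κ * Q + λ′ * R + σ * t → N - π ≡ t * σ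
  finish-identity-10 N π κ λ′ σ t {O = O} refl refl refl refl e f = fromZ (eqZ f (+ 1) ⊹ eqZ e (- N)) (solve (N ∷ π ∷ κ ∷ λ′ ∷ σ ∷ t ∷ O ∷ []))

  finish-identity-11 : ∀ (N π κ λ′ σ : ℤ) → ∀ t {Y P Q R O} → Y ≡ + 1 → P ≡ + 0 → Q ≡ + 1 → R ≡ + 0 → Y ≡ + 2 * P - O → N * O ≡ π * P + κ * Q + λ′ * R + σ * t → N + κ ≡ - t * σ
  finish-identity-11 N π κ λ′ σ t {O = O} refl refl refl refl e f = fromZ (eqZ f (- + 1) ⊹ eqZ e N) (solve (N ∷ π ∷ κ ∷ λ′ ∷ σ ∷ t ∷ O ∷ []))

  finish-identity-12 : ∀ (N π κ λ′ σ : ℤ) → ∀ t {Y P Q R O} → Y ≡ + 1 → P ≡ + 0 → Q ≡ + 0 → R ≡ + 1 → Y ≡ + 2 * P - O → N * O ≡ π * P + κ * Q + λ′ * R + σ * t → N + λ′ ≡ - t * σ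
  finish-identity-12 N π κ λ′ σ t {O = O} refl refl refl refl e f = fromZ (eqZ f (- + 1) ⊹ eqZ e N) (solve (N ∷ π ∷ κ ∷ λ′ ∷ σ ∷ t ∷ O ∷ []))

  finish-identity-13 : ∀ (α β γ δ K N κ c₁ c₂ c₃ : ℤ) → ∀ O A B C D X → K * X ≡ κ * O + c₁ * A + c₂ * B + c₃ * C → N * O ≡ α * A + β * B + γ * C + δ * D →
    α * K * X ≡ (α * κ + c₁ * N) * O + (c₂ * α - c₁ * β) * B + (c₃ * α - c₁ * γ) * C + - c₁ * δ * D
  finish-identity-13 α β γ δ K N κ c₁ c₂ c₃ O A B C D X e f = fromZ (eqZ e α ⊹ eqZ f (- c₁)) (solve (α ∷ β ∷ γ ∷ δ ∷ K ∷ N ∷ κ ∷ c₁ ∷ c₂ ∷ c₃ ∷ O ∷ A ∷ B ∷ C ∷ D ∷ X ∷ []))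

  ∣-≥ : ∀ {D x} → Pos x → D ∣ x → NN (x - D)
  ∣-≥ {D} {x} h k = split {C = NN (x - D)} (cmp x D) (λ q → q) (λ q → ⊥-elim (∣-small h q k))

open Base using (vol)
open Arith using (ab)
open Tet using (In₅)
open import Data.Integer using (+_)
open import Relation.Binary.PropositionalEquality using (_≢_)

-- Lattice point sets closed under hulls and free of unimodular tetrahedra

module Configurations (A : Pt → Set)
  (hull₅ : ∀ {a b c d x p} → A a → A b → A c → A d → A x → In₅ a b c d x p → A p)
  (no-unit : ∀ {a b c d} → A a → A b → A c → A d → ab (vol a b c d) ≢ + 1) where

  module InHull where

    open Tet
    open White
    open import Data.Integer hiding (suc; pos; ∣_∣)
    open import Data.Integer.Properties
    open import Data.Integer.Divisibility.Signed

    hull : ∀ {a b c d p} → A a → A b → A c → A d → In₄ a b c d p → A p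
    hull {a} Aa Ab Ac Ad i = hull₅ Aa Ab Ac Ad Aa (In₄⇒In₅ i)

  -- Flat layers and affine circuits

  module NoUnimodular where

    open Base
    open Arith
    open Tet
    open White
    open import Data.Nat using (zero; suc)
    open import Data.Integer hiding (suc; pos; ∣_∣)
    open import Data.Integer.Properties
    open import Data.Integer.Divisibility.Signed
    open import Data.Integer.Tactic.RingSolver using (solve)
    open import Data.List using (_∷_; [])
    open import Data.Product using (_×_; _,_)
    open import Data.Empty using (⊥; ⊥-elim)
    open import Function using (_∘_)
    open import Relation.Binary.PropositionalEquality using (_≡_; _≢_; refl; sym; trans; cong; cong₂)
    open Conf

    open InHull
    not-lattice : ∀ {a b c d} → A a → A b → A c → A d → Good a b c d → (∀ p → vol a b c d ∣ vol a b c p) → ⊥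
    not-lattice x y u v G H = no-unit x y u v (lattice-unit G H)

    -- If the tetrahedron is empty, `z` makes the coordinate at `d` integral for every lattice
    -- point, so the volume is 1. Otherwise a further lattice point has level 0, since `d` alone
    -- reaches level 1; it replaces `a` or `b` and lowers the volume.
    flat-bounded : ∀ n (z : Fun) {a b c d} → A a → A b → A c → A d → ev z a ≡ + 0 → ev z b ≡ + 0 → ev z c ≡ + 0 → ev z d ≡ + 1 →
      vol a b c d ≢ + 0 → NN (+ n - ab (vol a b c d)) → ⊥
    flat-bounded zero z {a} {b} {c} {d} _ _ _ _ _ _ _ _ v h = absurd (ab (vol a b c d)) (↓ (ab-≢0 v)) h
      where
      absurd : ∀ v → NN (v - + 1) → NN (+ 0 - v) → ⊥
      absurd = conf-identity-1
    flat-bounded (suc n) z {a} {b} {c} {d} Aa Ab Ac Ad za zb zc zd v h =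
      not-lattice Aa Ab Ac Ad (good E v) (λ p → divides (ev z p) (alg {vol a b c d} {vol p b c d} {vol a p c d} {vol a b p d} {vol a b c p} {ev z p} za zb zc zd (at (cramer a b c d p) z)))
      where
      alg : ∀ {D p₀ p₁ p₂ p₃ P A′ B C D′} → A′ ≡ + 0 → B ≡ + 0 → C ≡ + 0 → D′ ≡ + 1 →
        D * P ≡ p₀ * A′ + p₁ * B + p₂ * C + p₃ * D′ → p₃ ≡ P * D
      alg {D} {p₀} {p₁} {p₂} {p₃} {P} {A′} {B} {C} {D′} = conf-identity-2 {D} {p₀} {p₁} {p₂} {p₃} {P} {A′} {B} {C} {D′}
      E : Empty a b c d
      E {y} i@(in₄ {N} {n₀} {n₁} {n₂} {n₃} hN h₀ h₁ h₂ h₃ r) y≢a y≢b y≢c y≢d =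
        split? (n₀ ≟ + 0)
          (λ n₀≡0 → split? (n₁ ≟ + 0)
            -- With `n₀ = n₁ = 0` the point is on the edge `cd` at level 0, so it is `c`.
            (λ n₁≡0 → y≢c (vertex₀ hN h₁ h₀ h₃ (Rel-swap₀ (Rel-swap₁ (Rel-swap₀ r))) (all n₀≡0 n₁≡0 n₃≡0 (sum₄ r))))
            (λ n₁≢0 → let (v′ , lt) = descend₀ (nondeg′ v) hN h₁ h₀ h₂ h₃ (Rel-swap₀ r) y≢b n₁≢0 in
               flat-bounded n z Ay Aa Ac Ad zy za zc zd v′ (bd {v = ab (vol y a c d)} (ab-swap₀ a b c d) lt)))
          (λ n₀≢0 → let (v′ , lt) = descend₀ v hN h₀ h₁ h₂ h₃ r y≢a n₀≢0 in flat-bounded n z Ay Ab Ac Ad zy zb zc zd v′ (bd {v = ab (vol y b c d)} refl lt))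
        where
        Ay : A y
        Ay = hull Aa Ab Ac Ad i
        nondeg′ : vol a b c d ≢ + 0 → vol b a c d ≢ + 0
        nondeg′ v e = neg≢ v (trans (sym (vol-swap₀ a b c d)) e)
        lev : N * ev z y ≡ n₃
        lev = alg′ za zb zc zd (at r z)
          where
          alg′ : ∀ {Y A′ B C D′} → A′ ≡ + 0 → B ≡ + 0 → C ≡ + 0 → D′ ≡ + 1 → N * Y ≡ n₀ * A′ + n₁ * B + n₂ * C + n₃ * D′ → N * Y ≡ n₃
          alg′ refl refl refl refl h = trans h (solve (n₀ ∷ n₁ ∷ n₂ ∷ n₃ ∷ []))
        zy : ev z y ≡ + 0
        zy = alg″ lev
          where
          alg″ : ∀ {t} → N * t ≡ n₃ → t ≡ + 0
          alg″ {t} e = split {C = t ≡ + 0} (sgn t)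
            (λ (pos ht) → ⊥-elim (y≢d (vertex₀ hN h₀ h₁ h₂ (Rel-swap₀ (Rel-swap₁ (Rel-swap₂ r)))
               (cast (pos⇒nn hN ⊠ ht ⊞ eqNN e (- + 1)) (solve (N ∷ t ∷ n₃ ∷ []))))))
            (λ k → split {C = t ≡ + 0} k (λ e → e) (λ (pos ht) → ⊥-elim (contra (↓ hN ⊠ ht ⊞ ↓ hN ⊞ ht ⊞ h₃ ⊞ eqNN e (+ 1)) (solve (N ∷ t ∷ n₃ ∷ [])))))
        n₃≡0 : n₃ ≡ + 0
        n₃≡0 = trans (sym lev) (trans (cong (N *_) zy) (*-zeroʳ N))
        all : n₀ ≡ + 0 → n₁ ≡ + 0 → n₃ ≡ + 0 → N ≡ n₀ + n₁ + n₂ + n₃ → NN (n₂ - N)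
        all = conf-identity-4 N n₀ n₁ n₂ n₃
        bd : ∀ {u v} → u ≡ ab (vol a b c d) → Pos (u - v) → NN (+ n - v)
        bd {u} {v} e (pos k) = cast (h ⊞ k ⊞ eqNN e (- + 1)) (alg‴ (+ n) u v (ab (vol a b c d)))
          where
          alg‴ : ∀ n u v w → + 1 + n - w + (u - v - + 1) + (- + 1) * (u - w) ≡ n - v
          alg‴ = conf-identity-5

    flat : ∀ (z : Fun) {a b c d} → A a → A b → A c → A d → ev z a ≡ + 0 → ev z b ≡ + 0 → ev z c ≡ + 0 → ev z d ≡ + 1 →
      vol a b c d ≢ + 0 → ⊥
    flat z {a} {b} {c} {d} Aa Ab Ac Ad za zb zc zd v =
      flat-bounded (Data.Integer.∣ vol a b c d ∣) z Aa Ab Ac Ad za zb zc zd v (cast (num 0) (sym (+-inverseʳ (ab (vol a b c d)))))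

    Face : (a b c d e : Pt) → Set
    Face a b c d e = Good a b c d × (In₄ a b c d e → ⊥)

    Face-swap₀ : ∀ {a b c d e} → Face a b c d e → Face b a c d e
    Face-swap₀ (G , i) = Good-swap₀ G , (i ∘ In₄-swap₀)

    Face-swap₁ : ∀ {a b c d e} → Face a b c d e → Face a c b d e
    Face-swap₁ (G , i) = Good-swap₁ G , (i ∘ In₄-swap₁)

    Face-swap₂ : ∀ {a b c d e} → Face a b c d e → Face a b d c e
    Face-swap₂ (G , i) = Good-swap₂ G , (i ∘ In₄-swap₂)

    record Rel₅ (m₁ : ℤ) (e : Pt) (m₂ : ℤ) (f : Pt) (m₃ : ℤ) (g : Pt) (m₄ : ℤ) (h : Pt) (m₅ : ℤ) (k : Pt) : Set where
      constructor rel₅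
      field at₅ : ∀ z → m₁ * ev z e + m₂ * ev z f + m₃ * ev z g + m₄ * ev z h + m₅ * ev z k ≡ + 0
    open Rel₅ public

    -- Five points with an affine dependence, none of which lies in the hull of the others.
    record Circuit (e f g h k : Pt) (m₁ m₂ m₃ m₄ m₅ : ℤ) : Set where
      field
        rel : Rel₅ m₁ e m₂ f m₃ g m₄ h m₅ k
        i₁ : A e
        i₂ : A f
        i₃ : A g
        i₄ : A h
        i₅ : A k
        face₁ : m₁ ≢ + 0 → Face f g h k e
        face₂ : m₂ ≢ + 0 → Face e g h k f
        face₃ : m₃ ≢ + 0 → Face e f h k g
        face₄ : m₄ ≢ + 0 → Face e f g k h
        face₅ : m₅ ≢ + 0 → Face e f g h k

    swap₁₂ : ∀ {e f g h k m₁ m₂ m₃ m₄ m₅} → Circuit e f g h k m₁ m₂ m₃ m₄ m₅ → Circuit f e g h k m₂ m₁ m₃ m₄ m₅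
    swap₁₂ {e} {f} {g} {h} {k} {m₁} {m₂} {m₃} {m₄} {m₅} C = record
      { rel = rel₅ (λ z → trans (alg (m₁ * ev z e) (m₂ * ev z f) (m₃ * ev z g) (m₄ * ev z h) (m₅ * ev z k)) (at₅ rel z))
      ; i₁ = i₂ ; i₂ = i₁ ; i₃ = i₃ ; i₄ = i₄ ; i₅ = i₅
      ; face₁ = face₂ ; face₂ = face₁ ; face₃ = Face-swap₀ ∘ face₃ ; face₄ = Face-swap₀ ∘ face₄ ; face₅ = Face-swap₀ ∘ face₅ }
      where
      open Circuit C
      alg : ∀ x y u v w → y + x + u + v + w ≡ x + y + u + v + w
      alg = conf-identity-6

    swap₂₃ : ∀ {e f g h k m₁ m₂ m₃ m₄ m₅} → Circuit e f g h k m₁ m₂ m₃ m₄ m₅ → Circuit e g f h k m₁ m₃ m₂ m₄ m₅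
    swap₂₃ {e} {f} {g} {h} {k} {m₁} {m₂} {m₃} {m₄} {m₅} C = record
      { rel = rel₅ (λ z → trans (alg (m₁ * ev z e) (m₂ * ev z f) (m₃ * ev z g) (m₄ * ev z h) (m₅ * ev z k)) (at₅ rel z))
      ; i₁ = i₁ ; i₂ = i₃ ; i₃ = i₂ ; i₄ = i₄ ; i₅ = i₅
      ; face₁ = Face-swap₀ ∘ face₁ ; face₂ = face₃ ; face₃ = face₂ ; face₄ = Face-swap₁ ∘ face₄ ; face₅ = Face-swap₁ ∘ face₅ }
      where
      open Circuit C
      alg : ∀ x y u v w → x + u + y + v + w ≡ x + y + u + v + w
      alg = conf-identity-7

    swap₃₄ : ∀ {e f g h k m₁ m₂ m₃ m₄ m₅} → Circuit e f g h k m₁ m₂ m₃ m₄ m₅ → Circuit e f h g k m₁ m₂ m₄ m₃ m₅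
    swap₃₄ {e} {f} {g} {h} {k} {m₁} {m₂} {m₃} {m₄} {m₅} C = record
      { rel = rel₅ (λ z → trans (alg (m₁ * ev z e) (m₂ * ev z f) (m₃ * ev z g) (m₄ * ev z h) (m₅ * ev z k)) (at₅ rel z))
      ; i₁ = i₁ ; i₂ = i₂ ; i₃ = i₄ ; i₄ = i₃ ; i₅ = i₅
      ; face₁ = Face-swap₁ ∘ face₁ ; face₂ = Face-swap₁ ∘ face₂ ; face₃ = face₄ ; face₄ = face₃ ; face₅ = Face-swap₂ ∘ face₅ }
      where
      open Circuit C
      alg : ∀ x y u v w → x + y + v + u + w ≡ x + y + u + v + w
      alg = conf-identity-8

    swap₄₅ : ∀ {e f g h k m₁ m₂ m₃ m₄ m₅} → Circuit e f g h k m₁ m₂ m₃ m₄ m₅ → Circuit e f g k h m₁ m₂ m₃ m₅ m₄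
    swap₄₅ {e} {f} {g} {h} {k} {m₁} {m₂} {m₃} {m₄} {m₅} C = record
      { rel = rel₅ (λ z → trans (alg (m₁ * ev z e) (m₂ * ev z f) (m₃ * ev z g) (m₄ * ev z h) (m₅ * ev z k)) (at₅ rel z))
      ; i₁ = i₁ ; i₂ = i₂ ; i₃ = i₃ ; i₄ = i₅ ; i₅ = i₄
      ; face₁ = Face-swap₂ ∘ face₁ ; face₂ = Face-swap₂ ∘ face₂ ; face₃ = Face-swap₂ ∘ face₃ ; face₄ = face₅ ; face₅ = face₄ }
      where
      open Circuit C
      alg : ∀ x y u v w → x + y + u + w + v ≡ x + y + u + v + w
      alg = conf-identity-9

    negate : ∀ {e f g h k m₁ m₂ m₃ m₄ m₅} → Circuit e f g h k m₁ m₂ m₃ m₄ m₅ → Circuit e f g h k (- m₁) (- m₂) (- m₃) (- m₄) (- m₅)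
    negate {e} {f} {g} {h} {k} {m₁} {m₂} {m₃} {m₄} {m₅} C = record
      { rel = rel₅ (λ z → alg (at₅ rel z))
      ; i₁ = i₁ ; i₂ = i₂ ; i₃ = i₃ ; i₄ = i₄ ; i₅ = i₅
      ; face₁ = face₁ ∘ un ; face₂ = face₂ ∘ un ; face₃ = face₃ ∘ un ; face₄ = face₄ ∘ un ; face₅ = face₅ ∘ un }
      where
      open Circuit C
      un : ∀ {x} → - x ≢ + 0 → x ≢ + 0
      un h refl = h refl
      alg : ∀ {E F G H K} → m₁ * E + m₂ * F + m₃ * G + m₄ * H + m₅ * K ≡ + 0 →
        - m₁ * E + - m₂ * F + - m₃ * G + - m₄ * H + - m₅ * K ≡ + 0
      alg {E} {F} {G} {H} {K} = conf-identity-10 m₁ m₂ m₃ m₄ m₅ {E} {F} {G} {H} {K}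

    total : ∀ {e f g h k m₁ m₂ m₃ m₄ m₅} → Circuit e f g h k m₁ m₂ m₃ m₄ m₅ → m₁ + m₂ + m₃ + m₄ + m₅ ≡ + 0
    total {e} {f} {g} {h} {k} {m₁} {m₂} {m₃} {m₄} {m₅} C =
      alg (ev-one e) (ev-one f) (ev-one g) (ev-one h) (ev-one k) (at₅ (Circuit.rel C) one)
      where
      alg : ∀ {E F G H K} → E ≡ + 1 → F ≡ + 1 → G ≡ + 1 → H ≡ + 1 → K ≡ + 1 →
        m₁ * E + m₂ * F + m₃ * G + m₄ * H + m₅ * K ≡ + 0 → m₁ + m₂ + m₃ + m₄ + m₅ ≡ + 0
      alg {E} {F} {G} {H} {K} = conf-identity-11 m₁ m₂ m₃ m₄ m₅ {E} {F} {G} {H} {K}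

    flat′ : ∀ (z : Fun) {a b c d} → A a → A b → A c → A d → ev z a ≡ + 1 → ev z b ≡ + 1 → ev z c ≡ + 1 → ev z d ≡ + 0 →
      vol a b c d ≢ + 0 → ⊥
    flat′ z Aa Ab Ac Ad za zb zc zd v = flat z′ Aa Ab Ac Ad (val za) (val zb) (val zc) (val zd) v
      where
      z′ : Fun
      z′ = addF one (scaleF (- + 1) z)
      val : ∀ {x v} → ev z x ≡ v → ev z′ x ≡ + 1 + - + 1 * v
      val {x} refl = trans (ev-addF one (scaleF (- + 1) z) x) (cong₂ _+_ (ev-one x) (ev-scaleF (- + 1) z x))

  -- Howe's theorem for five points in convex position

  module Convex where

    open Base
    open Arith
    open Tet
    open White
    open import Data.Integer hiding (suc; pos; ∣_∣)
    open import Data.Integer.Properties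
    open import Data.Integer.Divisibility.Signed
    open import Data.Integer.Tactic.RingSolver using (solve)
    open import Data.List using (_∷_; [])
    open import Data.Product using (proj₁; proj₂)
    open import Data.Empty using (⊥)
    open import Relation.Binary.PropositionalEquality using (_≡_; _≢_; refl; sym; trans; cong; subst)
    open Howe

    open InHull
    open NoUnimodular

    -- The circuit says `e + f = h + k`: a parallelogram with apex `g`. On three of its faces every
    -- pairing but one produces a flat layer, and the remaining functionals `x`, `y`, `u` together
    -- make every lattice point integral in `fghk`.
    parallelogram : ∀ {e f g h k M} → M ≢ + 0 → Circuit e f g h k M M (+ 0) (- M) (- M) → ⊥
    parallelogram {e} {f} {g} {h} {k} {M} M≢0 C =
      white (proj₁ T₁)
        (λ zₑ → white (proj₁ (face₂ M≢0))
          (λ zf → white (proj₁ T₄)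
            (λ zₕ → final zₑ zf zₕ)
            (λ (splits z ve vg vf vk) → flat′ z i₁ i₃ i₄ i₂ ve vg (solve₄ (at₅ rel z) ve vf vg vk) vf (nondeg (Good-swap₂ (Good-swap₁ (proj₁ T₅)))) )
            (λ (splits z ve vk vf vg) → flat z i₂ i₃ i₄ i₁ vf vg (solve₄′ (at₅ rel z) ve vf vg vk) ve (nondeg (Good-swap₂ (Good-swap₁ (Good-swap₀ (proj₁ T₅)))))))
          (λ (splits z ve vh vg vk) → flat z i₂ i₃ i₅ i₁ (solve₂ (at₅ rel z) ve vg vh vk) vg vk ve (nondeg (Good-swap₂ (Good-swap₁ (Good-swap₀ (proj₁ T₄))))))
          (λ (splits z ve vk vg vh) → flat z i₂ i₃ i₄ i₁ (solve₂′ (at₅ rel z) ve vg vh vk) vg vh ve (nondeg (Good-swap₂ (Good-swap₁ (Good-swap₀ (proj₁ T₅)))))))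
        (λ (splits z vf vh vg vk) → flat z i₁ i₃ i₅ i₂ (solve₁ (at₅ rel z) vf vg vh vk) vg vk vf (nondeg (Good-swap₂ (Good-swap₁ (proj₁ T₄)))))
        (λ (splits z vf vk vg vh) → flat z i₁ i₃ i₄ i₂ (solve₁′ (at₅ rel z) vf vg vh vk) vg vh vf (nondeg (Good-swap₂ (Good-swap₁ (proj₁ T₅)))))
      where
      open Circuit C
      T₁ = face₁ M≢0
      T₄ = face₄ (neg≢ M≢0)
      T₅ = face₅ (neg≢ M≢0)
      solve₁ : ∀ {E F G H K} → M * E + M * F + + 0 * G + - M * H + - M * K ≡ + 0 → F ≡ + 1 → G ≡ + 0 → H ≡ + 1 → K ≡ + 0 → E ≡ + 0
      solve₁ {E} r refl refl refl refl = mul-cancel M M≢0 (fromZ (eqZ r (+ 1)) (solve (M ∷ E ∷ [])))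
      solve₁′ : ∀ {E F G H K} → M * E + M * F + + 0 * G + - M * H + - M * K ≡ + 0 → F ≡ + 1 → G ≡ + 0 → H ≡ + 0 → K ≡ + 1 → E ≡ + 0
      solve₁′ {E} r refl refl refl refl = mul-cancel M M≢0 (fromZ (eqZ r (+ 1)) (solve (M ∷ E ∷ [])))
      solve₂ : ∀ {E F G H K} → M * E + M * F + + 0 * G + - M * H + - M * K ≡ + 0 → E ≡ + 1 → G ≡ + 0 → H ≡ + 1 → K ≡ + 0 → F ≡ + 0
      solve₂ {F = F} r refl refl refl refl = mul-cancel M M≢0 (fromZ (eqZ r (+ 1)) (solve (M ∷ F ∷ [])))
      solve₂′ : ∀ {E F G H K} → M * E + M * F + + 0 * G + - M * H + - M * K ≡ + 0 → E ≡ + 1 → G ≡ + 0 → H ≡ + 0 → K ≡ + 1 → F ≡ + 0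
      solve₂′ {F = F} r refl refl refl refl = mul-cancel M M≢0 (fromZ (eqZ r (+ 1)) (solve (M ∷ F ∷ [])))
      solve₄ : ∀ {E F G H K} → M * E + M * F + + 0 * G + - M * H + - M * K ≡ + 0 → E ≡ + 1 → F ≡ + 0 → G ≡ + 1 → K ≡ + 0 → H ≡ + 1
      solve₄ {H = H} r refl refl refl refl = mul-cancel M M≢0 (fromZ (eqZ r (- + 1)) (solve (M ∷ H ∷ [])))
      solve₄′ : ∀ {E F G H K} → M * E + M * F + + 0 * G + - M * H + - M * K ≡ + 0 → E ≡ + 1 → F ≡ + 0 → G ≡ + 0 → K ≡ + 1 → H ≡ + 0
      solve₄′ {H = H} r refl refl refl refl = mul-cancel M M≢0 (fromZ (eqZ r (- + 1)) (solve (M ∷ H ∷ [])))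
      final : Split f g h k → Split e g h k → Split e f g k → ⊥
      final (splits x xf xg xh xk) (splits y ye yg yh yk) (splits u ue uf ug uk) =
        not-lattice i₂ i₃ i₄ i₅ (proj₁ T₁) λ p → every p (nondeg (proj₁ T₁)) (cramer f g h k p)
        where
        every : ∀ p {D c₀ c₁ c₂ c₃} → D ≢ + 0 → Rel₄ D p c₀ f c₁ g c₂ h c₃ k → D ∣ c₃
        every p {D} {c₀} {c₁} {c₂} {c₃} D≢0 r =
          transfer₃₂ (Good-swap₂ (Good-swap₁ (Good-swap₀ (proj₁ T₁)))) D≢0 (Rel-swap₂ (Rel-swap₁ (Rel-swap₀ r))) D∣c₀
          where
          yf : ev y f ≡ - + 1
          yf = mul-cancel M M≢0 (alg (at₅ rel y) ye yg yh yk)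
            where
            alg : ∀ {E F G H K} → M * E + M * F + + 0 * G + - M * H + - M * K ≡ + 0 → E ≡ + 1 → G ≡ + 1 → H ≡ + 0 → K ≡ + 0 → M * F ≡ M * - + 1
            alg {E} {F} {G} {H} {K} = howe-identity-1 M {E} {F} {G} {H} {K}
          uh : ev u h ≡ + 2
          uh = mul-cancel M M≢0 (alg (at₅ rel u) ue uf ug uk)
            where
            alg : ∀ {E F G H K} → M * E + M * F + + 0 * G + - M * H + - M * K ≡ + 0 → E ≡ + 1 → F ≡ + 1 → G ≡ + 0 → K ≡ + 0 → M * H ≡ M * + 2
            alg {E} {F} {G} {H} {K} = howe-identity-2 M {E} {F} {G} {H} {K}
          -- `x` and `y` agree on `g`, `h`, `k` and are opposite at `f`, so their sum isolates `c₁`.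
          D∣2c₁ : D ∣ + 2 * c₁
          D∣2c₁ = divides (ev x p + ev y p) (alg (at r x) (at r y) xf xg xh xk yf yg yh yk)
            where
            alg : ∀ {P Q F G H K F′ G′ H′ K′} → D * P ≡ c₀ * F + c₁ * G + c₂ * H + c₃ * K → D * Q ≡ c₀ * F′ + c₁ * G′ + c₂ * H′ + c₃ * K′ →
              F ≡ + 1 → G ≡ + 1 → H ≡ + 0 → K ≡ + 0 → F′ ≡ - + 1 → G′ ≡ + 1 → H′ ≡ + 0 → K′ ≡ + 0 → + 2 * c₁ ≡ (P + Q) * D
            alg {P} {Q} {F} {G} {H} {K} {F′} {G′} {H′} {K′} = howe-identity-3 D c₀ c₁ c₂ c₃ {P} {Q} {F} {G} {H} {K} {F′} {G′} {H′} {K′}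
          D∣2c₂ : D ∣ + 2 * c₂
          D∣2c₂ = transferᵏ₃₂ (+ 2) (Good-swap₁ (Good-swap₂ (Good-swap₁ (proj₁ T₁)))) D≢0 (Rel-swap₁ (Rel-swap₂ (Rel-swap₁ r))) D∣2c₁
          -- `u` takes the values 1, 0, 2, 0 on `f`, `g`, `h`, `k`, and `2c₂` is already divisible
          -- by `D`.
          D∣c₀ : D ∣ c₀
          D∣c₀ = ∣-to (∣-lin (ev u p) (- + 1) ∣-refl D∣2c₂) (alg (at r u) uf ug uh uk)
            where
            alg : ∀ {P F G H K} → D * P ≡ c₀ * F + c₁ * G + c₂ * H + c₃ * K → F ≡ + 1 → G ≡ + 0 → H ≡ + 2 → K ≡ + 0 → P * D + - + 1 * (+ 2 * c₂) ≡ c₀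
            alg {P} {F} {G} {H} {K} = howe-identity-4 D c₀ c₁ c₂ c₃ {P} {F} {G} {H} {K}

    Circuit-cong : ∀ {e f g h k m₁ m₂ m₃ m₄ m₅ m₂′ m₃′ m₄′ m₅′} → m₂ ≡ m₂′ → m₃ ≡ m₃′ → m₄ ≡ m₄′ → m₅ ≡ m₅′ →
      Circuit e f g h k m₁ m₂ m₃ m₄ m₅ → Circuit e f g h k m₁ m₂′ m₃′ m₄′ m₅′
    Circuit-cong refl refl refl refl C = C

    private
      -- The level `t` of `h` determines `m₂ = M(t - 1)` and `m₃ = M(2 - t)`. The bounds on both
      -- leave `t = 1`, a flat layer, or `t = 2`, a parallelogram.
      opposite : ∀ {e f g h k M m₂ m₃} → Pos M → Circuit e f g h k M m₂ m₃ (- M) (- M) → NN (M - m₂) → NN (M - m₃) → Split e f g k → ⊥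
      opposite {e} {f} {g} {h} {k} {M} {m₂} {m₃} (pos hM) C b₂ b₃ (splits z ze zf zg zk) =
        split (nn? (- ev z h)) (low {ev z h} eq₃ b₃) (λ p → split (nn? (ev z h - + 3)) (high {ev z h} eq₂ b₂) (λ q → mid p q))
        where
        open Circuit C
        M≢0 : M ≢ + 0
        M≢0 = pos≢0 (pos hM)
        eq₂ : m₂ ≡ M * (ev z h - + 1)
        eq₂ = alg (at₅ rel z) ze zf zg zk
          where
          alg : ∀ {E F G H K} → M * E + m₂ * F + m₃ * G + - M * H + - M * K ≡ + 0 → E ≡ + 1 → F ≡ + 1 → G ≡ + 0 → K ≡ + 0 → m₂ ≡ M * (H - + 1)
          alg {E} {F} {G} {H} {K} = howe-identity-5 M m₂ m₃ {E} {F} {G} {H} {K}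
        eq₃ : m₃ ≡ M * (+ 2 - ev z h)
        eq₃ = alg {ev z h} eq₂ (total C)
          where
          alg : ∀ {H} → m₂ ≡ M * (H - + 1) → M + m₂ + m₃ + - M + - M ≡ + 0 → m₃ ≡ M * (+ 2 - H)
          alg {H} = howe-identity-6 M m₂ m₃ {H}
        low : ∀ {H} → m₃ ≡ M * (+ 2 - H) → NN (M - m₃) → NN (- H) → ⊥
        low {H} e b q = contra (hM ⊞ b ⊞ (hM ⊞ num 1) ⊠ q ⊞ eqNN e (+ 1)) (solve (M ∷ m₃ ∷ H ∷ []))
        high : ∀ {H} → m₂ ≡ M * (H - + 1) → NN (M - m₂) → NN (H - + 3) → ⊥
        high {H} e b q = contra (hM ⊞ b ⊞ (hM ⊞ num 1) ⊠ q ⊞ eqNN e (+ 1)) (solve (M ∷ m₂ ∷ H ∷ []))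
        mid : Pos (- - ev z h) → Pos (- (ev z h - + 3)) → ⊥
        mid p q = split (pin₂ (subst Pos (neg-involutive (ev z h)) p) (subst Pos (flip (ev z h)) q))
          (λ zh → flat′ z i₁ i₂ i₄ i₅ ze zf zh zk (nondeg (proj₁ (face₃ (λ m₃≡0 → M≢0 (trans (sym (trans eq₃ (trans (cong (λ t → M * (+ 2 - t)) zh) (*-identityʳ M)))) m₃≡0))))))
          (λ zh → parallelogram M≢0 (Circuit-cong (trans eq₂ (trans (cong (λ t → M * (t - + 1)) zh) (*-identityʳ M)))
                                     (trans eq₃ (trans (cong (λ t → M * (+ 2 - t)) zh) (*-zeroʳ M))) refl refl C))
          where
          flip : ∀ t → - (t - + 3) ≡ + 3 - t
          flip = howe-identity-9

      -- On the face `efgk` two pairings are exchanged by the symmetry between `f` and `g`, and the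
      -- pairing of `e` with `k` puts `h` at level 0 beside `f` and `g`.
      opposites : ∀ {e f g h k M m₂ m₃} → Pos M → Circuit e f g h k M m₂ m₃ (- M) (- M) → NN (M - m₂) → NN (M - m₃) → ⊥
      opposites {e} {f} {g} {h} {k} {M} {m₂} {m₃} hM C b₂ b₃ = white (proj₁ (face₄ -M≢0)) (opposite hM C b₂ b₃) (opposite hM (swap₂₃ C) b₃ b₂)
        (λ (splits z ze zk zf zg) → flat z i₂ i₃ i₄ i₁ zf zg (lev (at₅ rel z) ze zf zg zk) ze (nondeg (Good-swap₂ (Good-swap₁ (Good-swap₀ (proj₁ (face₅ -M≢0)))))))
        where
        open Circuit C
        M≢0 : M ≢ + 0
        M≢0 = pos≢0 hM
        -M≢0 : - M ≢ + 0
        -M≢0 = neg≢ M≢0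
        lev : ∀ {E F G H K} → M * E + m₂ * F + m₃ * G + - M * H + - M * K ≡ + 0 → E ≡ + 1 → F ≡ + 0 → G ≡ + 0 → K ≡ + 1 → H ≡ + 0
        lev {H = H} r refl refl refl refl = mul-cancel M M≢0 (fromZ (eqZ r (- + 1)) (solve (M ∷ m₂ ∷ m₃ ∷ H ∷ [])))

      -- If `e` has level `t`, then `m₂ + m₃ = -Mt` and `m₄ + m₅ = M(t - 1)`, so `t` is one of -1,
      -- 0, 1, 2 because `M` bounds every coefficient. The inner values give a flat layer or put `e`
      -- on an edge; the outer ones make two coefficients equal to `-M`.
      paired : ∀ {e f g h k M m₂ m₃ m₄ m₅} → Pos M → Circuit e f g h k M m₂ m₃ m₄ m₅ →
        NN (M - m₂) → NN (M + m₂) → NN (M - m₃) → NN (M + m₃) → NN (M - m₄) → NN (M + m₄) → NN (M - m₅) → NN (M + m₅) → Split f g h k → ⊥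
      paired {e} {f} {g} {h} {k} {M} {m₂} {m₃} {m₄} {m₅} (pos hM) C u₂ l₂ u₃ l₃ u₄ l₄ u₅ l₅ (splits z zf zg zh zk) =
        cases (ev z e) refl
        where
        open Circuit C
        M≢0 : M ≢ + 0
        M≢0 = pos≢0 (pos hM)
        eq₂₃ : ∀ {t} → ev z e ≡ t → m₂ + m₃ ≡ - (M * t)
        eq₂₃ {t} e = alg (at₅ rel z) e zf zg zh zk
          where
          alg : ∀ {E F G H K} → M * E + m₂ * F + m₃ * G + m₄ * H + m₅ * K ≡ + 0 → E ≡ t → F ≡ + 1 → G ≡ + 1 → H ≡ + 0 → K ≡ + 0 → m₂ + m₃ ≡ - (M * t)
          alg {E} {F} {G} {H} {K} = howe-identity-11 M m₂ m₃ m₄ m₅ t {E} {F} {G} {H} {K}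
        eq₄₅ : ∀ {t} → ev z e ≡ t → m₄ + m₅ ≡ M * (t - + 1)
        eq₄₅ {t} e = fromZ (eqZ (total C) (+ 1) ⊹ eqZ (eq₂₃ e) (- + 1)) (solve (M ∷ m₂ ∷ m₃ ∷ m₄ ∷ m₅ ∷ t ∷ []))
        inside : m₂ ≡ + 0 → m₃ ≡ + 0 → ⊥
        inside e₂ e₃ = proj₂ (face₁ M≢0) (in₄ {N = M} {+ 0} {+ 0} { - m₄} { - m₅} (pos hM) (num 0) (num 0)
            (cast (l₅ ⊞ eqNN (total C) (- + 1) ⊞ eqNN e₂ (+ 1) ⊞ eqNN e₃ (+ 1)) (solve (M ∷ m₂ ∷ m₃ ∷ m₄ ∷ m₅ ∷ [])))
            (cast (l₄ ⊞ eqNN (total C) (- + 1) ⊞ eqNN e₂ (+ 1) ⊞ eqNN e₃ (+ 1)) (solve (M ∷ m₂ ∷ m₃ ∷ m₄ ∷ m₅ ∷ [])))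
            (rel₄ λ z → alg (at₅ rel z)))
          where
          alg : ∀ {E F G H K} → M * E + m₂ * F + m₃ * G + m₄ * H + m₅ * K ≡ + 0 → M * E ≡ + 0 * F + + 0 * G + - m₄ * H + - m₅ * K
          alg {E} {F} {G} {H} {K} r = fromZ (eqZ r (+ 1) ⊹ eqZ e₂ (- F) ⊹ eqZ e₃ (- G)) (solve (M ∷ m₂ ∷ m₃ ∷ m₄ ∷ m₅ ∷ E ∷ F ∷ G ∷ H ∷ K ∷ []))
        inside′ : m₄ ≡ + 0 → m₅ ≡ + 0 → ⊥
        inside′ e₄ e₅ = proj₂ (face₁ M≢0) (in₄ {N = M} { - m₂} { - m₃} {+ 0} {+ 0} (pos hM)
            (cast (l₃ ⊞ eqNN (total C) (- + 1) ⊞ eqNN e₄ (+ 1) ⊞ eqNN e₅ (+ 1)) (solve (M ∷ m₂ ∷ m₃ ∷ m₄ ∷ m₅ ∷ [])))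
            (cast (l₂ ⊞ eqNN (total C) (- + 1) ⊞ eqNN e₄ (+ 1) ⊞ eqNN e₅ (+ 1)) (solve (M ∷ m₂ ∷ m₃ ∷ m₄ ∷ m₅ ∷ [])))
            (num 0) (num 0) (rel₄ λ z → alg (at₅ rel z)))
          where
          alg : ∀ {E F G H K} → M * E + m₂ * F + m₃ * G + m₄ * H + m₅ * K ≡ + 0 → M * E ≡ - m₂ * F + - m₃ * G + + 0 * H + + 0 * K
          alg {E} {F} {G} {H} {K} r = fromZ (eqZ r (+ 1) ⊹ eqZ e₄ (- H) ⊹ eqZ e₅ (- K)) (solve (M ∷ m₂ ∷ m₃ ∷ m₄ ∷ m₅ ∷ E ∷ F ∷ G ∷ H ∷ K ∷ []))
        extremes : ∀ {x y} → NN (M + x) → NN (M + y) → x + y ≡ - (+ 2 * M) → x ≡ - M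
        extremes {x} {y} lx ly e = antisym (cast lx (solve (x ∷ M ∷ []))) (cast (ly ⊞ eqNN e (- + 1)) (solve (x ∷ y ∷ M ∷ [])))
        cases : ∀ t → ev z e ≡ t → ⊥
        cases t e = split (nn? (- t - + 2)) (λ q → contra (hM ⊞ (hM ⊞ num 1) ⊠ q ⊞ l₄ ⊞ l₅ ⊞ eqNN (eq₄₅ e) (- + 1)) (solve (M ∷ m₄ ∷ m₅ ∷ t ∷ [])))
          (λ p → split (nn? (t - + 3)) (λ q → contra (hM ⊞ (hM ⊞ num 1) ⊠ q ⊞ l₂ ⊞ l₃ ⊞ eqNN (eq₂₃ e) (- + 1)) (solve (M ∷ m₂ ∷ m₃ ∷ t ∷ []))) (λ q → mid p q))
          where
          mid : Pos (- (- t - + 2)) → Pos (- (t - + 3)) → ⊥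
          mid (pos p) (pos q) = split (cmp t (+ 1))
            (λ h → split (pin₂ {t} (castP h refl) (castP q (solve (t ∷ [])))) t≡1 t≡2)
            (λ (pos h) → split (pin₂ {t + + 2} (castP p (solve (t ∷ []))) (castP h (solve (t ∷ []))))
              (λ e′ → t≡-1 (fromZ (eqZ e′ (+ 1)) (solve (t ∷ [])))) (λ e′ → t≡0 (fromZ (eqZ e′ (+ 1)) (solve (t ∷ [])))))
            where
            t≡0 : t ≡ + 0 → ⊥
            t≡0 refl = split? (m₃ ≟ + 0)
              (λ m₃≡0 → inside (fromZ (eqZ (eq₂₃ e) (+ 1) ⊹ eqZ m₃≡0 (- + 1)) (solve (M ∷ m₂ ∷ m₃ ∷ []))) m₃≡0)
              (λ m₃≢0 → flat z i₁ i₄ i₅ i₂ e zh zk zf (nondeg (Good-swap₂ (Good-swap₁ (proj₁ (face₃ m₃≢0))))))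
            t≡1 : t ≡ + 1 → ⊥
            t≡1 refl = split? (m₄ ≟ + 0)
              (λ m₄≡0 → inside′ m₄≡0 (fromZ (eqZ (eq₄₅ e) (+ 1) ⊹ eqZ m₄≡0 (- + 1)) (solve (M ∷ m₄ ∷ m₅ ∷ []))))
              (λ m₄≢0 → flat′ z i₁ i₂ i₃ i₅ e zf zg zk (nondeg (proj₁ (face₄ m₄≢0))))
            t≡-1 : t ≡ - + 1 → ⊥
            t≡-1 refl = opposites (pos hM) (Circuit-cong refl refl (extremes l₄ l₅ s) (extremes l₅ l₄ (trans (+-comm m₅ m₄) s)) C) u₂ u₃
              where
              s : m₄ + m₅ ≡ - (+ 2 * M)
              s = trans (eq₄₅ e) (solve (M ∷ []))
            t≡2 : t ≡ + 2 → ⊥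
            t≡2 refl = opposites (pos hM) (Circuit-cong refl refl (extremes l₂ l₃ s) (extremes l₃ l₂ (trans (+-comm m₃ m₂) s)) (swap₃₄ (swap₂₃ (swap₄₅ (swap₃₄ C))))) u₄ u₅
              where
              s : m₂ + m₃ ≡ - (+ 2 * M)
              s = trans (eq₂₃ e) (solve (M ∷ []))

      largest-first : ∀ {e f g h k M m₂ m₃ m₄ m₅} → Pos M → Circuit e f g h k M m₂ m₃ m₄ m₅ →
        NN (M - ab m₂) → NN (M - ab m₃) → NN (M - ab m₄) → NN (M - ab m₅) → ⊥
      largest-first {M = M} {m₂} {m₃} {m₄} {m₅} hM C b₂ b₃ b₄ b₅ = white (proj₁ (Circuit.face₁ C (pos≢0 hM)))
        (paired hM C (up m₂ b₂) (lo m₂ b₂) (up m₃ b₃) (lo m₃ b₃) (up m₄ b₄) (lo m₄ b₄) (up m₅ b₅) (lo m₅ b₅))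
        (paired hM (swap₃₄ C) (up m₂ b₂) (lo m₂ b₂) (up m₄ b₄) (lo m₄ b₄) (up m₃ b₃) (lo m₃ b₃) (up m₅ b₅) (lo m₅ b₅))
        (paired hM (swap₃₄ (swap₄₅ C)) (up m₂ b₂) (lo m₂ b₂) (up m₅ b₅) (lo m₅ b₅) (up m₃ b₃) (lo m₃ b₃) (up m₄ b₄) (lo m₄ b₄))
        where
        up : ∀ x → NN (M - ab x) → NN (M - x)
        up x h = cast (h ⊞ ab-≥ x) (alg (ab x) x)
          where
          alg : ∀ a x → M - a + (a - x) ≡ M - x
          alg = howe-identity-19 M
        lo : ∀ x → NN (M - ab x) → NN (M + x)
        lo x h = cast (h ⊞ ab-≥⁻ x) (alg (ab x) x)
          where
          alg : ∀ a x → M - a + (a + x) ≡ M + x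
          alg = howe-identity-20 M

      ab-first : ∀ {e f g h k m₁ m₂ m₃ m₄ m₅} → m₁ ≢ + 0 → Circuit e f g h k m₁ m₂ m₃ m₄ m₅ →
        NN (ab m₁ - ab m₂) → NN (ab m₁ - ab m₃) → NN (ab m₁ - ab m₄) → NN (ab m₁ - ab m₅) → ⊥
      ab-first {m₁ = m₁} {m₂} {m₃} {m₄} {m₅} m₁≢0 C b₂ b₃ b₄ b₅ = split (sgn m₁)
        (λ h → largest-first h C (fix h m₂ b₂) (fix h m₃ b₃) (fix h m₄ b₄) (fix h m₅ b₅))
        (λ q → split q m₁≢0 (λ h → largest-first h (negate C) (fix′ h m₂ b₂) (fix′ h m₃ b₃) (fix′ h m₄ b₄) (fix′ h m₅ b₅)))
        where
        fix : Pos m₁ → ∀ x → NN (ab m₁ - ab x) → NN (m₁ - ab x)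
        fix h x = subst (λ t → NN (t - ab x)) (ab-pos (pos⇒nn h))
        fix′ : Pos (- m₁) → ∀ x → NN (ab m₁ - ab x) → NN (- m₁ - ab (- x))
        fix′ h x k = subst (λ t → NN (- m₁ - t)) (sym (ab-neg x)) (subst (λ t → NN (t - ab x)) (trans (sym (ab-neg m₁)) (ab-pos (pos⇒nn h))) k)

      ≥-trans : ∀ x y z → Pos (ab y - ab x) → NN (ab x - ab z) → NN (ab y - ab z)
      ≥-trans x y z (pos p) q = cast (p ⊞ q ⊞ num 1) (alg (ab x) (ab y) (ab z))
        where
        alg : ∀ x y z → y - x - + 1 + (x - z) + + 1 ≡ y - z
        alg = howe-identity-21

      bigger : ∀ {x y} → Pos (ab y - ab x) → y ≢ + 0
      bigger {x} h refl = alg (ab-nn x) h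
        where
        alg : ∀ {a} → NN a → Pos (+ 0 - a) → ⊥
        alg {a} = howe-identity-22 {a}

    -- Howe's theorem for five points.
    circuit-absurd : ∀ {e f g h k m₁ m₂ m₃ m₄ m₅} → m₁ ≢ + 0 → Circuit e f g h k m₁ m₂ m₃ m₄ m₅ → ⊥
    -- The coefficient of largest absolute value is moved to the front, one comparison at a time.
    circuit-absurd = s₂
      where
      s₅ : ∀ {e f g h k m₁ m₂ m₃ m₄ m₅} → m₁ ≢ + 0 → Circuit e f g h k m₁ m₂ m₃ m₄ m₅ → NN (ab m₁ - ab m₂) → NN (ab m₁ - ab m₃) → NN (ab m₁ - ab m₄) → ⊥
      s₅ {m₁ = m₁} {m₂} {m₃} {m₄} {m₅} nz C b₂ b₃ b₄ = split (cmp (ab m₁) (ab m₅)) (ab-first nz C b₂ b₃ b₄)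
        (λ h → ab-first (bigger {m₁} {m₅} h) (swap₁₂ (swap₂₃ (swap₃₄ (swap₄₅ C)))) (pos⇒nn h) (≥-trans m₁ m₅ m₂ h b₂) (≥-trans m₁ m₅ m₃ h b₃) (≥-trans m₁ m₅ m₄ h b₄))
      s₄ : ∀ {e f g h k m₁ m₂ m₃ m₄ m₅} → m₁ ≢ + 0 → Circuit e f g h k m₁ m₂ m₃ m₄ m₅ → NN (ab m₁ - ab m₂) → NN (ab m₁ - ab m₃) → ⊥
      s₄ {m₁ = m₁} {m₂} {m₃} {m₄} nz C b₂ b₃ = split (cmp (ab m₁) (ab m₄)) (s₅ nz C b₂ b₃)
        (λ h → s₅ (bigger {m₁} {m₄} h) (swap₁₂ (swap₂₃ (swap₃₄ C))) (pos⇒nn h) (≥-trans m₁ m₄ m₂ h b₂) (≥-trans m₁ m₄ m₃ h b₃))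
      s₃ : ∀ {e f g h k m₁ m₂ m₃ m₄ m₅} → m₁ ≢ + 0 → Circuit e f g h k m₁ m₂ m₃ m₄ m₅ → NN (ab m₁ - ab m₂) → ⊥
      s₃ {m₁ = m₁} {m₂} {m₃} nz C b₂ = split (cmp (ab m₁) (ab m₃)) (s₄ nz C b₂)
        (λ h → s₄ (bigger {m₁} {m₃} h) (swap₁₂ (swap₂₃ C)) (pos⇒nn h) (≥-trans m₁ m₃ m₂ h b₂))
      s₂ : ∀ {e f g h k m₁ m₂ m₃ m₄ m₅} → m₁ ≢ + 0 → Circuit e f g h k m₁ m₂ m₃ m₄ m₅ → ⊥
      s₂ {m₁ = m₁} {m₂} nz C = split (cmp (ab m₁) (ab m₂)) (s₃ nz C) (λ h → s₃ (bigger {m₁} {m₂} h) (swap₁₂ C) (pos⇒nn h))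

  -- Isolated points near an empty tetrahedron

  module Nearest where

    open Base
    open Arith
    open Tet
    open White
    open import Data.Nat using (zero; suc)
    open import Data.Integer hiding (suc; pos; ∣_∣)
    open import Data.Integer.Properties
    open import Data.Integer.Divisibility.Signed
    open import Data.Integer.Tactic.RingSolver using (solve)
    open import Data.List using (_∷_; [])
    open import Data.Product using (_×_; proj₁; proj₂)
    open import Data.Empty using (⊥; ⊥-elim)
    open import Relation.Binary.PropositionalEquality using (_≡_; _≢_; sym; trans; cong; subst)
    open Near

    open InHull public
    open NoUnimodular public
    open Convex public

    -- The size of the relation of r measures the volume of the hull of the tetrahedron and r.
    nearest : ∀ n {a b c d K r ρ₀ ρ₁ ρ₂ ρ₃} → Good a b c d → A a → A b → A c → A d → ab (vol a b c d) ≡ K → Pos K →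
      A r → Rel₄ K r ρ₀ a ρ₁ b ρ₂ c ρ₃ d → r ≢ a → r ≢ b → r ≢ c → r ≢ d → NN (+ n - sum-ab ρ₀ ρ₁ ρ₂ ρ₃) →
      (∀ {x χ₀ χ₁ χ₂ χ₃} → A x → Rel₄ K x χ₀ a χ₁ b χ₂ c χ₃ d → In₅ a b c d r x → x ≢ a → x ≢ b → x ≢ c → x ≢ d → Isolated a b c d x → ⊥) → ⊥
    nearest zero {K = K} {ρ₀ = ρ₀} {ρ₁} {ρ₂} {ρ₃} G _ _ _ _ _ hK _ R r≢a r≢b r≢c r≢d h _ =
      absurd (sum-ab ρ₀ ρ₁ ρ₂ ρ₃) h (excess (sum₄ R) (λ h₀ h₁ h₂ h₃ → empty G (in₄ hK h₀ h₁ h₂ h₃ R) r≢a r≢b r≢c r≢d))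
      where
      absurd : ∀ m → NN (+ 0 - m) → Pos (m - K) → ⊥
      absurd m p (pos q) = contra (p ⊞ q ⊞ pos⇒nn hK) (solve (m ∷ K ∷ []))
    nearest (suc n) {a} {b} {c} {d} {K} {r} {ρ₀} {ρ₁} {ρ₂} {ρ₃} G Aa Ab Ac Ad vK hK Ar R r≢a r≢b r≢c r≢d h k =
      k Ar R In₅-self r≢a r≢b r≢c r≢d (λ {y} i y≢a y≢b y≢c y≢d y≢r → step i y≢a y≢b y≢c y≢d y≢r (coords vK y))
      where
      big : Pos (sum-ab ρ₀ ρ₁ ρ₂ ρ₃ - K)
      big = excess (sum₄ R) (λ h₀ h₁ h₂ h₃ → empty G (in₄ hK h₀ h₁ h₂ h₃ R) r≢a r≢b r≢c r≢d)
      step : ∀ {y} → In₅ a b c d r y → y ≢ a → y ≢ b → y ≢ c → y ≢ d → y ≢ r → Coord K a b c d y → ⊥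
      step {y} i@(in₅ {N} {n₀} {n₁} {n₂} {n₃} {l} hN h₀ h₁ h₂ h₃ hl s) y≢a y≢b y≢c y≢d y≢r (coord {η₀} {η₁} {η₂} {η₃} Y) =
        nearest n G Aa Ab Ac Ad vK hK (hull₅ Aa Ab Ac Ad Ar i) Y y≢a y≢b y≢c y≢d bound
          (λ Ax X j → k Ax X (In₅-trans i j))
        where
        eqs : N * η₀ ≡ l * ρ₀ + K * n₀ × N * η₁ ≡ l * ρ₁ + K * n₁ × N * η₂ ≡ l * ρ₂ + K * n₂ × N * η₃ ≡ l * ρ₃ + K * n₃
        eqs = Rel-uniq (nondeg G) (Rel-mul N Y) (In₅-coords {N = N} {n₀} {n₁} {n₂} {n₃} {l} R s)
        S : N ≡ n₀ + n₁ + n₂ + n₃ + l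
        S = alg (ev-one a) (ev-one b) (ev-one c) (ev-one d) (ev-one r) (ev-one y) (s one)
          where
          alg : ∀ {A B C D X P} → A ≡ + 1 → B ≡ + 1 → C ≡ + 1 → D ≡ + 1 → X ≡ + 1 → P ≡ + 1 →
            N * P ≡ n₀ * A + n₁ * B + n₂ * C + n₃ * D + l * X → N ≡ n₀ + n₁ + n₂ + n₃ + l
          alg {A} {B} {C} {D} {X} {P} = near-identity-7 N n₀ n₁ n₂ n₃ l {A} {B} {C} {D} {X} {P}
        -- The triangle inequality for `Nη = lρ + Kn`. Summed over the four coordinates it bounds
        -- the new size by an average of the old size and `K`, with `l < N`; as the old size exceeds
        -- `K`, the new one is strictly smaller.
        est : ∀ {n} η ρ → NN n → N * η ≡ l * ρ + K * n → NN (l * ab ρ + K * n - N * ab η)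
        est {n} η ρ hn e = subst (λ t → NN (l * ab ρ + K * n - t)) (trans (cong ab (sym e) ) (trans (ab-* N η) (cong (_* ab η) (ab-pos (pos⇒nn hN)))))
            (ab-≤ {l * ab ρ + K * n} (l * ρ + K * n) (alg₁ (ab ρ) (ab-≥ ρ)) (alg₂ (ab ρ) (ab-≥⁻ ρ)))
          where
          alg₁ : ∀ m → NN (m - ρ) → NN (l * m + K * n - (l * ρ + K * n))
          alg₁ m q = cast (hl ⊠ q) (solve (l ∷ m ∷ ρ ∷ K ∷ n ∷ []))
          alg₂ : ∀ m → NN (m + ρ) → NN (l * m + K * n + (l * ρ + K * n))
          alg₂ m q = cast (hl ⊠ q ⊞ pos⇒nn hK ⊠ hn ⊞ pos⇒nn hK ⊠ hn) (solve (l ∷ m ∷ ρ ∷ K ∷ n ∷ []))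
        l<N : Pos (N - l)
        l<N = split {C = Pos (N - l)} (nn? (l - N)) (λ q → ⊥-elim (y≢r (pt-ext λ z → mul-cancel N (pos≢0 hN)
                (alg (ev z a) (ev z b) (ev z c) (ev z d) (ev z r) (ev z y) (z₀ h₀ h₁ h₂ h₃ S q) (z₁ q) (z₂ q) (z₃ q) S (s z)))))
              (λ (pos q) → castP q (solve (N ∷ l ∷ [])))
          where
          z₀ : ∀ {x y u v} → NN x → NN y → NN u → NN v → N ≡ x + y + u + v + l → NN (l - N) → x ≡ + 0
          z₀ {x} {y} {u} {v} hx hy hu hv e q = antisym (cast hx (solve (x ∷ []))) (cast (hy ⊞ hu ⊞ hv ⊞ q ⊞ eqNN e (+ 1)) (solve (N ∷ x ∷ y ∷ u ∷ v ∷ l ∷ [])))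
          z₁ : NN (l - N) → n₁ ≡ + 0
          z₁ = z₀ h₁ h₀ h₂ h₃ (trans S (solve (n₀ ∷ n₁ ∷ n₂ ∷ n₃ ∷ l ∷ [])))
          z₂ : NN (l - N) → n₂ ≡ + 0
          z₂ = z₀ h₂ h₀ h₁ h₃ (trans S (solve (n₀ ∷ n₁ ∷ n₂ ∷ n₃ ∷ l ∷ [])))
          z₃ : NN (l - N) → n₃ ≡ + 0
          z₃ = z₀ h₃ h₀ h₁ h₂ (trans S (solve (n₀ ∷ n₁ ∷ n₂ ∷ n₃ ∷ l ∷ [])))
          alg : ∀ A B C D X P {n₀ n₁ n₂ n₃} → n₀ ≡ + 0 → n₁ ≡ + 0 → n₂ ≡ + 0 → n₃ ≡ + 0 → N ≡ n₀ + n₁ + n₂ + n₃ + l →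
            N * P ≡ n₀ * A + n₁ * B + n₂ * C + n₃ * D + l * X → N * P ≡ N * X
          alg A B C D X P {n₀} {n₁} {n₂} {n₃} = near-identity-13 N l A B C D X P {n₀} {n₁} {n₂} {n₃}
        bound : NN (+ n - sum-ab η₀ η₁ η₂ η₃)
        bound = alg (+ n) (ab η₀) (ab η₁) (ab η₂) (ab η₃) (ab ρ₀) (ab ρ₁) (ab ρ₂) (ab ρ₃) h big
            (est η₀ ρ₀ h₀ (proj₁ eqs)) (est η₁ ρ₁ h₁ (proj₁ (proj₂ eqs))) (est η₂ ρ₂ h₂ (proj₁ (proj₂ (proj₂ eqs)))) (est η₃ ρ₃ h₃ (proj₂ (proj₂ (proj₂ eqs))))
          where
          alg : ∀ n a b c d a′ b′ c′ d′ → NN (+ 1 + n - (a′ + b′ + c′ + d′)) → Pos (a′ + b′ + c′ + d′ - K) →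
            NN (l * a′ + K * n₀ - N * a) → NN (l * b′ + K * n₁ - N * b) → NN (l * c′ + K * n₂ - N * c) → NN (l * d′ + K * n₃ - N * d) →
            NN (n - (a + b + c + d))
          alg n a b c d a′ b′ c′ d′ h g p q r s = two {a′ + b′ + c′ + d′} {a + b + c + d} {n₀ + n₁ + n₂ + n₃} h g
            (cast (p ⊞ q ⊞ r ⊞ s) (solve (a ∷ b ∷ c ∷ d ∷ a′ ∷ b′ ∷ c′ ∷ d′ ∷ K ∷ N ∷ l ∷ n₀ ∷ n₁ ∷ n₂ ∷ n₃ ∷ []))) S
            where
            two : ∀ {m s σ} → NN (+ 1 + n - m) → Pos (m - K) → NN (l * m + K * σ - N * s) → N ≡ σ + l → NN (n - s)
            two {m} {s} {σ} h g p S = pos⁻ (pos-cancel⁺ {N} {+ 1 + n - s} (pos⇒nn hN)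
                (castP (pos⇒nn hN ⊠ h ⊞ p ⊞ ↓ (posM l<N g) ⊞ eqNN S K) (solve (n ∷ m ∷ s ∷ σ ∷ K ∷ N ∷ l ∷ []))))
              where
              pos⁻ : Pos (+ 1 + n - s) → NN (n - s)
              pos⁻ = near-identity-14 n s

  -- An empty tetrahedron with an isolated fifth point

  module Five where

    open Base
    open Arith
    open Tet
    open White
    open Near
    open import Data.Integer hiding (suc; pos; ∣_∣)
    open import Data.Integer.Properties
    open import Data.Integer.Divisibility.Signed
    open import Data.Integer.Tactic.RingSolver using (solve)
    open import Data.List using (_∷_; [])
    open import Data.Product using (_×_; _,_; proj₁)
    open import Data.Empty using (⊥; ⊥-elim)
    open import Relation.Binary.PropositionalEquality using (_≡_; _≢_; sym; trans; cong; subst)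
    open Pairs

    open Nearest public

    -- An empty tetrahedron together with a lattice point x such that the hull of the five points has no other lattice point.
    record Pair (a b c d x : Pt) (K χ₀ χ₁ χ₂ χ₃ : ℤ) : Set where
      field
        G : Good a b c d
        Aa : A a
        Ab : A b
        Ac : A c
        Ad : A d
        Ax : A x
        vK : ab (vol a b c d) ≡ K
        X : Rel₄ K x χ₀ a χ₁ b χ₂ c χ₃ d
        x≢a : x ≢ a
        x≢b : x ≢ b
        x≢c : x ≢ c
        x≢d : x ≢ d
        iso : Isolated a b c d x

      K>0 : Pos K
      K>0 = subst Pos vK (ab-≢0 (nondeg G))

    Pair-swap₀ : ∀ {a b c d x K χ₀ χ₁ χ₂ χ₃} → Pair a b c d x K χ₀ χ₁ χ₂ χ₃ → Pair b a c d x K χ₁ χ₀ χ₂ χ₃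
    Pair-swap₀ {a} {b} {c} {d} P = record { G = Good-swap₀ G ; Aa = Ab ; Ab = Aa ; Ac = Ac ; Ad = Ad ; Ax = Ax ; vK = trans (ab-swap₀ a b c d) vK
      ; X = Rel-swap₀ X ; x≢a = x≢b ; x≢b = x≢a ; x≢c = x≢c ; x≢d = x≢d ; iso = λ i y z u v → iso (In₅-swap₀ i) z y u v }
      where open Pair P

    Pair-swap₁ : ∀ {a b c d x K χ₀ χ₁ χ₂ χ₃} → Pair a b c d x K χ₀ χ₁ χ₂ χ₃ → Pair a c b d x K χ₀ χ₂ χ₁ χ₃
    Pair-swap₁ {a} {b} {c} {d} P = record { G = Good-swap₁ G ; Aa = Aa ; Ab = Ac ; Ac = Ab ; Ad = Ad ; Ax = Ax ; vK = trans (ab-swap₁ a b c d) vK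
      ; X = Rel-swap₁ X ; x≢a = x≢a ; x≢b = x≢c ; x≢c = x≢b ; x≢d = x≢d ; iso = λ i y z u v → iso (In₅-swap₁ i) y u z v }
      where open Pair P

    Pair-swap₂ : ∀ {a b c d x K χ₀ χ₁ χ₂ χ₃} → Pair a b c d x K χ₀ χ₁ χ₂ χ₃ → Pair a b d c x K χ₀ χ₁ χ₃ χ₂
    Pair-swap₂ {a} {b} {c} {d} P = record { G = Good-swap₂ G ; Aa = Aa ; Ab = Ab ; Ac = Ad ; Ad = Ac ; Ax = Ax ; vK = trans (ab-swap₂ a b c d) vK
      ; X = Rel-swap₂ X ; x≢a = x≢a ; x≢b = x≢b ; x≢c = x≢d ; x≢d = x≢c ; iso = λ i y z u v → iso (In₅-swap₂ i) y z v u }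
      where open Pair P

    outside : ∀ {a b c d x K χ₀ χ₁ χ₂ χ₃} → Pair a b c d x K χ₀ χ₁ χ₂ χ₃ → In₄ a b c d x → ⊥
    outside P i = empty G i x≢a x≢b x≢c x≢d
      where open Pair P

    private
      replace-coefs : ∀ {a b c d x K χ₀ χ₁ χ₂ χ₃} → Pair a b c d x K χ₀ χ₁ χ₂ χ₃ → ∀ {N n₀ n₁ n₂ n₃} → Rel₄ N a n₀ x n₁ b n₂ c n₃ d →
        n₀ * χ₀ ≡ N * K × n₀ * χ₁ + K * n₁ ≡ + 0
      replace-coefs {a} {b} {c} {d} {x} {K} {χ₀} {χ₁} {χ₂} {χ₃} P {N} {n₀} {n₁} {n₂} {n₃} r =
        let (e₀ , e₁ , _) = Rel-uniq (nondeg G) (In₅-coords {K = K} {N} {+ 0} {n₁} {n₂} {n₃} {n₀} X s) (Rel-v₀ {N * K}) in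
        trans (sym (fix₀ n₀ χ₀)) e₀ , e₁
        where
        open Pair P
        fix₀ : ∀ n χ → n * χ + K * + 0 ≡ n * χ
        fix₀ = pairs-identity-1 K
        s : ∀ z → N * ev z a ≡ + 0 * ev z a + n₁ * ev z b + n₂ * ev z c + n₃ * ev z d + n₀ * ev z x
        s z = trans (at r z) (alg (ev z a) (ev z b) (ev z c) (ev z d) (ev z x))
          where
          alg : ∀ a b c d x → n₀ * x + n₁ * b + n₂ * c + n₃ * d ≡ + 0 * a + n₁ * b + n₂ * c + n₃ * d + n₀ * x
          alg = pairs-identity-2 n₀ n₁ n₂ n₃

      not-in⁻ : ∀ {a b c d x K χ₀ χ₁ χ₂ χ₃} → Pair a b c d x K χ₀ χ₁ χ₂ χ₃ → Pos (- χ₀) → In₄ x b c d a → ⊥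
      not-in⁻ {K = K} {χ₀} P (pos h) (in₄ {N} {n₀} hN h₀ _ _ _ r) = alg (proj₁ (replace-coefs P r))
        where
        alg : n₀ * χ₀ ≡ N * K → ⊥
        alg e = contra (h₀ ⊠ h ⊞ h₀ ⊞ ↓ (posM hN (Pair.K>0 P)) ⊞ eqNN e (+ 1)) (solve (n₀ ∷ χ₀ ∷ N ∷ K ∷ []))

      not-in⁺ : ∀ {a b c d x K χ₀ χ₁ χ₂ χ₃} → Pair a b c d x K χ₀ χ₁ χ₂ χ₃ → Pos χ₀ → Pos χ₁ → In₄ x b c d a → ⊥
      not-in⁺ {K = K} {χ₀} {χ₁} P h k (in₄ {N} {n₀} {n₁} hN h₀ h₁ _ _ r) = alg (replace-coefs P r)
        where
        alg : n₀ * χ₀ ≡ N * K × n₀ * χ₁ + K * n₁ ≡ + 0 → ⊥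
        alg (e , f) = contra (↓ (posM n₀>0 k) ⊞ pos⇒nn (Pair.K>0 P) ⊠ h₁ ⊞ eqNN f (- + 1)) (solve (n₀ ∷ χ₁ ∷ n₁ ∷ K ∷ []))
          where
          n₀>0 : Pos n₀
          n₀>0 = nn≢0 h₀ (λ z → pos≢0 (posM hN (Pair.K>0 P)) (trans (sym e) (cong (_* χ₀) z)))

      -- The tetrahedron `xbcd` is part of the hull of the five points, so isolation makes it empty
      -- as soon as it misses `a`.
      replaced : ∀ {a b c d x K χ₀ χ₁ χ₂ χ₃} → Pair a b c d x K χ₀ χ₁ χ₂ χ₃ → χ₀ ≢ + 0 → (In₄ x b c d a → ⊥) → Face x b c d a
      replaced {a} {b} {c} {d} {x} {K} P χ₀≢0 k = good
        (λ i y≢x y≢b y≢c y≢d → iso (In₄-replace i) (λ e → k (subst (In₄ x b c d) e i)) y≢b y≢c y≢d y≢x)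
        (λ e → mul≢0 χ₀≢0 (nondeg G) (trans (sym (coef₀ X)) (trans (cong (K *_) e) (*-zeroʳ K)))) , k
        where open Pair P

    -- A negative coordinate at `a` puts `x` and `a` on opposite sides of the plane `bcd`.
    face⁻ : ∀ {a b c d x K χ₀ χ₁ χ₂ χ₃} → Pair a b c d x K χ₀ χ₁ χ₂ χ₃ → Pos (- χ₀) → Face x b c d a
    face⁻ P h = replaced P (neg≢0 h) (not-in⁻ P h)

    -- Were `a` a combination of `x`, `b`, `c`, `d`, substituting the coordinates of `x` would leave
    -- `b` with the positive coefficient `n₀χ₁ + K n₁`.
    face⁺ : ∀ {a b c d x K χ₀ χ₁ χ₂ χ₃} → Pair a b c d x K χ₀ χ₁ χ₂ χ₃ → Pos χ₀ → Pos χ₁ → Face x b c d a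
    face⁺ P h k = replaced P (pos≢0 h) (not-in⁺ P h k)

    private
      face± : ∀ {a b c d x K χ₀ χ₁ χ₂ χ₃} → Pair a b c d x K χ₀ χ₁ χ₂ χ₃ → Pos χ₁ → - χ₀ ≢ + 0 → Face x b c d a
      face± {χ₀ = χ₀} P h nz = split (sgn χ₀) (λ k → face⁺ P k h) (λ q → split q (λ e → ⊥-elim (nz (cong -_ e))) (face⁻ P))

    -- At most one coordinate of x is positive: otherwise the five points are in convex position.
    two-positive : ∀ {a b c d x K χ₀ χ₁ χ₂ χ₃} → Pair a b c d x K χ₀ χ₁ χ₂ χ₃ → Pos χ₀ → Pos χ₁ → ⊥
    two-positive {a} {b} {c} {d} {x} {K} {χ₀} {χ₁} {χ₂} {χ₃} P h₀ h₁ = circuit-absurd (pos≢0 K>0) (record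
      { rel = rel₅ λ z → alg (ev z a) (ev z b) (ev z c) (ev z d) (ev z x) (at X z)
      ; i₁ = Ax ; i₂ = Aa ; i₃ = Ab ; i₄ = Ac ; i₅ = Ad
      ; face₁ = λ _ → G , outside P
      ; face₂ = face± P h₁
      ; face₃ = face± (Pair-swap₀ P) h₀
      ; face₄ = face± (Pair-swap₀ (Pair-swap₁ P)) h₀
      ; face₅ = face± (Pair-swap₀ (Pair-swap₁ (Pair-swap₂ P))) h₀
      })
      where
      open Pair P
      alg : ∀ A B C D X → K * X ≡ χ₀ * A + χ₁ * B + χ₂ * C + χ₃ * D → K * X + - χ₀ * A + - χ₁ * B + - χ₂ * C + - χ₃ * D ≡ + 0
      alg = pairs-identity-4 K χ₀ χ₁ χ₂ χ₃

  -- The weights of an interior lattice point and their functionals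

  module Quadruples where

    open Base
    open Arith
    open Tet
    open White
    open Conf
    open Near
    open Weights
    open import Data.Nat using (suc)
    open import Data.Integer hiding (suc; pos; ∣_∣)
    open import Data.Integer.Properties
    open import Data.Integer.Divisibility.Signed
    open import Data.Integer.Tactic.RingSolver using (solve)
    open import Data.List using (_∷_; [])
    open import Data.Empty using (⊥)
    open import Relation.Binary.PropositionalEquality using (_≡_; _≢_; refl; sym; trans; cong; cong₂)
    open Quads

    open Five public

    -- A tetrahedron abcd with an interior lattice point o, of barycentric weights α : β : γ : δ,
    -- such that the four tetrahedra at o are empty.
    record Quad (o a b c d : Pt) (N α β γ δ : ℤ) : Set where
      field
        rel : Rel₄ N o α a β b γ c δ d
        Ao : A o
        Aa : A a
        Ab : A b
        Ac : A c
        Ad : A d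
        Ga : Good o b c d
        Gb : Good o a c d
        Gc : Good o a b d
        Gd : Good o a b c

    Quad-swap₁ : ∀ {o a b c d N α β γ δ} → Quad o a b c d N α β γ δ → Quad o a c b d N α γ β δ
    Quad-swap₁ Q = record { rel = Rel-swap₁ rel ; Ao = Ao ; Aa = Aa ; Ab = Ac ; Ac = Ab ; Ad = Ad
      ; Ga = Good-swap₁ Ga ; Gb = Gc ; Gc = Gb ; Gd = Good-swap₂ Gd }
      where open Quad Q

    Quad-swap₂ : ∀ {o a b c d N α β γ δ} → Quad o a b c d N α β γ δ → Quad o a b d c N α β δ γ
    Quad-swap₂ Q = record { rel = Rel-swap₂ rel ; Ao = Ao ; Aa = Aa ; Ab = Ab ; Ac = Ad ; Ad = Ac
      ; Ga = Good-swap₂ Ga ; Gb = Good-swap₂ Gb ; Gc = Gd ; Gd = Gc }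
      where open Quad Q

    Quad-cancel : ∀ {o a b c d N α β γ δ N′ α′ β′ γ′ δ′} t → t ≢ + 0 → Quad o a b c d N α β γ δ →
      N ≡ t * N′ → α ≡ t * α′ → β ≡ t * β′ → γ ≡ t * γ′ → δ ≡ t * δ′ → Quad o a b c d N′ α′ β′ γ′ δ′
    Quad-cancel {o} {a} {b} {c} {d} {N′ = N′} {α′} {β′} {γ′} {δ′} t t≢0 Q refl refl refl refl refl = record
      { rel = rel₄ λ z → mul-cancel t t≢0 (alg (ev z o) (ev z a) (ev z b) (ev z c) (ev z d) (at rel z))
      ; Ao = Ao ; Aa = Aa ; Ab = Ab ; Ac = Ac ; Ad = Ad ; Ga = Ga ; Gb = Gb ; Gc = Gc ; Gd = Gd }
      where
      open Quad Q
      alg : ∀ O A B C D → t * N′ * O ≡ t * α′ * A + t * β′ * B + t * γ′ * C + t * δ′ * D →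
        t * (N′ * O) ≡ t * (α′ * A + β′ * B + γ′ * C + δ′ * D)
      alg = quads-identity-5 t N′ α′ β′ γ′ δ′

    record Values (o a b c d : Pt) (p q r s : ℤ) : Set where
      constructor values
      field
        fn : Fun
        vo : ev fn o ≡ + 0
        va : ev fn a ≡ p
        vb : ev fn b ≡ q
        vc : ev fn c ≡ r
        vd : ev fn d ≡ s

    infixl 6 _⊕_
    infixl 7 _⊙_

    _⊕_ : ∀ {o a b c d p q r s p′ q′ r′ s′} → Values o a b c d p q r s → Values o a b c d p′ q′ r′ s′ →
      Values o a b c d (p + p′) (q + q′) (r + r′) (s + s′)
    values f fo fa fb fc fd ⊕ values g go ga gb gc gd = values (addF f g) (val fo go) (val fa ga) (val fb gb) (val fc gc) (val fd gd)
      where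
      val : ∀ {x u v} → ev f x ≡ u → ev g x ≡ v → ev (addF f g) x ≡ u + v
      val {x} e e′ = trans (ev-addF f g x) (cong₂ _+_ e e′)

    _⊙_ : ∀ {o a b c d p q r s} k → Values o a b c d p q r s → Values o a b c d (k * p) (k * q) (k * r) (k * s)
    k ⊙ values f fo fa fb fc fd = values (scaleF k f) (trans (val fo) (*-zeroʳ k)) (val fa) (val fb) (val fc) (val fd)
      where
      val : ∀ {x u} → ev f x ≡ u → ev (scaleF k f) x ≡ k * u
      val {x} e = trans (ev-scaleF k f x) (cong (k *_) e)

    private
      level : ∀ {N o α a β b γ c δ d} → Rel₄ N o α a β b γ c δ d → δ ≢ + 0 → ∀ z {va vb vc} q →
        ev z o ≡ + 0 → ev z a ≡ va → ev z b ≡ vb → ev z c ≡ vc → α * va + β * vb + γ * vc + δ * q ≡ + 0 → ev z d ≡ q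
      level {N} {α = α} {β = β} {γ = γ} {δ = δ} {d = d} r δ≢0 z {va} {vb} {vc} q eo ea eb ec e =
        mul-cancel δ δ≢0 (alg (ev z d) (eval r z eo ea eb ec))
        where
        alg : ∀ t → N * + 0 ≡ α * va + β * vb + γ * vc + δ * t → δ * t ≡ δ * q
        alg t h = fromZ (eqZ h (- + 1) ⊹ eqZ e (- + 1)) (solve (N ∷ α ∷ β ∷ γ ∷ δ ∷ va ∷ vb ∷ vc ∷ t ∷ q ∷ []))

      -- The value at `d` would not be integral: the prescribed values contribute the nonzero
      -- remainder `r` modulo `δ`.
      clash : ∀ {N o α a β b γ c δ d} → Rel₄ N o α a β b γ c δ d → ∀ k r → Pos r → Pos (δ - r) → ∀ z {va vb vc} →
        ev z o ≡ + 0 → ev z a ≡ va → ev z b ≡ vb → ev z c ≡ vc → α * va + β * vb + γ * vc ≡ k * δ + r → ⊥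
      clash {N} {α = α} {β = β} {γ = γ} {δ = δ} {d = d} R k r lo hi z {va} {vb} {vc} eo ea eb ec e =
        ∣-small {δ} {r} lo hi (divides (- ev z d - k) (alg (ev z d) (eval R z eo ea eb ec)))
        where
        alg : ∀ t → N * + 0 ≡ α * va + β * vb + γ * vc + δ * t → r ≡ (- t - k) * δ
        alg t h = fromZ (eqZ h (- + 1) ⊹ eqZ e (- + 1)) (solve (N ∷ α ∷ β ∷ γ ∷ δ ∷ va ∷ vb ∷ vc ∷ t ∷ k ∷ r ∷ []))

      relC : ∀ {o a b c d N α β γ δ} → Quad o a b c d N α β γ δ → Rel₄ N o α a β b δ d γ c
      relC Q = Rel-swap₂ (Quad.rel Q)

      relB : ∀ {o a b c d N α β γ δ} → Quad o a b c d N α β γ δ → Rel₄ N o α a γ c δ d β b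
      relB Q = Rel-swap₂ (Rel-swap₁ (Quad.rel Q))

      p! : ∀ n → Pos (+ suc n)
      p! n = pos (num n)

      -- Here `o`, `b`, `c` have level 0 and `d` has level 1, which is a flat layer.
      unit : ∀ {o a b c d N α β γ δ p} → Quad o a b c d N α β γ δ → Values o a b c d p (+ 0) (+ 0) (+ 1) → ⊥
      unit Q (values z vo va vb vc vd) = flat z Ao Ab Ac Ad vo vb vc vd (nondeg Ga)
        where open Quad Q

    -- White's theorem on three of the four tetrahedra at `o` leaves functionals `f`, `g`, `h`, each
    -- unique up to adding earlier ones. A combination of them puts `d` one level above `o`, `b` and
    -- `c`.
    weights-1345 : ∀ {o a b c d} → Quad o a b c d (+ 13) (+ 1) (+ 3) (+ 4) (+ 5) → ⊥
    weights-1345 {o} {a} {b} {c} {d} Q = white₀ Gd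
      (λ z vo va vb vc → clash rel (+ 1) (+ 2) (p! 1) (p! 2) z vo va vb vc refl)
      (λ f fo fa fb fc → withF (values f fo fa fb fc (level rel (λ ()) f (- + 1) fo fa fb fc refl)))
      (λ z vo va vb vc → clash rel (+ 0) (+ 4) (p! 3) (p! 0) z vo va vb vc refl)
      where
      open Quad Q
      withG : Values o a b c d (+ 1) (+ 0) (+ 1) (- + 1) → Values o a b c d (+ 1) (+ 1) (- + 1) (+ 0) → ⊥
      withG f g = white₀ Gb
        (λ h ho ha hc hd → last (values h ho ha (level (relB Q) (λ ()) h (- + 3) ho ha hc hd refl) hc hd ⊕ g))
        (λ h ho ha hc hd → last (values h ho ha (level (relB Q) (λ ()) h (- + 2) ho ha hc hd refl) hc hd))
        (λ z vo va vc vd → clash (relB Q) (+ 1) (+ 2) (p! 1) (p! 0) z vo va vc vd refl)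
        where
        last : Values o a b c d (+ 1) (- + 2) (+ 0) (+ 1) → ⊥
        -- `h + 2g + 2f` takes the values 5, 0, 0, -1 at `a`, `b`, `c`, `d`.
        last h = unit Q (- + 1 ⊙ (h ⊕ + 2 ⊙ g ⊕ + 2 ⊙ f))
      withF : Values o a b c d (+ 1) (+ 0) (+ 1) (- + 1) → ⊥
      withF f = white₀ Gc
        (λ g go ga gb gd → withG f (values g go ga gb (level (relC Q) (λ ()) g (- + 2) go ga gb gd refl) gd ⊕ f))
        (λ z vo va vb vd → clash (relC Q) (+ 1) (+ 2) (p! 1) (p! 1) z vo va vb vd refl)
        (λ g go ga gb gd → withG f (values g go ga gb (level (relC Q) (λ ()) g (- + 1) go ga gb gd refl) gd))

    weights-1235 : ∀ {o a b c d} → Quad o a b c d (+ 11) (+ 1) (+ 2) (+ 3) (+ 5) → ⊥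
    weights-1235 {o} {a} {b} {c} {d} Q = white₀ Gd
      (λ f fo fa fb fc → withF (values f fo fa fb fc (level rel (λ ()) f (- + 1) fo fa fb fc refl)))
      (λ z vo va vb vc → clash rel (+ 0) (+ 4) (p! 3) (p! 0) z vo va vb vc refl)
      (λ z vo va vb vc → clash rel (+ 0) (+ 3) (p! 2) (p! 1) z vo va vb vc refl)
      where
      open Quad Q
      withG : Values o a b c d (+ 0) (+ 1) (+ 1) (- + 1) → Values o a b c d (+ 1) (+ 1) (- + 1) (+ 0) → ⊥
      withG f g = white₀ Gb
        (λ h ho ha hc hd → last (values h ho ha (level (relB Q) (λ ()) h (- + 4) ho ha hc hd refl) hc hd ⊕ g ⊕ f))
        (λ h ho ha hc hd → last (values h ho ha (level (relB Q) (λ ()) h (- + 3) ho ha hc hd refl) hc hd ⊕ f))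
        (λ h ho ha hc hd → last (values h ho ha (level (relB Q) (λ ()) h (- + 2) ho ha hc hd refl) hc hd))
        where
        last : Values o a b c d (+ 1) (- + 2) (+ 1) (+ 0) → ⊥
        -- `2h + 3g + f` takes the values 5, 0, 0, -1 at `a`, `b`, `c`, `d`.
        last h = unit Q (- + 2 ⊙ h ⊕ - + 3 ⊙ g ⊕ - + 1 ⊙ f)
      withF : Values o a b c d (+ 0) (+ 1) (+ 1) (- + 1) → ⊥
      withF f = white₀ Gc
        (λ z vo va vb vd → clash (relC Q) (+ 2) (+ 1) (p! 0) (p! 1) z vo va vb vd refl)
        (λ g go ga gb gd → withG f (values g go ga gb (level (relC Q) (λ ()) g (- + 2) go ga gb gd refl) gd ⊕ f))
        (λ g go ga gb gd → withG f (values g go ga gb (level (relC Q) (λ ()) g (- + 1) go ga gb gd refl) gd))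

    -- The coordinates of the vertices of E1 and E2, listed by increasing weight.
    functionals-2357 : ∀ {o a b c d} → Quad o a b c d (+ 17) (+ 2) (+ 3) (+ 5) (+ 7) →
      (Values o a b c d (+ 2) (+ 1) (+ 0) (- + 1) → Values o a b c d (+ 7) (+ 0) (+ 0) (- + 2) → Values o a b c d (+ 1) (+ 0) (+ 1) (- + 1) → ⊥) → ⊥
    functionals-2357 {o} {a} {b} {c} {d} Q k = white₀ Gd
      (λ z vo va vb vc → clash rel (+ 1) (+ 1) (p! 0) (p! 5) z vo va vb vc refl)
      (λ f fo fa fb fc → withF (values f fo fa fb fc (level rel (λ ()) f (- + 1) fo fa fb fc refl)))
      (λ z vo va vb vc → clash rel (+ 0) (+ 5) (p! 4) (p! 1) z vo va vb vc refl)
      where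
      open Quad Q
      withG : Values o a b c d (+ 1) (+ 0) (+ 1) (- + 1) → Values o a b c d (+ 1) (+ 1) (- + 1) (+ 0) → ⊥
      withG f g = white₀ Gb
        (λ h ho ha hc hd → last (values h ho ha (level (relB Q) (λ ()) h (- + 4) ho ha hc hd refl) hc hd ⊕ g))
        (λ h ho ha hc hd → last (values h ho ha (level (relB Q) (λ ()) h (- + 3) ho ha hc hd refl) hc hd))
        (λ z vo va vc vd → clash (relB Q) (+ 2) (+ 1) (p! 0) (p! 1) z vo va vc vd refl)
        where
        last : Values o a b c d (+ 1) (- + 3) (+ 0) (+ 1) → ⊥
        last h = k (f ⊕ g) (+ 3 ⊙ f ⊕ + 3 ⊙ g ⊕ h) f
      withF : Values o a b c d (+ 1) (+ 0) (+ 1) (- + 1) → ⊥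
      withF f = white₀ Gc
        -- The two admissible pairings yield functionals that differ by `f`, so both are brought to
        -- the same `g`.
        (λ g go ga gb gd → withG f (values g go ga gb (level (relC Q) (λ ()) g (- + 2) go ga gb gd refl) gd ⊕ f))
        (λ z vo va vb vd → clash (relC Q) (+ 1) (+ 4) (p! 3) (p! 0) z vo va vb vd refl)
        (λ g go ga gb gd → withG f (values g go ga gb (level (relC Q) (λ ()) g (- + 1) go ga gb gd refl) gd))

    functionals-3457 : ∀ {o a b c d} → Quad o a b c d (+ 19) (+ 3) (+ 4) (+ 5) (+ 7) →
      (Values o a b c d (+ 3) (+ 0) (+ 1) (- + 2) → Values o a b c d (+ 7) (+ 0) (+ 0) (- + 3) → Values o a b c d (+ 1) (+ 1) (+ 0) (- + 1) → ⊥) → ⊥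
    functionals-3457 {o} {a} {b} {c} {d} Q k = white₀ Gd
      (λ z vo va vb vc → clash rel (+ 1) (+ 2) (p! 1) (p! 4) z vo va vb vc refl)
      (λ z vo va vb vc → clash rel (+ 1) (+ 1) (p! 0) (p! 5) z vo va vb vc refl)
      (λ f fo fa fb fc → withF (values f fo fa fb fc (level rel (λ ()) f (- + 1) fo fa fb fc refl)))
      where
      open Quad Q
      withG : Values o a b c d (+ 1) (+ 1) (+ 0) (- + 1) → Values o a b c d (+ 1) (+ 0) (- + 2) (+ 1) → ⊥
      withG f g = white₀ Gb
        (λ h ho ha hc hd → last (values h ho ha (level (relB Q) (λ ()) h (- + 3) ho ha hc hd refl) hc hd ⊕ f))
        (λ z vo va vc vd → clash (relB Q) (+ 2) (+ 2) (p! 1) (p! 1) z vo va vc vd refl)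
        (λ h ho ha hc hd → last (values h ho ha (level (relB Q) (λ ()) h (- + 2) ho ha hc hd refl) hc hd))
        where
        last : Values o a b c d (+ 1) (- + 2) (+ 1) (+ 0) → ⊥
        last h = k (+ 2 ⊙ f ⊕ h) (+ 4 ⊙ f ⊕ g ⊕ + 2 ⊙ h) f
      withF : Values o a b c d (+ 1) (+ 1) (+ 0) (- + 1) → ⊥
      withF f = white₀ Gc
        (λ z vo va vb vd → clash (relC Q) (+ 2) (+ 1) (p! 0) (p! 3) z vo va vb vd refl)
        (λ g go ga gb gd → withG f (values g go ga gb (level (relC Q) (λ ()) g (- + 2) go ga gb gd refl) gd))
        (λ z vo va vb vd → clash (relC Q) (+ 1) (+ 2) (p! 1) (p! 2) z vo va vb vd refl)

    -- The common factor of the weights is `β - α` in the families (2,3,5,7) and (3,4,5,7), and `α`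
    -- in the families (1,3,4,5) and (1,2,3,5), which are then excluded.
    classify-quad : ∀ {o a b c d N α β γ δ} → Quad o a b c d N α β γ δ → Pos α → Pos (β - α) → Pos (γ - β) → Pos (δ - γ) →
      (Quad o a b c d (+ 17) (+ 2) (+ 3) (+ 5) (+ 7) → ⊥) → (Quad o a b c d (+ 19) (+ 3) (+ 4) (+ 5) (+ 7) → ⊥) → ⊥
    classify-quad {N = N} {α} {β} {γ} {δ} Q hα@(pos h₁) αβ@(pos h₂) βγ@(pos h₃) γδ k₁ k₂ =
      classify hα αβ βγ γδ (pairings Gd rel) (pairings Gc (relC Q)) (pairings Gb (relB Q))
        (λ k → weight-transfer (Good-swap₁ (Good-swap₂ (Good-swap₁ Gb))) β≢0 (Rel-swap₁ (Rel-swap₂ (Rel-swap₁ (Rel-swap₀ rel)))) k)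
        (λ k → weight-transfer (Good-swap₁ Gb) β≢0 (Rel-swap₁ (Rel-swap₀ rel)) k)
        (λ k → weight-transfer (Good-swap₁ (Good-swap₂ (Good-swap₁ Gc))) γ≢0 (Rel-swap₁ (Rel-swap₂ (Rel-swap₁ (Rel-swap₀ (Rel-swap₁ rel))))) k)
        (λ k → weight-transfer (Good-swap₁ (Good-swap₂ Gc)) γ≢0 (Rel-swap₁ (Rel-swap₂ (Rel-swap₀ (Rel-swap₁ rel)))) k)
        (λ e₁ e₂ e₃ → k₁ (Quad-cancel (β - α) t≢0 Q (alg₁₀ e₁ e₂ e₃ (sum₄ rel)) (alg₁₁ e₁) (alg₁₂ e₁) (alg₁₃ e₁ e₂) (alg₁₄ e₁ e₃)))
        (λ e₁ e₂ e₃ → k₂ (Quad-cancel (β - α) t≢0 Q (alg₂₀ e₁ e₂ e₃ (sum₄ rel)) (alg₂₁ e₁) (alg₂₂ e₁) (alg₂₃ e₁ e₂) (alg₂₄ e₁ e₃)))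
        (λ e₁ e₂ e₃ → weights-1345 (Quad-cancel α α≢0 Q (alg₃₀ e₁ e₂ e₃ (sum₄ rel)) (sym (*-identityʳ α)) (trans e₁ (*-comm (+ 3) α)) (alg₃₃ e₁ e₂) (alg₃₄ e₁ e₃)))
        (λ e₁ e₂ e₃ → weights-1235 (Quad-cancel α α≢0 Q (alg₄₀ e₁ e₂ e₃ (sum₄ rel)) (sym (*-identityʳ α)) (trans e₁ (*-comm (+ 2) α)) (alg₄₃ e₁ e₂) (alg₄₄ e₁ e₃)))
      where
      open Quad Q
      α≢0 : α ≢ + 0
      α≢0 = pos≢0 hα
      β≢0 : β ≢ + 0
      β≢0 = pos≢0 {β} (castP (h₁ ⊞ h₂ ⊞ num 1) (solve (α ∷ β ∷ [])))
      γ≢0 : γ ≢ + 0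
      γ≢0 = pos≢0 {γ} (castP (h₁ ⊞ h₂ ⊞ h₃ ⊞ num 2) (solve (α ∷ β ∷ γ ∷ [])))
      t≢0 : β - α ≢ + 0
      t≢0 = pos≢0 αβ
      alg₁₀ : + 3 * α ≡ + 2 * β → γ ≡ α + β → δ ≡ + 2 * α + β → N ≡ α + β + γ + δ → N ≡ (β - α) * + 17
      alg₁₀ = quads-identity-10 N α β γ δ
      alg₁₁ : + 3 * α ≡ + 2 * β → α ≡ (β - α) * + 2
      alg₁₁ = quads-identity-11 α β
      alg₁₂ : + 3 * α ≡ + 2 * β → β ≡ (β - α) * + 3
      alg₁₂ = quads-identity-12 α β
      alg₁₃ : + 3 * α ≡ + 2 * β → γ ≡ α + β → γ ≡ (β - α) * + 5
      alg₁₃ = quads-identity-13 α β γ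
      alg₁₄ : + 3 * α ≡ + 2 * β → δ ≡ + 2 * α + β → δ ≡ (β - α) * + 7
      alg₁₄ = quads-identity-14 α β δ
      alg₂₃ : + 4 * α ≡ + 3 * β → + 2 * γ ≡ + 2 * α + β → γ ≡ (β - α) * + 5
      alg₂₃ = quads-identity-15 α β γ
      alg₂₀ : + 4 * α ≡ + 3 * β → + 2 * γ ≡ + 2 * α + β → δ ≡ α + β → N ≡ α + β + γ + δ → N ≡ (β - α) * + 19
      alg₂₀ e f g s = fromZ (eqZ s (+ 1) ⊹ eqZ (alg₂₃ e f) (+ 1) ⊹ eqZ g (+ 1) ⊹ eqZ e (+ 4)) (solve (N ∷ α ∷ β ∷ γ ∷ δ ∷ []))
      alg₂₁ : + 4 * α ≡ + 3 * β → α ≡ (β - α) * + 3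
      alg₂₁ = quads-identity-17 α β
      alg₂₂ : + 4 * α ≡ + 3 * β → β ≡ (β - α) * + 4
      alg₂₂ = quads-identity-18 α β
      alg₂₄ : + 4 * α ≡ + 3 * β → δ ≡ α + β → δ ≡ (β - α) * + 7
      alg₂₄ = quads-identity-19 α β δ
      alg₃₀ : β ≡ + 3 * α → γ ≡ α + β → δ ≡ + 2 * α + β → N ≡ α + β + γ + δ → N ≡ α * + 13
      alg₃₀ = quads-identity-20 N α β γ δ
      alg₃₃ : β ≡ + 3 * α → γ ≡ α + β → γ ≡ α * + 4
      alg₃₃ = quads-identity-21 α β γ
      alg₃₄ : β ≡ + 3 * α → δ ≡ + 2 * α + β → δ ≡ α * + 5
      alg₃₄ = quads-identity-22 α β δ
      alg₄₀ : β ≡ + 2 * α → γ ≡ α + β → δ ≡ α + + 2 * β → N ≡ α + β + γ + δ → N ≡ α * + 11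
      alg₄₀ = quads-identity-23 N α β γ δ
      alg₄₃ : β ≡ + 2 * α → γ ≡ α + β → γ ≡ α * + 3
      alg₄₃ = quads-identity-24 α β γ
      alg₄₄ : β ≡ + 2 * α → δ ≡ α + + 2 * β → δ ≡ α * + 5
      alg₄₄ = quads-identity-25 α β δ

  -- Descent towards a point outside the generated lattice

  module Search where

    open Base
    open Arith
    open Tet
    open White
    open Conf
    open Near
    open Weights
    open Quads
    open import Data.Nat using (ℕ; zero; suc)
    open import Data.Integer hiding (suc; pos; ∣_∣)
    open import Data.Integer.Properties
    open import Data.Integer.Divisibility.Signed
    open import Data.Integer.Tactic.RingSolver using (solve)
    open import Data.List using (_∷_; [])
    open import Data.Product using (_×_; _,_; proj₁; proj₂)
    open import Data.Sum using (_⊎_; inj₁; inj₂)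
    open import Data.Empty using (⊥; ⊥-elim)
    open import Relation.Binary.PropositionalEquality using (_≡_; _≢_; refl; sym; trans; cong; subst)
    open Descent

    open Quadruples public

    -- The condition `nd` says that the target `r` is outside the lattice generated by the
    -- tetrahedron; in particular `r` is never one of its vertices, however often vertices are
    -- exchanged.
    record State (n : ℕ) (a b c d x r : Pt) (K χ₀ χ₁ χ₂ χ₃ ρ₀ ρ₁ ρ₂ ρ₃ : ℤ) : Set where
      field
        P : Pair a b c d x K χ₀ χ₁ χ₂ χ₃
        Ar : A r
        R : Rel₄ K r ρ₀ a ρ₁ b ρ₂ c ρ₃ d
        I : In₅ a b c d r x
        nd : K ∣ ρ₀ → K ∣ ρ₁ → K ∣ ρ₂ → K ∣ ρ₃ → ⊥
        bound : NN (+ suc n - sum-ab ρ₀ ρ₁ ρ₂ ρ₃)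

    State-swap₀ : ∀ {n a b c d x r K χ₀ χ₁ χ₂ χ₃ ρ₀ ρ₁ ρ₂ ρ₃} → State n a b c d x r K χ₀ χ₁ χ₂ χ₃ ρ₀ ρ₁ ρ₂ ρ₃ → State n b a c d x r K χ₁ χ₀ χ₂ χ₃ ρ₁ ρ₀ ρ₂ ρ₃
    State-swap₀ {n} {ρ₀ = ρ₀} {ρ₁} {ρ₂} {ρ₃} S = record { P = Pair-swap₀ P ; Ar = Ar ; R = Rel-swap₀ R ; I = In₅-swap₀ I ; nd = λ x y z w → nd y x z w
      ; bound = cast bound (alg (+ suc n) (ab ρ₀) (ab ρ₁) (ab ρ₂) (ab ρ₃)) }
      where
      open State S
      alg : ∀ n x y u v → n - (x + y + u + v) ≡ n - (y + x + u + v)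
      alg = descent-identity-1

    State-swap₁ : ∀ {n a b c d x r K χ₀ χ₁ χ₂ χ₃ ρ₀ ρ₁ ρ₂ ρ₃} → State n a b c d x r K χ₀ χ₁ χ₂ χ₃ ρ₀ ρ₁ ρ₂ ρ₃ → State n a c b d x r K χ₀ χ₂ χ₁ χ₃ ρ₀ ρ₂ ρ₁ ρ₃
    State-swap₁ {n} {ρ₀ = ρ₀} {ρ₁} {ρ₂} {ρ₃} S = record { P = Pair-swap₁ P ; Ar = Ar ; R = Rel-swap₁ R ; I = In₅-swap₁ I ; nd = λ x y z w → nd x z y w
      ; bound = cast bound (alg (+ suc n) (ab ρ₀) (ab ρ₁) (ab ρ₂) (ab ρ₃)) }
      where
      open State S
      alg : ∀ n x y u v → n - (x + y + u + v) ≡ n - (x + u + y + v)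
      alg = descent-identity-2

    State-swap₂ : ∀ {n a b c d x r K χ₀ χ₁ χ₂ χ₃ ρ₀ ρ₁ ρ₂ ρ₃} → State n a b c d x r K χ₀ χ₁ χ₂ χ₃ ρ₀ ρ₁ ρ₂ ρ₃ → State n a b d c x r K χ₀ χ₁ χ₃ χ₂ ρ₀ ρ₁ ρ₃ ρ₂
    State-swap₂ {n} {ρ₀ = ρ₀} {ρ₁} {ρ₂} {ρ₃} S = record { P = Pair-swap₂ P ; Ar = Ar ; R = Rel-swap₂ R ; I = In₅-swap₂ I ; nd = λ x y z w → nd x y w z
      ; bound = cast bound (alg (+ suc n) (ab ρ₀) (ab ρ₁) (ab ρ₂) (ab ρ₃)) }
      where
      open State S
      alg : ∀ n x y u v → n - (x + y + u + v) ≡ n - (x + y + v + u)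
      alg = descent-identity-3

    private
      -- Replacing a by x, whose coordinate at a is −1, brings the tetrahedron closer to r.
      replace-step : ∀ {n a b c d x r K χ₀ χ₁ χ₂ χ₃ ρ₀ ρ₁ ρ₂ ρ₃} → State n a b c d x r K χ₀ χ₁ χ₂ χ₃ ρ₀ ρ₁ ρ₂ ρ₃ → χ₀ ≡ - K →
        (∀ {ρ₀′ ρ₁′ ρ₂′ ρ₃′} → Rel₄ K r ρ₀′ x ρ₁′ b ρ₂′ c ρ₃′ d → (K ∣ ρ₀′ → K ∣ ρ₁′ → K ∣ ρ₂′ → K ∣ ρ₃′ → ⊥) →
          NN (+ n - sum-ab ρ₀′ ρ₁′ ρ₂′ ρ₃′) → ⊥) → ⊥
      replace-step {n} {a} {b} {c} {d} {x} {r} {K} {χ₀} {χ₁} {χ₂} {χ₃} {ρ₀} {ρ₁} {ρ₂} {ρ₃} S χ₀≡-K k =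
        go (State.I S)
        where
        open State S
        open Pair P
        K≢0 : K ≢ + 0
        K≢0 = pos≢0 K>0
        K∣χ₀ : K ∣ χ₀
        K∣χ₀ = divides (- + 1) (trans χ₀≡-K (sym (-1*i≡-i K)))
        -- With `χ₀ = -K`, transfer makes all coordinates of `x` integral. Exchanging `a` for `x`
        -- therefore preserves both the volume and the generated lattice.
        tr : K ∣ χ₁ × K ∣ χ₂ × K ∣ χ₃
        tr = transfer₃ (Good-swap₂ (Good-swap₁ (Good-swap₀ G))) K≢0 (Rel-swap₂ (Rel-swap₁ (Rel-swap₀ X))) K∣χ₀
        σ₁ σ₂ σ₃ : ℤ
        σ₁ = quotient (proj₁ tr)
        σ₂ = quotient (proj₁ (proj₂ tr))
        σ₃ = quotient (proj₂ (proj₂ tr))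
        s₁ : χ₁ ≡ σ₁ * K
        s₁ = _∣_.equality (proj₁ tr)
        s₂ : χ₂ ≡ σ₂ * K
        s₂ = _∣_.equality (proj₁ (proj₂ tr))
        s₃ : χ₃ ≡ σ₃ * K
        s₃ = _∣_.equality (proj₂ (proj₂ tr))
        R′ : Rel₄ K r (- ρ₀) x (ρ₁ + ρ₀ * σ₁) b (ρ₂ + ρ₀ * σ₂) c (ρ₃ + ρ₀ * σ₃) d
        R′ = rel₄ λ z → mul-cancel K K≢0 (alg (ev z a) (ev z b) (ev z c) (ev z d) (ev z x) (ev z r) s₁ s₂ s₃ (at X z) (at R z))
          where
          alg : ∀ A B C D X R {σ₁ σ₂ σ₃} → χ₁ ≡ σ₁ * K → χ₂ ≡ σ₂ * K → χ₃ ≡ σ₃ * K → K * X ≡ χ₀ * A + χ₁ * B + χ₂ * C + χ₃ * D →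
            K * R ≡ ρ₀ * A + ρ₁ * B + ρ₂ * C + ρ₃ * D → K * (K * R) ≡ K * (- ρ₀ * X + (ρ₁ + ρ₀ * σ₁) * B + (ρ₂ + ρ₀ * σ₂) * C + (ρ₃ + ρ₀ * σ₃) * D)
          alg A B C D X R {σ₁} {σ₂} {σ₃} e₁ e₂ e₃ h g = fromZ (eqZ g K ⊹ eqZ h ρ₀ ⊹ eqZ e₁ (ρ₀ * B) ⊹ eqZ e₂ (ρ₀ * C) ⊹ eqZ e₃ (ρ₀ * D) ⊹ eqZ χ₀≡-K (ρ₀ * A))
            (solve (K ∷ A ∷ B ∷ C ∷ D ∷ X ∷ R ∷ σ₁ ∷ σ₂ ∷ σ₃ ∷ χ₀ ∷ χ₁ ∷ χ₂ ∷ χ₃ ∷ ρ₀ ∷ ρ₁ ∷ ρ₂ ∷ ρ₃ ∷ []))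
        nd′ : K ∣ - ρ₀ → K ∣ ρ₁ + ρ₀ * σ₁ → K ∣ ρ₂ + ρ₀ * σ₂ → K ∣ ρ₃ + ρ₀ * σ₃ → ⊥
        nd′ h₀ h₁ h₂ h₃ = nd (∣-to (∣m⇒∣-m h₀) (neg-involutive ρ₀)) (back σ₁ h₁) (back σ₂ h₂) (back σ₃ h₃)
          where
          back : ∀ σ {ρ} → K ∣ ρ + ρ₀ * σ → K ∣ ρ
          back σ {ρ} h = ∣-to (∣-lin (+ 1) σ h h₀) (solve (σ ∷ ρ ∷ ρ₀ ∷ []))
        go : In₅ a b c d r x → ⊥
        go (in₅ {N} {n₀} {n₁} {n₂} {n₃} {l} hN h₀ h₁ h₂ h₃ hl s) =
          k R′ nd′ (final (+ n) (ab ρ₁) (ab ρ₂) (ab ρ₃) (ab (ρ₁ + ρ₀ * σ₁)) (ab (ρ₂ + ρ₀ * σ₂)) (ab (ρ₃ + ρ₀ * σ₃))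
            (ab-pos (pos⇒nn ρ₀<0))
            (trans (sym (ab-neg ρ₀)) (ab-pos (pos⇒nn ρ₀<0)))
            bound (ab-≥ ρ₁) (ab-≥ ρ₂) (ab-≥ ρ₃)
            (est ρ₁ σ₁ h₁ s₁ (proj₁ (proj₂ eqs))) (est ρ₂ σ₂ h₂ s₂ (proj₁ (proj₂ (proj₂ eqs)))) (est ρ₃ σ₃ h₃ s₃ (proj₂ (proj₂ (proj₂ eqs)))))
          where
          eqs : N * χ₀ ≡ l * ρ₀ + K * n₀ × N * χ₁ ≡ l * ρ₁ + K * n₁ × N * χ₂ ≡ l * ρ₂ + K * n₂ × N * χ₃ ≡ l * ρ₃ + K * n₃
          eqs = Rel-uniq (nondeg G) (Rel-mul N X) (In₅-coords {N = N} {n₀} {n₁} {n₂} {n₃} {l} R s)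
          tot : N ≡ n₀ + n₁ + n₂ + n₃ + l
          tot = alg (ev-one a) (ev-one b) (ev-one c) (ev-one d) (ev-one r) (ev-one x) (s one)
            where
            alg : ∀ {A B C D X P} → A ≡ + 1 → B ≡ + 1 → C ≡ + 1 → D ≡ + 1 → X ≡ + 1 → P ≡ + 1 →
              N * P ≡ n₀ * A + n₁ * B + n₂ * C + n₃ * D + l * X → N ≡ n₀ + n₁ + n₂ + n₃ + l
            alg {A} {B} {C} {D} {X} {P} = descent-identity-6 N n₀ n₁ n₂ n₃ l {A} {B} {C} {D} {X} {P}
          -- The coordinate at `a` of `x`, as a point of the hull of the tetrahedron and `r`. It
          -- forces `ρ₀ < 0`: the target lies on the same side of `bcd` as `x`.
          key : l * ρ₀ ≡ - (K * (N + n₀))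
          key = fromZ (eqZ (proj₁ eqs) (- + 1) ⊹ eqZ χ₀≡-K N) (solve (N ∷ K ∷ χ₀ ∷ l ∷ ρ₀ ∷ n₀ ∷ []))
          l*[-ρ₀]>0 : Pos (l * - ρ₀)
          l*[-ρ₀]>0 = castP (↓ (posM K>0 hN) ⊞ pos⇒nn K>0 ⊠ h₀ ⊞ eqNN key (- + 1)) (solve (N ∷ K ∷ l ∷ ρ₀ ∷ n₀ ∷ []))
          ρ₀<0 : Pos (- ρ₀)
          ρ₀<0 = pos-cancel⁺ hl l*[-ρ₀]>0
          l>0 : Pos l
          l>0 = nn≢0 hl (λ z → pos≢0 l*[-ρ₀]>0 (cong (_* - ρ₀) z))
          est : ∀ {n χ} ρ σ → NN n → χ ≡ σ * K → N * χ ≡ l * ρ + K * n → NN (- ρ₀ * n + n₀ * ab ρ - N * ab (ρ + ρ₀ * σ))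
          est {n} {χ} ρ σ hn e f = subst (λ t → NN (- ρ₀ * n + n₀ * ab ρ - t)) (trans (ab-* N (ρ + ρ₀ * σ)) (cong (_* ab (ρ + ρ₀ * σ)) (ab-pos (pos⇒nn hN))))
              (ab-≤ { - ρ₀ * n + n₀ * ab ρ} (N * (ρ + ρ₀ * σ)) (low (ab ρ) (ab-≥⁻ ρ)) (high (ab ρ) (ab-≥ ρ)))
            where
            eq : N * (ρ + ρ₀ * σ) ≡ ρ₀ * n - n₀ * ρ
            eq = mul-cancel K K≢0 (fromZ (eqZ f ρ₀ ⊹ eqZ e (- (N * ρ₀)) ⊹ eqZ key ρ) (solve (N ∷ K ∷ ρ ∷ ρ₀ ∷ σ ∷ n ∷ n₀ ∷ χ ∷ l ∷ [])))
            low : ∀ m → NN (m + ρ) → NN (- ρ₀ * n + n₀ * m - N * (ρ + ρ₀ * σ))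
            low m h = cast (h₀ ⊠ h ⊞ pos⇒nn ρ₀<0 ⊠ hn ⊞ pos⇒nn ρ₀<0 ⊠ hn ⊞ eqNN eq (- + 1)) (solve (N ∷ ρ ∷ ρ₀ ∷ σ ∷ n ∷ n₀ ∷ m ∷ []))
            high : ∀ m → NN (m - ρ) → NN (- ρ₀ * n + n₀ * m + N * (ρ + ρ₀ * σ))
            high m h = cast (h₀ ⊠ h ⊞ eqNN eq (+ 1)) (solve (N ∷ ρ ∷ ρ₀ ∷ σ ∷ n ∷ n₀ ∷ m ∷ []))
          final : ∀ n u v w u′ v′ w′ {t t′} → t ≡ - ρ₀ → t′ ≡ - ρ₀ → NN (+ 1 + n - (t′ + u + v + w)) → NN (u - ρ₁) → NN (v - ρ₂) → NN (w - ρ₃) →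
            NN (- ρ₀ * n₁ + n₀ * u - N * u′) → NN (- ρ₀ * n₂ + n₀ * v - N * v′) → NN (- ρ₀ * n₃ + n₀ * w - N * w′) → NN (n - (t + u′ + v′ + w′))
          final n u v w u′ v′ w′ refl refl b p q r′ e f g =
            two {u + v + w} {u′ + v′ + w′} {n₁ + n₂ + n₃} (cast b (solve (n ∷ ρ₀ ∷ u ∷ v ∷ w ∷ [])))
              (cast (p ⊞ q ⊞ r′ ⊞ eqNN (sum₄ R) (- + 1)) (solve (K ∷ u ∷ v ∷ w ∷ ρ₀ ∷ ρ₁ ∷ ρ₂ ∷ ρ₃ ∷ [])))
              (cast (e ⊞ f ⊞ g) (solve (N ∷ n₀ ∷ n₁ ∷ n₂ ∷ n₃ ∷ ρ₀ ∷ u ∷ v ∷ w ∷ u′ ∷ v′ ∷ w′ ∷ [])))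
              (h₁ ⊞ h₂ ⊞ h₃) (trans tot (solve (n₀ ∷ n₁ ∷ n₂ ∷ n₃ ∷ l ∷ []))) (solve (n ∷ ρ₀ ∷ u′ ∷ v′ ∷ w′ ∷ []))
            where
            two : ∀ {m s σ y} → NN (+ 1 + n + ρ₀ - m) → NN (m - (K - ρ₀)) → NN (- ρ₀ * σ + n₀ * m - N * s) → NN σ → N ≡ n₀ + σ + l →
              n + ρ₀ - s ≡ y → NN y
            two {m} {s} {σ} b p e hσ S eq = cast (pos⁻ (pos-cancel⁺ {N} {+ 1 + n + ρ₀ - s} (pos⇒nn hN)
                (castP (pos⇒nn hN ⊠ b ⊞ e ⊞ (hσ ⊞ hl) ⊠ p ⊞ hσ ⊠ pos⇒nn K>0 ⊞ ↓ (posM l>0 K>0) ⊞ hl ⊠ pos⇒nn ρ₀<0 ⊞ eqNN S m)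
                  (solve (n ∷ m ∷ s ∷ σ ∷ K ∷ N ∷ l ∷ ρ₀ ∷ n₀ ∷ []))))) eq
              where
              pos⁻ : Pos (+ 1 + n + ρ₀ - s) → NN (n + ρ₀ - s)
              pos⁻ = descent-identity-12 n ρ₀ s

    private
      -- With `χ₃ = 0` the vertex `a` lies in the plane of the facet `xbc` of the empty tetrahedron
      -- `xbcd`, which has volume `-χ₀`. Transfer makes `χ₀` divide `K`, impossible when `-χ₀ > K`.
      zero-big : ∀ {a b c d x K χ₀ χ₁ χ₂ χ₃} → Pair a b c d x K χ₀ χ₁ χ₂ χ₃ → Pos (- χ₀ - K) → χ₃ ≡ + 0 → ⊥
      zero-big {K = K} {χ₀} {χ₃ = χ₃} P (pos h) e = ∣-small { - χ₀} {K} K>0 (pos h)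
        (∣-neg (proj₁ (transfer₃ (proj₁ (face⁻ P χ₀<0)) (neg≢0 χ₀<0) (Rel-solve X) (divides (+ 0) (cong -_ e)))))
        where
        open Pair P
        χ₀<0 : Pos (- χ₀)
        χ₀<0 = castP (h ⊞ pos⇒nn K>0) (solve (χ₀ ∷ K ∷ []))

      at-vertex : ∀ {a b c d x K χ₀ χ₁ χ₂ χ₃} → Pair a b c d x K χ₀ χ₁ χ₂ χ₃ → χ₁ ≡ + 0 → χ₂ ≡ + 0 → χ₃ ≡ + 0 → ⊥
      at-vertex {K = K} {χ₀} {χ₁} {χ₂} {χ₃} P e₁ e₂ e₃ = x≢a (vertex₀ K>0 (z e₁) (z e₂) (z e₃) X
          (cast (eqNN (sum₄ X) (- + 1) ⊞ eqNN e₁ (- + 1) ⊞ eqNN e₂ (- + 1) ⊞ eqNN e₃ (- + 1)) (solve (K ∷ χ₀ ∷ χ₁ ∷ χ₂ ∷ χ₃ ∷ []))))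
        where
        open Pair P
        z : ∀ {x} → x ≡ + 0 → NN x
        z refl = num 0

      -- With three negative coordinates, the vertex `o` is the one that becomes interior once `x`
      -- is added; its weights are the volume `K` and the negated coordinates.
      quad : ∀ {o b c d x K χ₀ χ₁ χ₂ χ₃} → Pair o b c d x K χ₀ χ₁ χ₂ χ₃ → Pos (- χ₁) → Pos (- χ₂) → Pos (- χ₃) →
        Quad o x b c d χ₀ K (- χ₁) (- χ₂) (- χ₃)
      quad P h₁ h₂ h₃ = record { rel = Rel-solve X ; Ao = Aa ; Aa = Ax ; Ab = Ab ; Ac = Ac ; Ad = Ad ; Ga = G
        ; Gb = Good-swap₀ (proj₁ (face⁻ (Pair-swap₀ P) h₁))
        ; Gc = Good-swap₀ (proj₁ (face⁻ (Pair-swap₀ (Pair-swap₁ P)) h₂))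
        ; Gd = Good-swap₀ (proj₁ (face⁻ (Pair-swap₀ (Pair-swap₁ (Pair-swap₂ P))) h₃)) }
        where open Pair P

      -- If `β = γ`, then `β` divides `γ` and by transfer also `α`, against `0 < α < β`.
      strict-order : ∀ {o a b c d N α β γ δ} → Quad o a b c d N α β γ δ → Pos α → Pos (β - α) → Pos (β - γ) ⊎ Pos (γ - β)
      strict-order {α = α} {β} {γ} Q (pos hα) (pos h) = go (sgn (β - γ))
        where
        open Quad Q
        go : Pos (β - γ) ⊎ β - γ ≡ + 0 ⊎ Pos (- (β - γ)) → Pos (β - γ) ⊎ Pos (γ - β)
        go (inj₁ k) = inj₁ k
        go (inj₂ (inj₂ (pos k))) = inj₂ (castP k (solve (β ∷ γ ∷ [])))
        go (inj₂ (inj₁ e)) = ⊥-elim (∣-small {β} {+ 1 * α} (castP hα (solve (α ∷ []))) (castP h (solve (α ∷ β ∷ [])))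
          (weight-transfer (Good-swap₁ (Good-swap₂ Gb)) (pos≢0 {β} (castP (hα ⊞ h ⊞ num 1) (solve (α ∷ β ∷ []))))
            (Rel-swap₁ (Rel-swap₂ (Rel-swap₀ rel))) (+ 1)
            (divides (+ 1) (cong (+ 1 *_) (sym (i-j≡0⇒i≡j β γ e))))))

    module _
      (found₁ : ∀ {o a b c d} → Quad o a b c d (+ 17) (+ 2) (+ 3) (+ 5) (+ 7) → ⊥)
      (found₂ : ∀ {o a b c d} → Quad o a b c d (+ 19) (+ 3) (+ 4) (+ 5) (+ 7) → ⊥) where

      private
        sort-quad : ∀ {o a b c d N α β γ δ} → Quad o a b c d N α β γ δ → Pos α → Pos (β - α) → Pos (γ - α) → Pos (δ - α) → ⊥
        sort-quad {β = β} {γ} {δ} Q hα hβ hγ hδ =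
          go (strict-order Q hα hβ) (strict-order (Quad-swap₂ (Quad-swap₁ Q)) hα hγ) (strict-order (Quad-swap₂ Q) hα hβ)
          where
          go : Pos (β - γ) ⊎ Pos (γ - β) → Pos (γ - δ) ⊎ Pos (δ - γ) → Pos (β - δ) ⊎ Pos (δ - β) → ⊥
          go (inj₂ p) (inj₂ q) _        = classify-quad Q hα hβ p q found₁ found₂
          go (inj₂ p) (inj₁ q) (inj₂ t) = classify-quad (Quad-swap₂ Q) hα hβ t q found₁ found₂
          go (inj₂ p) (inj₁ q) (inj₁ t) = classify-quad (Quad-swap₁ (Quad-swap₂ Q)) hα hδ t p found₁ found₂
          go (inj₁ p) (inj₁ q) _        = classify-quad (Quad-swap₁ (Quad-swap₂ (Quad-swap₁ Q))) hα hδ q p found₁ found₂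
          go (inj₁ p) (inj₂ q) (inj₁ t) = classify-quad (Quad-swap₂ (Quad-swap₁ Q)) hα hγ q t found₁ found₂
          go (inj₁ p) (inj₂ q) (inj₂ t) = classify-quad (Quad-swap₁ Q) hα hγ p t found₁ found₂

        Minimal : ℤ → Set
        Minimal K = ∀ {a b c d} → A a → A b → A c → A d → vol a b c d ≢ + 0 → NN (ab (vol a b c d) - K)

        -- A nonzero coordinate is up to sign the volume of `xbcd`, hence at least the minimal
        -- volume `K`.
        size : ∀ {a b c d x K χ₀ χ₁ χ₂ χ₃} → Minimal K → Pair a b c d x K χ₀ χ₁ χ₂ χ₃ → NN (- χ₀) → χ₀ ≡ + 0 ⊎ χ₀ ≡ - K ⊎ Pos (- χ₀ - K)
        size {a} {b} {c} {d} {x} {K} {χ₀} min P h = split? {C = χ₀ ≡ + 0 ⊎ χ₀ ≡ - K ⊎ Pos (- χ₀ - K)} (χ₀ ≟ + 0) inj₁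
          (λ nz → inj₂ (big (subst (λ t → NN (t - K)) (trans (subVol X K>0 vK) (trans (sym (ab-neg χ₀)) (ab-pos h)))
            (min Ax Ab Ac Ad (λ e → mul≢0 nz (nondeg G) (trans (sym (coef₀ X)) (trans (cong (K *_) e) (*-zeroʳ K))))))))
          where
          open Pair P
          big : NN (- χ₀ - K) → χ₀ ≡ - K ⊎ Pos (- χ₀ - K)
          big k = split {C = χ₀ ≡ - K ⊎ Pos (- χ₀ - K)} (posOr (- χ₀ - K)) inj₂
            (λ k′ → inj₁ (antisym (cast k′ (solve (χ₀ ∷ K ∷ []))) (cast k (solve (χ₀ ∷ K ∷ [])))))

        weaken : ∀ {x K} → Pos K → Pos (- x - K) → Pos (- x)
        weaken {x} {K} = descent-identity-14 {x} {K}

        -- Each of three coordinates is 0, `-K` or below `-K`. A `-K` continues the descent; three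
        -- zeros, or a zero beside a value below `-K`, are impossible; three values below `-K` make
        -- the positive vertex interior, with `K` as its smallest weight.
        one-positive : ∀ {n a b c d x r K χ₀ χ₁ χ₂ χ₃ ρ₀ ρ₁ ρ₂ ρ₃} → Minimal K → State n a b c d x r K χ₀ χ₁ χ₂ χ₃ ρ₀ ρ₁ ρ₂ ρ₃ →
          NN (- χ₁) → NN (- χ₂) → NN (- χ₃) →
          (∀ {a b c d x χ₀ χ₁ χ₂ χ₃ ρ₀ ρ₁ ρ₂ ρ₃} → State n a b c d x r K χ₀ χ₁ χ₂ χ₃ ρ₀ ρ₁ ρ₂ ρ₃ → χ₀ ≡ - K → ⊥) → ⊥
        one-positive {K = K} {χ₁ = χ₁} {χ₂} {χ₃} min S h₁ h₂ h₃ k =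
          go (size min (Pair-swap₀ P) h₁) (size min (Pair-swap₀ (Pair-swap₁ P)) h₂) (size min (Pair-swap₀ (Pair-swap₁ (Pair-swap₂ P))) h₃)
          where
          open State S
          K>0 : Pos K
          K>0 = Pair.K>0 P
          Range : ℤ → Set
          Range χ = χ ≡ + 0 ⊎ χ ≡ - K ⊎ Pos (- χ - K)
          go : Range χ₁ → Range χ₂ → Range χ₃ → ⊥
          go (inj₂ (inj₁ e)) _ _ = k (State-swap₀ S) e
          go _ (inj₂ (inj₁ e)) _ = k (State-swap₀ (State-swap₁ S)) e
          go _ _ (inj₂ (inj₁ e)) = k (State-swap₀ (State-swap₁ (State-swap₂ S))) e
          go (inj₁ e₁) (inj₁ e₂) (inj₁ e₃) = at-vertex P e₁ e₂ e₃
          go (inj₂ (inj₂ b₁)) _ (inj₁ e₃) = zero-big (Pair-swap₀ P) b₁ e₃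
          go _ (inj₂ (inj₂ b₂)) (inj₁ e₃) = zero-big (Pair-swap₀ (Pair-swap₁ P)) b₂ e₃
          go (inj₂ (inj₂ b₁)) (inj₁ e₂) _ = zero-big (Pair-swap₀ (Pair-swap₂ P)) b₁ e₂
          go _ (inj₁ e₂) (inj₂ (inj₂ b₃)) = zero-big (Pair-swap₀ (Pair-swap₁ (Pair-swap₂ P))) b₃ e₂
          go (inj₁ e₁) (inj₂ (inj₂ b₂)) _ = zero-big (Pair-swap₂ (Pair-swap₀ (Pair-swap₁ P))) b₂ e₁
          go (inj₂ (inj₂ b₁)) (inj₂ (inj₂ b₂)) (inj₂ (inj₂ b₃)) =
            sort-quad (quad P (weaken K>0 b₁) (weaken K>0 b₂) (weaken K>0 b₃)) K>0 b₁ b₂ b₃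

        from-front : ∀ {n a b c d x r K χ₀ χ₁ χ₂ χ₃ ρ₀ ρ₁ ρ₂ ρ₃} → Minimal K → State n a b c d x r K χ₀ χ₁ χ₂ χ₃ ρ₀ ρ₁ ρ₂ ρ₃ → Pos χ₀ →
          (∀ {a b c d x χ₀ χ₁ χ₂ χ₃ ρ₀ ρ₁ ρ₂ ρ₃} → State n a b c d x r K χ₀ χ₁ χ₂ χ₃ ρ₀ ρ₁ ρ₂ ρ₃ → χ₀ ≡ - K → ⊥) → ⊥
        from-front {χ₁ = χ₁} {χ₂} {χ₃} min S h k = split (posOr χ₁) (two-positive P h) (λ h₁ →
          split (posOr χ₂) (two-positive (Pair-swap₁ P) h) (λ h₂ →
          split (posOr χ₃) (two-positive (Pair-swap₁ (Pair-swap₂ P)) h) (λ h₃ → one-positive min S h₁ h₂ h₃ k)))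
          where open State S

        some-positive : ∀ {n a b c d x r K χ₀ χ₁ χ₂ χ₃ ρ₀ ρ₁ ρ₂ ρ₃} → Minimal K → State n a b c d x r K χ₀ χ₁ χ₂ χ₃ ρ₀ ρ₁ ρ₂ ρ₃ →
          (∀ {a b c d x χ₀ χ₁ χ₂ χ₃ ρ₀ ρ₁ ρ₂ ρ₃} → State n a b c d x r K χ₀ χ₁ χ₂ χ₃ ρ₀ ρ₁ ρ₂ ρ₃ → χ₀ ≡ - K → ⊥) → ⊥
        some-positive {K = K} {χ₀} {χ₁} {χ₂} {χ₃} min S k =
          split (posOr χ₀) (λ h → from-front min S h k) (λ h₀ →
          split (posOr χ₁) (λ h → from-front min (State-swap₀ S) h k) (λ h₁ →
          split (posOr χ₂) (λ h → from-front min (State-swap₀ (State-swap₁ S)) h k) (λ h₂ →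
          split (posOr χ₃) (λ h → from-front min (State-swap₀ (State-swap₁ (State-swap₂ S))) h k) (λ h₃ →
          -- The coordinates add up to `K > 0`, so they cannot all be nonpositive.
          contra (h₀ ⊞ h₁ ⊞ h₂ ⊞ h₃ ⊞ ↓ K>0 ⊞ eqNN (sum₄ X) (- + 1)) (solve (K ∷ χ₀ ∷ χ₁ ∷ χ₂ ∷ χ₃ ∷ []))))))
          where
          open State S
          open Pair P

        -- Every replacement shrinks the coordinates of `r` and keeps the volume at `K`. At size
        -- zero they could no longer add up to `K`.
        search : ∀ n {a b c d K r ρ₀ ρ₁ ρ₂ ρ₃} → Minimal K → Good a b c d → A a → A b → A c → A d → ab (vol a b c d) ≡ K → A r →
          Rel₄ K r ρ₀ a ρ₁ b ρ₂ c ρ₃ d → (K ∣ ρ₀ → K ∣ ρ₁ → K ∣ ρ₂ → K ∣ ρ₃ → ⊥) → NN (+ n - sum-ab ρ₀ ρ₁ ρ₂ ρ₃) → ⊥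
        search zero {K = K} {ρ₀ = ρ₀} {ρ₁} {ρ₂} {ρ₃} min G _ _ _ _ vK _ R nd h =
          absurd (sum-ab ρ₀ ρ₁ ρ₂ ρ₃) (ρ₀ + ρ₁ + ρ₂ + ρ₃) (pairwise (ab ρ₀) (ab ρ₁) (ab ρ₂) (ab ρ₃) (ab-≥ ρ₀) (ab-≥ ρ₁) (ab-≥ ρ₂) (ab-≥ ρ₃)) h (sum₄ R)
          where
          pairwise : ∀ w x y z → NN (w - ρ₀) → NN (x - ρ₁) → NN (y - ρ₂) → NN (z - ρ₃) → NN (w + x + y + z - (ρ₀ + ρ₁ + ρ₂ + ρ₃))
          pairwise = descent-identity-15 ρ₀ ρ₁ ρ₂ ρ₃
          absurd : ∀ m s → NN (m - s) → NN (+ 0 - m) → K ≡ s → ⊥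
          absurd m s p q e = contra (p ⊞ q ⊞ ↓ (subst Pos vK (ab-≢0 (nondeg G))) ⊞ eqNN e (- + 1)) (solve (m ∷ s ∷ K ∷ []))
        search (suc n) {a} {b} {c} {d} {K} {r} {ρ₀} {ρ₁} {ρ₂} {ρ₃} min G Aa Ab Ac Ad vK Ar R nd h =
          nearest (suc n) G Aa Ab Ac Ad vK K>0 Ar R (vtx Rel-v₀ K∣K 0′ 0′ 0′) (vtx Rel-v₁ 0′ K∣K 0′ 0′) (vtx Rel-v₂ 0′ 0′ K∣K 0′) (vtx Rel-v₃ 0′ 0′ 0′ K∣K) h
            (λ Ax X I x≢a x≢b x≢c x≢d iso → some-positive min
              (record { P = record { G = G ; Aa = Aa ; Ab = Ab ; Ac = Ac ; Ad = Ad ; Ax = Ax ; vK = vK ; X = X ; x≢a = x≢a ; x≢b = x≢b ; x≢c = x≢c ; x≢d = x≢d ; iso = iso }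
                      ; Ar = Ar ; R = R ; I = I ; nd = nd ; bound = h })
              (λ S e → replace-step S e (λ R′ nd′ h′ → next S e R′ nd′ h′)))
          where
          K>0 : Pos K
          K>0 = subst Pos vK (ab-≢0 (nondeg G))
          K∣K : K ∣ K
          K∣K = ∣-refl
          0′ : K ∣ + 0
          0′ = divides (+ 0) refl
          vtx : ∀ {v n₀ n₁ n₂ n₃} → Rel₄ K v n₀ a n₁ b n₂ c n₃ d → K ∣ n₀ → K ∣ n₁ → K ∣ n₂ → K ∣ n₃ → r ≢ v
          vtx {v} {n₀} {n₁} {n₂} {n₃} V d₀ d₁ d₂ d₃ e =
            let (e₀ , e₁ , e₂ , e₃) = Rel-uniq (nondeg G) (subst (λ t → Rel₄ K t n₀ a n₁ b n₂ c n₃ d) (sym e) V) R in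
            nd (∣-to d₀ e₀) (∣-to d₁ e₁) (∣-to d₂ e₂) (∣-to d₃ e₃)
          next : ∀ {a b c d x χ₀ χ₁ χ₂ χ₃ ρ₀ ρ₁ ρ₂ ρ₃ ρ₀′ ρ₁′ ρ₂′ ρ₃′} → State n a b c d x r K χ₀ χ₁ χ₂ χ₃ ρ₀ ρ₁ ρ₂ ρ₃ → χ₀ ≡ - K →
            Rel₄ K r ρ₀′ x ρ₁′ b ρ₂′ c ρ₃′ d → (K ∣ ρ₀′ → K ∣ ρ₁′ → K ∣ ρ₂′ → K ∣ ρ₃′ → ⊥) → NN (+ n - sum-ab ρ₀′ ρ₁′ ρ₂′ ρ₃′) → ⊥
          next {χ₀ = χ₀} S e R′ nd′ h′ = search n min (proj₁ (face⁻ Q (subst Pos (sym -χ₀≡K) K>0))) (Pair.Ax Q) (Pair.Ab Q) (Pair.Ac Q) (Pair.Ad Q)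
              (trans (subVol (Pair.X Q) K>0 (Pair.vK Q)) (trans (sym (ab-neg χ₀)) (trans (cong ab -χ₀≡K) (ab-pos (pos⇒nn K>0))))) Ar R′ nd′ h′
            where
            Q = State.P S
            -χ₀≡K : - χ₀ ≡ K
            -χ₀≡K = trans (cong -_ e) (neg-involutive K)

      -- If every lattice point of A had integral coordinates, the tetrahedron would span the lattice.
      no-tetrahedron : (∀ (φ : Fun) (D : ℤ) → (∀ {r} → A r → D ∣ ev φ r) → ∀ p → D ∣ ev φ p) →
        ∀ n {a b c d} → A a → A b → A c → A d → vol a b c d ≢ + 0 → NN (+ n - ab (vol a b c d)) → ⊥
      no-tetrahedron span zero {a} {b} {c} {d} _ _ _ _ v h = absurd (ab (vol a b c d)) (↓ (ab-≢0 v)) h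
        where
        absurd : ∀ v → NN (v - + 1) → NN (+ 0 - v) → ⊥
        absurd = descent-identity-17
      no-tetrahedron span (suc n) {a} {b} {c} {d} Aa Ab Ac Ad v h =
        not-lattice Aa Ab Ac Ad G (λ p → ∣-to (span F₃ D (λ {r} Ar → ∣-to (divisible Ar (coords refl r)) (sym (ev₃ r))) p) (ev₃ p))
        where
        open Slots a b c d
        K : ℤ
        K = ab D
        lower : ∀ {v w} → v ≡ K → Pos (v - w) → NN (+ n - w)
        lower {v} {w} e (pos k) = cast (h ⊞ k ⊞ eqNN e (- + 1)) (alg (+ n) v w K)
          where
          alg : ∀ n v w K → + 1 + n - K + (v - w - + 1) + (- + 1) * (v - K) ≡ n - w
          alg = descent-identity-18
        -- A tetrahedron of smaller volume is already refuted by the recursion, so within this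
        -- refutation `K` is the minimum.
        min : Minimal K
        min {a′} {b′} {c′} {d′} x y z u v′ = split {C = NN (ab (vol a′ b′ c′ d′) - K)} (cmp (ab (vol a′ b′ c′ d′)) K) (λ q → q)
          (λ q → ⊥-elim (no-tetrahedron span n x y z u v′ (lower {K} {ab (vol a′ b′ c′ d′)} refl q)))
        vs₀ : vol b a c d ≢ + 0
        vs₀ e = neg≢ v (trans (sym (vol-swap₀ a b c d)) e)
        vs₁ : vol c a b d ≢ + 0
        vs₁ e = neg≢ (neg≢ v) (trans (sym (trans (vol-swap₀ a c b d) (cong -_ (vol-swap₁ a b c d)))) e)
        -- A further lattice point of the tetrahedron replaces a vertex and gives a smaller
        -- nondegenerate one, which the recursion refutes.
        G : Good a b c d
        G = good E v
          where
          E : Empty a b c d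
          E {y} i@(in₄ {N} {n₀} {n₁} {n₂} {n₃} hN h₀ h₁ h₂ h₃ r) y≢a y≢b y≢c y≢d =
            split? (n₀ ≟ + 0) (λ e₀ → split? (n₁ ≟ + 0) (λ e₁ → split? (n₂ ≟ + 0)
              (λ e₂ → y≢d (vertex₀ hN h₀ h₁ h₂ (Rel-swap₀ (Rel-swap₁ (Rel-swap₂ r)))
                (cast (eqNN (sum₄ r) (- + 1) ⊞ eqNN e₀ (- + 1) ⊞ eqNN e₁ (- + 1) ⊞ eqNN e₂ (- + 1)) (solve (N ∷ n₀ ∷ n₁ ∷ n₂ ∷ n₃ ∷ [])))))
              (λ nz → let (v′ , lt) = descend₀ vs₁ hN h₂ h₀ h₁ h₃ (Rel-swap₀ (Rel-swap₁ r)) y≢c nz in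
                no-tetrahedron span n Ay Aa Ab Ad v′ (lower {w = ab (vol y a b d)} (trans (ab-swap₀ a c b d) (ab-swap₁ a b c d)) lt)))
              (λ nz → let (v′ , lt) = descend₀ vs₀ hN h₁ h₀ h₂ h₃ (Rel-swap₀ r) y≢b nz in
                no-tetrahedron span n Ay Aa Ac Ad v′ (lower {w = ab (vol y a c d)} (ab-swap₀ a b c d) lt)))
              (λ nz → let (v′ , lt) = descend₀ v hN h₀ h₁ h₂ h₃ r y≢a nz in
                no-tetrahedron span n Ay Ab Ac Ad v′ (lower {w = ab (vol y b c d)} refl lt))
            where
            Ay : A y
            Ay = hull Aa Ab Ac Ad i
        divisible : ∀ {r} → A r → Coord K a b c d r → D ∣ vol a b c r
        divisible {r} Ar (coord {ρ₀} {ρ₁} {ρ₂} {ρ₃} R) = split? (K ∣? ρ₃)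
          (λ (divides q e) → divides q (mul-cancel K (pos≢0 (ab-≢0 v)) (trans (coef₃ R) (alg K D {q} e))))
          (λ ∤ → ⊥-elim (search (Data.Integer.∣ sum-ab ρ₀ ρ₁ ρ₂ ρ₃ ∣) min G Aa Ab Ac Ad refl Ar R (λ _ _ _ h → ∤ h)
            (cast (num 0) (sym (trans (cong (_- sum-ab ρ₀ ρ₁ ρ₂ ρ₃) (ab-pos (ab-nn ρ₀ ⊞ ab-nn ρ₁ ⊞ ab-nn ρ₂ ⊞ ab-nn ρ₃))) (+-inverseʳ (sum-ab ρ₀ ρ₁ ρ₂ ρ₃)))))))
          where
          alg : ∀ K D {q ρ₃} → ρ₃ ≡ q * K → ρ₃ * D ≡ K * (q * D)
          alg K D {q} {ρ₃} = descent-identity-19 K D {q} {ρ₃}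

  -- Excluding further lattice points around an interior point

  module Closing where

    open Base
    open Arith
    open Tet
    open White
    open Conf
    open Near
    open Weights
    open Quads
    open import Data.Integer hiding (suc; pos; ∣_∣)
    open import Data.Integer.Properties
    open import Data.Integer.Divisibility.Signed
    open import Data.Integer.Tactic.RingSolver using (solve)
    open import Data.List using (_∷_; [])
    open import Data.Product using (proj₁; proj₂)
    open import Data.Sum using (_⊎_; inj₁; inj₂)
    open import Data.Empty using (⊥; ⊥-elim)
    open import Relation.Nullary using (¬_)
    open import Relation.Nullary.Decidable using (from-no)
    open import Relation.Binary.PropositionalEquality using (_≡_; _≢_; refl; sym; trans; cong; subst)
    open Finish

    open Search public

    Double : (o v y : Pt) → Set
    Double o v y = ∀ z → ev z y ≡ + 2 * ev z v - ev z o

    private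
      -- Here `y` lies on the line `op`. Transfer in `opqr` gives `K ∣ χ₀` and transfer in `ypqr`
      -- gives `χ₀ ∣ K`, so `χ₀ = -K` and `χ₁ = 2K`.
      doubled : ∀ {o p q r y K χ₀ χ₁ χ₂ χ₃} → Pair o p q r y K χ₀ χ₁ χ₂ χ₃ → Pos (- χ₀) → χ₂ ≡ + 0 → χ₃ ≡ + 0 → Double o p y
      doubled {o} {p} {q} {r} {y} {K} {χ₀} {χ₁} {χ₂} {χ₃} P neg e₂ e₃ z =
        mul-cancel K (pos≢0 K>0) (alg (ev z o) (ev z p) (ev z q) (ev z r) (ev z y) (at X z))
        where
        open Pair P
        χ₀≡-K : χ₀ ≡ - K
        χ₀≡-K = antisym
          (cast (∣-≥ { - χ₀} {K} K>0 (∣-neg (proj₁ (transfer₃ (proj₁ (face⁻ P neg)) (neg≢0 neg) (Rel-solve X) (divides (+ 0) (cong -_ e₃)))))) (solve (χ₀ ∷ K ∷ [])))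
          (cast (∣-≥ {K} { - χ₀} neg (∣m⇒∣-m (proj₁ (transfer₃ G (pos≢0 K>0) X (divides (+ 0) e₃))))) (solve (χ₀ ∷ K ∷ [])))
        χ₁≡2K : χ₁ ≡ + 2 * K
        χ₁≡2K = fromZ (eqZ (sum₄ X) (- + 1) ⊹ eqZ χ₀≡-K (- + 1) ⊹ eqZ e₂ (- + 1) ⊹ eqZ e₃ (- + 1)) (solve (K ∷ χ₀ ∷ χ₁ ∷ χ₂ ∷ χ₃ ∷ []))
        alg : ∀ O P Q R Y → K * Y ≡ χ₀ * O + χ₁ * P + χ₂ * Q + χ₃ * R → K * Y ≡ K * (+ 2 * P - O)
        alg O P Q R Y e = fromZ (eqZ e (+ 1) ⊹ eqZ χ₀≡-K O ⊹ eqZ χ₁≡2K P ⊹ eqZ e₂ Q ⊹ eqZ e₃ R) (solve (K ∷ χ₀ ∷ χ₁ ∷ χ₂ ∷ χ₃ ∷ O ∷ P ∷ Q ∷ R ∷ Y ∷ []))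

    -- The nearest isolated point `y` of the hull stays in the cone over `pqr`. Being outside the
    -- empty tetrahedron, it has a negative coordinate at `o`, and at most one other coordinate is
    -- positive. So it lies on a ray from `o` through a vertex and is that vertex doubled.
    cone : ∀ {o p q r x M κ k₁ k₂ k₃} → Good o p q r → A o → A p → A q → A r → A x → Pos M → Rel₄ M x κ o k₁ p k₂ q k₃ r →
      NN k₁ → NN k₂ → NN k₃ → x ≢ o → x ≢ p → x ≢ q → x ≢ r →
      (∀ {y} → A y → In₅ o p q r x y → Double o p y ⊎ Double o q y ⊎ Double o r y → ⊥) → ⊥
    cone {o} {p} {q} {r} {x} {M} {κ} {k₁} {k₂} {k₃} G Ao Ap Aq Ar Ax hM T h₁ h₂ h₃ x≢o x≢p x≢q x≢r k = start (coords refl x)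
      where
      K : ℤ
      K = ab (vol o p q r)
      hK : Pos K
      hK = ab-≢0 (nondeg G)
      start : Coord K o p q r x → ⊥
      start (coord {ρ₀} {ρ₁} {ρ₂} {ρ₃} R) = nearest (Data.Integer.∣ sum-ab ρ₀ ρ₁ ρ₂ ρ₃ ∣) G Ao Ap Aq Ar refl hK Ax R x≢o x≢p x≢q x≢r
          (cast (num 0) (sym (trans (cong (_- sum-ab ρ₀ ρ₁ ρ₂ ρ₃) (ab-pos (ab-nn ρ₀ ⊞ ab-nn ρ₁ ⊞ ab-nn ρ₂ ⊞ ab-nn ρ₃))) (+-inverseʳ (sum-ab ρ₀ ρ₁ ρ₂ ρ₃)))))
          (λ {y} {χ₀} {χ₁} {χ₂} {χ₃} Ay Y I y≢o y≢p y≢q y≢r iso → near Ay I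
            (record { G = G ; Aa = Ao ; Ab = Ap ; Ac = Aq ; Ad = Ar ; Ax = Ay ; vK = refl ; X = Y ; x≢a = y≢o ; x≢b = y≢p ; x≢c = y≢q ; x≢d = y≢r ; iso = iso }))
        where
        eqs = Rel-uniq (nondeg G) (Rel-mul K T) (subst (λ t → Rel₄ t x _ o _ p _ q _ r) (*-comm M K) (Rel-mul M R))
        nonneg : ∀ {k ρ} → NN k → K * k ≡ M * ρ → NN ρ
        nonneg {k} {ρ} h e = pos-cancel hM (cast (pos⇒nn hK ⊠ h) e)
        ρ₁≥0 = nonneg h₁ (proj₁ (proj₂ eqs))
        ρ₂≥0 = nonneg h₂ (proj₁ (proj₂ (proj₂ eqs)))
        ρ₃≥0 = nonneg h₃ (proj₂ (proj₂ (proj₂ eqs)))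
        near : ∀ {y χ₀ χ₁ χ₂ χ₃} → A y → In₅ o p q r x y → Pair o p q r y K χ₀ χ₁ χ₂ χ₃ → ⊥
        near {y} {χ₀} {χ₁} {χ₂} {χ₃} Ay I@(in₅ {N} {n₀} {n₁} {n₂} {n₃} {l} hN m₀ m₁ m₂ m₃ hl s) P =
          split (nn? χ₀) (λ χ₀≥0 → outside P (in₄ hK χ₀≥0 χ₁≥0 χ₂≥0 χ₃≥0 X))
          (λ neg → split? (χ₁ ≟ + 0)
            (λ e₁ → split? (χ₂ ≟ + 0)
              (λ e₂ → k Ay I (inj₂ (inj₂ (doubled (Pair-swap₁ (Pair-swap₂ P)) neg e₁ e₂))))
              (λ n₂ → k Ay I (inj₂ (inj₁ (doubled (Pair-swap₁ P) neg e₁ (vanish χ₃≥0 (λ p₃ → two-positive (Pair-swap₁ (Pair-swap₂ (Pair-swap₀ (Pair-swap₁ P)))) (nn≢0 χ₂≥0 n₂) p₃)))))))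
            (λ n₁ → k Ay I (inj₁ (doubled P neg
              (vanish χ₂≥0 (two-positive (Pair-swap₁ (Pair-swap₀ P)) (nn≢0 χ₁≥0 n₁)))
              (vanish χ₃≥0 (two-positive (Pair-swap₁ (Pair-swap₂ (Pair-swap₀ P))) (nn≢0 χ₁≥0 n₁)))))))
          where
          open Pair P using (X)
          eq = Rel-uniq (nondeg G) (Rel-mul N X) (In₅-coords {N = N} {n₀} {n₁} {n₂} {n₃} {l} R s)
          up : ∀ {χ ρ n} → NN ρ → NN n → N * χ ≡ l * ρ + K * n → NN χ
          up hρ hn e = pos-cancel hN (cast (hl ⊠ hρ ⊞ pos⇒nn hK ⊠ hn) (sym e))
          χ₁≥0 = up ρ₁≥0 m₁ (proj₁ (proj₂ eq))
          χ₂≥0 = up ρ₂≥0 m₂ (proj₁ (proj₂ (proj₂ eq)))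
          χ₃≥0 = up ρ₃≥0 m₃ (proj₂ (proj₂ (proj₂ eq)))
          vanish : ∀ {χ} → NN χ → (Pos χ → ⊥) → χ ≡ + 0
          vanish {χ} h k = split? {C = χ ≡ + 0} (χ ≟ + 0) (λ e → e) (λ nz → ⊥-elim (k (nn≢0 h nz)))

    -- A further lattice point `y` of `xpqr` lies in the cone over `pqr`, so the hull of `opqr` and
    -- `y` contains a doubled vertex. Every doubled vertex has height `-V` over `pqr`, where `o` has
    -- height `V`, while `y` is strictly above `-V` unless it is `x`.
    doubled-good : ∀ {o p q r x} → Good o p q r → A o → A p → A q → A r → A x → Double o p x → Good x p q r
    doubled-good {o} {p} {q} {r} {x} G Ao Ap Aq Ar Ax dbl = good E nd
      where
      X : ∀ {K} → Rel₄ K x (- K) o (+ 2 * K) p (+ 0) q (+ 0) r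
      X {K} = rel₄ λ z → alg (ev z o) (ev z p) (ev z q) (ev z r) (dbl z)
        where
        alg : ∀ O P Q R {X} → X ≡ + 2 * P - O → K * X ≡ - K * O + + 2 * K * P + + 0 * Q + + 0 * R
        alg O P Q R {X} = finish-identity-3 K O P Q R {X}
      nd : vol x p q r ≢ + 0
      nd e = nondeg G (mul-cancel (- + 1) (λ ()) (trans (sym (coef₀ (X {+ 1}))) (trans (cong (+ 1 *_) e) refl)))
      E : Empty x p q r
      E {y} i@(in₄ {N} {n₀} {n₁} {n₂} {n₃} hN h₀ h₁ h₂ h₃ r′) y≢x y≢p y≢q y≢r =
        cone G Ao Ap Aq Ar (hull Ax Ap Aq Ar i) hN Y (num 2 ⊠ h₀ ⊞ h₁) h₂ h₃ y≢o y≢p y≢q y≢r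
          (λ {w} _ I D → split D (far F₀b I) (λ D → split D (far F₀c I) (far F₀d I)))
        where
        Y : Rel₄ N y (- n₀) o (+ 2 * n₀ + n₁) p n₂ q n₃ r
        Y = rel₄ λ z → alg (ev z o) (ev z p) (ev z q) (ev z r) (ev z y) (dbl z) (at r′ z)
          where
          alg : ∀ O P Q R Y {X} → X ≡ + 2 * P - O → N * Y ≡ n₀ * X + n₁ * P + n₂ * Q + n₃ * R → N * Y ≡ - n₀ * O + (+ 2 * n₀ + n₁) * P + n₂ * Q + n₃ * R
          alg O P Q R Y {X} = finish-identity-4 N n₀ n₁ n₂ n₃ O P Q R Y {X}
        y≢o : y ≢ o
        y≢o e = alg (proj₁ (Rel-uniq (nondeg G) (subst (λ t → Rel₄ N t _ o _ p _ q _ r) e Y) (Rel-v₀ {N})))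
          where
          alg : - n₀ ≡ N → ⊥
          alg e = contra (↓ hN ⊞ h₀ ⊞ eqNN e (+ 1)) (solve (N ∷ n₀ ∷ []))
        open Slots o p q r using (F₀; F₀a; F₀b; F₀c; F₀d) renaming (D to V)
        far : ∀ {v w} → ev F₀ v ≡ + 0 → In₅ o p q r y w → Double o v w → ⊥
        far {v} {w} Fv (in₅ {M} {m₀} {m₁} {m₂} {m₃} {l} hM k₀ k₁ k₂ k₃ hl s) D =
          absurd (mul-cancel V (nondeg G) (eqn (ev F₀ y) (ev F₀ w) (ev F₀ v) F₀a F₀b F₀c F₀d Fv (D F₀) (s F₀) (at Y F₀)))
          where
          eqn : ∀ Fy Fw Fv {Fo Fp Fq Fr} → Fo ≡ V → Fp ≡ + 0 → Fq ≡ + 0 → Fr ≡ + 0 → Fv ≡ + 0 → Fw ≡ + 2 * Fv - Fo →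
            M * Fw ≡ m₀ * Fo + m₁ * Fp + m₂ * Fq + m₃ * Fr + l * Fy → N * Fy ≡ - n₀ * Fo + (+ 2 * n₀ + n₁) * Fp + n₂ * Fq + n₃ * Fr →
            V * (l * n₀) ≡ V * (M * N + N * m₀)
          eqn Fy Fw Fv {Fo} refl refl refl refl refl refl e f = alg Fo e f
            where
            alg : ∀ V → M * (+ 2 * + 0 - V) ≡ m₀ * V + m₁ * + 0 + m₂ * + 0 + m₃ * + 0 + l * Fy → N * Fy ≡ - n₀ * V + (+ 2 * n₀ + n₁) * + 0 + n₂ * + 0 + n₃ * + 0 →
              V * (l * n₀) ≡ V * (M * N + N * m₀)
            alg = finish-identity-6 Fy M N l m₀ m₁ m₂ m₃ n₀ n₁ n₂ n₃
          tot : M ≡ m₀ + m₁ + m₂ + m₃ + l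
          tot = alg (ev-one o) (ev-one p) (ev-one q) (ev-one r) (ev-one y) (ev-one w) (s one)
            where
            alg : ∀ {A B C D X P} → A ≡ + 1 → B ≡ + 1 → C ≡ + 1 → D ≡ + 1 → X ≡ + 1 → P ≡ + 1 →
              M * P ≡ m₀ * A + m₁ * B + m₂ * C + m₃ * D + l * X → M ≡ m₀ + m₁ + m₂ + m₃ + l
            alg {A} {B} {C} {D} {X} {P} = finish-identity-7 M m₀ m₁ m₂ m₃ l {A} {B} {C} {D} {X} {P}
          M-l≥0 : NN (M - l)
          M-l≥0 = cast (k₀ ⊞ k₁ ⊞ k₂ ⊞ k₃ ⊞ eqNN tot (+ 1)) (solve (M ∷ m₀ ∷ m₁ ∷ m₂ ∷ m₃ ∷ l ∷ []))
          absurd : l * n₀ ≡ M * N + N * m₀ → ⊥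
          absurd e = split (nn? (n₀ - N)) (λ h → y≢x (vertex₀ hN h₁ h₂ h₃ r′ h))
            (λ h → contra (↓ (posM hM h) ⊞ M-l≥0 ⊠ h₀ ⊞ pos⇒nn hN ⊠ k₀ ⊞ eqNN e (+ 1)) (solve (M ∷ N ∷ l ∷ m₀ ∷ n₀ ∷ [])))

    -- The tetrahedron `ypqr` with `y = 2p - o` is empty. Each of its splittings determines the
    -- value 1 or -1 at `o`, and the dependence turns this into a divisibility by the weight `σ` of
    -- the remaining vertex.
    no-double : ∀ {o p q r s N π κ λ′ σ} → Rel₄ N o π p κ q λ′ r σ s → Good o p q r → A o → A p → A q → A r →
      ¬ (σ ∣ N - π) → ¬ (σ ∣ N + κ) → ¬ (σ ∣ N + λ′) → ∀ {y} → A y → Double o p y → ⊥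
    no-double {o} {p} {q} {r} {s} {N} {π} {κ} {λ′} {σ} R G Ao Ap Aq Ar d₁ d₂ d₃ {y} Ay D = white (doubled-good G Ao Ap Aq Ar Ay D)
      (λ (splits z vy vp vq vr) → d₁ (divides (ev z s) (alg₁ (ev z s) vy vp vq vr (D z) (at R z))))
      (λ (splits z vy vq vp vr) → d₂ (divides (- ev z s) (alg₂ (ev z s) vy vp vq vr (D z) (at R z))))
      (λ (splits z vy vr vp vq) → d₃ (divides (- ev z s) (alg₃ (ev z s) vy vp vq vr (D z) (at R z))))
      where
      alg₁ : ∀ t {Y P Q R O} → Y ≡ + 1 → P ≡ + 1 → Q ≡ + 0 → R ≡ + 0 → Y ≡ + 2 * P - O → N * O ≡ π * P + κ * Q + λ′ * R + σ * t → N - π ≡ t * σ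
      alg₁ t {Y} {P} {Q} {R} {O} = finish-identity-10 N π κ λ′ σ t {Y} {P} {Q} {R} {O}
      alg₂ : ∀ t {Y P Q R O} → Y ≡ + 1 → P ≡ + 0 → Q ≡ + 1 → R ≡ + 0 → Y ≡ + 2 * P - O → N * O ≡ π * P + κ * Q + λ′ * R + σ * t → N + κ ≡ - t * σ
      alg₂ t {Y} {P} {Q} {R} {O} = finish-identity-11 N π κ λ′ σ t {Y} {P} {Q} {R} {O}
      alg₃ : ∀ t {Y P Q R O} → Y ≡ + 1 → P ≡ + 0 → Q ≡ + 0 → R ≡ + 1 → Y ≡ + 2 * P - O → N * O ≡ π * P + κ * Q + λ′ * R + σ * t → N + λ′ ≡ - t * σ
      alg₃ t {Y} {P} {Q} {R} {O} = finish-identity-12 N π κ λ′ σ t {Y} {P} {Q} {R} {O}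

    record Rigid (o a b c d : Pt) (N α β γ δ : ℤ) : Set where
      field
        Q : Quad o a b c d N α β γ δ
        hα : Pos α
        hβ : Pos β
        hγ : Pos γ
        hδ : Pos δ
        da : ∀ {y} → A y → Double o a y → ⊥
        db : ∀ {y} → A y → Double o b y → ⊥
        dc : ∀ {y} → A y → Double o c y → ⊥
        dd : ∀ {y} → A y → Double o d y → ⊥

    private
      Rigid-swap₀ : ∀ {o a b c d N α β γ δ} → Rigid o a b c d N α β γ δ → Rigid o b a c d N β α γ δ
      Rigid-swap₀ S = record { Q = record { rel = Rel-swap₀ rel ; Ao = Ao ; Aa = Ab ; Ab = Aa ; Ac = Ac ; Ad = Ad ; Ga = Gb ; Gb = Ga ; Gc = Good-swap₁ Gc ; Gd = Good-swap₁ Gd }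
        ; hα = hβ ; hβ = hα ; hγ = hγ ; hδ = hδ ; da = db ; db = da ; dc = dc ; dd = dd }
        where
        open Rigid S
        open Quad Q

      Rigid-swap₁ : ∀ {o a b c d N α β γ δ} → Rigid o a b c d N α β γ δ → Rigid o a c b d N α γ β δ
      Rigid-swap₁ S = record { Q = Quad-swap₁ Q ; hα = hα ; hβ = hγ ; hγ = hβ ; hδ = hδ ; da = da ; db = dc ; dc = db ; dd = dd }
        where open Rigid S

      -- Compare the ratios `c₁/α`, `c₂/β`, `c₃/γ` and the ratio 0 at `d`: the smallest belongs to
      -- the vertex opposite the wanted facet. Here `a` has the smallest of the first three; if it
      -- is nonnegative, the facet is `abc`, and otherwise eliminating `a` by the dependence of `o`
      -- gives the facet `bcd`.
      lowest : ∀ {o a b c d N α β γ δ x K κ c₁ c₂ c₃} → Rigid o a b c d N α β γ δ → A x → Pos K → Rel₄ K x κ o c₁ a c₂ b c₃ c →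
        NN (c₂ * α - c₁ * β) → NN (c₃ * α - c₁ * γ) → x ≢ o → x ≢ a → x ≢ b → x ≢ c → x ≢ d → ⊥
      lowest {o} {a} {b} {c} {d} {N} {α} {β} {γ} {δ} {x} {K} {κ} {c₁} {c₂} {c₃} S Ax hK X l₂ l₃ x≢o x≢a x≢b x≢c x≢d = split (nn? c₁)
        (λ h → cone Gd Ao Aa Ab Ac Ax hK X h
          (pos-cancel hα (cast (l₂ ⊞ h ⊠ pos⇒nn hβ) (solve (α ∷ β ∷ c₁ ∷ c₂ ∷ []))))
          (pos-cancel hα (cast (l₃ ⊞ h ⊠ pos⇒nn hγ) (solve (α ∷ γ ∷ c₁ ∷ c₃ ∷ [])))) x≢o x≢a x≢b x≢c
          (λ Ay _ D → split D (da Ay) (λ D → split D (db Ay) (dc Ay))))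
        (λ h → cone Ga Ao Ab Ac Ad Ax (posM hα hK) X′ l₂ l₃ (pos⇒nn h ⊠ pos⇒nn hδ) x≢o x≢b x≢c x≢d
          (λ Ay _ D → split D (db Ay) (λ D → split D (dc Ay) (dd Ay))))
        where
        open Rigid S
        open Quad Q
        X′ : Rel₄ (α * K) x (α * κ + c₁ * N) o (c₂ * α - c₁ * β) b (c₃ * α - c₁ * γ) c (- c₁ * δ) d
        X′ = rel₄ λ z → alg (ev z o) (ev z a) (ev z b) (ev z c) (ev z d) (ev z x) (at X z) (at rel z)
          where
          alg : ∀ O A B C D X → K * X ≡ κ * O + c₁ * A + c₂ * B + c₃ * C → N * O ≡ α * A + β * B + γ * C + δ * D →
            α * K * X ≡ (α * κ + c₁ * N) * O + (c₂ * α - c₁ * β) * B + (c₃ * α - c₁ * γ) * C + - c₁ * δ * D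
          alg = finish-identity-13 α β γ δ K N κ c₁ c₂ c₃

    -- Every other point lies in the cone over one of the four facets.
    only-five : ∀ {o a b c d N α β γ δ x} → Rigid o a b c d N α β γ δ → A x → x ≢ o → x ≢ a → x ≢ b → x ≢ c → x ≢ d → ⊥
    only-five {o} {a} {b} {c} {d} {N} {α} {β} {γ} {δ} {x} S Ax x≢o x≢a x≢b x≢c x≢d = start (coords refl x)
      where
      open Rigid S
      open Quad Q
      start : Coord (ab (vol o a b c)) o a b c x → ⊥
      start (coord {κ} {c₁} {c₂} {c₃} X) = split (nn? (c₂ * α - c₁ * β))
        (λ p → split (nn? (c₃ * α - c₁ * γ)) (λ q → lowest S Ax hK X p q x≢o x≢a x≢b x≢c x≢d)
          (λ (pos q) → third (cast (q ⊞ num 1) (solve (c₁ ∷ c₃ ∷ α ∷ γ ∷ [])))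
            (pos-cancel hα (cast (p ⊠ pos⇒nn hγ ⊞ (q ⊞ num 1) ⊠ pos⇒nn hβ) (solve (c₁ ∷ c₂ ∷ c₃ ∷ α ∷ β ∷ γ ∷ []))))))
        (λ (pos p) → split (nn? (c₃ * β - c₂ * γ))
          (λ q → lowest (Rigid-swap₀ S) Ax hK (Rel-swap₁ X) (cast (p ⊞ num 1) (solve (c₁ ∷ c₂ ∷ α ∷ β ∷ []))) q x≢o x≢b x≢a x≢c x≢d)
          (λ (pos q) → third (pos-cancel hβ (cast ((p ⊞ num 1) ⊠ pos⇒nn hγ ⊞ (q ⊞ num 1) ⊠ pos⇒nn hα) (solve (c₁ ∷ c₂ ∷ c₃ ∷ α ∷ β ∷ γ ∷ []))))
            (cast (q ⊞ num 1) (solve (c₂ ∷ c₃ ∷ β ∷ γ ∷ [])))))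
        where
        hK : Pos (ab (vol o a b c))
        hK = ab-≢0 (nondeg Gd)
        third : NN (c₁ * γ - c₃ * α) → NN (c₂ * γ - c₃ * β) → ⊥
        third p q = lowest (Rigid-swap₀ (Rigid-swap₁ S)) Ax hK (Rel-swap₁ (Rel-swap₂ X)) p q x≢o x≢c x≢a x≢b x≢d

    -- The modulus has to avoid three numbers. The weight 7 serves for `a` and `c`; `17 - 3` is
    -- divisible by 7 and `17 - 7` by 2 and 5, so `b` is treated with 5 and `d` with 3.
    rigid-2357 : ∀ {o a b c d} → Quad o a b c d (+ 17) (+ 2) (+ 3) (+ 5) (+ 7) → Rigid o a b c d (+ 17) (+ 2) (+ 3) (+ 5) (+ 7)
    rigid-2357 Q = record { Q = Q ; hα = pos (num 1) ; hβ = pos (num 2) ; hγ = pos (num 4) ; hδ = pos (num 6)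
      ; da = no-double rel Gd Ao Aa Ab Ac (from-no (+ 7 ∣? + 15)) (from-no (+ 7 ∣? + 20)) (from-no (+ 7 ∣? + 22))
      ; db = no-double (Rel-swap₂ (Rel-swap₀ rel)) (Good-swap₁ Gc) Ao Ab Aa Ad (from-no (+ 5 ∣? + 14)) (from-no (+ 5 ∣? + 19)) (from-no (+ 5 ∣? + 24))
      ; dc = no-double (Rel-swap₀ (Rel-swap₁ rel)) (Good-swap₁ (Good-swap₂ Gd)) Ao Ac Aa Ab (from-no (+ 7 ∣? + 12)) (from-no (+ 7 ∣? + 19)) (from-no (+ 7 ∣? + 20))
      ; dd = no-double (Rel-swap₂ (Rel-swap₀ (Rel-swap₁ (Rel-swap₂ rel)))) (Good-swap₁ (Good-swap₂ Gb)) Ao Ad Aa Ac (from-no (+ 3 ∣? + 10)) (from-no (+ 3 ∣? + 19)) (from-no (+ 3 ∣? + 22)) }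
      where open Quad Q

    -- The weight 7 serves for `a` and `b`; `19 - 5` is divisible by 7 and `19 - 7` by 3 and 4, so
    -- `c` is treated with 4 and `d` with 5.
    rigid-3457 : ∀ {o a b c d} → Quad o a b c d (+ 19) (+ 3) (+ 4) (+ 5) (+ 7) → Rigid o a b c d (+ 19) (+ 3) (+ 4) (+ 5) (+ 7)
    rigid-3457 Q = record { Q = Q ; hα = pos (num 2) ; hβ = pos (num 3) ; hγ = pos (num 4) ; hδ = pos (num 6)
      ; da = no-double rel Gd Ao Aa Ab Ac (from-no (+ 7 ∣? + 16)) (from-no (+ 7 ∣? + 23)) (from-no (+ 7 ∣? + 24))
      ; db = no-double (Rel-swap₀ rel) (Good-swap₁ Gd) Ao Ab Aa Ac (from-no (+ 7 ∣? + 15)) (from-no (+ 7 ∣? + 22)) (from-no (+ 7 ∣? + 24))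
      ; dc = no-double (Rel-swap₂ (Rel-swap₀ (Rel-swap₁ rel))) (Good-swap₁ Gb) Ao Ac Aa Ad (from-no (+ 4 ∣? + 14)) (from-no (+ 4 ∣? + 22)) (from-no (+ 4 ∣? + 26))
      ; dd = no-double (Rel-swap₀ (Rel-swap₁ (Rel-swap₂ rel))) (Good-swap₁ (Good-swap₂ Gc)) Ao Ad Aa Ab (from-no (+ 5 ∣? + 12)) (from-no (+ 5 ∣? + 22)) (from-no (+ 5 ∣? + 23)) }
      where open Quad Q

-- Rational convex combinations with cleared denominators

module Hull where

  open Base
  open Arith
  open Tet
  open import Data.Nat as ℕ using (ℕ; suc; z≤n)
  import Data.Nat.Properties as ℕP
  open import Data.Integer hiding (suc; pos; ∣_∣)
  open import Data.Integer.Properties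
  open import Data.Integer.Divisibility.Signed using (_∣_; divides; ∣m∣n⇒∣m+n; ∣n⇒∣m*n)
  open import Data.Integer.Tactic.RingSolver using (solve; solve-∀)
  open import Data.Rational as ℚ using (ℚ; 0ℚ; 1ℚ; mkℚ; ↥_; ↧_; toℚᵘ)
  import Data.Rational.Properties as ℚP
  import Data.Rational.Solver as ℚS
  open import Data.Rational.Unnormalised as ℚᵘ using (ℚᵘ; mkℚᵘ; *≡*; *≤*)
  import Data.Rational.Unnormalised.Properties as ℚᵘP
  open import Data.List using (List; _∷_; []; map)
  open import Data.List.Properties using (∷-injective)
  open import Data.List.Relation.Unary.All using (All; []; _∷_)
  import Data.List.Relation.Unary.All as All
  open import Data.List.Relation.Unary.Any using (here; there)
  open import Data.List.Membership.Propositional using (_∈_)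
  open import Data.Product using (Σ; _×_; _,_; proj₁; proj₂)
  open import Function using (_∘_)
  open import Relation.Binary.PropositionalEquality using (_≡_; refl; sym; trans; cong; cong₂; subst; module ≡-Reasoning)

  private
    toQᵘ : ∀ n → toℚᵘ (toQ n) ℚᵘ.≃ mkℚᵘ n 0
    toQᵘ n = ℚP.toℚᵘ-fromℚᵘ (mkℚᵘ n 0)

  toQ-+ : ∀ m n → toQ (m + n) ≡ toQ m ℚ.+ toQ n
  toQ-+ m n = ℚP.toℚᵘ-injective (ℚᵘP.≃-trans (toQᵘ (m + n)) (ℚᵘP.≃-sym (ℚᵘP.≃-trans (ℚP.toℚᵘ-homo-+ (toQ m) (toQ n))
    (ℚᵘP.≃-trans (ℚᵘP.+-cong (toQᵘ m) (toQᵘ n)) (*≡* (alg m n))))))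
    where
    alg : ∀ m n → (m * + 1 + n * + 1) * + 1 ≡ (m + n) * + 1
    alg = solve-∀

  toQ-* : ∀ m n → toQ (m * n) ≡ toQ m ℚ.* toQ n
  toQ-* m n = ℚP.toℚᵘ-injective (ℚᵘP.≃-trans (toQᵘ (m * n)) (ℚᵘP.≃-sym (ℚᵘP.≃-trans (ℚP.toℚᵘ-homo-* (toQ m) (toQ n))
    (ℚᵘP.≃-trans (ℚᵘP.*-cong (toQᵘ m) (toQᵘ n)) (*≡* refl)))))

  toQ-injective : ∀ {m n} → toQ m ≡ toQ n → m ≡ n
  toQ-injective {m} {n} e = trans (sym (*-identityʳ m)) (trans (ℚᵘP.drop-*≡* (ℚᵘP.≃-trans (ℚᵘP.≃-sym (toQᵘ m))
    (ℚᵘP.≃-trans (ℚᵘP.≃-reflexive (cong toℚᵘ e)) (toQᵘ n)))) (*-identityʳ n))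

  toQ-↧ : ∀ c → toQ (↧ c) ℚ.* c ≡ toQ (↥ c)
  toQ-↧ c@(mkℚ n d _) = ℚP.toℚᵘ-injective (ℚᵘP.≃-trans (ℚP.toℚᵘ-homo-* (toQ (↧ c)) c)
    (ℚᵘP.≃-trans (ℚᵘP.*-cong (toQᵘ (↧ c)) (ℚᵘP.≃-refl {toℚᵘ c})) (ℚᵘP.≃-trans (*≡* {mkℚᵘ (+ suc d) 0 ℚᵘ.* mkℚᵘ n d} {mkℚᵘ n 0} alg) (ℚᵘP.≃-sym (toQᵘ (↥ c))))))
    where
    alg : + suc d * n * + 1 ≡ n * + suc (d ℕ.+ 0)
    alg = trans (*-identityʳ (+ suc d * n)) (trans (*-comm (+ suc d) n) (cong (λ t → n * + suc t) (sym (ℕP.+-identityʳ d))))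

  inv : ∀ n → ℚ
  inv n = + 1 ℚ./ suc n

  toQ-inv : ∀ n → toQ (+ suc n) ℚ.* inv n ≡ 1ℚ
  toQ-inv n = ℚP.toℚᵘ-injective (ℚᵘP.≃-trans (ℚP.toℚᵘ-homo-* (toQ (+ suc n)) (inv n))
    (ℚᵘP.≃-trans (ℚᵘP.*-cong (toQᵘ (+ suc n)) (ℚP.toℚᵘ-fromℚᵘ (mkℚᵘ (+ 1) n))) (*≡* {mkℚᵘ (+ suc n) 0 ℚᵘ.* mkℚᵘ (+ 1) n} {mkℚᵘ (+ 1) 0} alg)))
    where
    alg : + suc n * + 1 * + 1 ≡ + 1 * + suc (n ℕ.+ 0)
    alg = trans (*-identityʳ (+ suc n * + 1)) (trans (*-comm (+ suc n) (+ 1)) (cong (λ t → + 1 * + suc t) (sym (ℕP.+-identityʳ n))))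

  toQ-nonNeg : ∀ {n} → NN n → ℚ.NonNegative (toQ n)
  toQ-nonNeg {+ n} _ = ℚ.nonNegative (ℚP.toℚᵘ-cancel-≤ (ℚᵘP.≤-respʳ-≃ (ℚᵘP.≃-sym (toQᵘ (+ n))) (*≤* (subst (+ 0 ≤_) (sym (*-identityʳ (+ n))) (+≤+ z≤n)))))
  toQ-nonNeg { -[1+ n ]} (nn ())

  inv-nonNeg : ∀ n → ℚ.NonNegative (inv n)
  inv-nonNeg n = ℚ.nonNegative (ℚP.toℚᵘ-cancel-≤ (ℚᵘP.≤-respʳ-≃ (ℚᵘP.≃-sym (ℚP.toℚᵘ-fromℚᵘ (mkℚᵘ (+ 1) n))) (*≤* (+≤+ z≤n))))

  numerator-nn : ∀ c → 0ℚ ℚ.≤ c → NN (↥ c)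
  numerator-nn c (ℚ.*≤* p) = cast (nn p) (trans (*-identityʳ (↥ c)) refl)

  private
    module S = ℚS.+-*-Solver

    rearrange : ∀ d n c x w → d ℚ.* n ℚ.* (c ℚ.* x ℚ.+ w) ≡ d ℚ.* c ℚ.* n ℚ.* x ℚ.+ d ℚ.* (n ℚ.* w)
    rearrange = S.solve 5 (λ d n c x w → d S.:* n S.:* (c S.:* x S.:+ w) S.:= d S.:* c S.:* n S.:* x S.:+ d S.:* (n S.:* w)) refl

    regroup : ∀ c i x w → c ℚ.* i ℚ.* x ℚ.+ w ℚ.* i ≡ (c ℚ.* x ℚ.+ w) ℚ.* i
    regroup = S.solve 4 (λ c i x w → c S.:* i S.:* x S.:+ w S.:* i S.:= (c S.:* x S.:+ w) S.:* i) refl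

    exchange : ∀ n x i → n ℚ.* x ℚ.* i ≡ n ℚ.* i ℚ.* x
    exchange = S.solve 3 (λ n x i → n S.:* x S.:* i S.:= n S.:* i S.:* x) refl

  wsQ : (Pt → ℤ) → List (ℚ × Pt) → ℚ
  wsQ f [] = 0ℚ
  wsQ f ((c , v) ∷ cs) = c ℚ.* toQ (f v) ℚ.+ wsQ f cs

  wsZ : (Pt → ℤ) → List (ℤ × Pt) → ℤ
  wsZ f [] = + 0
  wsZ f ((c , v) ∷ cs) = c * f v + wsZ f cs

  scale : ℤ → List (ℤ × Pt) → List (ℤ × Pt)
  scale k = map (λ (c , v) → k * c , v)

  wsZ-scale : ∀ f k cs → wsZ f (scale k cs) ≡ k * wsZ f cs
  wsZ-scale f k [] = sym (*-zeroʳ k)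
  wsZ-scale f k ((c , v) ∷ cs) = trans (cong (λ t → k * c * f v + t) (wsZ-scale f k cs)) (alg k c (f v) (wsZ f cs))
    where
    alg : ∀ k c x y → k * c * x + k * y ≡ k * (c * x + y)
    alg = solve-∀

  scale-pts : ∀ k cs → map proj₂ (scale k cs) ≡ map proj₂ cs
  scale-pts k [] = refl
  scale-pts k ((c , v) ∷ cs) = cong (v ∷_) (scale-pts k cs)

  scale-nn : ∀ {k cs} → NN k → All (NN ∘ proj₁) cs → All (NN ∘ proj₁) (scale k cs)
  scale-nn h [] = []
  scale-nn h (p ∷ ps) = (h ⊠ p) ∷ scale-nn h ps

  linQ-ws : ∀ cs → linQ cs ≡ (wsQ proj₁ cs , wsQ (proj₁ ∘ proj₂) cs , wsQ (proj₂ ∘ proj₂) cs)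
  linQ-ws [] = refl
  linQ-ws ((c , (x , y , z)) ∷ cs) rewrite linQ-ws cs = refl

  sumQ-ws : ∀ cs → sumQ (map proj₁ cs) ≡ wsQ (λ _ → + 1) cs
  sumQ-ws [] = refl
  sumQ-ws ((c , v) ∷ cs) = cong₂ ℚ._+_ (sym (ℚP.*-identityʳ c)) (sumQ-ws cs)

  -- InConv with the denominators cleared; N·p = Σ cᵢvᵢ and N = Σ cᵢ are expressed by evaluating all affine functionals.
  record Hull (V : List Pt) (p : Pt) : Set where
    constructor hullOf
    field
      cs : List (ℤ × Pt)
      pts : map proj₂ cs ≡ V
      coef≥0 : All (NN ∘ proj₁) cs
      {N} : ℤ
      N>0 : Pos N
      comb : ∀ z → N * ev z p ≡ wsZ (ev z) cs

  private
    record Cleared (cs : List (ℚ × Pt)) : Set where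
      constructor cleared
      field
        N : ℤ
        N>0 : Pos N
        ns : List (ℤ × Pt)
        pts : map proj₂ ns ≡ map proj₂ cs
        coef≥0 : All (NN ∘ proj₁) ns
        eq : ∀ f → toQ N ℚ.* wsQ f cs ≡ toQ (wsZ f ns)

    -- Each new coefficient multiplies the common denominator by its own. The resulting equation
    -- holds for every weight function at once, so the same numerators serve the three coordinates
    -- and the coefficient sum.
    clear : ∀ cs → All (λ cv → 0ℚ ℚ.≤ proj₁ cv) cs → Cleared cs
    clear [] [] = cleared (+ 1) (pos (num 0)) [] refl [] (λ f → refl)
    clear ((c , v) ∷ cs) (p ∷ ps) with clear cs ps
    ... | cleared N hN ns e h q = cleared (↧ c * N) (posM ↧>0 hN) ((↥ c * N , v) ∷ scale (↧ c) ns) (cong (v ∷_) (trans (scale-pts (↧ c) ns) e))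
        ((numerator-nn c p ⊠ pos⇒nn hN) ∷ scale-nn (pos⇒nn ↧>0) h) eq
      where
      ↧>0 : Pos (↧ c)
      ↧>0 = pos (num _)
      eq : ∀ f → toQ (↧ c * N) ℚ.* (c ℚ.* toQ (f v) ℚ.+ wsQ f cs) ≡ toQ (↥ c * N * f v + wsZ f (scale (↧ c) ns))
      eq f = begin
        toQ (↧ c * N) ℚ.* (c ℚ.* toQ (f v) ℚ.+ wsQ f cs) ≡⟨ cong (ℚ._* _) (toQ-* (↧ c) N) ⟩
        toQ (↧ c) ℚ.* toQ N ℚ.* (c ℚ.* toQ (f v) ℚ.+ wsQ f cs)
          ≡⟨ rearrange (toQ (↧ c)) (toQ N) c (toQ (f v)) (wsQ f cs) ⟩
        (toQ (↧ c) ℚ.* c) ℚ.* toQ N ℚ.* toQ (f v) ℚ.+ toQ (↧ c) ℚ.* (toQ N ℚ.* wsQ f cs)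
          ≡⟨ cong₂ (λ s t → s ℚ.* toQ N ℚ.* toQ (f v) ℚ.+ toQ (↧ c) ℚ.* t) (toQ-↧ c) (q f) ⟩
        toQ (↥ c) ℚ.* toQ N ℚ.* toQ (f v) ℚ.+ toQ (↧ c) ℚ.* toQ (wsZ f ns)
          ≡⟨ cong₂ ℚ._+_ (trans (cong (ℚ._* toQ (f v)) (sym (toQ-* (↥ c) N))) (sym (toQ-* (↥ c * N) (f v)))) (trans (sym (toQ-* (↧ c) (wsZ f ns))) (cong toQ (sym (wsZ-scale f (↧ c) ns)))) ⟩
        toQ (↥ c * N * f v) ℚ.+ toQ (wsZ f (scale (↧ c) ns)) ≡⟨ sym (toQ-+ (↥ c * N * f v) (wsZ f (scale (↧ c) ns))) ⟩
        toQ (↥ c * N * f v + wsZ f (scale (↧ c) ns)) ∎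
        where open ≡-Reasoning

  ws-ev : ∀ n m k t cs → wsZ (ev ((n , m , k) , t)) cs ≡
    n * wsZ proj₁ cs + m * wsZ (proj₁ ∘ proj₂) cs + k * wsZ (proj₂ ∘ proj₂) cs + t * wsZ (λ _ → + 1) cs
  ws-ev n m k t [] = zero-form n m k t
    where
    zero-form : ∀ n m k t → + 0 ≡ n * + 0 + m * + 0 + k * + 0 + t * + 0
    zero-form = solve-∀
  ws-ev n m k t ((c , (x , y , z)) ∷ cs) =
      trans {j = c * (n * x + m * y + k * z + t) + (n * X + m * Y + k * Z + t * W)}
        (cong₂ (λ u v → c * u + v) (ev-def n m k t x y z) (ws-ev n m k t cs))
        (trans {j = (c * (n * x) + n * X) + (c * (m * y) + m * Y) + (c * (k * z) + k * Z) + (c * t + t * W)}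
          (alg c (n * x) (m * y) (k * z) t (n * X) (m * Y) (k * Z) (t * W))
          (cong₂ _+_ (cong₂ _+_ (cong₂ _+_ (term n x X) (term m y Y)) (term k z Z)) (const t W)))
    where
    X = wsZ proj₁ cs
    Y = wsZ (proj₁ ∘ proj₂) cs
    Z = wsZ (proj₂ ∘ proj₂) cs
    W = wsZ (λ _ → + 1) cs
    distr : ∀ c u U t T → c * (u + t) + (U + T) ≡ (c * u + U) + (c * t + T)
    distr = solve-∀
    term : ∀ n x X → c * (n * x) + n * X ≡ n * (c * x + X)
    term n x X = commute c n x X
      where
      commute : ∀ c n x X → c * (n * x) + n * X ≡ n * (c * x + X)
      commute = solve-∀
    const : ∀ t W → c * t + t * W ≡ t * (c * + 1 + W)
    const t W = commute c t W
      where
      commute : ∀ c t W → c * t + t * W ≡ t * (c * + 1 + W)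
      commute = solve-∀
    alg : ∀ c p q r t P Q R T → c * (p + q + r + t) + (P + Q + R + T) ≡ (c * p + P) + (c * q + Q) + (c * r + R) + (c * t + T)
    alg c p q r t P Q R T = trans (distr c (p + q + r) (P + Q + R) t T) (cong (_+ (c * t + T))
      (trans (distr c (p + q) (P + Q) r R) (cong (_+ (c * r + R)) (distr c p P q Q))))

  fromInConv : ∀ {V p} → InConv V p → Hull V p
  fromInConv {V} {p@(x , y , z)} (cs , pts , h , s , l) with clear cs h
  ... | cleared N hN ns e hn q = hullOf ns (trans e pts) hn hN (λ { ((n , m , k) , t) → sym (trans (ws-ev n m k t ns)
      (trans (cong₂ _+_ (cong₂ _+_ (cong₂ _+_ (cong (n *_) (sym Nx)) (cong (m *_) (sym Ny))) (cong (k *_) (sym Nz))) (cong (t *_) (sym No)))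
        (trans (alg n m k t N x y z) (cong (N *_) (sym (ev-def n m k t x y z)))))) })
    where
    alg : ∀ n m k t N x y z → n * (N * x) + m * (N * y) + k * (N * z) + t * N ≡ N * (n * x + m * y + k * z + t)
    alg = solve-∀
    coordinates : (wsQ proj₁ cs , wsQ (proj₁ ∘ proj₂) cs , wsQ (proj₂ ∘ proj₂) cs) ≡ (toQ x , toQ y , toQ z)
    coordinates = trans (sym (linQ-ws cs)) l
    val : ∀ f {w} → wsQ f cs ≡ toQ w → N * w ≡ wsZ f ns
    val f {w} e = toQ-injective (trans (toQ-* N w) (trans (cong (toQ N ℚ.*_) (sym e)) (q f)))
    Nx : N * x ≡ wsZ proj₁ ns
    Nx = val proj₁ (cong proj₁ coordinates)
    Ny : N * y ≡ wsZ (proj₁ ∘ proj₂) ns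
    Ny = val (proj₁ ∘ proj₂) (cong (proj₁ ∘ proj₂) coordinates)
    Nz : N * z ≡ wsZ (proj₂ ∘ proj₂) ns
    Nz = val (proj₂ ∘ proj₂) (cong (proj₂ ∘ proj₂) coordinates)
    No : N ≡ wsZ (λ _ → + 1) ns
    No = trans (sym (*-identityʳ N)) (val (λ _ → + 1) (trans (sym (sumQ-ws cs)) s))

  private
    rationals : ℚ → List (ℤ × Pt) → List (ℚ × Pt)
    rationals i = map (λ (c , v) → toQ c ℚ.* i , v)

    rationals-pts : ∀ i cs → map proj₂ (rationals i cs) ≡ map proj₂ cs
    rationals-pts i [] = refl
    rationals-pts i ((c , v) ∷ cs) = cong (v ∷_) (rationals-pts i cs)

    rationals-nn : ∀ {i cs} → ℚ.NonNegative i → All (NN ∘ proj₁) cs → All (λ cv → 0ℚ ℚ.≤ proj₁ cv) (rationals i cs)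
    rationals-nn h [] = []
    rationals-nn {i} {(c , v) ∷ cs} h (p ∷ ps) =
      ℚP.nonNegative⁻¹ (toQ c ℚ.* i) {{ℚP.nonNeg*nonNeg⇒nonNeg (toQ c) {{toQ-nonNeg p}} i {{h}}}} ∷ rationals-nn h ps

    rationals-ws : ∀ f i cs → wsQ f (rationals i cs) ≡ toQ (wsZ f cs) ℚ.* i
    rationals-ws f i [] = sym (ℚP.*-zeroˡ i)
    rationals-ws f i ((c , v) ∷ cs) = begin
      toQ c ℚ.* i ℚ.* toQ (f v) ℚ.+ wsQ f (rationals i cs) ≡⟨ cong (λ t → toQ c ℚ.* i ℚ.* toQ (f v) ℚ.+ t) (rationals-ws f i cs) ⟩
      toQ c ℚ.* i ℚ.* toQ (f v) ℚ.+ toQ (wsZ f cs) ℚ.* i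
        ≡⟨ regroup (toQ c) i (toQ (f v)) (toQ (wsZ f cs)) ⟩
      (toQ c ℚ.* toQ (f v) ℚ.+ toQ (wsZ f cs)) ℚ.* i
        ≡⟨ cong (ℚ._* i) (trans (cong (ℚ._+ toQ (wsZ f cs)) (sym (toQ-* c (f v)))) (sym (toQ-+ (c * f v) (wsZ f cs)))) ⟩
      toQ (c * f v + wsZ f cs) ℚ.* i ∎
      where open ≡-Reasoning

  toInConv : ∀ {V p} → Hull V p → InConv V p
  toInConv {V} {p@(x , y , z)} (hullOf cs pts h {+ suc n} hN comb) =
    rationals i cs , trans (rationals-pts i cs) pts , rationals-nn (inv-nonNeg n) h ,
    trans (sumQ-ws (rationals i cs)) (trans (rationals-ws (λ _ → + 1) i cs)
      (trans (cong (λ t → toQ t ℚ.* i) (val one (λ _ → + 1) ev-one)) (trans (cong (λ t → toQ t ℚ.* i) (*-identityʳ N)) (toQ-inv n)))) ,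
    trans (linQ-ws (rationals i cs)) (cong₂ _,_ (coordinate coordX proj₁ ev-X) (cong₂ _,_ (coordinate coordY (proj₁ ∘ proj₂) ev-Y) (coordinate coordZ (proj₂ ∘ proj₂) ev-Z)))
    where
    N : ℤ
    N = + suc n
    i : ℚ
    i = inv n
    ws-cong : ∀ {f g : Pt → ℤ} → (∀ p → f p ≡ g p) → ∀ cs → wsZ f cs ≡ wsZ g cs
    ws-cong e [] = refl
    ws-cong e ((c , v) ∷ cs) = cong₂ (λ s t → c * s + t) (e v) (ws-cong e cs)
    val : ∀ φ f → (∀ p → ev φ p ≡ f p) → wsZ f cs ≡ N * f p
    val φ f e = trans (sym (ws-cong e cs)) (trans (sym (comb φ)) (cong (N *_) (e p)))
    coordinate : ∀ φ f → (∀ p → ev φ p ≡ f p) → wsQ f (rationals i cs) ≡ toQ (f p)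
    coordinate φ f e = begin
      wsQ f (rationals i cs) ≡⟨ rationals-ws f i cs ⟩
      toQ (wsZ f cs) ℚ.* i ≡⟨ cong (λ t → toQ t ℚ.* i) (val φ f e) ⟩
      toQ (N * f p) ℚ.* i ≡⟨ cong (ℚ._* i) (toQ-* N (f p)) ⟩
      toQ N ℚ.* toQ (f p) ℚ.* i ≡⟨ exchange (toQ N) (toQ (f p)) i ⟩
      toQ N ℚ.* i ℚ.* toQ (f p) ≡⟨ cong (ℚ._* toQ (f p)) (toQ-inv n) ⟩
      1ℚ ℚ.* toQ (f p) ≡⟨ ℚP.*-identityˡ (toQ (f p)) ⟩
      toQ (f p) ∎
      where open ≡-Reasoning
  toInConv (hullOf cs pts h {+ 0} (pos (nn ())) comb)
  toInConv (hullOf cs pts h { -[1+ n ]} (pos (nn ())) comb)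

  private
    -- Nonnegative combinations before normalisation, recorded by their values on all functionals;
    -- in this form they can be added and scaled without a common denominator.
    Cone : List Pt → (Fun → ℤ) → Set
    Cone V φ = Σ (List (ℤ × Pt)) λ cs → map proj₂ cs ≡ V × All (NN ∘ proj₁) cs × (∀ z → φ z ≡ wsZ (ev z) cs)

    cone-scale : ∀ {V φ} k → NN k → Cone V φ → Cone V (λ z → k * φ z)
    cone-scale k hk (cs , p , h , e) = scale k cs , trans (scale-pts k cs) p , scale-nn hk h ,
      λ z → trans (cong (k *_) (e z)) (sym (wsZ-scale (ev z) k cs))

    cone-add : ∀ {V φ ψ} → Cone V φ → Cone V ψ → Cone V (λ z → φ z + ψ z)
    cone-add {V} {φ} {ψ} (cs , p , h , e) (ds , q , k , f) = go cs ds (trans p (sym q)) h k p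
        (λ us → λ (a , b , g) → us , a , b , λ z → trans (cong₂ _+_ (e z) (f z)) (sym (g z)))
      where
      go : ∀ cs ds → map proj₂ cs ≡ map proj₂ ds → All (NN ∘ proj₁) cs → All (NN ∘ proj₁) ds → ∀ {V} → map proj₂ cs ≡ V → ∀ {R : Set} →
        (∀ us → map proj₂ us ≡ V × All (NN ∘ proj₁) us × (∀ z → wsZ (ev z) us ≡ wsZ (ev z) cs + wsZ (ev z) ds) → R) → R
      go [] [] _ [] [] refl k = k [] (refl , [] , λ z → refl)
      go ((c , v) ∷ cs) ((d , w) ∷ ds) e (hc ∷ hs) (hd ∷ ks) refl k with (v≡w , es) ← ∷-injective e =
        go cs ds es hs ks refl λ us (a , b , g) → k ((c + d , v) ∷ us) (cong (v ∷_) a , (hc ⊞ hd) ∷ b ,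
          λ z → trans (cong (λ t → (c + d) * ev z v + t) (g z))
            (trans (alg c d (ev z v) (wsZ (ev z) cs) (wsZ (ev z) ds)) (cong (λ t → c * ev z v + wsZ (ev z) cs + (d * ev z t + wsZ (ev z) ds)) v≡w)))
        where
        alg : ∀ c d x s t → (c + d) * x + (s + t) ≡ c * x + s + (d * x + t)
        alg = solve-∀

    cone-cong : ∀ {V φ ψ} → (∀ z → φ z ≡ ψ z) → Cone V φ → Cone V ψ
    cone-cong h (cs , p , q , e) = cs , p , q , λ z → trans (sym (h z)) (e z)

    toCone : ∀ {V p} (H : Hull V p) → Cone V (λ z → Hull.N H * ev z p)
    toCone (hullOf cs pts h hN comb) = cs , pts , h , comb

  -- The five memberships have different denominators. Scaling each by the product of the other four
  -- brings them over the common denominator `P`.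
  Hull-hull₅ : ∀ {V a b c d x p} → Hull V a → Hull V b → Hull V c → Hull V d → Hull V x → In₅ a b c d x p → Hull V p
  Hull-hull₅ {V} {a} {b} {c} {d} {x} {p} Ha Hb Hc Hd Hx (in₅ {M} {m₀} {m₁} {m₂} {m₃} {l} hM h₀ h₁ h₂ h₃ hl r) =
    let (cs , pts , h , e) = total in hullOf cs pts h (posM hM (posM pa (posM pb (posM pc (posM pd px))))) e
    where
    open Hull Ha using () renaming (N to A; N>0 to pa)
    open Hull Hb using () renaming (N to B; N>0 to pb)
    open Hull Hc using () renaming (N to C; N>0 to pc)
    open Hull Hd using () renaming (N to D; N>0 to pd)
    open Hull Hx using () renaming (N to X; N>0 to px)
    a≥0 = pos⇒nn pa
    b≥0 = pos⇒nn pb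
    c≥0 = pos⇒nn pc
    d≥0 = pos⇒nn pd
    x≥0 = pos⇒nn px
    P : ℤ
    P = A * (B * (C * (D * X)))
    term : ∀ m W A e → A * W ≡ P → m * W * (A * e) ≡ P * (m * e)
    term m W A e h = trans (assoc m W A e) (cong (_* (m * e)) h)
      where
      assoc : ∀ m W A e → m * W * (A * e) ≡ A * W * (m * e)
      assoc = solve-∀
    perm₁ : ∀ A B R → B * (A * R) ≡ A * (B * R)
    perm₁ = solve-∀
    perm₂ : ∀ A B C R → C * (A * (B * R)) ≡ A * (B * (C * R))
    perm₂ = solve-∀
    perm₃ : ∀ A B C D X → D * (A * (B * (C * X))) ≡ A * (B * (C * (D * X)))
    perm₃ = solve-∀
    perm₄ : ∀ A B C D X → X * (A * (B * (C * D))) ≡ A * (B * (C * (D * X)))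
    perm₄ = solve-∀
    distrib : ∀ P t₀ t₁ t₂ t₃ t₄ → P * t₀ + P * t₁ + P * t₂ + P * t₃ + P * t₄ ≡ P * (t₀ + t₁ + t₂ + t₃ + t₄)
    distrib = solve-∀
    swap : ∀ P M e → P * (M * e) ≡ M * P * e
    swap = solve-∀
    assemble : ∀ ea eb ec ed ex ep → M * ep ≡ m₀ * ea + m₁ * eb + m₂ * ec + m₃ * ed + l * ex →
      m₀ * (B * (C * (D * X))) * (A * ea) + m₁ * (A * (C * (D * X))) * (B * eb) + m₂ * (A * (B * (D * X))) * (C * ec) +
        m₃ * (A * (B * (C * X))) * (D * ed) + l * (A * (B * (C * D))) * (X * ex) ≡ M * P * ep
    assemble ea eb ec ed ex ep e = trans (cong₂ _+_ (cong₂ _+_ (cong₂ _+_ (cong₂ _+_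
        (term m₀ (B * (C * (D * X))) A ea refl)
        (term m₁ (A * (C * (D * X))) B eb (perm₁ A B (C * (D * X)))))
        (term m₂ (A * (B * (D * X))) C ec (perm₂ A B C (D * X))))
        (term m₃ (A * (B * (C * X))) D ed (perm₃ A B C D X)))
        (term l (A * (B * (C * D))) X ex (perm₄ A B C D X)))
      (trans (distrib P (m₀ * ea) (m₁ * eb) (m₂ * ec) (m₃ * ed) (l * ex)) (trans (cong (P *_) (sym e)) (swap P M ep)))
    total : Cone V (λ z → M * P * ev z p)
    total = cone-cong (λ z → assemble (ev z a) (ev z b) (ev z c) (ev z d) (ev z x) (ev z p) (r z))
      (cone-add (cone-add (cone-add (cone-add
        (cone-scale (m₀ * (B * (C * (D * X)))) (h₀ ⊠ (b≥0 ⊠ (c≥0 ⊠ (d≥0 ⊠ x≥0)))) (toCone Ha))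
        (cone-scale (m₁ * (A * (C * (D * X)))) (h₁ ⊠ (a≥0 ⊠ (c≥0 ⊠ (d≥0 ⊠ x≥0)))) (toCone Hb)))
        (cone-scale (m₂ * (A * (B * (D * X)))) (h₂ ⊠ (a≥0 ⊠ (b≥0 ⊠ (d≥0 ⊠ x≥0)))) (toCone Hc)))
        (cone-scale (m₃ * (A * (B * (C * X)))) (h₃ ⊠ (a≥0 ⊠ (b≥0 ⊠ (c≥0 ⊠ x≥0)))) (toCone Hd)))
        (cone-scale (l * (A * (B * (C * D)))) (hl ⊠ (a≥0 ⊠ (b≥0 ⊠ (c≥0 ⊠ d≥0)))) (toCone Hx)))

  Hull-∈ : ∀ {V v} → v ∈ V → Hull V v
  Hull-∈ {V} {v} i = hullOf (point i) (point-pts i) (point-nn i) {+ 1} (pos (num 0)) (λ z → trans (*-identityˡ (ev z v)) (sym (point-ws z i)))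
    where
    zeros : List Pt → List (ℤ × Pt)
    zeros = map (λ v → + 0 , v)
    zeros-pts : ∀ V → map proj₂ (zeros V) ≡ V
    zeros-pts [] = refl
    zeros-pts (v ∷ V) = cong (v ∷_) (zeros-pts V)
    zeros-nn : ∀ V → All (NN ∘ proj₁) (zeros V)
    zeros-nn [] = []
    zeros-nn (v ∷ V) = num 0 ∷ zeros-nn V
    zeros-ws : ∀ z V → wsZ (ev z) (zeros V) ≡ + 0
    zeros-ws z [] = refl
    zeros-ws z (v ∷ V) = trans (cong₂ _+_ (*-zeroˡ (ev z v)) (zeros-ws z V)) refl
    point : ∀ {V v} → v ∈ V → List (ℤ × Pt)
    point {w ∷ V} (here e) = (+ 1 , w) ∷ zeros V
    point {w ∷ V} (there i) = (+ 0 , w) ∷ point i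
    point-pts : ∀ {V v} (i : v ∈ V) → map proj₂ (point i) ≡ V
    point-pts {w ∷ V} (here e) = cong (w ∷_) (zeros-pts V)
    point-pts {w ∷ V} (there i) = cong (w ∷_) (point-pts i)
    point-nn : ∀ {V v} (i : v ∈ V) → All (NN ∘ proj₁) (point i)
    point-nn {w ∷ V} (here e) = num 1 ∷ zeros-nn V
    point-nn (there i) = num 0 ∷ point-nn i
    point-ws : ∀ z {V v} (i : v ∈ V) → wsZ (ev z) (point i) ≡ ev z v
    point-ws z {w ∷ V} (here refl) = trans (cong₂ _+_ (*-identityˡ (ev z w)) (zeros-ws z V)) (+-identityʳ (ev z w))
    point-ws z {w ∷ V} (there i) = trans (cong₂ _+_ (*-zeroˡ (ev z w)) (point-ws z i)) (+-identityˡ _)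

  Hull-≤ : ∀ {V p} → Hull V p → ∀ φ k → (∀ {v} → v ∈ V → NN (k - ev φ v)) → NN (k - ev φ p)
  Hull-≤ {V} {p} (hullOf cs refl h {N} hN comb) φ k le = pos-cancel hN (cast (sums cs h le) (trans (cong₂ (λ s t → k * s - t) No (sym (comb φ))) (factor N k (ev φ p))))
    where
    nil : ∀ k → + 0 ≡ k * + 0 - + 0
    nil = solve-∀
    snoc : ∀ c k x s t → c * (k - x) + (k * s - t) ≡ k * (c * + 1 + s) - (c * x + t)
    snoc = solve-∀
    factor : ∀ N k x → k * N - N * x ≡ N * (k - x)
    factor = solve-∀
    sums : ∀ cs → All (NN ∘ proj₁) cs → (∀ {v} → v ∈ map proj₂ cs → NN (k - ev φ v)) → NN (k * wsZ (λ _ → + 1) cs - wsZ (ev φ) cs)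
    sums [] [] _ = cast (num 0) (nil k)
    sums ((c , v) ∷ cs) (hc ∷ hs) le = cast (hc ⊠ le (here refl) ⊞ sums cs hs (le ∘ there)) (snoc c k (ev φ v) (wsZ (λ _ → + 1) cs) (wsZ (ev φ) cs))
    ones : ∀ cs → wsZ (ev one) cs ≡ wsZ (λ _ → + 1) cs
    ones [] = refl
    ones ((c , v) ∷ cs) = cong₂ (λ s t → c * s + t) (ev-one v) (ones cs)
    No : wsZ (λ _ → + 1) cs ≡ N
    No = trans (sym (ones cs)) (trans (sym (comb one)) (trans (cong (N *_) (ev-one p)) (*-identityʳ N)))

  private
    linZ-ws : ∀ cs → linZ cs ≡ (wsZ proj₁ cs , wsZ (proj₁ ∘ proj₂) cs , wsZ (proj₂ ∘ proj₂) cs)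
    linZ-ws [] = refl
    linZ-ws ((c , (x , y , z)) ∷ cs) rewrite linZ-ws cs = refl

    sumZ-ws : ∀ cs → sumZ (map proj₁ cs) ≡ wsZ (λ _ → + 1) cs
    sumZ-ws [] = refl
    sumZ-ws ((c , v) ∷ cs) = cong₂ _+_ (sym (*-identityʳ c)) (sumZ-ws cs)

  ev-linZ : ∀ φ cs {p} → sumZ (map proj₁ cs) ≡ + 1 → linZ cs ≡ p → ev φ p ≡ wsZ (ev φ) cs
  ev-linZ ((n , m , k) , t) cs s l = trans (cong (ev ((n , m , k) , t)) (trans (sym l) (linZ-ws cs)))
    (trans (ev-def n m k t (wsZ proj₁ cs) (wsZ (proj₁ ∘ proj₂) cs) (wsZ (proj₂ ∘ proj₂) cs))
      (trans (cong (λ u → n * wsZ proj₁ cs + m * wsZ (proj₁ ∘ proj₂) cs + k * wsZ (proj₂ ∘ proj₂) cs + u)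
        (trans (sym (*-identityʳ t)) (cong (t *_) (trans (sym s) (sumZ-ws cs)))))
        (sym (ws-ev n m k t cs))))

  -- The coefficients of an integral affine combination add up to one, so even the constant term of
  -- a functional distributes over the terms.
  spanning-∣ : ∀ {V} → LatticeSpanning V → ∀ φ D → (∀ {r} → Hull V r → D ∣ ev φ r) → ∀ p → D ∣ ev φ p
  spanning-∣ sp φ D h p with sp p
  ... | cs , i , s , l = ∣-to (go cs i) (sym (ev-linZ φ cs s l))
    where
    go : ∀ cs → All (λ cp → InConv _ (proj₂ cp)) cs → D ∣ wsZ (ev φ) cs
    go [] [] = divides (+ 0) refl
    go ((c , v) ∷ cs) (i ∷ is) = ∣m∣n⇒∣m+n (∣n⇒∣m*n c (h (fromInConv i))) (go cs is)

-- Deciding whether a list contains a prescribed frame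

module Frame where

  open Base
  open Arith
  open Tet
  open White
  open Hull
  open import Data.Nat as ℕ using (ℕ)
  import Data.Nat.Properties as ℕP
  import Data.Nat.Divisibility as ℕD
  open import Data.Nat.Primality using (Prime; prime⇒irreducible; prime⇒nonZero)
  open import Data.Integer hiding (suc; pos) renaming (∣_∣ to abs)
  open import Data.Integer.Properties
  open import Data.Integer.Divisibility.Signed using (_∣_; divides; _∣?_)
  open import Data.Integer.Tactic.RingSolver using (solve-∀)
  open import Data.List using (List; _∷_; []; map)
  open import Data.List.Relation.Unary.All using (All; []; _∷_)
  import Data.List.Relation.Unary.All as All
  open import Data.List.Relation.Unary.Any using (Any; any?)
  open import Data.List.Membership.Propositional using (_∈_; find; lose)
  open import Data.List.Membership.Propositional.Properties using (∈-map⁺)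
  import Data.List.Membership.DecPropositional as DecMembership
  open import Data.Product using (∃; _×_; _,_; proj₁; proj₂)
  open import Data.Product.Properties using (≡-dec)
  open import Data.Empty using (⊥-elim)
  open import Function using (_∘_)
  open import Relation.Nullary using (¬_; Dec; no)
  open import Relation.Nullary.Decidable using (_×-dec_; map′)
  open import Relation.Binary.Definitions using (DecidableEquality)
  open import Relation.Binary.PropositionalEquality using (_≡_; _≢_; refl; sym; trans; cong; cong₂; subst)

  _≟ᵖ_ : DecidableEquality Pt
  _≟ᵖ_ = ≡-dec _≟_ (≡-dec _≟_ _≟_)

  open DecMembership _≟ᵖ_ public using (_∈?_)

  origin : Pt
  origin = + 0 , + 0 , + 0

  toAffine : Fun → Fun → Fun → Affine
  toAffine f g h = record { r₁ = proj₁ f ; r₂ = proj₁ g ; r₃ = proj₁ h ; t = proj₂ f , proj₂ g , proj₂ h }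

  apply-affMap : ∀ f g h p → apply (toAffine f g h) p ≡ affMap f g h p
  apply-affMap ((n , m , k) , t) ((n′ , m′ , k′) , t′) ((n″ , m″ , k″) , t″) (x , y , z) =
    sym (cong₂ _,_ (ev-def n m k t x y z) (cong₂ _,_ (ev-def n′ m′ k′ t′ x y z) (ev-def n″ m″ k″ t″ x y z)))

  record Interpolant (a b c d : Pt) (u v w x : ℤ) : Set where
    constructor interpolant
    field
      fn : Fun
      at-a : ev fn a ≡ u
      at-b : ev fn b ≡ v
      at-c : ev fn c ≡ w
      at-d : ev fn d ≡ x

  private
    comb₄ : (u v w x p q r s : ℤ) → ℤ
    comb₄ u v w x p q r s = u * p + v * q + w * r + x * s

    comb₄-cong : ∀ u v w x {p q r s p′ q′ r′ s′} → p ≡ p′ → q ≡ q′ → r ≡ r′ → s ≡ s′ → comb₄ u v w x p q r s ≡ comb₄ u v w x p′ q′ r′ s′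
    comb₄-cong u v w x e₀ e₁ e₂ e₃ = cong₂ _+_ (cong₂ _+_ (cong₂ _+_ (cong (u *_) e₀) (cong (v *_) e₁)) (cong (w *_) e₂)) (cong (x *_) e₃)

  Interpolant-unique : ∀ {a b c d u v w x} → vol a b c d ≢ + 0 → (I J : Interpolant a b c d u v w x) → ∀ p → ev (Interpolant.fn I) p ≡ ev (Interpolant.fn J) p
  Interpolant-unique {a} {b} {c} {d} nd (interpolant f fa fb fc fd) (interpolant g ga gb gc gd) p =
    mul-cancel (vol a b c d) nd (trans (vol-cramer a b c d p f) (trans
      (comb₄-cong (vol p b c d) (vol a p c d) (vol a b p d) (vol a b c p) (trans fa (sym ga)) (trans fb (sym gb)) (trans fc (sym gc)) (trans fd (sym gd)))
      (sym (vol-cramer a b c d p g))))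

  -- Lagrange interpolation by volume functionals gives `φ` with `D` times the prescribed values. An
  -- integral interpolant exists exactly when `D` divides `φ`, and four lattice points decide that.
  interpolant? : ∀ a b c d u v w x → vol a b c d ≢ + 0 → Dec (Interpolant a b c d u v w x)
  interpolant? a b c d u v w x nd = map′ build divisible
      ((D ∣? ev φ O) ×-dec (D ∣? ev φ e₁) ×-dec (D ∣? ev φ e₂) ×-dec (D ∣? ev φ e₃))
    where
    open Slots a b c d
    φ : Fun
    φ = addF (addF (addF (scaleF u F₀) (scaleF v F₁)) (scaleF w F₂)) (scaleF x F₃)
    ev-φ : ∀ p → ev φ p ≡ comb₄ u v w x (ev F₀ p) (ev F₁ p) (ev F₂ p) (ev F₃ p)
    ev-φ p = trans (ev-addF (addF (addF (scaleF u F₀) (scaleF v F₁)) (scaleF w F₂)) (scaleF x F₃) p) (cong₂ _+_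
      (trans (ev-addF (addF (scaleF u F₀) (scaleF v F₁)) (scaleF w F₂) p) (cong₂ _+_
        (trans (ev-addF (scaleF u F₀) (scaleF v F₁) p) (cong₂ _+_ (ev-scaleF u F₀ p) (ev-scaleF v F₁ p)))
        (ev-scaleF w F₂ p))) (ev-scaleF x F₃ p))
    val₀ : ∀ D u v w x → u * D + v * + 0 + w * + 0 + x * + 0 ≡ D * u
    val₀ = solve-∀
    val₁ : ∀ D u v w x → u * + 0 + v * D + w * + 0 + x * + 0 ≡ D * v
    val₁ = solve-∀
    val₂ : ∀ D u v w x → u * + 0 + v * + 0 + w * D + x * + 0 ≡ D * w
    val₂ = solve-∀
    val₃ : ∀ D u v w x → u * + 0 + v * + 0 + w * + 0 + x * D ≡ D * x
    val₃ = solve-∀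
    build : D ∣ ev φ O × D ∣ ev φ e₁ × D ∣ ev φ e₂ × D ∣ ev φ e₃ → Interpolant a b c d u v w x
    build (divides t q , divides t₁ q₁ , divides t₂ q₂ , divides t₃ q₃) = finish (_ , ev-basis φ t₁ t₂ t₃ t D q q₁ q₂ q₃)
      where
      finish : (∃ λ z → ∀ p → ev φ p ≡ D * ev z p) → Interpolant a b c d u v w x
      finish (z , e) = interpolant z
        (mul-cancel D nd (trans (sym (e a)) (trans (ev-φ a) (trans (comb₄-cong u v w x F₀a F₁a F₂a F₃a) (val₀ D u v w x)))))
        (mul-cancel D nd (trans (sym (e b)) (trans (ev-φ b) (trans (comb₄-cong u v w x F₀b F₁b F₂b F₃b) (val₁ D u v w x)))))
        (mul-cancel D nd (trans (sym (e c)) (trans (ev-φ c) (trans (comb₄-cong u v w x F₀c F₁c F₂c F₃c) (val₂ D u v w x)))))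
        (mul-cancel D nd (trans (sym (e d)) (trans (ev-φ d) (trans (comb₄-cong u v w x F₀d F₁d F₂d F₃d) (val₃ D u v w x)))))
    divisible : Interpolant a b c d u v w x → D ∣ ev φ O × D ∣ ev φ e₁ × D ∣ ev φ e₂ × D ∣ ev φ e₃
    divisible (interpolant z za zb zc zd) = all O , all e₁ , all e₂ , all e₃
      where
      flip : ∀ u v w x p q r s → comb₄ u v w x p q r s ≡ comb₄ p q r s u v w x
      flip u v w x p q r s = cong₂ _+_ (cong₂ _+_ (cong₂ _+_ (*-comm u p) (*-comm v q)) (*-comm w r)) (*-comm x s)
      all : ∀ p → D ∣ ev φ p
      all p = divides (ev z p) (trans (ev-φ p) (trans (comb₄-cong u v w x (ev₀ p) (ev₁ p) (ev₂ p) (ev₃ p))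
        (trans (flip u v w x (vol p b c d) (vol a p c d) (vol a b p d) (vol a b c p))
          (trans (comb₄-cong (vol p b c d) (vol a p c d) (vol a b p d) (vol a b c p) (sym za) (sym zb) (sym zc) (sym zd))
            (trans (sym (vol-cramer a b c d p z)) (*-comm D (ev z p)))))))

  module Target (qa qb qc qd : Pt) (E : List Pt) where

    -- The interpolants are the coordinates of an affine map from `a`, `b`, `c`, `d` to the model's
    -- vertices. The field `image` is a decidable condition that places the image of `V` in the hull
    -- of `E`, once the origin is known to be there.
    record Framed (V : List Pt) (a b c d : Pt) : Set where
      constructor framed
      field
        nondegenerate : vol a b c d ≢ + 0
        X : Interpolant a b c d (proj₁ qa) (proj₁ qb) (proj₁ qc) (proj₁ qd)
        Y : Interpolant a b c d (proj₁ (proj₂ qa)) (proj₁ (proj₂ qb)) (proj₁ (proj₂ qc)) (proj₁ (proj₂ qd))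
        Z : Interpolant a b c d (proj₂ (proj₂ qa)) (proj₂ (proj₂ qb)) (proj₂ (proj₂ qc)) (proj₂ (proj₂ qd))
        image : All (λ v → affMap (Interpolant.fn X) (Interpolant.fn Y) (Interpolant.fn Z) v ∈ origin ∷ E) V

    framed? : ∀ V a b c d → Dec (Framed V a b c d)
    framed? V a b c d = split? (vol a b c d ≟ + 0) (λ e → no λ F → Framed.nondegenerate F e) λ nd →
      split? (interpolant? a b c d (proj₁ qa) (proj₁ qb) (proj₁ qc) (proj₁ qd) nd) (λ X →
      split? (interpolant? a b c d (proj₁ (proj₂ qa)) (proj₁ (proj₂ qb)) (proj₁ (proj₂ qc)) (proj₁ (proj₂ qd)) nd) (λ Y →
      split? (interpolant? a b c d (proj₂ (proj₂ qa)) (proj₂ (proj₂ qb)) (proj₂ (proj₂ qc)) (proj₂ (proj₂ qd)) nd) (λ Z →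
      map′ (framed nd X Y Z)
        (λ (framed _ X′ Y′ Z′ i) → All.map (λ {v} → subst (_∈ origin ∷ E)
          (cong₂ _,_ (Interpolant-unique nd X′ X v) (cong₂ _,_ (Interpolant-unique nd Y′ Y v) (Interpolant-unique nd Z′ Z v)))) i)
        (All.all? (λ v → affMap (Interpolant.fn X) (Interpolant.fn Y) (Interpolant.fn Z) v ∈? origin ∷ E) V))
      (λ n → no (n ∘ Framed.Z))) (λ n → no (n ∘ Framed.Y))) (λ n → no (n ∘ Framed.X))

    Copy : List Pt → Set
    Copy V = Any (λ a → Any (λ b → Any (λ c → Any (λ d → Framed V a b c d) V) V) V) V

    copy? : ∀ V → Dec (Copy V)
    copy? V = any? (λ a → any? (λ b → any? (λ c → any? (λ d → framed? V a b c d) V) V) V) V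

    toCopy : ∀ {V a b c d} → a ∈ V → b ∈ V → c ∈ V → d ∈ V → Framed V a b c d → Copy V
    toCopy i j k l F = lose i (lose j (lose k (lose l F)))

    -- det f · vol(abcd) is the prime vol(E) and |vol(abcd)| ≠ 1, so det f = ±1.
    Copy⇒UnimodEquiv : ∀ {V} → Prime (normVol qa qb qc qd) → All (InConv E) (origin ∷ E) → All (_∈ qa ∷ qb ∷ qc ∷ qd ∷ []) E →
      ¬ HasUnimodularTet V → Copy V → UnimodEquiv V E
    Copy⇒UnimodEquiv {V} pr centre cover no-unit copy with find copy
    ... | a , i , copy with find copy
    ... | b , j , copy with find copy
    ... | c , k , copy with find copy
    ... | d , l , framed nd (interpolant f fa fb fc fd) (interpolant g ga gb gc gd) (interpolant h ha hb hc hd) img =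
        F , unimodular , All.map (λ {v} m → subst (InConv E) (sym (apply-affMap f g h v)) (All.lookup centre m)) img ,
        All.map (λ m → toInConv (Hull-∈ (All.lookup vertices m))) cover
      where
      F : Affine
      F = toAffine f g h
      to : ∀ {p q} → ev f p ≡ proj₁ q → ev g p ≡ proj₁ (proj₂ q) → ev h p ≡ proj₂ (proj₂ q) → affMap f g h p ≡ q
      to e e′ e″ = cong₂ _,_ e (cong₂ _,_ e′ e″)
      member : ∀ {p q} → p ∈ V → affMap f g h p ≡ q → q ∈ map (apply F) V
      member {p} i e = subst (_∈ map (apply F) V) (trans (apply-affMap f g h p) e) (∈-map⁺ (apply F) i)
      vertices : All (_∈ map (apply F) V) (qa ∷ qb ∷ qc ∷ qd ∷ [])
      vertices = member i (to fa ga ha) ∷ member j (to fb gb hb) ∷ member k (to fc gc hc) ∷ member l (to fd gd hd) ∷ []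
      δ : ℤ
      δ = det3 (proj₁ f) (proj₁ g) (proj₁ h)
      eq₄ : ∀ {a b c d a′ b′ c′ d′ : Pt} → a ≡ a′ → b ≡ b′ → c ≡ c′ → d ≡ d′ → vol a b c d ≡ vol a′ b′ c′ d′
      eq₄ refl refl refl refl = refl
      product : abs (vol a b c d) ℕ.* abs δ ≡ normVol qa qb qc qd
      product = trans (ℕP.*-comm (abs (vol a b c d)) (abs δ)) (trans (sym (abs-* δ (vol a b c d))) (trans (cong abs (trans (sym (vol-affMap f g h a b c d))
        (eq₄ (to fa ga ha) (to fb gb hb) (to fc gc hc) (to fd gd hd)))) (sym (normVol-vol qa qb qc qd))))
      unimodular : abs δ ≡ 1
      unimodular = split {C = abs δ ≡ 1} (prime⇒irreducible pr (ℕD.divides (abs (vol a b c d)) (sym product))) (λ e → e) λ e → ⊥-elim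
        (no-unit (a , b , c , d , toInConv (Hull-∈ i) , toInConv (Hull-∈ j) , toInConv (Hull-∈ k) , toInConv (Hull-∈ l) ,
          trans (normVol-vol a b c d) (unit (normVol qa qb qc qd) (abs (vol a b c d)) (prime⇒nonZero pr) (trans (cong (abs (vol a b c d) ℕ.*_) (sym e)) product))))
        where
        unit : ∀ n m → ℕ.NonZero n → m ℕ.* n ≡ n → m ≡ 1
        unit n m nz e = ℕP.*-cancelʳ-≡ m 1 n {{nz}} (trans e (sym (ℕP.*-identityˡ n)))

-- The origin as an interior point of both models

module Centre where

  open Base
  open Arith
  open Tet
  open Hull
  open Frame
  open import Data.Integer hiding (suc; pos) renaming (∣_∣ to abs)
  open import Data.Integer.Tactic.RingSolver using (solve-∀)
  open import Data.List using (_∷_; [])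
  open import Data.List.Relation.Unary.All using (All; []; _∷_)
  import Data.List.Relation.Unary.All as All
  open import Data.Product using (_,_)
  open import Relation.Binary.PropositionalEquality using (_≡_; sym; trans; cong; cong₂)

  centre₁ : ∀ {V} → All (Hull V) E1 → Hull V origin
  centre₁ (hb ∷ hc ∷ ha ∷ hd ∷ []) = Hull-hull₅ ha hb hc hd ha
    -- The denominator is the sum of the weights 2, 3, 5, 7; the fifth point repeats the first with
    -- weight 0.
    (in₅ {N = + 17} {n₀ = + 2} {n₁ = + 3} {n₂ = + 5} {n₃ = + 7} {l = + 0} (pos (num 16)) (num 2) (num 3) (num 5) (num 7) (num 0)
      λ { ((n , m , k) , t) → trans (cong (+ 17 *_) (ev-def n m k t (+ 0) (+ 0) (+ 0))) (trans (alg n m k t) (sym (cong₂ _+_ (cong₂ _+_ (cong₂ _+_ (cong₂ _+_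
        (cong (+ 2 *_) (ev-def n m k t (+ 2) (+ 7) (+ 1))) (cong (+ 3 *_) (ev-def n m k t (+ 1) (+ 0) (+ 0))))
        (cong (+ 5 *_) (ev-def n m k t (+ 0) (+ 0) (+ 1)))) (cong (+ 7 *_) (ev-def n m k t -[1+ 0 ] -[1+ 1 ] -[1+ 0 ])))
        (cong (+ 0 *_) (ev-def n m k t (+ 2) (+ 7) (+ 1)))))) })
    where
    alg : ∀ n m k t → + 17 * (n * + 0 + m * + 0 + k * + 0 + t) ≡ + 2 * (n * + 2 + m * + 7 + k * + 1 + t) + + 3 * (n * + 1 + m * + 0 + k * + 0 + t) +
      + 5 * (n * + 0 + m * + 0 + k * + 1 + t) + + 7 * (n * -[1+ 0 ] + m * -[1+ 1 ] + k * -[1+ 0 ] + t) + + 0 * (n * + 2 + m * + 7 + k * + 1 + t)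
    alg = solve-∀

  centre₂ : ∀ {V} → All (Hull V) E2 → Hull V origin
  centre₂ (hc ∷ hb ∷ ha ∷ hd ∷ []) = Hull-hull₅ ha hb hc hd ha
    (in₅ {N = + 19} {n₀ = + 3} {n₁ = + 4} {n₂ = + 5} {n₃ = + 7} {l = + 0} (pos (num 18)) (num 3) (num 4) (num 5) (num 7) (num 0)
      λ { ((n , m , k) , t) → trans (cong (+ 19 *_) (ev-def n m k t (+ 0) (+ 0) (+ 0))) (trans (alg n m k t) (sym (cong₂ _+_ (cong₂ _+_ (cong₂ _+_ (cong₂ _+_
        (cong (+ 3 *_) (ev-def n m k t (+ 3) (+ 7) (+ 1))) (cong (+ 4 *_) (ev-def n m k t (+ 0) (+ 0) (+ 1))))
        (cong (+ 5 *_) (ev-def n m k t (+ 1) (+ 0) (+ 0)))) (cong (+ 7 *_) (ev-def n m k t -[1+ 1 ] -[1+ 2 ] -[1+ 0 ])))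
        (cong (+ 0 *_) (ev-def n m k t (+ 3) (+ 7) (+ 1)))))) })
    where
    alg : ∀ n m k t → + 19 * (n * + 0 + m * + 0 + k * + 0 + t) ≡ + 3 * (n * + 3 + m * + 7 + k * + 1 + t) + + 4 * (n * + 0 + m * + 0 + k * + 1 + t) +
      + 5 * (n * + 1 + m * + 0 + k * + 0 + t) + + 7 * (n * -[1+ 1 ] + m * -[1+ 2 ] + k * -[1+ 0 ] + t) + + 0 * (n * + 3 + m * + 7 + k * + 1 + t)
    alg = solve-∀

  vertices-in-hull : ∀ E → All (Hull E) E
  vertices-in-hull E = All.tabulate Hull-∈

  five-in₁ : All (InConv E1) (origin ∷ E1)
  five-in₁ = All.map toInConv (centre₁ (vertices-in-hull E1) ∷ vertices-in-hull E1)

  five-in₂ : All (InConv E2) (origin ∷ E2)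
  five-in₂ = All.map toInConv (centre₂ (vertices-in-hull E2) ∷ vertices-in-hull E2)

-- Recognising the two tetrahedra in the given list

module Classify where

  open Base
  open Arith
  open Tet
  open Hull
  open Frame
  open Centre
  open import Data.Nat using (suc)
  open import Data.Nat.Primality using (prime?)
  open import Data.Integer hiding (suc; pos) renaming (∣_∣ to abs)
  open import Data.Integer.Properties
  open import Data.Integer.Tactic.RingSolver using (solve-∀)
  open import Data.List using (_∷_; [])
  open import Data.List.Relation.Unary.All using (All; []; _∷_)
  import Data.List.Relation.Unary.All as All
  open import Data.List.Relation.Unary.Any using (here; there)
  open import Data.List.Membership.Propositional using (_∈_)
  open import Data.Product using (_,_; proj₁; proj₂)
  open import Data.Sum using (_⊎_; inj₁; inj₂)
  open import Data.Empty using (⊥; ⊥-elim)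
  open import Function using (_∘_)
  open import Relation.Nullary using (¬_)
  open import Relation.Nullary.Decidable using (from-yes)
  open import Relation.Binary.PropositionalEquality using (_≡_; _≢_; refl; sym; trans; cong; cong₂; subst)

  module Target₁ = Target (+ 2 , + 7 , + 1) (+ 1 , + 0 , + 0) (+ 0 , + 0 , + 1) (-[1+ 0 ] , -[1+ 1 ] , -[1+ 0 ]) E1
  module Target₂ = Target (+ 3 , + 7 , + 1) (+ 0 , + 0 , + 1) (+ 1 , + 0 , + 0) (-[1+ 1 ] , -[1+ 2 ] , -[1+ 0 ]) E2

  -- If `x` were not in the list, `φ` would be nonpositive on all listed points and therefore on
  -- their hull, which contains `x`.
  exposed : ∀ {V L x} → (∀ {v} → v ∈ V → v ∈ L) → Hull V x → ∀ φ → Pos (ev φ x) → All (λ w → w ≢ x → NN (+ 0 - ev φ w)) L → x ∈ V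
  exposed {V} {L} {x} sub H φ (pos p) h = split? {C = x ∈ V} (x ∈? V) (λ i → i) λ n → ⊥-elim
    (contra (p ⊞ Hull-≤ H φ (+ 0) (λ i → All.lookup h (sub i) (λ e → n (subst (_∈ V) e i)))) (alg (ev φ x)))
    where
    alg : ∀ x → x - + 1 + (+ 0 - x) ≡ -[1+ 0 ]
    alg = solve-∀

  classification : ∀ V → Is3Polytope V → LatticeSpanning V → ¬ HasUnimodularTet V → UnimodEquiv V E1 ⊎ UnimodEquiv V E2
  classification V (a₀ , b₀ , c₀ , d₀ , ia , ib , ic , id , nd) spanning none =
    split? (Target₁.copy? V) (inj₁ ∘ Target₁.Copy⇒UnimodEquiv (from-yes (prime? 17)) five-in₁
        (there (here refl) ∷ there (there (here refl)) ∷ here refl ∷ there (there (there (here refl))) ∷ []) none) λ no₁ →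
    split? (Target₂.copy? V) (inj₂ ∘ Target₂.Copy⇒UnimodEquiv (from-yes (prime? 19)) five-in₂
        (there (there (here refl)) ∷ there (here refl) ∷ here refl ∷ there (there (there (here refl))) ∷ []) none) λ no₂ →
    ⊥-elim (no-tetrahedron (found₁ no₁) (found₂ no₂) (spanning-∣ spanning) (abs (vol a₀ b₀ c₀ d₀)) (Hull-∈ ia) (Hull-∈ ib) (Hull-∈ ic) (Hull-∈ id)
      (λ e → nd (trans (normVol-vol a₀ b₀ c₀ d₀) (cong abs e))) (cast (num 0) (sym (+-inverseʳ (ab (vol a₀ b₀ c₀ d₀))))))
    where
    open Configurations (Hull V) Hull-hull₅ (λ {a} {b} {c} {d} ha hb hc hd e →
      none (a , b , c , d , toInConv ha , toInConv hb , toInConv hc , toInConv hd , trans (normVol-vol a b c d) (+-injective e)))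
    open Closing

    candidates : ∀ {o a b c d N α β γ δ} → Rigid o a b c d N α β γ δ → ∀ {v} → v ∈ V → v ∈ o ∷ a ∷ b ∷ c ∷ d ∷ []
    candidates {o} {a} {b} {c} {d} R {v} i = split? (v ∈? o ∷ a ∷ b ∷ c ∷ d ∷ []) (λ m → m) λ n → ⊥-elim
      (only-five R (Hull-∈ i) (n ∘ here) (n ∘ there ∘ here) (n ∘ there ∘ there ∘ here) (n ∘ there ∘ there ∘ there ∘ here) (n ∘ there ∘ there ∘ there ∘ there ∘ here))

    nonpos : ∀ {φ w y} n → ev φ w ≡ y → + 0 - y ≡ + n → NN (+ 0 - ev φ w)
    nonpos n e h = cast (num n) (sym (trans (cong (λ t → + 0 - t) e) h))
    positive-at : ∀ {φ w} n → ev φ w ≡ + suc n → Pos (ev φ w)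
    positive-at n e = castP (num n) (sym (cong (_- + 1) e))

    triple : ∀ {f g h p q} → ev f p ≡ proj₁ q → ev g p ≡ proj₁ (proj₂ q) → ev h p ≡ proj₂ (proj₂ q) → affMap f g h p ≡ q
    triple e e′ e″ = cong₂ _,_ e (cong₂ _,_ e′ e″)

    -- An affine map multiplies volumes by its determinant, so a degenerate tetrahedron has a
    -- degenerate image.
    nondegenerate : ∀ f g h a b c d {qa qb qc qd} → affMap f g h a ≡ qa → affMap f g h b ≡ qb → affMap f g h c ≡ qc → affMap f g h d ≡ qd →
      normVol qa qb qc qd ≢ 0 → vol a b c d ≢ + 0
    nondegenerate f g h a b c d refl refl refl refl n e = n (trans (normVol-vol (affMap f g h a) (affMap f g h b) (affMap f g h c) (affMap f g h d))
      (cong abs (trans (vol-affMap f g h a b c d) (trans (cong (det3 (proj₁ f) (proj₁ g) (proj₁ h) *_) e) (*-zeroʳ (det3 (proj₁ f) (proj₁ g) (proj₁ h)))))))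

    found₁ : ¬ Target₁.Copy V → ∀ {o a b c d} → Quad o a b c d (+ 17) (+ 2) (+ 3) (+ 5) (+ 7) → ⊥
    found₁ none {o} {a} {b} {c} {d} Q = functionals-2357 Q λ X Y Z → none (copy X Y Z)
      where
      open Quad Q
      sub = candidates (rigid-2357 Q)
      copy : Values o a b c d (+ 2) (+ 1) (+ 0) (- + 1) → Values o a b c d (+ 7) (+ 0) (+ 0) (- + 2) → Values o a b c d (+ 1) (+ 0) (+ 1) (- + 1) → Target₁.Copy V
      copy X@(values f fo fa fb fc fd) Y@(values g go ga gb gc gd) Z@(values h ho ha hb hc hd) = Target₁.toCopy a∈ b∈ c∈ d∈
        (Target₁.framed (nondegenerate f g h a b c d (triple fa ga ha) (triple fb gb hb) (triple fc gc hc) (triple fd gd hd) (λ ()))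
          (interpolant f fa fb fc fd) (interpolant g ga gb gc gd) (interpolant h ha hb hc hd)
          (All.tabulate (λ i → All.lookup images (sub i))))
        where
        images : All (λ v → affMap f g h v ∈ origin ∷ E1) (o ∷ a ∷ b ∷ c ∷ d ∷ [])
        images = here (triple fo go ho) ∷ there (there (there (here (triple fa ga ha)))) ∷ there (here (triple fb gb hb)) ∷
          there (there (here (triple fc gc hc))) ∷ there (there (there (there (here (triple fd gd hd))))) ∷ []
        -- The combinations are positive at one vertex and nonpositive at the other four points; for
        -- instance `3X - Y - Z` takes the values -2, 3, -1, 0 at `a`, `b`, `c`, `d`, and `5Z - Y`
        -- takes -2, 0, 5, -3.
        a∈ : a ∈ V
        a∈ = exposed sub Aa g (positive-at 6 ga) ((λ _ → nonpos 0 go refl) ∷ (λ n → ⊥-elim (n refl)) ∷ (λ _ → nonpos 0 gb refl) ∷ (λ _ → nonpos 0 gc refl) ∷ (λ _ → nonpos 2 gd refl) ∷ [])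
        b∈ : b ∈ V
        b∈ with (+ 3 ⊙ X) ⊕ (- + 1 ⊙ Y) ⊕ (- + 1 ⊙ Z)
        ... | values φ po pa pb pc pd = exposed sub Ab φ (positive-at 2 pb) ((λ _ → nonpos 0 po refl) ∷ (λ _ → nonpos 2 pa refl) ∷ (λ n → ⊥-elim (n refl)) ∷ (λ _ → nonpos 1 pc refl) ∷ (λ _ → nonpos 0 pd refl) ∷ [])
        c∈ : c ∈ V
        c∈ with (+ 5 ⊙ Z) ⊕ (- + 1 ⊙ Y)
        ... | values φ po pa pb pc pd = exposed sub Ac φ (positive-at 4 pc) ((λ _ → nonpos 0 po refl) ∷ (λ _ → nonpos 2 pa refl) ∷ (λ _ → nonpos 0 pb refl) ∷ (λ n → ⊥-elim (n refl)) ∷ (λ _ → nonpos 3 pd refl) ∷ [])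
        d∈ : d ∈ V
        d∈ with - + 1 ⊙ Y
        ... | values φ po pa pb pc pd = exposed sub Ad φ (positive-at 1 pd) ((λ _ → nonpos 0 po refl) ∷ (λ _ → nonpos 7 pa refl) ∷ (λ _ → nonpos 0 pb refl) ∷ (λ _ → nonpos 0 pc refl) ∷ (λ n → ⊥-elim (n refl)) ∷ [])

    found₂ : ¬ Target₂.Copy V → ∀ {o a b c d} → Quad o a b c d (+ 19) (+ 3) (+ 4) (+ 5) (+ 7) → ⊥
    found₂ none {o} {a} {b} {c} {d} Q = functionals-3457 Q λ X Y Z → none (copy X Y Z)
      where
      open Quad Q
      sub = candidates (rigid-3457 Q)
      copy : Values o a b c d (+ 3) (+ 0) (+ 1) (- + 2) → Values o a b c d (+ 7) (+ 0) (+ 0) (- + 3) → Values o a b c d (+ 1) (+ 1) (+ 0) (- + 1) → Target₂.Copy V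
      copy X@(values f fo fa fb fc fd) Y@(values g go ga gb gc gd) Z@(values h ho ha hb hc hd) = Target₂.toCopy a∈ b∈ c∈ d∈
        (Target₂.framed (nondegenerate f g h a b c d (triple fa ga ha) (triple fb gb hb) (triple fc gc hc) (triple fd gd hd) (λ ()))
          (interpolant f fa fb fc fd) (interpolant g ga gb gc gd) (interpolant h ha hb hc hd)
          (All.tabulate (λ i → All.lookup images (sub i))))
        where
        images : All (λ v → affMap f g h v ∈ origin ∷ E2) (o ∷ a ∷ b ∷ c ∷ d ∷ [])
        images = here (triple fo go ho) ∷ there (there (there (here (triple fa ga ha)))) ∷ there (there (here (triple fb gb hb))) ∷
          there (here (triple fc gc hc)) ∷ there (there (there (there (here (triple fd gd hd))))) ∷ []
        -- Here `4Z - Y` takes the values -3, 4, 0, -1 at `a`, `b`, `c`, `d`, and `2X - Y` takes -1,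
        -- 0, 2, -1.
        a∈ : a ∈ V
        a∈ = exposed sub Aa g (positive-at 6 ga) ((λ _ → nonpos 0 go refl) ∷ (λ n → ⊥-elim (n refl)) ∷ (λ _ → nonpos 0 gb refl) ∷ (λ _ → nonpos 0 gc refl) ∷ (λ _ → nonpos 3 gd refl) ∷ [])
        b∈ : b ∈ V
        b∈ with (+ 4 ⊙ Z) ⊕ (- + 1 ⊙ Y)
        ... | values φ po pa pb pc pd = exposed sub Ab φ (positive-at 3 pb) ((λ _ → nonpos 0 po refl) ∷ (λ _ → nonpos 3 pa refl) ∷ (λ n → ⊥-elim (n refl)) ∷ (λ _ → nonpos 0 pc refl) ∷ (λ _ → nonpos 1 pd refl) ∷ [])
        c∈ : c ∈ V
        c∈ with (+ 2 ⊙ X) ⊕ (- + 1 ⊙ Y)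
        ... | values φ po pa pb pc pd = exposed sub Ac φ (positive-at 1 pc) ((λ _ → nonpos 0 po refl) ∷ (λ _ → nonpos 1 pa refl) ∷ (λ _ → nonpos 0 pb refl) ∷ (λ n → ⊥-elim (n refl)) ∷ (λ _ → nonpos 1 pd refl) ∷ [])
        d∈ : d ∈ V
        d∈ with - + 1 ⊙ Y
        ... | values φ po pa pb pc pd = exposed sub Ad φ (positive-at 2 pd) ((λ _ → nonpos 0 po refl) ∷ (λ _ → nonpos 7 pa refl) ∷ (λ _ → nonpos 0 pb refl) ∷ (λ _ → nonpos 0 pc refl) ∷ (λ n → ⊥-elim (n refl)) ∷ [])

-- Finite verification for the two exceptional tetrahedra

module Examples where

  open Base
  open Arith
  open Hull
  open Frame
  open Centre
  open import Data.Nat as ℕ using (ℕ; suc)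
  import Data.Nat.Properties as ℕP
  open import Data.Integer hiding (suc; pos) renaming (∣_∣ to abs)
  open import Data.Integer.Properties
  open import Data.Integer.Tactic.RingSolver using (solve-∀)
  open import Data.List using (List; _∷_; []; map; upTo)
  open import Data.List.Relation.Unary.All using (All; []; _∷_; all?)
  import Data.List.Relation.Unary.All as All
  open import Data.List.Relation.Unary.Any using (Any; here; there; any?)
  open import Data.List.Relation.Unary.Unique.DecPropositional _≟ᵖ_ using (unique?)
  open import Data.List.Membership.Propositional using (_∈_)
  open import Data.List.Membership.Propositional.Properties using (∈-map⁺; ∈-upTo⁺)
  import Data.List.Membership.DecPropositional ℕP._≟_ as ℕ∈
  open import Data.Product using (_×_; _,_; proj₁; proj₂)
  open import Data.Sum using (_⊎_; inj₁; inj₂)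
  open import Data.Empty using (⊥-elim)
  open import Relation.Nullary using (¬_; Dec)
  open import Relation.Nullary.Decidable using (from-yes; from-no; _×-dec_; _⊎-dec_; _→-dec_; ¬?)
  open import Relation.Binary.PropositionalEquality using (_≡_; _≢_; refl; sym; trans; cong; cong₂; subst)

  Constraint : Set
  Constraint = Pt × ℤ

  Satisfies : Pt → Constraint → Set
  Satisfies p (n , k) = dot n p ≤ k

  Inside : List Constraint → Pt → Set
  Inside C p = All (Satisfies p) C

  inside? : ∀ C p → Dec (Inside C p)
  inside? C p = all? (λ (n , k) → dot n p ≤? k) C

  Hull-inside : ∀ {W p C} → All (Inside C) W → Hull W p → Inside C p
  Hull-inside {W} {p} {C} h H = All.tabulate λ { {n , k} i → lift n k (Hull-≤ H (n , + 0) k λ j → lower n k (All.lookup (All.lookup h j) i)) }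
    where
    ev-dot : ∀ n q → ev (n , + 0) q ≡ dot n q
    ev-dot (n , m , k) (x , y , z) = trans (ev-def n m k (+ 0) x y z) (+-identityʳ (n * x + m * y + k * z))
    lower : ∀ n k {q} → dot n q ≤ k → NN (k - ev (n , + 0) q)
    lower n k {q} h = cast (nn (i≤j⇒0≤j-i h)) (cong (λ t → k - t) (sym (ev-dot n q)))
    lift : ∀ n k {q} → NN (k - ev (n , + 0) q) → dot n q ≤ k
    lift n k {q} h with cast h (cong (λ t → k - t) (ev-dot n q))
    ... | nn le = 0≤i-j⇒j≤i le

  range : ℤ → ℕ → List ℤ
  range lo n = map (λ i → lo + + i) (upTo (suc n))

  ∈-range : ∀ {lo n x} → lo ≤ x → x ≤ lo + + n → x ∈ range lo n
  ∈-range {lo} {n} {x} l u = subst (_∈ range lo n) (trans (cong (λ t → lo + t) e) (cancel lo x)) (∈-map⁺ (λ i → lo + + i) (∈-upTo⁺ (ℕ.s≤s bound)))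
    where
    cancel : ∀ lo x → lo + (x - lo) ≡ x
    cancel = solve-∀
    shift : ∀ lo n → lo + n - lo ≡ n
    shift = solve-∀
    e : + abs (x - lo) ≡ x - lo
    e = 0≤i⇒+∣i∣≡i (i≤j⇒0≤j-i l)
    bound : abs (x - lo) ℕ.≤ n
    bound = drop‿+≤+ (subst (_≤ + n) (sym e) (subst (x - lo ≤_) (shift lo (+ n)) (+-monoˡ-≤ (- lo) u)))

  -- For each coordinate, the lowest value and the number of values after it.
  Box : Set
  Box = (ℤ × ℕ) × (ℤ × ℕ) × (ℤ × ℕ)

  boxed : Box → List Constraint → List Constraint
  boxed ((x , l) , (y , m) , (z , n)) C =
    ((-[1+ 0 ] , + 0 , + 0) , - x) ∷ ((+ 1 , + 0 , + 0) , x + + l) ∷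
    ((+ 0 , -[1+ 0 ] , + 0) , - y) ∷ ((+ 0 , + 1 , + 0) , y + + m) ∷
    ((+ 0 , + 0 , -[1+ 0 ]) , - z) ∷ ((+ 0 , + 0 , + 1) , z + + n) ∷ C

  -- The ranges already enforce the bounds of the box, so only the further constraints are tested.
  Enumerates : Box → List Constraint → List Pt → Set
  Enumerates ((x , l) , (y , m) , (z , n)) C L =
    All (λ x → All (λ y → All (λ z → Inside C (x , y , z) → (x , y , z) ∈ L) (range z n)) (range y m)) (range x l)

  enumerates? : ∀ B C L → Dec (Enumerates B C L)
  enumerates? ((x , l) , (y , m) , (z , n)) C L =
    all? (λ x → all? (λ y → all? (λ z → inside? C (x , y , z) →-dec (x , y , z) ∈? L) (range z n)) (range y m)) (range x l)

  -- Inequalities that hold at the vertices hold on the hull, and what they leave inside the box is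
  -- a finite check.
  lattice-points : ∀ {W L} B C → All (Inside (boxed B C)) W → Enumerates B C L → ∀ p → InConv W p → p ∈ L
  lattice-points {W} {L} B@((x₀ , l) , (y₀ , m) , (z₀ , n)) C h enum (x , y , z) i = go (Hull-inside h (fromInConv i))
    where
    low : ∀ {a b t} → t ≡ - b → t ≤ - a → a ≤ b
    low {a} {b} e h = neg-cancel-≤ (subst (_≤ - a) e h)
    x⁻ : ∀ x y z → -[1+ 0 ] * x + + 0 * y + + 0 * z ≡ - x
    x⁻ = solve-∀
    x⁺ : ∀ x y z → + 1 * x + + 0 * y + + 0 * z ≡ x
    x⁺ = solve-∀
    y⁻ : ∀ x y z → + 0 * x + -[1+ 0 ] * y + + 0 * z ≡ - y
    y⁻ = solve-∀
    y⁺ : ∀ x y z → + 0 * x + + 1 * y + + 0 * z ≡ y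
    y⁺ = solve-∀
    z⁻ : ∀ x y z → + 0 * x + + 0 * y + -[1+ 0 ] * z ≡ - z
    z⁻ = solve-∀
    z⁺ : ∀ x y z → + 0 * x + + 0 * y + + 1 * z ≡ z
    z⁺ = solve-∀
    go : Inside (boxed B C) (x , y , z) → (x , y , z) ∈ L
    go (a ∷ b ∷ c ∷ d ∷ e ∷ f ∷ rest) = All.lookup (All.lookup (All.lookup enum
      (∈-range (low (x⁻ x y z) a) (subst (_≤ x₀ + + l) (x⁺ x y z) b)))
      (∈-range (low (y⁻ x y z) c) (subst (_≤ y₀ + + m) (y⁺ x y z) d)))
      (∈-range (low (z⁻ x y z) e) (subst (_≤ z₀ + + n) (z⁺ x y z) f)) rest

  Quadruples : (Pt → Pt → Pt → Pt → Set) → List Pt → Set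
  Quadruples P L = All (λ a → All (λ b → All (λ c → All (P a b c) L) L) L) L

  quadruples? : ∀ {P} → (∀ a b c d → Dec (P a b c d)) → ∀ L → Dec (Quadruples P L)
  quadruples? P? L = all? (λ a → all? (λ b → all? (λ c → all? (P? a b c) L) L) L) L

  lookup₄ : ∀ {P L a b c d} → Quadruples P L → a ∈ L → b ∈ L → c ∈ L → d ∈ L → P a b c d
  lookup₄ h i j k l = All.lookup (All.lookup (All.lookup (All.lookup h i) j) k) l

  -- The last alternative is the whole tetrahedron, which is not empty because it contains the
  -- origin.
  Listed : List Pt → List Tet → Pt → Pt → Pt → Pt → Set
  Listed E Ts a b c d = normVol a b c d ≡ 0 ⊎ Any (λ T → All (_∈ verts T) (a ∷ b ∷ c ∷ d ∷ [])) Ts ⊎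
    (All (_∈ a ∷ b ∷ c ∷ d ∷ []) E × ¬ origin ∈ a ∷ b ∷ c ∷ d ∷ [])

  listed? : ∀ E Ts a b c d → Dec (Listed E Ts a b c d)
  listed? E Ts a b c d = (normVol a b c d ℕP.≟ 0) ⊎-dec any? (λ T → all? (_∈? verts T) (a ∷ b ∷ c ∷ d ∷ [])) Ts ⊎-dec
    (all? (_∈? (a ∷ b ∷ c ∷ d ∷ [])) E ×-dec ¬? (origin ∈? (a ∷ b ∷ c ∷ d ∷ [])))

  empty-complete : ∀ {E} Ts → (∀ p → InConv E p → p ∈ origin ∷ E) → (∀ {W} → All (Hull W) E → Hull W origin) → Quadruples (Listed E Ts) (origin ∷ E) →
    ∀ T → EmptyTet E T → Any (λ T′ → All (_∈ verts T′) (verts T)) Ts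
  empty-complete Ts pts centre table (a , b , c , d) (ia ∷ ib ∷ ic ∷ id ∷ [] , nd , empty)
    with lookup₄ table (pts a ia) (pts b ib) (pts c ic) (pts d id)
  ... | inj₁ e = ⊥-elim (nd e)
  ... | inj₂ (inj₁ i) = i
  ... | inj₂ (inj₂ (all , o∉)) = ⊥-elim (o∉ (empty origin (toInConv (centre (All.map Hull-∈ all)))))

  private
    a₁ b₁ c₁ d₁ a₂ b₂ c₂ d₂ : Pt
    a₁ = + 2 , + 7 , + 1
    b₁ = + 1 , + 0 , + 0
    c₁ = + 0 , + 0 , + 1
    d₁ = -[1+ 0 ] , -[1+ 1 ] , -[1+ 0 ]
    a₂ = + 3 , + 7 , + 1
    b₂ = + 0 , + 0 , + 1
    c₂ = + 1 , + 0 , + 0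
    d₂ = -[1+ 1 ] , -[1+ 2 ] , -[1+ 0 ]

    box₁ box₂ : Box
    box₁ = (-[1+ 0 ] , 3) , (-[1+ 1 ] , 9) , (-[1+ 0 ] , 2)
    box₂ = (-[1+ 1 ] , 5) , (-[1+ 2 ] , 10) , (-[1+ 0 ] , 2)

    -- Volume functionals of the facets: the right-hand side is the volume spanned by the facet and
    -- the origin, and the opposite vertex takes this value minus 17 or 19, the volume of the whole
    -- tetrahedron.
    facets₁ facets₂ : List Constraint
    facets₁ = ((+ 2 , -[1+ 2 ] , + 2) , + 2) ∷ ((-[1+ 13 ] , + 4 , + 3) , + 3) ∷ ((+ 5 , + 1 , -[1+ 11 ]) , + 5) ∷ ((+ 7 , -[1+ 1 ] , + 7) , + 7) ∷ []
    facets₂ = ((+ 3 , -[1+ 3 ] , + 3) , + 3) ∷ ((+ 4 , + 1 , -[1+ 14 ]) , + 4) ∷ ((-[1+ 13 ] , + 6 , + 5) , + 5) ∷ ((+ 7 , -[1+ 2 ] , + 7) , + 7) ∷ []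

    Ts₁ Ts₂ : List Tet
    Ts₁ = (origin , b₁ , c₁ , d₁) ∷ (origin , a₁ , c₁ , d₁) ∷ (origin , a₁ , b₁ , d₁) ∷ (origin , a₁ , b₁ , c₁) ∷ []
    Ts₂ = (origin , b₂ , c₂ , d₂) ∷ (origin , a₂ , c₂ , d₂) ∷ (origin , a₂ , b₂ , d₂) ∷ (origin , a₂ , b₂ , c₂) ∷ []

    points₁ : ∀ p → InConv E1 p → p ∈ origin ∷ E1
    points₁ = lattice-points box₁ facets₁ (from-yes (all? (inside? (boxed box₁ facets₁)) E1)) (from-yes (enumerates? box₁ facets₁ (origin ∷ E1)))

    points₂ : ∀ p → InConv E2 p → p ∈ origin ∷ E2
    points₂ = lattice-points box₂ facets₂ (from-yes (all? (inside? (boxed box₂ facets₂)) E2)) (from-yes (enumerates? box₂ facets₂ (origin ∷ E2)))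

    -- Besides 0 and the four empty volumes, only the full volume 17 occurs; the table thus excludes
    -- volume 1.
    volumes₁ : Quadruples (λ a b c d → normVol a b c d ∈ 0 ∷ 2 ∷ 3 ∷ 5 ∷ 7 ∷ 17 ∷ []) (origin ∷ E1)
    volumes₁ = from-yes (quadruples? (λ a b c d → normVol a b c d ℕ∈.∈? (0 ∷ 2 ∷ 3 ∷ 5 ∷ 7 ∷ 17 ∷ [])) (origin ∷ E1))

    volumes₂ : Quadruples (λ a b c d → normVol a b c d ∈ 0 ∷ 3 ∷ 4 ∷ 5 ∷ 7 ∷ 19 ∷ []) (origin ∷ E2)
    volumes₂ = from-yes (quadruples? (λ a b c d → normVol a b c d ℕ∈.∈? (0 ∷ 3 ∷ 4 ∷ 5 ∷ 7 ∷ 19 ∷ [])) (origin ∷ E2))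

    listed₁ : Quadruples (Listed E1 Ts₁) (origin ∷ E1)
    listed₁ = from-yes (quadruples? (listed? E1 Ts₁) (origin ∷ E1))

    listed₂ : Quadruples (Listed E2 Ts₂) (origin ∷ E2)
    listed₂ = from-yes (quadruples? (listed? E2 Ts₂) (origin ∷ E2))

    -- The constraint n · p ≤ 0 cuts off the vertex of E that is missing from T.
    Certificate : Box → List Constraint → List Pt → Tet → Pt → Set
    Certificate B C E T n = All (_∈ origin ∷ E) (verts T) × volT T ≢ 0 × All (Inside (boxed B ((n , + 0) ∷ C))) (verts T) × Enumerates B ((n , + 0) ∷ C) (verts T)

    certificate? : ∀ B C E T n → Dec (Certificate B C E T n)
    certificate? B C E T n = all? (_∈? (origin ∷ E)) (verts T) ×-dec ¬? (volT T ℕP.≟ 0) ×-dec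
      all? (inside? (boxed B ((n , + 0) ∷ C))) (verts T) ×-dec enumerates? B ((n , + 0) ∷ C) (verts T)

    certified : ∀ {B C E T n} → All (InConv E) (origin ∷ E) → Certificate B C E T n → EmptyTet E T
    certified {B} {C} {n = n} five (sub , nd , ins , enum) = All.map (All.lookup five) sub , nd , lattice-points B ((n , + 0) ∷ C) ins enum

    empty-tets₁ : All (EmptyTet E1) Ts₁
    empty-tets₁ =
      certified {box₁} {facets₁} five-in₁ (from-yes (certificate? box₁ facets₁ E1 (origin , b₁ , c₁ , d₁) (+ 0 , + 1 , + 0))) ∷
      certified {box₁} {facets₁} five-in₁ (from-yes (certificate? box₁ facets₁ E1 (origin , a₁ , c₁ , d₁) (+ 7 , -[1+ 1 ] , + 0))) ∷
      certified {box₁} {facets₁} five-in₁ (from-yes (certificate? box₁ facets₁ E1 (origin , a₁ , b₁ , d₁) (+ 0 , -[1+ 0 ] , + 7))) ∷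
      certified {box₁} {facets₁} five-in₁ (from-yes (certificate? box₁ facets₁ E1 (origin , a₁ , b₁ , c₁) (+ 0 , -[1+ 0 ] , + 0))) ∷ []

    empty-tets₂ : All (EmptyTet E2) Ts₂
    empty-tets₂ =
      certified {box₂} {facets₂} five-in₂ (from-yes (certificate? box₂ facets₂ E2 (origin , b₂ , c₂ , d₂) (+ 0 , + 1 , + 0))) ∷
      certified {box₂} {facets₂} five-in₂ (from-yes (certificate? box₂ facets₂ E2 (origin , a₂ , c₂ , d₂) (+ 0 , -[1+ 0 ] , + 7))) ∷
      certified {box₂} {facets₂} five-in₂ (from-yes (certificate? box₂ facets₂ E2 (origin , a₂ , b₂ , d₂) (+ 7 , -[1+ 2 ] , + 0))) ∷
      certified {box₂} {facets₂} five-in₂ (from-yes (certificate? box₂ facets₂ E2 (origin , a₂ , b₂ , c₂) (+ 0 , -[1+ 0 ] , + 0))) ∷ []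

    no-unimodular₁ : ¬ HasUnimodularTet E1
    no-unimodular₁ (a , b , c , d , ia , ib , ic , id , e) = from-no (1 ℕ∈.∈? (0 ∷ 2 ∷ 3 ∷ 5 ∷ 7 ∷ 17 ∷ []))
      (subst (_∈ 0 ∷ 2 ∷ 3 ∷ 5 ∷ 7 ∷ 17 ∷ []) e (lookup₄ volumes₁ (points₁ a ia) (points₁ b ib) (points₁ c ic) (points₁ d id)))

    no-unimodular₂ : ¬ HasUnimodularTet E2
    no-unimodular₂ (a , b , c , d , ia , ib , ic , id , e) = from-no (1 ℕ∈.∈? (0 ∷ 3 ∷ 4 ∷ 5 ∷ 7 ∷ 19 ∷ []))
      (subst (_∈ 0 ∷ 3 ∷ 4 ∷ 5 ∷ 7 ∷ 19 ∷ []) e (lookup₄ volumes₂ (points₂ a ia) (points₂ b ib) (points₂ c ic) (points₂ d id)))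

    -- (0,1,0) = a + b + 2c + 3d for E1 and (0,1,0) = a + b + c + 2d for E2.
    spanning₁ : LatticeSpanning E1
    spanning₁ (x , y , z) = (x + y , b₁) ∷ (z + + 2 * y , c₁) ∷ (y , a₁) ∷ (+ 3 * y , d₁) ∷ (+ 1 - x - z - + 7 * y , origin) ∷ [] ,
      order five-in₁ , total x y z , cong₂ _,_ (X x y z) (cong₂ _,_ (Y x y z) (Z x y z))
      where
      order : ∀ {P : Pt → Set} {k l m n r : ℤ} → All P (origin ∷ E1) → All (λ (cp : ℤ × Pt) → P (proj₂ cp)) ((k , b₁) ∷ (l , c₁) ∷ (m , a₁) ∷ (n , d₁) ∷ (r , origin) ∷ [])
      order (o ∷ b ∷ c ∷ a ∷ d ∷ []) = b ∷ c ∷ a ∷ d ∷ o ∷ []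
      total : ∀ x y z → (x + y) + ((z + + 2 * y) + (y + (+ 3 * y + ((+ 1 - x - z - + 7 * y) + + 0)))) ≡ + 1
      total = solve-∀
      X : ∀ x y z → (x + y) * + 1 + ((z + + 2 * y) * + 0 + (y * + 2 + (+ 3 * y * -[1+ 0 ] + ((+ 1 - x - z - + 7 * y) * + 0 + + 0)))) ≡ x
      X = solve-∀
      Y : ∀ x y z → (x + y) * + 0 + ((z + + 2 * y) * + 0 + (y * + 7 + (+ 3 * y * -[1+ 1 ] + ((+ 1 - x - z - + 7 * y) * + 0 + + 0)))) ≡ y
      Y = solve-∀
      Z : ∀ x y z → (x + y) * + 0 + ((z + + 2 * y) * + 1 + (y * + 1 + (+ 3 * y * -[1+ 0 ] + ((+ 1 - x - z - + 7 * y) * + 0 + + 0)))) ≡ z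
      Z = solve-∀

    spanning₂ : LatticeSpanning E2
    spanning₂ (x , y , z) = (x + y , c₂) ∷ (z + y , b₂) ∷ (y , a₂) ∷ (+ 2 * y , d₂) ∷ (+ 1 - x - z - + 5 * y , origin) ∷ [] ,
      order five-in₂ , total x y z , cong₂ _,_ (X x y z) (cong₂ _,_ (Y x y z) (Z x y z))
      where
      order : ∀ {P : Pt → Set} {k l m n r : ℤ} → All P (origin ∷ E2) → All (λ (cp : ℤ × Pt) → P (proj₂ cp)) ((k , c₂) ∷ (l , b₂) ∷ (m , a₂) ∷ (n , d₂) ∷ (r , origin) ∷ [])
      order (o ∷ c ∷ b ∷ a ∷ d ∷ []) = c ∷ b ∷ a ∷ d ∷ o ∷ []
      total : ∀ x y z → (x + y) + ((z + y) + (y + (+ 2 * y + ((+ 1 - x - z - + 5 * y) + + 0)))) ≡ + 1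
      total = solve-∀
      X : ∀ x y z → (x + y) * + 1 + ((z + y) * + 0 + (y * + 3 + (+ 2 * y * -[1+ 1 ] + ((+ 1 - x - z - + 5 * y) * + 0 + + 0)))) ≡ x
      X = solve-∀
      Y : ∀ x y z → (x + y) * + 0 + ((z + y) * + 0 + (y * + 7 + (+ 2 * y * -[1+ 2 ] + ((+ 1 - x - z - + 5 * y) * + 0 + + 0)))) ≡ y
      Y = solve-∀
      Z : ∀ x y z → (x + y) * + 0 + ((z + y) * + 1 + (y * + 1 + (+ 2 * y * -[1+ 0 ] + ((+ 1 - x - z - + 5 * y) * + 0 + + 0)))) ≡ z
      Z = solve-∀

  exceptional₁ : Exceptional E1 (2 ∷ 3 ∷ 5 ∷ 7 ∷ [])
  exceptional₁ = (b₁ , c₁ , a₁ , d₁ , here refl , there (here refl) , there (there (here refl)) , there (there (there (here refl))) , λ ()) ,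
    spanning₁ , no-unimodular₁ , (origin ∷ E1 , refl , from-yes (unique? (origin ∷ E1)) , five-in₁ , points₁) ,
    (Ts₁ , refl , empty-tets₁ , empty-complete Ts₁ points₁ centre₁ listed₁)

  exceptional₂ : Exceptional E2 (3 ∷ 4 ∷ 5 ∷ 7 ∷ [])
  exceptional₂ = (c₂ , b₂ , a₂ , d₂ , here refl , there (here refl) , there (there (here refl)) , there (there (there (here refl))) , λ ()) ,
    spanning₂ , no-unimodular₂ , (origin ∷ E2 , refl , from-yes (unique? (origin ∷ E2)) , five-in₂ , points₂) ,
    (Ts₂ , refl , empty-tets₂ , empty-complete Ts₂ points₂ centre₂ listed₂)

  normVol-apply : ∀ F a b c d → Unimodular F → normVol (apply F a) (apply F b) (apply F c) (apply F d) ≡ normVol a b c d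
  normVol-apply F a b c d u = trans (cong₄ (apply-affMap f g h a) (apply-affMap f g h b) (apply-affMap f g h c) (apply-affMap f g h d))
    (trans (normVol-vol (affMap f g h a) (affMap f g h b) (affMap f g h c) (affMap f g h d)) (trans (cong abs (vol-affMap f g h a b c d))
      (trans (abs-* δ (vol a b c d)) (trans (cong (ℕ._* abs (vol a b c d)) u) (trans (ℕP.*-identityˡ (abs (vol a b c d))) (sym (normVol-vol a b c d)))))))
    where
    open Affine F
    f g h : Fun
    f = r₁ , proj₁ t
    g = r₂ , proj₁ (proj₂ t)
    h = r₃ , proj₂ (proj₂ t)
    δ : ℤ
    δ = det3 r₁ r₂ r₃
    cong₄ : ∀ {a b c d a′ b′ c′ d′} → a ≡ a′ → b ≡ b′ → c ≡ c′ → d ≡ d′ → normVol a b c d ≡ normVol a′ b′ c′ d′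
    cong₄ refl refl refl refl = refl

  -- An equivalence would send the vertices of `E1`, of volume 17, to lattice points of the other
  -- tetrahedron, where no quadruple has that volume.
  inequivalent : ¬ UnimodEquiv E1 E2
  inequivalent (F , u , ib ∷ ic ∷ ia ∷ id ∷ [] , _) = from-no (17 ℕ∈.∈? (0 ∷ 3 ∷ 4 ∷ 5 ∷ 7 ∷ 19 ∷ []))
    (subst (_∈ 0 ∷ 3 ∷ 4 ∷ 5 ∷ 7 ∷ 19 ∷ []) (normVol-apply F b₁ c₁ a₁ d₁ u)
      (lookup₄ volumes₂ (points₂ (apply F b₁) ib) (points₂ (apply F c₁) ic) (points₂ (apply F a₁) ia) (points₂ (apply F d₁) id)))

open Classify using (classification)
open Examples using (exceptional₁; exceptional₂; inequivalent)

theorem1p7 : ((V : List Pt) → Is3Polytope V → LatticeSpanning V → ¬ HasUnimodularTet V →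
    UnimodEquiv V E1 ⊎ UnimodEquiv V E2)
    × Exceptional E1 (2 ∷ 3 ∷ 5 ∷ 7 ∷ [])
    × Exceptional E2 (3 ∷ 4 ∷ 5 ∷ 7 ∷ [])
    × ¬ UnimodEquiv E1 E2
theorem1p7 = classification , exceptional₁ , exceptional₂ , inequivalent
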